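{- For every $\varepsilon>0$ there is $N_0$ such that for every finite vector space $V$ of order $N\ge N_0$ over a field of characteristic at least $5$, there is a Cayley graph on $V$ (with respect to its additive group) whose clique number and independence number are both at most $(2+\varepsilon)\log_2 N$.
   Context: A Cayley graph on the additive group of $V$ with symmetric generating set $S\subseteq V\setminus\{0\}$ ($S=-S$) has vertex set $V$, with $x,y$ adjacent iff $x-y\in S$. -}

module Defs where

open import Level using (Level; _⊔_)
open import Data.Nat using (ℕ; zero; suc; _≤_)
import Data.Nat as ℕ
open import Data.Fin using (Fin)
open import Data.List using (List; foldr; length)
open import Data.List.Relation.Unary.All using (All)
open import Data.List.Relation.Unary.AllPairs using (AllPairs)
open import Data.Product using (Σ; _×_; ∃)
open import Relation.Nullary using (¬_)
open import Relation.Binary.PropositionalEquality as ≡ using ()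
open import Function.Bundles using (Inverse)
open import Algebra.Bundles using (CommutativeRing)
open import Algebra.Module.Bundles using (Module)

private variable c ℓ m ℓm : Level

IsField : CommutativeRing c ℓ → Set (c ⊔ ℓ)
IsField F = (¬ (1# ≈ 0#)) × (∀ x → ¬ (x ≈ 0#) → Σ Carrier λ y → x * y ≈ 1#)
  where open CommutativeRing F

natCast : (F : CommutativeRing c ℓ) → ℕ → CommutativeRing.Carrier F
natCast F zero    = CommutativeRing.0# F
natCast F (suc k) = CommutativeRing._+_ F (CommutativeRing.1# F) (natCast F k)

-- characteristic at least 5 (characteristic 0 included):
-- k · 1 ≠ 0 for 1 ≤ k ≤ 4
CharAtLeast5 : CommutativeRing c ℓ → Set ℓ
CharAtLeast5 F = ∀ k → 1 ≤ k → k ≤ 4 → ¬ (natCast F k ≈ 0#)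
  where open CommutativeRing F

HasOrder : {F : CommutativeRing c ℓ} → Module F m ℓm → ℕ → Set (m ⊔ ℓm)
HasOrder V N = Inverse (≡.setoid (Fin N)) ≈ᴹ-setoid
  where open Module V

module _ {F : CommutativeRing c ℓ} (V : Module F m ℓm) where
  open Module V

  sumᴹ : List Carrierᴹ → Carrierᴹ
  sumᴹ = foldr _+ᴹ_ 0ᴹ

  record IsCayleySet {ℓs : Level} (S : Carrierᴹ → Set ℓs) : Set (m ⊔ ℓm ⊔ ℓs) where
    field
      respects  : ∀ {x y} → x ≈ᴹ y → S x → S y
      no-zero   : ¬ S 0ᴹ
      symmetric : ∀ {x} → S x → S (-ᴹ x)
      generates : ∀ v → Σ (List Carrierᴹ) λ xs → All S xs × (sumᴹ xs ≈ᴹ v)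

  Adj : {ℓs : Level} → (Carrierᴹ → Set ℓs) → Carrierᴹ → Carrierᴹ → Set ℓs
  Adj S x y = S (x +ᴹ (-ᴹ y))

  IsClique : {ℓs : Level} → (Carrierᴹ → Set ℓs) → List Carrierᴹ → Set (m ⊔ ℓm ⊔ ℓs)
  IsClique S = AllPairs (λ x y → (¬ (x ≈ᴹ y)) × Adj S x y)

  IsIndependent : {ℓs : Level} → (Carrierᴹ → Set ℓs) → List Carrierᴹ → Set (m ⊔ ℓm ⊔ ℓs)
  IsIndependent S = AllPairs (λ x y → (¬ (x ≈ᴹ y)) × ¬ Adj S x y)

  -- "clique number satisfies B" / "independence number satisfies B"
  -- for a downward-closed bound B on ℕ (here B k means k ≤ (2+ε)log₂ N):
  -- every clique (resp. independent set) has a size satisfying B.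
  CliqueNumberBoundedBy : {ℓs : Level} → (Carrierᴹ → Set ℓs) → (ℕ → Set) → Set (m ⊔ ℓm ⊔ ℓs)
  CliqueNumberBoundedBy S B = ∀ xs → IsClique S xs → B (length xs)

  IndependenceNumberBoundedBy : {ℓs : Level} → (Carrierᴹ → Set ℓs) → (ℕ → Set) → Set (m ⊔ ℓm ⊔ ℓs)
  IndependenceNumberBoundedBy S B = ∀ xs → IsIndependent S xs → B (length xs)

-- For ε = p / q (p, q > 0) and N ≥ 1, a natural number k satisfies
--   k ≤ (2 + ε) log₂ N   iff   2^(k q) ≤ N^(2 q + p).

≤[2+_/_]log₂ : ℕ → ℕ → ℕ → ℕ → Set
≤[2+ p / q ]log₂ N k = 2 ℕ.^ (k ℕ.* q) ≤ N ℕ.^ (2 ℕ.* q ℕ.+ p)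

{-# OPTIONS --safe #-}

-- The colour of g ∈ V is a random bit shared by ± g, except that 2g gets the colour opposite to g
-- whenever g lies in M, a maximal symmetric set without pairs g, 2g.  For g ≠ 0 one of g, 2g, 4g is
-- in M, so a difference set A - A that is monochromatic away from 0 never contains g, 2g, 4g and 8g
-- together, and Petridis' inequality turns this into the growth bound |X|^14 |C| ≤ |X - C|^14 for
-- X, C ⊆ A.
--
-- A fixed X is monochromatic with probability about 2^(-|X - X|/2).  The union bound is not taken
-- over all sets of size n but over straight-line programs: every A as above with |A| = n contains an
-- X whose elements can be computed from ρ free choices with ρ n ≤ (1 + o(1)) |X - X|.  There are
-- N^(ρ + o(ρ)) such programs, fewer than 2^(|X - X|/2) as soon as n > (2 + ε) log₂ N.
--
-- To find X, let n = β^E with a large constant E.  If |A - A| ≥ n² / β^c, a few seeds C explain all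
-- popular differences and sums of A; running greedily through A, every free choice is charged to the
-- differences it creates, and nearly all of these are new.  If |A - A| is smaller, a cheap symmetric
-- set W of translations has many a ∈ A with many elements of A in a + W.  Either few translates of
-- 4W cover these a, which describes them, or passing from W to (T - T) + 4W for a separated T
-- enlarges most of the sets A ∩ (a + W) by a factor β, by the growth bound.  The second case occurs
-- at most E times.

module Submission where

open import Data.Nat using (ℕ; zero; suc; _+_; _*_; _∸_; _^_; _≤_; _<_; _⊓_; z≤n; s≤s; _/_; NonZero; >-nonZero; >-nonZero⁻¹)
open import Data.Nat.DivMod using (m/n*n≤m; m≡m%n+[m/n]*n; m%n<n; /-monoˡ-≤; m*n/n≡m)
open import Data.Nat.Properties hiding (_≟_)
open import Data.Nat.Tactic.RingSolver using (solve-∀)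
open import Data.List using (List; []; _∷_; length; map; filter; take; _++_; concat; concatMap; foldr; replicate; upTo; allFin; cartesianProduct; deduplicate)
open import Data.List.Properties using (length-map; filter-accept; filter-reject; length-filter; length-++; length-take; length-upTo; length-tabulate; take++drop≡id; map-++; map-∘; map-id)
open import Data.List.Relation.Unary.All as All using (All; []; _∷_)
import Data.List.Relation.Unary.All.Properties as AllProperties
open import Data.List.Relation.Unary.Any as Any using (Any; here; there)
open import Data.List.Relation.Unary.AllPairs as AllPairs using (AllPairs; []; _∷_)
import Data.List.Relation.Unary.AllPairs.Properties as Pairs
open import Data.List.Relation.Unary.Unique.Propositional using (Unique)
import Data.List.Relation.Unary.Unique.Propositional.Properties as Uniq
open import Data.List.Relation.Unary.Unique.DecPropositional.Properties using (deduplicate-!)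
open import Data.List.Membership.Propositional using (_∈_; _∉_; find; mapWith∈)
open import Data.List.Membership.Propositional.Properties
import Data.List.Membership.DecPropositional as DecMembership
open import Data.Fin using (Fin; zero; suc)
import Data.Fin.Properties as Fin
open import Data.Vec as Vec using (Vec; []; _∷_)
open import Data.Product using (Σ; ∃; _×_; _,_; proj₁; proj₂)
open import Data.Sum using (_⊎_; inj₁; inj₂) renaming ([_,_] to ⊎-elim; map to ⊎-map)
open import Data.Bool using (Bool; true; false; not; if_then_else_)
open import Data.Bool.Properties using (not-involutive; not-¬; ¬-not)
import Data.Bool as Bool
open import Data.Maybe using (Maybe; just; nothing)
open import Data.Maybe.Properties using (just-injective)
open import Data.Empty using (⊥; ⊥-elim)
open import Data.Unit using (tt)
open import Relation.Nullary using (¬_; Dec; yes; no; does; contradiction)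
open import Relation.Nullary.Decidable using (¬?; _×-dec_; _⊎-dec_; _→-dec_)
open import Relation.Unary using (Pred; Decidable)
open import Relation.Binary.Definitions using (DecidableEquality)
open import Relation.Binary.PropositionalEquality
open import Algebra.Structures using (IsAbelianGroup)
open import Algebra.Bundles using (AbelianGroup; CommutativeRing)
open import Algebra.Module.Bundles using (Module)
import Algebra.Properties.AbelianGroup as AbelianGroupProperties
open import Function using (_∘_; id)
import Relation.Binary.Reasoning.Setoid as SetoidReasoning
open import Function.Bundles using (Inverse)
open import Level using (Level; 0ℓ; Lift; lift)
open import Defs

-- Sums and counts over lists

-- There are N ^ n sets of size n ≈ 2 log₂ N, that is 2 ^ (n² / 2), which only just matches the
-- probability 2 ^ (- |A - A| / 2) when |A - A| is close to n². A set with fewer differences is more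
-- likely to be monochromatic and must have a proportionally shorter description. Just below n² no
-- constant may be lost, which forces the exact count of new differences per free choice; far below
-- n² a power of β can be spared, and cruder covering arguments suffice. The far range is accessible
-- through growth: with 14 = 2 + 4 + 8 one gets |A - A| ≥ |A| ^ (15/14), a surplus of about E / 14
-- powers of β over |A| that pays for all losses, and E is fixed accordingly. The colouring exists
-- to provide this growth, since sets with little growth, such as subgroups, are the obstacle for a
-- plain random Cayley graph. Characteristics 2 and 3 are excluded because g and - g share a colour
-- while g and 2g may be opposed: neither 2g = 0 nor 2g = - g may happen for g ≠ 0.

private variable
  X Y : Set

∑ : List X → (X → ℕ) → ℕ
∑ []       f = 0
∑ (x ∷ xs) f = f x + ∑ xs f

𝟙 : {P : Set} → Dec P → ℕ
𝟙 d = if does d then 1 else 0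

count : {P : Pred X 0ℓ} → Decidable P → List X → ℕ
count P? xs = length (filter P? xs)

𝟙-yes : {P : Set} (d : Dec P) → P → 𝟙 d ≡ 1
𝟙-yes (yes _) _ = refl
𝟙-yes (no ¬p) p = contradiction p ¬p

𝟙-mono : {P Q : Set} (d : Dec P) (e : Dec Q) → (P → Q) → 𝟙 d ≤ 𝟙 e
𝟙-mono (yes p) e f = ≤-reflexive (sym (𝟙-yes e (f p)))
𝟙-mono (no _)  e f = z≤n

*𝟙-≤ : {P : Set} (d : Dec P) {k n : ℕ} → (P → k ≤ n) → k * 𝟙 d ≤ n
*𝟙-≤ (yes p) {k} h = ≤-trans (≤-reflexive (*-identityʳ k)) (h p)
*𝟙-≤ (no _)  {k} h = ≤-trans (≤-reflexive (*-zeroʳ k)) z≤n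

≤-*𝟙+ : {P : Set} (d : Dec P) {n k r : ℕ} → (P → n ≤ k) → (¬ P → n ≤ r) → n ≤ k * 𝟙 d + r
≤-*𝟙+ (yes p) {k = k} h _ = ≤-trans (h p) (≤-trans (≤-reflexive (sym (*-identityʳ k))) (m≤m+n _ _))
≤-*𝟙+ (no ¬p) {k = k} _ h = ≤-trans (h ¬p) (m≤n+m _ (k * 0))

count-∑ : {P : Pred X 0ℓ} (P? : Decidable P) (xs : List X) → count P? xs ≡ ∑ xs (λ x → 𝟙 (P? x))
count-∑ P? []       = refl
count-∑ P? (x ∷ xs) with does (P? x)
... | true  = cong suc (count-∑ P? xs)
... | false = count-∑ P? xs

∑-mono : (xs : List X) {f g : X → ℕ} → (∀ {x} → x ∈ xs → f x ≤ g x) → ∑ xs f ≤ ∑ xs g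
∑-mono []       h = z≤n
∑-mono (x ∷ xs) h = +-mono-≤ (h (here refl)) (∑-mono xs (h ∘ there))

∑-cong : (xs : List X) {f g : X → ℕ} → (∀ {x} → x ∈ xs → f x ≡ g x) → ∑ xs f ≡ ∑ xs g
∑-cong []       h = refl
∑-cong (x ∷ xs) h = cong₂ _+_ (h (here refl)) (∑-cong xs (h ∘ there))

∑-zero : (xs : List X) → ∑ xs (λ _ → 0) ≡ 0
∑-zero []       = refl
∑-zero (x ∷ xs) = ∑-zero xs

∑-const : (xs : List X) (c : ℕ) → ∑ xs (λ _ → c) ≡ length xs * c
∑-const []       c = refl
∑-const (x ∷ xs) c = cong (c +_) (∑-const xs c)

∑-+ : (xs : List X) (f g : X → ℕ) → ∑ xs (λ x → f x + g x) ≡ ∑ xs f + ∑ xs g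
∑-+ []       f g = refl
∑-+ (x ∷ xs) f g = trans (cong (f x + g x +_) (∑-+ xs f g)) (lemma (f x) (g x) (∑ xs f) (∑ xs g))
  where
  lemma : ∀ a b c d → a + b + (c + d) ≡ a + c + (b + d)
  lemma = solve-∀

∑-*ˡ : (c : ℕ) (xs : List X) (f : X → ℕ) → ∑ xs (λ x → c * f x) ≡ c * ∑ xs f
∑-*ˡ c []       f = sym (*-zeroʳ c)
∑-*ˡ c (x ∷ xs) f = trans (cong (c * f x +_) (∑-*ˡ c xs f)) (sym (*-distribˡ-+ c (f x) (∑ xs f)))

∑-*ʳ : (c : ℕ) (xs : List X) (f : X → ℕ) → ∑ xs (λ x → f x * c) ≡ ∑ xs f * c
∑-*ʳ c xs f = trans (∑-cong xs (λ {x} _ → *-comm (f x) c)) (trans (∑-*ˡ c xs f) (*-comm c _))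

∑-++ : (xs ys : List X) (f : X → ℕ) → ∑ (xs ++ ys) f ≡ ∑ xs f + ∑ ys f
∑-++ []       ys f = refl
∑-++ (x ∷ xs) ys f = trans (cong (f x +_) (∑-++ xs ys f)) (sym (+-assoc (f x) _ _))

∑-map : (φ : X → Y) (xs : List X) (f : Y → ℕ) → ∑ (map φ xs) f ≡ ∑ xs (f ∘ φ)
∑-map φ []       f = refl
∑-map φ (x ∷ xs) f = cong (f (φ x) +_) (∑-map φ xs f)

∑-swap : (xs : List X) (ys : List Y) (f : X → Y → ℕ) →
         ∑ xs (λ x → ∑ ys (f x)) ≡ ∑ ys (λ y → ∑ xs (λ x → f x y))
∑-swap []       ys f = sym (∑-zero ys)
∑-swap (x ∷ xs) ys f = trans (cong (∑ ys (f x) +_) (∑-swap xs ys f)) (sym (∑-+ ys (f x) _))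

∑-cartesianProduct : (xs : List X) (ys : List Y) (f : X × Y → ℕ) →
                     ∑ (cartesianProduct xs ys) f ≡ ∑ xs (λ x → ∑ ys (λ y → f (x , y)))
∑-cartesianProduct []       ys f = refl
∑-cartesianProduct (x ∷ xs) ys f =
  trans (∑-++ (map (x ,_) ys) _ f) (cong₂ _+_ (∑-map (x ,_) ys f) (∑-cartesianProduct xs ys f))

length-cartesianProduct : (xs : List X) (ys : List Y) → length (cartesianProduct xs ys) ≡ length xs * length ys
length-cartesianProduct []       ys = refl
length-cartesianProduct (x ∷ xs) ys = trans (length-++ (map (x ,_) ys))
  (cong₂ _+_ (length-map (x ,_) ys) (length-cartesianProduct xs ys))

∈⇒≤∑ : {xs : List X} {x : X} (f : X → ℕ) → x ∈ xs → f x ≤ ∑ xs f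
∈⇒≤∑ f (here refl) = m≤m+n _ _
∈⇒≤∑ f (there p)   = ≤-trans (∈⇒≤∑ f p) (m≤n+m _ _)

∑-length : (xs : List X) → ∑ xs (λ _ → 1) ≡ length xs
∑-length xs = trans (∑-const xs 1) (*-identityʳ _)

∑<∑⇒∃ : (xs : List X) (f g : X → ℕ) → ∑ xs f < ∑ xs g → ∃ λ x → x ∈ xs × f x < g x
∑<∑⇒∃ (x ∷ xs) f g lt with f x <? g x
... | yes p = x , here refl , p
... | no ¬p with ∑<∑⇒∃ xs f g (≰⇒> λ le → <⇒≱ lt (+-mono-≤ (≮⇒≥ ¬p) le))
... | y , y∈ , q = y , there y∈ , q

∑≤∑⇒∃ : (xs : List X) (f g : X → ℕ) → 0 < length xs → ∑ xs f ≤ ∑ xs g → ∃ λ x → x ∈ xs × f x ≤ g x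
∑≤∑⇒∃ xs f g ne le with ∑<∑⇒∃ xs f (suc ∘ g)
  (≤-trans (s≤s le) (≤-trans (+-monoˡ-≤ (∑ xs g) ne) (≤-reflexive
    (trans (cong (_+ ∑ xs g) (sym (∑-length xs))) (sym (∑-+ xs (λ _ → 1) g))))))
... | x , x∈ , s≤s q = x , x∈ , q

double-count : {R : X → Y → Set} (R? : ∀ x y → Dec (R x y)) (xs : List X) (ys : List Y) →
               ∑ xs (λ x → count (R? x) ys) ≡ ∑ ys (λ y → count (λ x → R? x y) xs)
double-count R? xs ys = trans (∑-cong xs (λ {x} _ → count-∑ (R? x) ys))
  (trans (∑-swap xs ys _) (∑-cong ys (λ {y} _ → sym (count-∑ (λ x → R? x y) xs))))

count-mono : {P Q : Pred X 0ℓ} (P? : Decidable P) (Q? : Decidable Q) (xs : List X) →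
             (∀ {x} → x ∈ xs → P x → Q x) → count P? xs ≤ count Q? xs
count-mono P? Q? xs h = ≤-trans (≤-reflexive (count-∑ P? xs))
  (≤-trans (∑-mono xs (λ {x} x∈ → 𝟙-mono (P? x) (Q? x) (h x∈))) (≤-reflexive (sym (count-∑ Q? xs))))

count-split : {P : Pred X 0ℓ} (P? : Decidable P) (xs : List X) →
              count P? xs + count (¬? ∘ P?) xs ≡ length xs
count-split P? []       = refl
count-split P? (x ∷ xs) with does (P? x)
... | true  = cong suc (count-split P? xs)
... | false = trans (+-suc _ _) (cong suc (count-split P? xs))

count-⊎ : {P Q R : Pred X 0ℓ} (P? : Decidable P) (Q? : Decidable Q) (R? : Decidable R) (xs : List X) →
          (∀ {x} → x ∈ xs → P x → Q x ⊎ R x) → count P? xs ≤ count Q? xs + count R? xs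
count-⊎ P? Q? R? xs h = ≤-trans (≤-reflexive (count-∑ P? xs))
  (≤-trans (∑-mono xs step) (≤-reflexive (trans (∑-+ xs _ _) (sym (cong₂ _+_ (count-∑ Q? xs) (count-∑ R? xs))))))
  where
  step : ∀ {x} → x ∈ xs → 𝟙 (P? x) ≤ 𝟙 (Q? x) + 𝟙 (R? x)
  step {x} x∈ with P? x
  ... | no _  = z≤n
  ... | yes p with h x∈ p
  ... | inj₁ q = ≤-trans (≤-reflexive (sym (𝟙-yes (Q? x) q))) (m≤m+n _ _)
  ... | inj₂ r = ≤-trans (≤-reflexive (sym (𝟙-yes (R? x) r))) (m≤n+m _ _)

count-none : {P : Pred X 0ℓ} (P? : Decidable P) (xs : List X) → (∀ {x} → x ∈ xs → ¬ P x) → count P? xs ≡ 0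
count-none P? []       h = refl
count-none P? (x ∷ xs) h = trans (cong length (filter-reject P? (h (here refl)))) (count-none P? xs (h ∘ there))

count-all : {P : Pred X 0ℓ} (P? : Decidable P) (xs : List X) → (∀ {x} → x ∈ xs → P x) → count P? xs ≡ length xs
count-all P? []       h = refl
count-all P? (x ∷ xs) h = trans (cong length (filter-accept P? (h (here refl)))) (cong suc (count-all P? xs (h ∘ there)))

count-≤1 : {P : Pred X 0ℓ} (P? : Decidable P) {xs : List X} → Unique xs →
           (∀ {x y} → x ∈ xs → y ∈ xs → P x → P y → x ≡ y) → count P? xs ≤ 1
count-≤1 P? []         h = z≤n
count-≤1 P? {x ∷ xs} (x∉ ∷ u) h with P? x
... | no _  = count-≤1 P? u (λ p q → h (there p) (there q))
... | yes p = s≤s (≤-reflexive (count-none P? xs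
                (λ y∈ q → All.lookup x∉ y∈ (h (here refl) (there y∈) p q))))

∃⇒0<count : {P : Pred X 0ℓ} (P? : Decidable P) {xs : List X} {x : X} → x ∈ xs → P x → 0 < count P? xs
∃⇒0<count P? x∈ p = nonempty (∈-filter⁺ P? x∈ p)
  where
  nonempty : ∀ {ys : List X} {y} → y ∈ ys → 0 < length ys
  nonempty (here _)  = s≤s z≤n
  nonempty (there _) = s≤s z≤n

0<length⇒∃ : (xs : List X) → 0 < length xs → ∃ λ x → x ∈ xs
0<length⇒∃ (x ∷ xs) _ = x , here refl

∈⇒0<length : {xs : List X} {x : X} → x ∈ xs → 0 < length xs
∈⇒0<length (here _)  = s≤s z≤n
∈⇒0<length (there _) = s≤s z≤n

Σ-cauchy-schwarz : (xs : List X) (f : X → ℕ) → ∑ xs f * ∑ xs f ≤ length xs * ∑ xs (λ x → f x * f x)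
Σ-cauchy-schwarz xs f = *-cancelˡ-≤ 2 (begin
  2 * (∑ xs f * ∑ xs f)                                          ≡⟨ cong (2 *_) (sym (∑-*ˡ (∑ xs f) xs f)) ⟩
  2 * ∑ xs (λ x → ∑ xs f * f x)                                  ≡⟨ sym (∑-*ˡ 2 xs _) ⟩
  ∑ xs (λ x → 2 * (∑ xs f * f x))                                ≡⟨ ∑-cong xs (λ {x} _ → trans (cong (2 *_) (sym (∑-*ʳ (f x) xs f))) (sym (∑-*ˡ 2 xs _))) ⟩
  ∑ xs (λ x → ∑ xs (λ y → 2 * (f y * f x)))                      ≤⟨ ∑-mono xs (λ {x} _ → ∑-mono xs (λ {y} _ → am-gm (f y) (f x))) ⟩
  ∑ xs (λ x → ∑ xs (λ y → f y * f y + f x * f x))                ≡⟨ ∑-cong xs (λ {x} _ → trans (∑-+ xs _ _) (cong (S +_) (∑-const xs (f x * f x)))) ⟩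
  ∑ xs (λ x → S + length xs * (f x * f x))                       ≡⟨ ∑-+ xs _ _ ⟩
  ∑ xs (λ _ → S) + ∑ xs (λ x → length xs * (f x * f x))          ≡⟨ cong₂ _+_ (∑-const xs S) (∑-*ˡ (length xs) xs _) ⟩
  length xs * S + length xs * S                                  ≡⟨ cong (length xs * S +_) (sym (+-identityʳ _)) ⟩
  2 * (length xs * S)                                            ∎)
  where
  open ≤-Reasoning
  S = ∑ xs (λ x → f x * f x)
  expand : ∀ a k → 2 * (a * (a + k)) + k * k ≡ a * a + (a + k) * (a + k)
  expand = solve-∀
  expand′ : ∀ a k → 2 * ((a + k) * a) + k * k ≡ (a + k) * (a + k) + a * a
  expand′ = solve-∀
  am-gm : ∀ a b → 2 * (a * b) ≤ a * a + b * b
  am-gm a b with ≤-total a b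
  ... | inj₁ a≤b = subst (λ b → 2 * (a * b) ≤ a * a + b * b) (m+[n∸m]≡n a≤b)
                     (≤-trans (m≤m+n _ _) (≤-reflexive (expand a (b ∸ a))))
  ... | inj₂ b≤a = subst (λ a → 2 * (a * b) ≤ a * a + b * b) (m+[n∸m]≡n b≤a)
                     (≤-trans (m≤m+n _ _) (≤-reflexive (expand′ b (a ∸ b))))

map-unique : {xs : List X} (φ : X → Y) → (∀ {x y} → x ∈ xs → y ∈ xs → φ x ≡ φ y → x ≡ y) →
             Unique xs → Unique (map φ xs)
map-unique {xs = []}     φ inj []       = []
map-unique {xs = x ∷ xs} φ inj (x∉ ∷ u) =
  All.tabulate (λ z∈ eq → let (y , y∈ , z≡) = ∈-map⁻ φ z∈ in
    All.lookup x∉ y∈ (inj (here refl) (there y∈) (trans eq z≡)))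
  ∷ map-unique φ (λ p q → inj (there p) (there q)) u

module _ (_≟_ : DecidableEquality Y) where

  fibres : {xs : List X} {ys : List Y} (φ : X → Y) → Unique ys → (∀ {x} → x ∈ xs → φ x ∈ ys) →
           length xs ≡ ∑ ys (λ y → count (λ x → φ x ≟ y) xs)
  fibres {xs = xs} {ys} φ u φ∈ = trans (sym (∑-length xs))
    (trans (∑-cong xs (λ x∈ → sym (one x∈))) (double-count (λ x y → φ x ≟ y) xs ys))
    where
    one : ∀ {x} → x ∈ xs → count (λ y → φ x ≟ y) ys ≡ 1
    one x∈ = ≤-antisym (count-≤1 _ u (λ _ _ p q → trans (sym p) q)) (∃⇒0<count _ (φ∈ x∈) refl)

  pigeonhole : {xs : List X} {ys : List Y} (φ : X → Y) → Unique ys → (∀ {x} → x ∈ xs → φ x ∈ ys) →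
               0 < length ys → ∃ λ y → y ∈ ys × length xs ≤ length ys * count (λ x → φ x ≟ y) xs
  pigeonhole {xs = xs} {ys} φ u φ∈ ne = ∑≤∑⇒∃ ys _ _ ne (≤-reflexive
    (trans (∑-const ys (length xs)) (trans (cong (length ys *_) (fibres φ u φ∈)) (sym (∑-*ˡ (length ys) ys _)))))

  -- Cauchy-Schwarz on the fibre sizes. When φ is a difference map, this is the usual lower bound
  -- for additive energy in terms of the size of a difference set.
  collisions : {xs : List X} {ys : List Y} (φ : X → Y) → Unique ys → (∀ {x} → x ∈ xs → φ x ∈ ys) →
               length xs * length xs ≤ length ys * ∑ xs (λ x → count (λ x′ → φ x′ ≟ φ x) xs)
  collisions {xs = xs} {ys} φ u φ∈ = begin
    length xs * length xs                              ≡⟨ cong₂ _*_ (fibres φ u φ∈) (fibres φ u φ∈) ⟩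
    ∑ ys k * ∑ ys k                                    ≤⟨ Σ-cauchy-schwarz ys k ⟩
    length ys * ∑ ys (λ y → k y * k y)                 ≡⟨ cong (length ys *_) (∑-cong ys (λ {y} _ → square y)) ⟩
    length ys * ∑ ys (λ y → ∑ xs (λ x → 𝟙 (φ x ≟ y) * k y))
                                                       ≡⟨ cong (length ys *_) (∑-swap ys xs _) ⟩
    length ys * ∑ xs (λ x → ∑ ys (λ y → 𝟙 (φ x ≟ y) * k y))
                                                       ≡⟨ cong (length ys *_) (∑-cong xs (λ x∈ → pick x∈)) ⟩
    length ys * ∑ xs (λ x → k (φ x))                   ∎
    where
    open ≤-Reasoning
    k : Y → ℕ
    k y = count (λ x → φ x ≟ y) xs
    square : ∀ y → k y * k y ≡ ∑ xs (λ x → 𝟙 (φ x ≟ y) * k y)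
    square y = trans (cong (_* k y) (count-∑ (λ x → φ x ≟ y) xs)) (sym (∑-*ʳ (k y) xs _))
    pick : ∀ {x} → x ∈ xs → ∑ ys (λ y → 𝟙 (φ x ≟ y) * k y) ≡ k (φ x)
    pick {x} x∈ = trans (∑-cong ys (λ {y} _ → same y))
      (trans (∑-*ʳ (k (φ x)) ys _) (trans (cong (_* k (φ x)) (trans (sym (count-∑ (φ x ≟_) ys))
        (≤-antisym (count-≤1 _ u (λ _ _ p q → trans (sym p) q)) (∃⇒0<count _ (φ∈ x∈) refl)))) (*-identityˡ _)))
      where
      same : ∀ y → 𝟙 (φ x ≟ y) * k y ≡ 𝟙 (φ x ≟ y) * k (φ x)
      same y with φ x ≟ y
      ... | yes refl = refl
      ... | no _     = refl

  inj⇒length≤ : {xs : List X} {ys : List Y} (φ : X → Y) → Unique xs → (∀ {x} → x ∈ xs → φ x ∈ ys) →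
                (∀ {x x′} → x ∈ xs → x′ ∈ xs → φ x ≡ φ x′ → x ≡ x′) → length xs ≤ length ys
  inj⇒length≤ {xs = []}     φ u φ∈ inj = z≤n
  inj⇒length≤ {xs = x ∷ xs} {ys} φ (x∉ ∷ u) φ∈ inj = ≤-trans
    (s≤s (inj⇒length≤ {ys = filter (λ y → ¬? (y ≟ φ x)) ys} φ u
      (λ {x′} x′∈ → ∈-filter⁺ (λ y → ¬? (y ≟ φ x)) (φ∈ (there x′∈))
        (λ eq → All.lookup x∉ x′∈ (sym (inj (there x′∈) (here refl) eq))))
      (λ p q → inj (there p) (there q))))
    (≤-trans (+-monoˡ-≤ _ (∃⇒0<count (_≟ φ x) (φ∈ (here refl)) refl)) (≤-reflexive (count-split (_≟ φ x) ys)))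

  ⊆⇒length≤ : {xs ys : List Y} → Unique xs → (∀ {x} → x ∈ xs → x ∈ ys) → length xs ≤ length ys
  ⊆⇒length≤ u sub = inj⇒length≤ id u sub (λ _ _ eq → eq)

-- Maximal separated subsets

separated : {R : X → X → Set} (R? : ∀ x y → Dec (R x y)) → List X → List X
separated R? []       = []
separated R? (x ∷ xs) with Any.any? (R? x) (separated R? xs)
... | yes _ = separated R? xs
... | no _  = x ∷ separated R? xs

module _ {R : X → X → Set} (R? : ∀ x y → Dec (R x y)) where

  separated-⊆ : ∀ xs {x} → x ∈ separated R? xs → x ∈ xs
  separated-⊆ (y ∷ xs) x∈ with Any.any? (R? y) (separated R? xs)
  separated-⊆ (y ∷ xs) x∈          | yes _ = there (separated-⊆ xs x∈)
  separated-⊆ (y ∷ xs) (here eq)   | no _  = here eq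
  separated-⊆ (y ∷ xs) (there x∈)  | no _  = there (separated-⊆ xs x∈)

  separated-pairs : ∀ xs → AllPairs (λ x y → ¬ R x y) (separated R? xs)
  separated-pairs []       = []
  separated-pairs (x ∷ xs) with Any.any? (R? x) (separated R? xs)
  ... | yes _ = separated-pairs xs
  ... | no ¬a = All.tabulate (λ y∈ r → ¬a (Any.map (λ { refl → r }) y∈)) ∷ separated-pairs xs

  separated-covers : (∀ x → R x x) → ∀ xs {x} → x ∈ xs → ∃ λ y → y ∈ separated R? xs × R x y
  separated-covers rfl (x ∷ xs) x∈ with Any.any? (R? x) (separated R? xs)
  separated-covers rfl (x ∷ xs) (here refl) | yes a = find a
  separated-covers rfl (x ∷ xs) (there x∈) | yes a = separated-covers rfl xs x∈
  separated-covers rfl (x ∷ xs) (here refl) | no _ = x , here refl , rfl x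
  separated-covers rfl (x ∷ xs) (there x∈) | no _ =
    let (y , y∈ , r) = separated-covers rfl xs x∈ in y , there y∈ , r

-- Finite abelian groups without 2- and 3-torsion

record FinGroup : Set₁ where
  infixl 6 _⊕_ _⊖_
  infix  8 ⊝_
  field
    G               : Set
    _≟_             : DecidableEquality G
    _⊕_             : G → G → G
    𝟘               : G
    ⊝_              : G → G
    isAbelianGroup  : IsAbelianGroup _≡_ _⊕_ 𝟘 ⊝_
    univ            : List G
    univ-complete   : ∀ x → x ∈ univ
    no-2-torsion    : ∀ x → x ⊕ x ≡ 𝟘 → x ≡ 𝟘
    no-3-torsion    : ∀ x → x ⊕ x ⊕ x ≡ 𝟘 → x ≡ 𝟘

  _⊖_ : G → G → G
  x ⊖ y = x ⊕ ⊝ y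

  abelianGroup : AbelianGroup 0ℓ 0ℓ
  abelianGroup = record { isAbelianGroup = isAbelianGroup }

-- Deciding linear identities in an abelian group

module Linear (𝔾 : FinGroup) where
  open FinGroup 𝔾
  open IsAbelianGroup isAbelianGroup using (assoc; comm; identityˡ; identityʳ; inverseˡ; inverseʳ)
  open AbelianGroupProperties abelianGroup using (∙-cancelʳ)

  infixl 6 _:+_ _:-_
  infix  8 :-_
  data Expr (n : ℕ) : Set where
    var  : Fin n → Expr n
    _:+_ : Expr n → Expr n → Expr n
    :-_  : Expr n → Expr n
    :0   : Expr n

  _:-_ : ∀ {n} → Expr n → Expr n → Expr n
  e :- f = e :+ :- f

  x₀ : ∀ {n} → Expr (1 + n)
  x₀ = var zero
  x₁ : ∀ {n} → Expr (2 + n)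
  x₁ = var (suc zero)
  x₂ : ∀ {n} → Expr (3 + n)
  x₂ = var (suc (suc zero))
  x₃ : ∀ {n} → Expr (4 + n)
  x₃ = var (suc (suc (suc zero)))
  x₄ : ∀ {n} → Expr (5 + n)
  x₄ = var (suc (suc (suc (suc zero))))
  x₅ : ∀ {n} → Expr (6 + n)
  x₅ = var (suc (suc (suc (suc (suc zero)))))
  x₆ : ∀ {n} → Expr (7 + n)
  x₆ = var (suc (suc (suc (suc (suc (suc zero))))))
  x₇ : ∀ {n} → Expr (8 + n)
  x₇ = var (suc (suc (suc (suc (suc (suc (suc zero)))))))

  ⟦_⟧ : ∀ {n} → Expr n → Vec G n → G
  ⟦ var i ⟧ ρ  = Vec.lookup ρ i
  ⟦ e :+ f ⟧ ρ = ⟦ e ⟧ ρ ⊕ ⟦ f ⟧ ρ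
  ⟦ :- e ⟧ ρ   = ⊝ ⟦ e ⟧ ρ
  ⟦ :0 ⟧ ρ     = 𝟘

  private
    _·_ : ℕ → G → G
    zero  · x = 𝟘
    suc k · x = x ⊕ k · x

    interchange : ∀ a b c d → (a ⊕ b) ⊕ (c ⊕ d) ≡ (a ⊕ c) ⊕ (b ⊕ d)
    interchange a b c d = begin
      (a ⊕ b) ⊕ (c ⊕ d) ≡⟨ assoc a b (c ⊕ d) ⟩
      a ⊕ (b ⊕ (c ⊕ d)) ≡⟨ cong (a ⊕_) (trans (sym (assoc b c d)) (trans (cong (_⊕ d) (comm b c)) (assoc c b d))) ⟩
      a ⊕ (c ⊕ (b ⊕ d)) ≡⟨ sym (assoc a c (b ⊕ d)) ⟩
      (a ⊕ c) ⊕ (b ⊕ d) ∎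
      where open ≡-Reasoning

    ·-+ : ∀ k l x → (k + l) · x ≡ k · x ⊕ l · x
    ·-+ zero    l x = sym (identityˡ _)
    ·-+ (suc k) l x = trans (cong (x ⊕_) (·-+ k l x)) (sym (assoc x _ _))

    Coeffs : ℕ → Set
    Coeffs n = Vec ℕ n

    zeros : ∀ n → Coeffs n
    zeros n = Vec.replicate n 0

    unit : ∀ {n} → Fin n → Coeffs n
    unit {suc n} zero    = 1 ∷ zeros n
    unit {suc n} (suc i) = 0 ∷ unit i

    _⊞ᶜ_ : ∀ {n} → Coeffs n → Coeffs n → Coeffs n
    _⊞ᶜ_ = Vec.zipWith _+_

    comb : ∀ {n} → Coeffs n → Vec G n → G
    comb []       []      = 𝟘
    comb (k ∷ ks) (x ∷ ρ) = k · x ⊕ comb ks ρ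

    comb-zeros : ∀ {n} (ρ : Vec G n) → comb (zeros n) ρ ≡ 𝟘
    comb-zeros []      = refl
    comb-zeros (x ∷ ρ) = trans (identityˡ _) (comb-zeros ρ)

    comb-unit : ∀ {n} (i : Fin n) (ρ : Vec G n) → comb (unit i) ρ ≡ Vec.lookup ρ i
    comb-unit zero    (x ∷ ρ) = trans (cong₂ _⊕_ (identityʳ x) (comb-zeros ρ)) (identityʳ x)
    comb-unit (suc i) (x ∷ ρ) = trans (identityˡ _) (comb-unit i ρ)

    comb-⊞ : ∀ {n} (p q : Coeffs n) (ρ : Vec G n) → comb (p ⊞ᶜ q) ρ ≡ comb p ρ ⊕ comb q ρ
    comb-⊞ []      []      []      = sym (identityˡ 𝟘)
    comb-⊞ (k ∷ p) (l ∷ q) (x ∷ ρ) =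
      trans (cong₂ _⊕_ (·-+ k l x) (comb-⊞ p q ρ)) (interchange _ _ _ _)

  -- An integer coefficient vector is kept as a difference of two vectors of natural numbers.
  pos neg : ∀ {n} → Expr n → Coeffs n
  pos (var i)    = unit i
  pos (e :+ f)   = pos e ⊞ᶜ pos f
  pos (:- e)     = neg e
  pos {n} :0     = zeros n
  neg {n} (var i) = zeros n
  neg (e :+ f)   = neg e ⊞ᶜ neg f
  neg (:- e)     = pos e
  neg {n} :0     = zeros n

  private
    correct : ∀ {n} (e : Expr n) ρ → ⟦ e ⟧ ρ ⊕ comb (neg e) ρ ≡ comb (pos e) ρ
    correct (var i) ρ  = trans (cong (Vec.lookup ρ i ⊕_) (comb-zeros ρ)) (trans (identityʳ _) (sym (comb-unit i ρ)))
    correct (e :+ f) ρ = trans (cong (⟦ e ⟧ ρ ⊕ ⟦ f ⟧ ρ ⊕_) (comb-⊞ (neg e) (neg f) ρ))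
      (trans (interchange _ _ _ _) (trans (cong₂ _⊕_ (correct e ρ) (correct f ρ)) (sym (comb-⊞ (pos e) (pos f) ρ))))
    correct (:- e) ρ   = trans (cong (⊝ ⟦ e ⟧ ρ ⊕_) (sym (correct e ρ)))
      (trans (sym (assoc _ _ _)) (trans (cong (_⊕ comb (neg e) ρ) (inverseˡ _)) (identityˡ _)))
    correct {n} :0 ρ   = identityˡ _

  -- Moving the negative parts across leaves an equation between vectors of numerals, which `refl`
  -- settles at every use; cancelling both negative parts in the group returns the identity.
  solve : ∀ {n} (e f : Expr n) (ρ : Vec G n) → pos e ⊞ᶜ neg f ≡ pos f ⊞ᶜ neg e → ⟦ e ⟧ ρ ≡ ⟦ f ⟧ ρ
  solve e f ρ eq = ∙-cancelʳ (comb (neg e ⊞ᶜ neg f) ρ) _ _ (begin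
    ⟦ e ⟧ ρ ⊕ comb (neg e ⊞ᶜ neg f) ρ              ≡⟨ cong (⟦ e ⟧ ρ ⊕_) (comb-⊞ (neg e) (neg f) ρ) ⟩
    ⟦ e ⟧ ρ ⊕ (comb (neg e) ρ ⊕ comb (neg f) ρ)    ≡⟨ sym (assoc _ _ _) ⟩
    ⟦ e ⟧ ρ ⊕ comb (neg e) ρ ⊕ comb (neg f) ρ      ≡⟨ cong (_⊕ comb (neg f) ρ) (correct e ρ) ⟩
    comb (pos e) ρ ⊕ comb (neg f) ρ                ≡⟨ sym (comb-⊞ (pos e) (neg f) ρ) ⟩
    comb (pos e ⊞ᶜ neg f) ρ                        ≡⟨ cong (λ p → comb p ρ) eq ⟩
    comb (pos f ⊞ᶜ neg e) ρ                        ≡⟨ comb-⊞ (pos f) (neg e) ρ ⟩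
    comb (pos f) ρ ⊕ comb (neg e) ρ                ≡⟨ cong (_⊕ comb (neg e) ρ) (sym (correct f ρ)) ⟩
    ⟦ f ⟧ ρ ⊕ comb (neg f) ρ ⊕ comb (neg e) ρ      ≡⟨ assoc _ _ _ ⟩
    ⟦ f ⟧ ρ ⊕ (comb (neg f) ρ ⊕ comb (neg e) ρ)    ≡⟨ cong (⟦ f ⟧ ρ ⊕_) (comm _ _) ⟩
    ⟦ f ⟧ ρ ⊕ (comb (neg e) ρ ⊕ comb (neg f) ρ)    ≡⟨ cong (⟦ f ⟧ ρ ⊕_) (sym (comb-⊞ (neg e) (neg f) ρ)) ⟩
    ⟦ f ⟧ ρ ⊕ comb (neg e ⊞ᶜ neg f) ρ              ∎)
    where open ≡-Reasoning

  ⊖-self : ∀ x → x ⊖ x ≡ 𝟘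
  ⊖-self = inverseʳ

  ⊖≡𝟘⇒≡ : ∀ {x y} → x ⊖ y ≡ 𝟘 → x ≡ y
  ⊖≡𝟘⇒≡ {x} {y} eq = trans (solve x₀ ((x₀ :- x₁) :+ x₁) (x ∷ y ∷ []) refl) (trans (cong (_⊕ y) eq) (identityˡ y))

  -- An equation follows from another one with the same difference of sides.
  by₁ : ∀ {x y z w} → x ⊖ y ≡ z ⊖ w → z ≡ w → x ≡ y
  by₁ {w = w} eq refl = ⊖≡𝟘⇒≡ (trans eq (⊖-self w))

  by₂ : ∀ {x y z w z′ w′} → x ⊖ y ≡ (z ⊖ w) ⊕ (z′ ⊖ w′) → z ≡ w → z′ ≡ w′ → x ≡ y
  by₂ {w = w} {w′ = w′} eq refl refl =
    ⊖≡𝟘⇒≡ (trans eq (trans (cong₂ _⊕_ (⊖-self w) (⊖-self w′)) (identityˡ 𝟘)))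

-- Difference sets and sumsets

module Sets (𝔾 : FinGroup) where
  open FinGroup 𝔾 public
  open Linear 𝔾 public
  open DecMembership _≟_ using (_∈?_) public

  infixl 6 _⊟_ _⊞_
  infix  4 _⊆_

  abstract
    -- Repetitions are removed so that `length` is the cardinality of the difference set.
    _⊟_ : List G → List G → List G
    X ⊟ Y = deduplicate _≟_ (map (λ (x , y) → x ⊖ y) (cartesianProduct X Y))

    _⊞_ : List G → List G → List G
    X ⊞ Y = deduplicate _≟_ (map (λ (x , y) → x ⊕ y) (cartesianProduct X Y))

    ⊟-unique : ∀ X Y → Unique (X ⊟ Y)
    ⊟-unique X Y = deduplicate-! _≟_ _

    ∣⊟∣≤ : ∀ X Y → length (X ⊟ Y) ≤ length X * length Y
    ∣⊟∣≤ X Y = ≤-trans (⊆⇒length≤ _≟_ (deduplicate-! _≟_ _) (∈-deduplicate⁻ _≟_ (map (λ (x , y) → x ⊖ y) (cartesianProduct X Y))))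
      (≤-reflexive (trans (length-map _ (cartesianProduct X Y)) (length-cartesianProduct X Y)))

    ∣⊞∣≤ : ∀ X Y → length (X ⊞ Y) ≤ length X * length Y
    ∣⊞∣≤ X Y = ≤-trans (⊆⇒length≤ _≟_ (deduplicate-! _≟_ _) (∈-deduplicate⁻ _≟_ (map (λ (x , y) → x ⊕ y) (cartesianProduct X Y))))
      (≤-reflexive (trans (length-map _ (cartesianProduct X Y)) (length-cartesianProduct X Y)))

    ∈-⊟⁺ : ∀ {X Y x y} → x ∈ X → y ∈ Y → x ⊖ y ∈ X ⊟ Y
    ∈-⊟⁺ x∈ y∈ = ∈-deduplicate⁺ _≟_ (∈-map⁺ _ (∈-cartesianProduct⁺ x∈ y∈))

    ∈-⊞⁺ : ∀ {X Y x y} → x ∈ X → y ∈ Y → x ⊕ y ∈ X ⊞ Y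
    ∈-⊞⁺ x∈ y∈ = ∈-deduplicate⁺ _≟_ (∈-map⁺ _ (∈-cartesianProduct⁺ x∈ y∈))

    ∈-⊟⁻ : ∀ X Y {z} → z ∈ X ⊟ Y → ∃ λ x → ∃ λ y → x ∈ X × y ∈ Y × z ≡ x ⊖ y
    ∈-⊟⁻ X Y z∈ with ∈-map⁻ (λ (x , y) → x ⊖ y) (∈-deduplicate⁻ _≟_ _ z∈)
    ... | (x , y) , xy∈ , eq = let (x∈ , y∈) = ∈-cartesianProduct⁻ X Y xy∈ in x , y , x∈ , y∈ , eq

    ∈-⊞⁻ : ∀ X Y {z} → z ∈ X ⊞ Y → ∃ λ x → ∃ λ y → x ∈ X × y ∈ Y × z ≡ x ⊕ y
    ∈-⊞⁻ X Y z∈ with ∈-map⁻ (λ (x , y) → x ⊕ y) (∈-deduplicate⁻ _≟_ _ z∈)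
    ... | (x , y) , xy∈ , eq = let (x∈ , y∈) = ∈-cartesianProduct⁻ X Y xy∈ in x , y , x∈ , y∈ , eq

  double-injective : ∀ {g h} → g ⊕ g ≡ h ⊕ h → g ≡ h
  double-injective {g} {h} eq = ⊖≡𝟘⇒≡ (no-2-torsion (g ⊖ h) (by₁ (solve (((x₀ :- x₁) :+ (x₀ :- x₁)) :- :0) ((x₀ :+ x₀) :- (x₁ :+ x₁)) (g ∷ h ∷ []) refl) eq))

  _⊆_ : List G → List G → Set
  X ⊆ Y = ∀ {x} → x ∈ X → x ∈ Y

  ⊟-mono : ∀ {X X′ Y Y′} → X ⊆ X′ → Y ⊆ Y′ → X ⊟ Y ⊆ X′ ⊟ Y′
  ⊟-mono {X} {Y = Y} p q z∈ with ∈-⊟⁻ X Y z∈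
  ... | x , y , x∈ , y∈ , refl = ∈-⊟⁺ (p x∈) (q y∈)

  ∣⊟∣-mono : ∀ {X X′ Y Y′} → X ⊆ X′ → Y ⊆ Y′ → length (X ⊟ Y) ≤ length (X′ ⊟ Y′)
  ∣⊟∣-mono {X} {X′} {Y} {Y′} p q = ⊆⇒length≤ _≟_ (⊟-unique X Y) (⊟-mono {X} {X′} {Y} {Y′} p q)

  empty⇒length≡0 : ∀ {X : Set} {xs : List X} → (∀ {x} → x ∉ xs) → length xs ≡ 0
  empty⇒length≡0 {xs = []}     h = refl
  empty⇒length≡0 {xs = x ∷ xs} h = ⊥-elim (h (here refl))

-- Petridis' inequality

sublists : {X : Set} → List X → List (List X)
sublists []       = [] ∷ []
sublists (x ∷ xs) = sublists xs ++ map (x ∷_) (sublists xs)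

filter-∈-sublists : {X : Set} {P : Pred X 0ℓ} (P? : Decidable P) (xs : List X) {ys : List X} →
                    ys ∈ sublists xs → filter P? ys ∈ sublists xs
filter-∈-sublists P? [] (here refl) = here refl
filter-∈-sublists P? (x ∷ xs) {ys} ys∈ with ∈-++⁻ (sublists xs) ys∈
... | inj₁ p = ∈-++⁺ˡ (filter-∈-sublists P? xs p)
... | inj₂ p with ∈-map⁻ (x ∷_) p
... | zs , zs∈ , refl with does (P? x)
... | true  = ∈-++⁺ʳ (sublists xs) (∈-map⁺ (x ∷_) (filter-∈-sublists P? xs zs∈))
... | false = ∈-++⁺ˡ (filter-∈-sublists P? xs zs∈)

self-∈-sublists : {X : Set} (xs : List X) → xs ∈ sublists xs
self-∈-sublists []       = here refl
self-∈-sublists (x ∷ xs) = ∈-++⁺ʳ (sublists xs) (∈-map⁺ (x ∷_) (self-∈-sublists xs))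

sublists-⊆ : {X : Set} (xs : List X) {ys : List X} → ys ∈ sublists xs → ∀ {y} → y ∈ ys → y ∈ xs
sublists-⊆ [] (here refl) y∈ = y∈
sublists-⊆ (x ∷ xs) ys∈ y∈ with ∈-++⁻ (sublists xs) ys∈
... | inj₁ p = there (sublists-⊆ xs p y∈)
... | inj₂ p with ∈-map⁻ (x ∷_) p
sublists-⊆ (x ∷ xs) ys∈ (here eq)  | inj₂ p | zs , zs∈ , refl = here eq
sublists-⊆ (x ∷ xs) ys∈ (there y∈) | inj₂ p | zs , zs∈ , refl = there (sublists-⊆ xs zs∈ y∈)

sublists-unique : {X : Set} {xs : List X} → Unique xs → ∀ {ys} → ys ∈ sublists xs → Unique ys
sublists-unique {xs = []} u (here refl) = []
sublists-unique {xs = x ∷ xs} (x∉ ∷ u) ys∈ with ∈-++⁻ (sublists xs) ys∈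
... | inj₁ p = sublists-unique u p
... | inj₂ p with ∈-map⁻ (x ∷_) p
... | zs , zs∈ , refl = All.tabulate (λ y∈ → All.lookup x∉ (sublists-⊆ xs zs∈ y∈)) ∷ sublists-unique u zs∈

-- A minimiser of a x / b x among the x with b x > 0.
argmin : {X : Set} (a b : X → ℕ) (xs : List X) {x₀ : X} → x₀ ∈ xs → 0 < b x₀ →
         ∃ λ x → x ∈ xs × 0 < b x × (∀ {y} → y ∈ xs → 0 < b y → a x * b y ≤ a y * b x)
argmin {X} a b xs x₀∈ b₀ = go xs (All.tabulate id) (_ , x₀∈ , b₀ , λ ())
  where
  Best : List X → Set
  Best ys = ∃ λ x → x ∈ xs × 0 < b x × (∀ {y} → y ∈ ys → 0 < b y → a x * b y ≤ a y * b x)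
  go : ∀ ys → All (_∈ xs) ys → Best [] → Best ys
  go []       _          best = best
  go (y ∷ ys) (y∈ ∷ ys∈) best with go ys ys∈ best
  ... | x , x∈ , bx , min with 0 <? b y
  ... | no ¬by = x , x∈ , bx , λ { (here refl) by → contradiction by ¬by ; (there p) → min p }
  ... | yes by with a x * b y ≤? a y * b x
  ... | yes le = x , x∈ , bx , λ { (here refl) _ → le ; (there p) → min p }
  ... | no ¬le = y , y∈ , by , λ { (here refl) _ → ≤-refl ; {z} (there p) bz → better z (min p bz) }
    where
    lt : a y * b x < a x * b y
    lt = ≰⇒> ¬le
    rearr : ∀ p q r → p * q * r ≡ p * r * q
    rearr = solve-∀
    better : ∀ z → a x * b z ≤ a z * b x → a y * b z ≤ a z * b y
    better z h = *-cancelʳ-≤ _ _ (b x) {{>-nonZero bx}} (begin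
      a y * b z * b x ≡⟨ rearr (a y) (b z) (b x) ⟩
      a y * b x * b z ≤⟨ *-monoˡ-≤ (b z) (<⇒≤ lt) ⟩
      a x * b y * b z ≡⟨ rearr (a x) (b y) (b z) ⟩
      a x * b z * b y ≤⟨ *-monoˡ-≤ (b y) h ⟩
      a z * b x * b y ≡⟨ rearr (a z) (b x) (b y) ⟩
      a z * b y * b x ∎)
      where open ≤-Reasoning

module Growth (𝔾 : FinGroup) where
  open Sets 𝔾

  module Petridis (X C : List G) (uX : Unique X)
    (minimal : ∀ {P : Pred G 0ℓ} (P? : Decidable P) →
               length (X ⊟ C) * count P? X ≤ length (filter P? X ⊟ C) * length X) where

    -- Petridis' induction, adding one z. Let `X₁` consist of the w in X for which w - (C + z) is
    -- already present. At most |X - C| - |X₁ - C| new elements arise, minimality bounds |X₁ - C|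
    -- below by |X - C| |X₁| / |X|, and X - Z itself grows by at least |X| - |X₁|.
    petridis : ∀ Z → length (X ⊟ (C ⊞ Z)) * length X ≤ length (X ⊟ C) * length (X ⊟ Z)
    petridis [] = ≤-trans (≤-reflexive (cong (_* length X) (empty⇒length≡0 none))) z≤n
      where
      none : ∀ {z} → z ∉ X ⊟ (C ⊞ [])
      none z∈ with ∈-⊟⁻ X (C ⊞ []) z∈
      ... | _ , y , _ , y∈ , _ with ∈-⊞⁻ C [] y∈
      ... | _ , _ , _ , () , _
    petridis (z ∷ Z) = +-cancelʳ-≤ (P * y) _ _ (begin
      length big₁ * x + P * y              ≤⟨ +-monoʳ-≤ _ (minimal inside?) ⟩
      length big₁ * x + length (X₁ ⊟ C) * x ≡⟨ sym (*-distribʳ-+ x (length big₁) _) ⟩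
      (length big₁ + length (X₁ ⊟ C)) * x   ≤⟨ *-monoˡ-≤ x claim₁ ⟩
      (length big₀ + P) * x                ≡⟨ *-distribʳ-+ x (length big₀) P ⟩
      length big₀ * x + P * x              ≤⟨ +-monoˡ-≤ (P * x) (petridis Z) ⟩
      P * length s₀ + P * x                ≡⟨ sym (*-distribˡ-+ P (length s₀) x) ⟩
      P * (length s₀ + x)                  ≤⟨ *-monoʳ-≤ P claim₂ ⟩
      P * (length s₁ + y)                  ≡⟨ *-distribˡ-+ P (length s₁) y ⟩
      P * length s₁ + P * y                ∎)
      where
      open ≤-Reasoning
      x = length X
      P = length (X ⊟ C)
      big₀ = X ⊟ (C ⊞ Z)
      big₁ = X ⊟ (C ⊞ (z ∷ Z))
      s₀ = X ⊟ Z
      s₁ = X ⊟ (z ∷ Z)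
      inside? = λ w → All.all? (λ c → (w ⊖ (c ⊕ z)) ∈? big₀) C
      X₁ = filter inside? X
      y = length X₁
      new? = λ w → ¬? (w ∈? big₀)
      N = filter new? big₁

      -- A new element shifted by z lies in X - C. It avoids X₁ - C, because w in `X₁` makes w - (c
      -- + z) an old element.
      claim₁ : length big₁ + length (X₁ ⊟ C) ≤ length big₀ + P
      claim₁ = begin
        length big₁ + length (X₁ ⊟ C)                                ≡⟨ cong (_+ length (X₁ ⊟ C)) (sym (count-split (_∈? big₀) big₁)) ⟩
        (count (_∈? big₀) big₁ + length N) + length (X₁ ⊟ C)         ≡⟨ +-assoc (count (_∈? big₀) big₁) _ _ ⟩
        count (_∈? big₀) big₁ + (length N + length (X₁ ⊟ C))         ≤⟨ +-mono-≤ old fresh ⟩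
        length big₀ + P                                             ∎
        where
        old : count (_∈? big₀) big₁ ≤ length big₀
        old = ⊆⇒length≤ _≟_ (Uniq.filter⁺ (_∈? big₀) (⊟-unique X _)) (λ w∈ → proj₂ (∈-filter⁻ (_∈? big₀) {xs = big₁} w∈))
        shifted : ∀ {w} → w ∈ N → ∃ λ a → ∃ λ c → a ∈ X × c ∈ C × w ≡ a ⊖ (c ⊕ z)
        shifted {w} w∈ with ∈-filter⁻ new? {xs = big₁} w∈
        ... | w∈₁ , w∉₀ with ∈-⊟⁻ X (C ⊞ (z ∷ Z)) w∈₁
        ... | a , b , a∈ , b∈ , refl with ∈-⊞⁻ C (z ∷ Z) b∈
        ... | c , _ , c∈ , here refl , refl = a , c , a∈ , c∈ , refl
        ... | c , _ , c∈ , there z′∈ , refl = contradiction (∈-⊟⁺ a∈ (∈-⊞⁺ c∈ z′∈)) w∉₀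
        fresh : length N + length (X₁ ⊟ C) ≤ P
        fresh = ≤-trans (≤-reflexive (trans (cong (_+ length (X₁ ⊟ C)) (sym (length-map (_⊕ z) N))) (sym (length-++ (map (_⊕ z) N)))))
          (⊆⇒length≤ _≟_ (Uniq.++⁺ (map-unique (_⊕ z) (λ {p} {q} _ _ eq → by₁ (solve (x₀ :- x₁) ((x₀ :+ x₂) :- (x₁ :+ x₂)) (p ∷ q ∷ z ∷ []) refl) eq)
                                     (Uniq.filter⁺ new? (⊟-unique X _)))
                                   (⊟-unique X₁ C) disj)
                         sub)
          where
          sub : map (_⊕ z) N ++ (X₁ ⊟ C) ⊆ X ⊟ C
          sub w∈ with ∈-++⁻ (map (_⊕ z) N) w∈
          ... | inj₂ p = ⊟-mono {X₁} {X} {C} {C} (λ q → proj₁ (∈-filter⁻ inside? {xs = X} q)) id p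
          ... | inj₁ p with ∈-map⁻ (_⊕ z) p
          ... | v , v∈ , refl with shifted v∈
          ... | a , c , a∈ , c∈ , refl =
            subst (_∈ X ⊟ C) (solve (x₀ :- x₁) ((x₀ :- (x₁ :+ x₂)) :+ x₂) (a ∷ c ∷ z ∷ []) refl) (∈-⊟⁺ a∈ c∈)
          disj : ∀ {w} → w ∈ map (_⊕ z) N × w ∈ X₁ ⊟ C → ⊥
          disj (p , q) with ∈-map⁻ (_⊕ z) p
          ... | v , v∈ , refl with ∈-⊟⁻ X₁ C q
          ... | b , c , b∈ , c∈ , eq = proj₂ (∈-filter⁻ new? {xs = big₁} v∈)
            (subst (_∈ big₀) (sym (by₁ (solve (x₀ :- (x₁ :- (x₂ :+ x₃))) ((x₀ :+ x₃) :- (x₁ :- x₂)) (v ∷ b ∷ c ∷ z ∷ []) refl) eq))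
              (All.lookup (proj₂ (∈-filter⁻ inside? {xs = X} b∈)) c∈))

      -- If w - z = b - z′ with z′ in Z, then w - (c + z) = b - (c + z′) is old for every c, so w is
      -- in `X₁`. Hence the elements of X outside `X₁` yield new differences w - z.
      claim₂ : length s₀ + x ≤ length s₁ + y
      claim₂ = begin
        length s₀ + x                                  ≡⟨ cong (length s₀ +_) (trans (sym (count-split inside? X)) (+-comm y _)) ⟩
        length s₀ + (length O + y)                     ≡⟨ sym (+-assoc (length s₀) _ y) ⟩
        (length s₀ + length O) + y                     ≡⟨ cong (λ l → length s₀ + l + y) (sym (length-map (_⊖ z) O)) ⟩
        (length s₀ + length (map (_⊖ z) O)) + y        ≡⟨ cong (_+ y) (sym (length-++ s₀)) ⟩
        length (s₀ ++ map (_⊖ z) O) + y                ≤⟨ +-monoˡ-≤ y (⊆⇒length≤ _≟_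
                                                            (Uniq.++⁺ (⊟-unique X Z) (map-unique (_⊖ z) (λ {p} {q} _ _ eq → by₁ (solve (x₀ :- x₁) ((x₀ :- x₂) :- (x₁ :- x₂)) (p ∷ q ∷ z ∷ []) refl) eq)
                                                              (Uniq.filter⁺ (¬? ∘ inside?) uX)) disj) sub) ⟩
        length s₁ + y                                  ∎
        where
        O = filter (¬? ∘ inside?) X
        sub : s₀ ++ map (_⊖ z) O ⊆ s₁
        sub w∈ with ∈-++⁻ s₀ w∈
        ... | inj₁ p = ⊟-mono {X} {X} {Z} {z ∷ Z} id there p
        ... | inj₂ p with ∈-map⁻ (_⊖ z) p
        ... | v , v∈ , refl = ∈-⊟⁺ (proj₁ (∈-filter⁻ (¬? ∘ inside?) {xs = X} v∈)) (here refl)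
        disj : ∀ {w} → w ∈ s₀ × w ∈ map (_⊖ z) O → ⊥
        disj (p , q) with ∈-map⁻ (_⊖ z) q
        ... | v , v∈ , refl with ∈-⊟⁻ X Z p
        ... | b , z′ , b∈ , z′∈ , eq = proj₂ (∈-filter⁻ (¬? ∘ inside?) {xs = X} v∈) (All.tabulate (λ {c} c∈ →
          subst (_∈ big₀) (sym (by₁ (solve ((x₀ :- (x₃ :+ x₂)) :- (x₁ :- (x₃ :+ x₄))) ((x₀ :- x₂) :- (x₁ :- x₄)) (v ∷ b ∷ z ∷ c ∷ z′ ∷ []) refl) eq))
            (∈-⊟⁺ b∈ (∈-⊞⁺ c∈ z′∈))))

  infixr 7 _·_
  _·_ : ℕ → G → G
  zero  · x = 𝟘
  suc k · x = x ⊕ k · x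

  WindowFree : List G → Set
  WindowFree A = ∀ {δ} → δ ≢ 𝟘 → δ ∈ A ⊟ A → 2 · δ ∈ A ⊟ A → 4 · δ ∈ A ⊟ A → 8 · δ ∈ A ⊟ A → ⊥

  sumset : ℕ → List G → List G
  sumset zero    C = 𝟘 ∷ []
  sumset (suc j) C = C ⊞ sumset j C

  ·-∈-sumset : ∀ j {C c} → c ∈ C → j · c ∈ sumset j C
  ·-∈-sumset zero    c∈ = here refl
  ·-∈-sumset (suc j) c∈ = ∈-⊞⁺ c∈ (·-∈-sumset j c∈)

  two-elements : {xs : List G} → 1 < length xs → Unique xs → ∃ λ x → ∃ λ y → x ∈ xs × y ∈ xs × x ≢ y
  two-elements {x ∷ []}     (s≤s ()) _
  two-elements {x ∷ y ∷ xs} _ ((x≢y ∷ _) ∷ _) = x , y , here refl , there (here refl) , x≢y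

  -- The exponent is 2 + 4 + 8. Let K = |X′ - C| / |X′| be minimal over the nonempty sublists X′ of
  -- X. Refining C for j = 2, 4, 8 loses a factor K ^ j each time and puts a translate of j · C
  -- inside X′. Two elements surviving all three would differ by some g with g, 2g, 4g and 8g in A -
  -- A, so |C| ≤ K ^ 14.
  growth : ∀ {A X C} → WindowFree A → X ⊆ A → C ⊆ A → Unique X → Unique C → 0 < length X →
           length X ^ 14 * length C ≤ length (X ⊟ C) ^ 14
  growth {A} {X} {C} wf X⊆ C⊆ uX uC neX
    with argmin (λ Y → length (Y ⊟ C)) length (sublists X) (self-∈-sublists X) neX
  ... | X′ , X′∈ , neX′ , min = *-cancelʳ-≤ _ _ (x ^ 14) {{m^n≢0 x 14 {{>-nonZero neX′}}}} (begin
      length X ^ 14 * length C * x ^ 14     ≡⟨ rearr (length X ^ 14) (length C) (x ^ 14) ⟩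
      length C * x ^ 14 * length X ^ 14     ≤⟨ *-monoˡ-≤ (length X ^ 14) small ⟩
      P ^ 14 * length X ^ 14                ≡⟨ sym (^-distribʳ-* 14 P (length X)) ⟩
      (P * length X) ^ 14                   ≤⟨ ^-monoˡ-≤ 14 (min (self-∈-sublists X) neX) ⟩
      (length (X ⊟ C) * x) ^ 14             ≡⟨ ^-distribʳ-* 14 (length (X ⊟ C)) x ⟩
      length (X ⊟ C) ^ 14 * x ^ 14          ∎)
    where
    open ≤-Reasoning
    x = length X′
    P = length (X′ ⊟ C)
    X′⊆ : X′ ⊆ X
    X′⊆ = sublists-⊆ X X′∈
    uX′ : Unique X′
    uX′ = sublists-unique uX X′∈
    rearr : ∀ p q r → p * q * r ≡ q * r * p
    rearr = solve-∀
    ^-distribʳ-* : ∀ k a b → (a * b) ^ k ≡ a ^ k * b ^ k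
    ^-distribʳ-* zero    a b = refl
    ^-distribʳ-* (suc k) a b = trans (cong (a * b *_) (^-distribʳ-* k a b)) (swap a b (a ^ k) (b ^ k))
      where
      swap : ∀ p q r s → p * q * (r * s) ≡ p * r * (q * s)
      swap = solve-∀
    minimal : ∀ {Q : Pred G 0ℓ} (Q? : Decidable Q) →
              length (X′ ⊟ C) * count Q? X′ ≤ length (filter Q? X′ ⊟ C) * length X′
    minimal Q? with 0 <? count Q? X′
    ... | yes ne = min (filter-∈-sublists Q? X X′∈) ne
    ... | no ¬ne = ≤-trans (≤-reflexive (trans (cong (P *_) (n≤0⇒n≡0 (≮⇒≥ ¬ne))) (*-zeroʳ P))) z≤n
    open Petridis X′ C uX′ minimal
    -- One more summand C costs one more factor P / x, by `petridis` with Z the previous sumset.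
    iterate : ∀ j → length (X′ ⊟ sumset j C) * x ^ j ≤ P ^ j * x
    iterate zero = ≤-trans (≤-reflexive (*-identityʳ _)) (≤-trans
      (⊆⇒length≤ _≟_ (⊟-unique X′ _) sub) (≤-reflexive (sym (*-identityˡ x))))
      where
      sub : X′ ⊟ (𝟘 ∷ []) ⊆ X′
      sub z∈ with ∈-⊟⁻ X′ (𝟘 ∷ []) z∈
      ... | a , _ , a∈ , here refl , refl = subst (_∈ X′) (solve x₀ (x₀ :- :0) (a ∷ []) refl) a∈
    iterate (suc j) = begin
      length (X′ ⊟ (C ⊞ sumset j C)) * (x * x ^ j)    ≡⟨ sym (*-assoc (length (X′ ⊟ (C ⊞ sumset j C))) x (x ^ j)) ⟩
      length (X′ ⊟ (C ⊞ sumset j C)) * x * x ^ j      ≤⟨ *-monoˡ-≤ (x ^ j) (petridis (sumset j C)) ⟩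
      P * length (X′ ⊟ sumset j C) * x ^ j            ≡⟨ *-assoc P _ (x ^ j) ⟩
      P * (length (X′ ⊟ sumset j C) * x ^ j)          ≤⟨ *-monoʳ-≤ P (iterate j) ⟩
      P * (P ^ j * x)                                 ≡⟨ sym (*-assoc P (P ^ j) x) ⟩
      P * P ^ j * x                                   ∎
    -- The pairs (a, c) take at most K ^ j |X′| values a - j · c, so the most popular value z serves
    -- at least |C₁| / K ^ j of the c.
    refine : ∀ j {C₁} → C₁ ⊆ C → Unique C₁ →
             ∃ λ C₂ → C₂ ⊆ C₁ × Unique C₂ × (∃ λ z → ∀ {c} → c ∈ C₂ → z ⊕ j · c ∈ X′) ×
                      length C₁ * x ^ j ≤ P ^ j * length C₂
    refine j {C₁} C₁⊆ uC₁ with 0 <? length C₁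
    ... | no ¬p = [] , (λ ()) , [] , (𝟘 , λ ()) , ≤-trans (≤-reflexive (cong (_* x ^ j) (n≤0⇒n≡0 (≮⇒≥ ¬p)))) z≤n
    ... | yes neC₁ =
      let (z , _ , le) = pigeonhole _≟_ {xs = pairs} {ys = D} φ (⊟-unique X′ _) φ∈ neD
          inX? = λ c → (z ⊕ j · c) ∈? X′
          C₂ = filter inX? C₁
          fib : count (λ p → φ p ≟ z) pairs ≤ length C₂
          fib = inj⇒length≤ _≟_ {ys = C₂} proj₂ (Uniq.filter⁺ (λ p → φ p ≟ z) (Uniq.cartesianProduct⁺ uX′ uC₁))
            (λ {p} p∈ → let (p∈₁ , eq) = ∈-filter⁻ (λ p → φ p ≟ z) {xs = pairs} p∈
                            (a∈ , c∈) = ∈-cartesianProduct⁻ X′ C₁ p∈₁ in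
                        ∈-filter⁺ inX? c∈ (subst (_∈ X′) (by₁ (solve (x₀ :- (x₂ :+ x₁)) ((x₀ :- x₁) :- x₂) (proj₁ p ∷ j · proj₂ p ∷ z ∷ []) refl) eq) a∈))
            (λ {p} {q} p∈ q∈ eq → cong₂ _,_ (first {p} {q} (trans (proj₂ (∈-filter⁻ (λ p → φ p ≟ z) {xs = pairs} p∈))
                                                   (sym (proj₂ (∈-filter⁻ (λ p → φ p ≟ z) {xs = pairs} q∈)))) eq) eq)
      in C₂ , (λ q → proj₁ (∈-filter⁻ inX? {xs = C₁} q)) , Uniq.filter⁺ inX? uC₁ ,
         (z , λ q → proj₂ (∈-filter⁻ inX? {xs = C₁} q)) ,
         *-cancelʳ-≤ _ _ x {{>-nonZero neX′}} (begin
           length C₁ * x ^ j * x                            ≡⟨ rearr′ (length C₁) (x ^ j) x ⟩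
           x * length C₁ * x ^ j                            ≡⟨ cong (_* x ^ j) (sym (length-cartesianProduct X′ C₁)) ⟩
           length pairs * x ^ j                             ≤⟨ *-monoˡ-≤ (x ^ j) (≤-trans le (*-monoʳ-≤ (length D) fib)) ⟩
           length D * length C₂ * x ^ j                     ≡⟨ rearr″ (length D) (length C₂) (x ^ j) ⟩
           length D * x ^ j * length C₂                     ≤⟨ *-monoˡ-≤ (length C₂) (iterate j) ⟩
           P ^ j * x * length C₂                            ≡⟨ rearr″ (P ^ j) x (length C₂) ⟩
           P ^ j * length C₂ * x                            ∎)
      where
      pairs = cartesianProduct X′ C₁
      D = X′ ⊟ sumset j C
      φ : G × G → G
      φ (a , c) = a ⊖ j · c
      φ∈ : ∀ {p} → p ∈ pairs → φ p ∈ D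
      φ∈ p∈ = let (a∈ , c∈) = ∈-cartesianProduct⁻ X′ C₁ p∈ in ∈-⊟⁺ a∈ (·-∈-sumset j (C₁⊆ c∈))
      neD : 0 < length D
      neD = let (a , a∈) = 0<length⇒∃ X′ neX′ ; (c , c∈) = 0<length⇒∃ C₁ neC₁ in
            ∈⇒0<length (∈-⊟⁺ a∈ (·-∈-sumset j (C₁⊆ c∈)))
      first : ∀ {p q} → φ p ≡ φ q → proj₂ p ≡ proj₂ q → proj₁ p ≡ proj₁ q
      first {a , c} {b , .c} eq refl = by₁ (solve (x₀ :- x₁) ((x₀ :- x₂) :- (x₁ :- x₂)) (a ∷ b ∷ j · c ∷ []) refl) eq
      rearr′ : ∀ p q r → p * q * r ≡ r * p * q
      rearr′ = solve-∀
      rearr″ : ∀ p q r → p * q * r ≡ p * r * q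
      rearr″ = solve-∀
    ·-⊖ : ∀ j {c c′} z → (z ⊕ j · c) ⊖ (z ⊕ j · c′) ≡ j · (c ⊖ c′)
    ·-⊖ zero    z = solve ((x₀ :+ :0) :- (x₀ :+ :0)) :0 (z ∷ []) refl
    ·-⊖ (suc j) {c} {c′} z = trans (solve ((x₄ :+ (x₀ :+ x₁)) :- (x₄ :+ (x₂ :+ x₃))) ((x₀ :- x₂) :+ ((x₄ :+ x₁) :- (x₄ :+ x₃))) (c ∷ j · c ∷ c′ ∷ j · c′ ∷ z ∷ []) refl)
      (cong (c ⊖ c′ ⊕_) (·-⊖ j z))
    small : length C * x ^ 14 ≤ P ^ 14
    small with refine 2 {C} id uC
    ... | C₁ , C₁⊆ , u₁ , (z₁ , in₁) , le₁ with refine 4 {C₁} C₁⊆ u₁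
    ... | C₂ , C₂⊆ , u₂ , (z₂ , in₂) , le₂ with refine 8 {C₂} (C₁⊆ ∘ C₂⊆) u₂
    ... | C₃ , C₃⊆ , u₃ , (z₃ , in₃) , le₃ with 1 <? length C₃
    ... | yes two =
      let (c , c′ , c∈ , c′∈ , c≢) = two-elements two u₃ in
      ⊥-elim (wf {c ⊖ c′} (λ eq → c≢ (⊖≡𝟘⇒≡ eq))
        (∈-⊟⁺ (C⊆ (C₁⊆ (C₂⊆ (C₃⊆ c∈)))) (C⊆ (C₁⊆ (C₂⊆ (C₃⊆ c′∈)))))
        (subst (_∈ A ⊟ A) (·-⊖ 2 z₁) (∈-⊟⁺ (X⊆ (X′⊆ (in₁ (C₂⊆ (C₃⊆ c∈))))) (X⊆ (X′⊆ (in₁ (C₂⊆ (C₃⊆ c′∈)))))))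
        (subst (_∈ A ⊟ A) (·-⊖ 4 z₂) (∈-⊟⁺ (X⊆ (X′⊆ (in₂ (C₃⊆ c∈)))) (X⊆ (X′⊆ (in₂ (C₃⊆ c′∈))))))
        (subst (_∈ A ⊟ A) (·-⊖ 8 z₃) (∈-⊟⁺ (X⊆ (X′⊆ (in₃ c∈))) (X⊆ (X′⊆ (in₃ c′∈))))))
    ... | no ¬two = begin
      length C * x ^ 14                          ≡⟨ cong (length C *_) (trans (^-distribˡ-+-* x 2 12) (cong (x ^ 2 *_) (^-distribˡ-+-* x 4 8))) ⟩
      length C * (x ^ 2 * (x ^ 4 * x ^ 8))       ≡⟨ sym (*-assoc (length C) _ _) ⟩
      length C * x ^ 2 * (x ^ 4 * x ^ 8)         ≤⟨ *-monoˡ-≤ _ le₁ ⟩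
      P ^ 2 * length C₁ * (x ^ 4 * x ^ 8)        ≡⟨ shuffle (P ^ 2) (length C₁) (x ^ 4) (x ^ 8) ⟩
      P ^ 2 * (length C₁ * x ^ 4 * x ^ 8)        ≤⟨ *-monoʳ-≤ (P ^ 2) (*-monoˡ-≤ (x ^ 8) le₂) ⟩
      P ^ 2 * (P ^ 4 * length C₂ * x ^ 8)        ≡⟨ cong (P ^ 2 *_) (*-assoc (P ^ 4) _ _) ⟩
      P ^ 2 * (P ^ 4 * (length C₂ * x ^ 8))      ≤⟨ *-monoʳ-≤ (P ^ 2) (*-monoʳ-≤ (P ^ 4) (≤-trans le₃ (*-monoʳ-≤ (P ^ 8) (≮⇒≥ ¬two)))) ⟩
      P ^ 2 * (P ^ 4 * (P ^ 8 * 1))              ≡⟨ cong (λ q → P ^ 2 * (P ^ 4 * q)) (*-identityʳ (P ^ 8)) ⟩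
      P ^ 2 * (P ^ 4 * P ^ 8)                    ≡⟨ sym (trans (^-distribˡ-+-* P 2 12) (cong (P ^ 2 *_) (^-distribˡ-+-* P 4 8))) ⟩
      P ^ 14                                     ∎
      where
      shuffle : ∀ p q r s → p * q * (r * s) ≡ p * (q * r * s)
      shuffle = solve-∀

-- Hitting sets

module _ {I T : Set} {R : I → T → Set} (R? : ∀ i t → Dec (R i t)) (us : List T) (B : ℕ)
         (us≢[] : 0 < length us) (0<B : 0 < B) where

  private
    hit-one : (Q : List I) → (∀ {i} → i ∈ Q → length us ≤ B * count (R? i) us) →
              ∃ λ t → t ∈ us × length Q ≤ B * count (λ i → R? i t) Q
    hit-one Q dense = ∑≤∑⇒∃ us _ _ us≢[] (begin
      ∑ us (λ _ → length Q)                      ≡⟨ trans (∑-const us (length Q)) (*-comm (length us) _) ⟩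
      length Q * length us                       ≡⟨ sym (∑-const Q (length us)) ⟩
      ∑ Q (λ _ → length us)                      ≤⟨ ∑-mono Q dense ⟩
      ∑ Q (λ i → B * count (R? i) us)            ≡⟨ ∑-*ˡ B Q _ ⟩
      B * ∑ Q (λ i → count (R? i) us)            ≡⟨ cong (B *_) (double-count R? Q us) ⟩
      B * ∑ us (λ t → count (λ i → R? i t) Q)    ≡⟨ sym (∑-*ˡ B us _) ⟩
      ∑ us (λ t → B * count (λ i → R? i t) Q)    ∎)
      where open ≤-Reasoning

    Partial : List I → List T → List I → Set
    Partial Q ts Q′ = (∀ {t} → t ∈ ts → t ∈ us) × (∀ {i} → i ∈ Q′ → i ∈ Q) ×
                      (∀ {i} → i ∈ Q → (∃ λ t → t ∈ ts × R i t) ⊎ i ∈ Q′)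

    -- As long as more than half of Q is missed, the next element hits at least |Q| / (2B) of its
    -- members; the second alternative records this. For j = 2B that alternative leaves nothing
    -- missed, so Q is at least halved in either case.
    hit-some : ∀ j (Q : List I) → (∀ {i} → i ∈ Q → length us ≤ B * count (R? i) us) →
               ∃ λ ts → ∃ λ Q′ → Partial Q ts Q′ × length ts ≤ j ×
               (2 * length Q′ ≤ length Q ⊎ j * length Q + 2 * B * length Q′ ≤ 2 * B * length Q)
    hit-some zero    Q dense = [] , Q , ((λ ()) , id , inj₂) , z≤n , inj₂ ≤-refl
    hit-some (suc j) Q dense with hit-some j Q dense
    ... | ts , Q′ , part , le , inj₁ done = ts , Q′ , part , m≤n⇒m≤1+n le , inj₁ done
    ... | ts , Q′ , (ts⊆ , Q′⊆ , cov) , le , inj₂ inv with 2 * length Q′ ≤? length Q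
    ... | yes done = ts , Q′ , (ts⊆ , Q′⊆ , cov) , m≤n⇒m≤1+n le , inj₁ done
    ... | no ¬done with hit-one Q′ (dense ∘ Q′⊆)
    ... | t , t∈ , many = t ∷ ts , Q″ , ((λ { (here refl) → t∈ ; (there p) → ts⊆ p }) ,
            (λ p → Q′⊆ (proj₁ (∈-filter⁻ miss? {xs = Q′} p))) , cov′) , s≤s le , inj₂ (begin
      length Q + j * length Q + 2 * B * length Q″               ≡⟨ cong (_+ 2 * B * length Q″) (+-comm (length Q) _) ⟩
      j * length Q + length Q + 2 * B * length Q″               ≤⟨ +-monoˡ-≤ (2 * B * length Q″) (+-monoʳ-≤ (j * length Q) enough) ⟩
      j * length Q + 2 * B * k + 2 * B * length Q″              ≡⟨ collect (j * length Q) (2 * B) k (length Q″) ⟩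
      j * length Q + 2 * B * (k + length Q″)                    ≡⟨ cong (λ l → j * length Q + 2 * B * l) (count-split (λ i → R? i t) Q′) ⟩
      j * length Q + 2 * B * length Q′                          ≤⟨ inv ⟩
      2 * B * length Q                                          ∎)
      where
      open ≤-Reasoning
      miss? = λ i → ¬? (R? i t)
      Q″ = filter miss? Q′
      k = count (λ i → R? i t) Q′
      collect : ∀ a b c d → a + b * c + b * d ≡ a + b * (c + d)
      collect = solve-∀
      enough : length Q ≤ 2 * B * k
      enough = ≤-trans (<⇒≤ (≰⇒> ¬done)) (≤-trans (*-monoʳ-≤ 2 many) (≤-reflexive (sym (*-assoc 2 B k))))
      cov′ : ∀ {i} → i ∈ Q → (∃ λ s → s ∈ t ∷ ts × R i s) ⊎ i ∈ Q″
      cov′ {i} i∈ with cov i∈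
      ... | inj₁ (s , s∈ , r) = inj₁ (s , there s∈ , r)
      ... | inj₂ i∈′ with R? i t
      ... | yes r = inj₁ (t , here refl , r)
      ... | no ¬r = inj₂ (∈-filter⁺ miss? i∈′ ¬r)

  -- Every batch of 2B greedy choices halves the set of missed members, and fewer than 2 ^ ℓ members
  -- vanish after ℓ halvings.
  hit : ∀ ℓ (Q : List I) → length Q < 2 ^ ℓ → (∀ {i} → i ∈ Q → length us ≤ B * count (R? i) us) →
        ∃ λ ts → (∀ {t} → t ∈ ts → t ∈ us) × length ts ≤ ℓ * (2 * B) × (∀ {i} → i ∈ Q → ∃ λ t → t ∈ ts × R i t)
  hit zero    []      lt dense = [] , (λ ()) , z≤n , λ ()
  hit zero    (_ ∷ _) (s≤s ()) dense
  hit (suc ℓ) Q lt dense with hit-some (2 * B) Q dense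
  ... | ts , Q′ , (ts⊆ , Q′⊆ , cov) , le , dis with hit ℓ Q′ (*-cancelˡ-< 2 _ _ (≤-<-trans (halved dis) lt)) (dense ∘ Q′⊆)
    where
    halved : 2 * length Q′ ≤ length Q ⊎ 2 * B * length Q + 2 * B * length Q′ ≤ 2 * B * length Q → 2 * length Q′ ≤ length Q
    halved (inj₁ p) = p
    halved (inj₂ p) = ≤-trans (*-monoʳ-≤ 2 (*-cancelˡ-≤ {length Q′} {0} (2 * B) {{m*n≢0 2 B {{_}} {{>-nonZero 0<B}}}}
      (+-cancelˡ-≤ (2 * B * length Q) _ _ (≤-trans p (≤-reflexive (sym (trans (cong (2 * B * length Q +_) (*-zeroʳ (2 * B))) (+-identityʳ _)))))))) z≤n
  ... | ts′ , ts′⊆ , le′ , hits = ts ++ ts′ ,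
      (λ p → ⊎-elim ts⊆ ts′⊆ (∈-++⁻ ts p)) ,
      ≤-trans (≤-reflexive (length-++ ts)) (+-mono-≤ le le′) ,
      λ i∈ → combine (cov i∈)
    where
    combine : ∀ {i} → (∃ λ t → t ∈ ts × R i t) ⊎ i ∈ Q′ → ∃ λ t → t ∈ ts ++ ts′ × R i t
    combine (inj₁ (t , t∈ , r)) = t , ∈-++⁺ˡ t∈ , r
    combine (inj₂ i∈) = let (t , t∈ , r) = hits i∈ in t , ∈-++⁺ʳ ts t∈ , r

module _ {I T : Set} (_≟_ : DecidableEquality T) {R : I → T → Set} (R? : ∀ i t → Dec (R i t)) (us : List T) (B s : ℕ)
         (us≢[] : 0 < length us) (0<B : 0 < B) (uus : Unique us) where

  open DecMembership _≟_ using (_∈?_)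

  -- There are s rounds of `hit`, each aimed at the members with too few hits and confined to
  -- elements not chosen before. The chosen elements that such a member loses number fewer than s,
  -- which the subtraction of s in the density hypothesis pays for.
  hit-many : ∀ ℓ (Q : List I) → length Q < 2 ^ ℓ → (∀ {i} → i ∈ Q → length us ≤ B * (count (R? i) us ∸ s)) →
             ∃ λ ts → (∀ {t} → t ∈ ts → t ∈ us) × Unique ts × length ts ≤ s * (ℓ * (2 * B)) × (∀ {i} → i ∈ Q → s ≤ count (R? i) ts)
  hit-many ℓ Q lt dense = rounds s ≤-refl
    where
    rounds : ∀ r → r ≤ s → ∃ λ ts → (∀ {t} → t ∈ ts → t ∈ us) × Unique ts × length ts ≤ r * (ℓ * (2 * B)) × (∀ {i} → i ∈ Q → r ≤ count (R? i) ts)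
    rounds zero    _   = [] , (λ ()) , [] , z≤n , λ _ → z≤n
    rounds (suc r) r<s with rounds r (<⇒≤ r<s)
    ... | ts , ts⊆ , uts , le , many
      with hit {R = λ i t → R i t × t ∉ ts} (λ i t → R? i t ×-dec ¬? (t ∈? ts)) us B us≢[] 0<B ℓ Q′
               (≤-<-trans (length-filter few? Q) lt) dense′
      where
      few? = λ i → count (R? i) ts ≤? r
      Q′ = filter few? Q
      dense′ : ∀ {i} → i ∈ Q′ → length us ≤ B * count (λ t → R? i t ×-dec ¬? (t ∈? ts)) us
      dense′ {i} i∈ = let (i∈Q , few) = ∈-filter⁻ few? {xs = Q} i∈ in
        ≤-trans (dense i∈Q) (*-monoʳ-≤ B (≤-trans (∸-monoˡ-≤ s (total few)) (≤-reflexive (m+n∸n≡m _ s))))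
        where
        total : count (R? i) ts ≤ r → count (R? i) us ≤ count (λ t → R? i t ×-dec ¬? (t ∈? ts)) us + s
        total few = ≤-trans (count-⊎ (R? i) (λ t → R? i t ×-dec ¬? (t ∈? ts)) (λ t → R? i t ×-dec (t ∈? ts)) us split)
          (+-monoʳ-≤ (count (λ t → R? i t ×-dec ¬? (t ∈? ts)) us) (≤-trans (⊆⇒length≤ _≟_ (Uniq.filter⁺ _ uus)
            (λ p → let (_ , (q , t∈)) = ∈-filter⁻ (λ t → R? i t ×-dec (t ∈? ts)) {xs = us} p in ∈-filter⁺ (R? i) t∈ q))
            (≤-trans few (<⇒≤ r<s))))
          where
          split : ∀ {t} → t ∈ us → R i t → (R i t × t ∉ ts) ⊎ (R i t × t ∈ ts)
          split {t} _ q with t ∈? ts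
          ... | yes t∈ = inj₂ (q , t∈)
          ... | no t∉  = inj₁ (q , t∉)
    ... | ts′ , ts′⊆ , le′ , hits = ts ++ new ,
        (λ p → ⊎-elim ts⊆ (λ q → ts′⊆ (proj₁ (new⁻ q))) (∈-++⁻ ts p)) ,
        Uniq.++⁺ uts (Uniq.filter⁺ _ (deduplicate-! _≟_ ts′)) (λ (p , q) → proj₂ (new⁻ q) p) ,
        ≤-trans (≤-reflexive (length-++ ts)) (≤-trans (+-mono-≤ le new-short) (≤-reflexive (+-comm (r * (ℓ * (2 * B))) _))) ,
        more
      where
      few? = λ i → count (R? i) ts ≤? r
      new? = λ t → ¬? (t ∈? ts)
      new = filter new? (deduplicate _≟_ ts′)
      new⁻ : ∀ {t} → t ∈ new → t ∈ ts′ × t ∉ ts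
      new⁻ p = let (q , t∉) = ∈-filter⁻ new? {xs = deduplicate _≟_ ts′} p in ∈-deduplicate⁻ _≟_ ts′ q , t∉
      new-short : length new ≤ ℓ * (2 * B)
      new-short = ≤-trans (⊆⇒length≤ _≟_ (Uniq.filter⁺ _ (deduplicate-! _≟_ ts′)) (proj₁ ∘ new⁻)) le′
      count-++ : ∀ {P : Pred T 0ℓ} (P? : Decidable P) xs ys → count P? (xs ++ ys) ≡ count P? xs + count P? ys
      count-++ P? xs ys = trans (count-∑ P? (xs ++ ys)) (trans (∑-++ xs ys _) (sym (cong₂ _+_ (count-∑ P? xs) (count-∑ P? ys))))
      more : ∀ {i} → i ∈ Q → suc r ≤ count (R? i) (ts ++ new)
      more {i} i∈ with count (R? i) ts ≤? r
      ... | no ¬few = ≤-trans (≰⇒> ¬few) (≤-trans (m≤m+n _ _) (≤-reflexive (sym (count-++ (R? i) ts new))))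
      ... | yes few = let (t , t∈ , (q , t∉)) = hits (∈-filter⁺ few? i∈ few) in
        ≤-trans (≤-trans (s≤s (many i∈)) (≤-trans (≤-reflexive (+-comm 1 _))
          (+-monoʳ-≤ (count (R? i) ts) (∃⇒0<count (R? i) (∈-filter⁺ new? (∈-deduplicate⁺ _≟_ t∈) t∉) q))))
          (≤-reflexive (sym (count-++ (R? i) ts new)))

mapWith∈-∈ : {X Y : Set} (xs : List X) (f : ∀ {x} → x ∈ xs → Y) {x : X} (x∈ : x ∈ xs) → f x∈ ∈ mapWith∈ xs f
mapWith∈-∈ (x ∷ xs) f (here refl) = here refl
mapWith∈-∈ (x ∷ xs) f (there p)   = there (mapWith∈-∈ xs (f ∘ there) p)

∈-mapWith∈ : {X Y : Set} (xs : List X) (f : ∀ {x} → x ∈ xs → Y) {y : Y} → y ∈ mapWith∈ xs f →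
             ∃ λ x → Σ (x ∈ xs) λ x∈ → y ≡ f x∈
∈-mapWith∈ (x ∷ xs) f (here eq) = x , here refl , eq
∈-mapWith∈ (x ∷ xs) f (there p) = let (x′ , x∈ , eq) = ∈-mapWith∈ xs (f ∘ there) p in x′ , there x∈ , eq

filter-map-unique : {X Y : Set} {P : Pred X 0ℓ} (P? : Decidable P) (f : X → Y) (xs : List X) →
                    Unique (map f xs) → Unique (map f (filter P? xs))
filter-map-unique P? f []       u        = []
filter-map-unique P? f (x ∷ xs) (x∉ ∷ u) with does (P? x)
... | false = filter-map-unique P? f xs u
... | true  = All.tabulate (λ z∈ → let (y , y∈ , eq) = ∈-map⁻ f z∈ in
    subst (f x ≢_) (sym eq) (All.lookup x∉ (∈-map⁺ f (proj₁ (∈-filter⁻ P? {xs = xs} y∈)))))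
  ∷ filter-map-unique P? f xs u

length-mapWith∈ : {X Y : Set} (xs : List X) {f : ∀ {x} → x ∈ xs → Y} → length (mapWith∈ xs f) ≡ length xs
length-mapWith∈ []       = refl
length-mapWith∈ (x ∷ xs) = cong suc (length-mapWith∈ xs)

module Spread {I T K : Set} (_≟_ : DecidableEquality K) (pay : I → T → List (K × K))
  (pay-unique₁ : ∀ v t → Unique (map proj₁ (pay v t))) (pay-unique₂ : ∀ v t → Unique (map proj₂ (pay v t)))
  (us : List T) (B rounds gain : ℕ) (us≢[] : 0 < length us) (0<B : 0 < B) where

  open DecMembership _≟_ using (_∈?_)

  Fresh : List (K × K) → K × K → Set
  Fresh ps (p , q) = p ∉ map proj₁ ps × q ∉ map proj₂ ps

  fresh? : ∀ ps pq → Dec (Fresh ps pq)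
  fresh? ps (p , q) = ¬? (p ∈? map proj₁ ps) ×-dec ¬? (q ∈? map proj₂ ps)

  Progressive : I → List (K × K) → T → Set
  Progressive v ps t = gain ≤ count (fresh? ps) (pay v t)

  progressive? : ∀ v ps t → Dec (Progressive v ps t)
  progressive? v ps t = gain ≤? count (fresh? ps) (pay v t)

  Valid : I → List T → List (K × K) → Set
  Valid v ts ps = (∀ {pq} → pq ∈ ps → ∃ λ t → t ∈ ts × pq ∈ pay v t) × Unique (map proj₁ ps) × Unique (map proj₂ ps)

  -- Each round applies `hit` to the members v together with what they have collected so far, a t
  -- being a hit if `pay v t` has `gain` fresh pairs. The pairs form a partial matching: the first
  -- components can be hit once more by a later choice, and the second components belonging to those
  -- hits are then just as many. Density is demanded only of collections that are still short.
  spread : ∀ ℓ (Q : List I) → length Q < 2 ^ ℓ →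
           (∀ {v} → v ∈ Q → ∀ ts ps → Valid v ts ps → (∀ {t} → t ∈ ts → t ∈ us) → length ps < rounds * gain →
              length us ≤ B * count (progressive? v ps) us) →
           ∃ λ ts → (∀ {t} → t ∈ ts → t ∈ us) × length ts ≤ rounds * (ℓ * (2 * B)) ×
             (∀ {v} → v ∈ Q → ∃ λ ps → Valid v ts ps × rounds * gain ≤ length ps)
  spread ℓ Q lt dense = go rounds ≤-refl
    where
    go : ∀ r → r ≤ rounds → ∃ λ ts → (∀ {t} → t ∈ ts → t ∈ us) × length ts ≤ r * (ℓ * (2 * B)) ×
           (∀ {v} → v ∈ Q → ∃ λ ps → Valid v ts ps × r * gain ≤ length ps)
    go zero    _   = [] , (λ ()) , z≤n , λ _ → [] , ((λ ()) , [] , []) , z≤n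
    go (suc r) r<R with go r (<⇒≤ r<R)
    ... | ts , ts⊆ , le , coll
      with hit {R = λ (v , ps) t → rounds * gain ≤ length ps ⊎ Progressive v ps t}
               (λ (v , ps) t → (rounds * gain ≤? length ps) ⊎-dec progressive? v ps t) us B us≢[] 0<B ℓ qs
               (≤-<-trans (≤-reflexive (length-mapWith∈ Q)) lt) dense′
      where
      -- The collection belongs to a proof of v ∈ Q, so v is paired with it to form the index that
      -- has to be hit.
      qs : List (I × List (K × K))
      qs = mapWith∈ Q (λ {v} v∈ → v , proj₁ (coll v∈))
      dense′ : ∀ {i} → i ∈ qs → length us ≤ B * count (λ t → (rounds * gain ≤? length (proj₂ i)) ⊎-dec progressive? (proj₁ i) (proj₂ i) t) us
      dense′ i∈ with ∈-mapWith∈ Q _ i∈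
      ... | v , v∈ , refl with rounds * gain ≤? length (proj₁ (coll v∈))
      ... | yes full = ≤-trans (≤-reflexive (sym (*-identityˡ _))) (*-mono-≤ 0<B (≤-reflexive (sym (count-all
              (λ t → yes full ⊎-dec progressive? v (proj₁ (coll v∈)) t) us (λ _ → inj₁ full)))))
      ... | no ¬full = ≤-trans (dense v∈ ts (proj₁ (coll v∈)) (proj₁ (proj₂ (coll v∈))) ts⊆ (≰⇒> ¬full))
              (*-monoʳ-≤ B (count-mono (progressive? v (proj₁ (coll v∈))) (λ t → no ¬full ⊎-dec progressive? v (proj₁ (coll v∈)) t) us (λ _ → inj₂)))
    ... | ts′ , ts′⊆ , le′ , hits = ts ++ ts′ , (λ p → ⊎-elim ts⊆ ts′⊆ (∈-++⁻ ts p)) ,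
        ≤-trans (≤-reflexive (trans (length-++ ts) (+-comm (length ts) _))) (+-mono-≤ le′ le) ,
        λ v∈ → extend (coll v∈) (hits (mapWith∈-∈ Q _ v∈))
      where
      extend : ∀ {v} (c : ∃ λ ps → Valid v ts ps × r * gain ≤ length ps) →
               (∃ λ t → t ∈ ts′ × (rounds * gain ≤ length (proj₁ c) ⊎ Progressive v (proj₁ c) t)) →
               ∃ λ ps → Valid v (ts ++ ts′) ps × suc r * gain ≤ length ps
      extend (ps , (src , u₁ , u₂) , _) (t , t∈ , inj₁ full) =
        ps , ((λ p → let (s , s∈ , q) = src p in s , ∈-++⁺ˡ s∈ , q) , u₁ , u₂) , ≤-trans (*-monoˡ-≤ gain r<R) full
      extend {v} (ps , (src , u₁ , u₂) , len) (t , t∈ , inj₂ prog) =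
        fr ++ ps , (src′ , unique proj₁ (proj₁ ∘ proj₂ ∘ fr⁻) (pay-unique₁ v t) u₁ , unique proj₂ (proj₂ ∘ proj₂ ∘ fr⁻) (pay-unique₂ v t) u₂) ,
        ≤-trans (+-mono-≤ prog len) (≤-reflexive (sym (length-++ fr)))
        where
        fr = filter (fresh? ps) (pay v t)
        fr⁻ : ∀ {pq} → pq ∈ fr → pq ∈ pay v t × Fresh ps pq
        fr⁻ = ∈-filter⁻ (fresh? ps) {xs = pay v t}
        src′ : ∀ {pq} → pq ∈ fr ++ ps → ∃ λ s → s ∈ ts ++ ts′ × pq ∈ pay v s
        src′ p with ∈-++⁻ fr p
        ... | inj₁ q = t , ∈-++⁺ʳ ts t∈ , proj₁ (fr⁻ q)
        ... | inj₂ q = let (s , s∈ , w) = src q in s , ∈-++⁺ˡ s∈ , w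
        unique : (f : K × K → K) → (∀ {pq} → pq ∈ fr → f pq ∉ map f ps) → Unique (map f (pay v t)) → Unique (map f ps) → Unique (map f (fr ++ ps))
        unique f new u u′ = subst Unique (sym (map-++ f fr ps)) (Uniq.++⁺ (filter-map-unique (fresh? ps) f (pay v t) u) u′
          (λ (p , q) → let (pq , pq∈ , eq) = ∈-map⁻ f p in new pq∈ (subst (_∈ map f ps) eq q)))

-- Sets without popular differences

∈-≤∑-≟ : {Y : Set} (_≟_ : DecidableEquality Y) (y : Y) (ys : List Y) →
         𝟙 (DecMembership._∈?_ _≟_ y ys) ≤ ∑ ys (λ x → 𝟙 (y ≟ x))
∈-≤∑-≟ _≟_ y ys with DecMembership._∈?_ _≟_ y ys
... | no _   = z≤n
... | yes y∈ = ≤-trans (≤-reflexive (sym (𝟙-yes (y ≟ y) refl))) (∈⇒≤∑ (λ x → 𝟙 (y ≟ x)) y∈)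

module Popularity (𝔾 : FinGroup) where
  open Sets 𝔾

  diffs : List G → G → ℕ
  diffs U d = count (λ a → (a ⊕ d) ∈? U) U

  sums : List G → G → ℕ
  sums U σ = count (λ a → (σ ⊖ a) ∈? U) U

  neighbours : List G → List G → G → ℕ
  neighbours U T a = count (λ a′ → (a′ ⊖ a) ∈? (T ⊟ T)) U

module _ (𝔾 : FinGroup) where
  open Sets 𝔾
  open Popularity 𝔾

  -- A relation a′ = a - t + p in U says a′ - a = p - t, so a′ becomes a neighbour of a once t and p
  -- are both in T. As U - U is small, additive energy supplies many such relations for most a.
  -- Flatness and the removal of heavy sums keep the pairs (p, a′) of different t from repeating too
  -- often, so few t collect many pairs for every good a, and a second choice then hits their p.
  module Flat (U : List G) (uU : Unique U) (H D z ρ R B B₂ m ℓ : ℕ) (flat : ∀ {d} → d ≢ 𝟘 → diffs U d ≤ H) (small : length (U ⊟ U) ≤ D)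
    (0<u : 0 < length U) (0<B : 0 < B) (0<B₂ : 0 < B₂) (0<z : 0 < z) (0<ρ : 0 < ρ) (u<2^ℓ : length U < 2 ^ ℓ) (N₀ : 2 * (z * z) * H ≤ length U)
    (N₁ : 8 * D * (2 + 2 * (z * z)) ≤ 3 * (length U * length U)) (N₂ : 32 * D * ρ ≤ length U * length U)
    (N₃ : 32 * D * H * (R * (length U + z * H)) ≤ z * (length U * length U * length U)) (N₄ : 32 * D * H ≤ B * (length U * length U))
    (N₅ : length U ≤ B₂ * (R * ρ ∸ m)) where

    private
      u = length U

      instance
        u≢0 : NonZero u
        u≢0 = >-nonZero 0<u
        z≢0 : NonZero z
        z≢0 = >-nonZero 0<z
        ρ≢0 : NonZero ρ
        ρ≢0 = >-nonZero 0<ρ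

      Heavy : G → Set
      Heavy σ = u < z * sums U σ

      abstract
       heavy? : ∀ σ → Dec (Heavy σ)
       heavy? σ = u <? z * sums U σ

      -- Two heavy sums whose reflections of U overlap produce a popular difference.
      few-heavy : ∀ {S} → Unique S → (∀ {σ} → σ ∈ S → Heavy σ) → length S ≤ 2 * (z * z)
      few-heavy {S} uS heavy with 0 <? length S
      ... | no ¬p = ≤-trans (≮⇒≥ ¬p) z≤n
      ... | yes 0<q = *-cancelʳ-≤ q (2 * (z * z)) u (+-cancelʳ-≤ (q * u) (q * u) _ (begin
        q * u + q * u                                    ≡⟨ sym (cong (q * u +_) (+-identityʳ (q * u))) ⟩
        2 * (q * u)                                      ≤⟨ *-monoʳ-≤ 2 main ⟩
        2 * (z * z * (u + q * H))                        ≡⟨ expand z u q H ⟩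
        2 * (z * z) * u + q * (2 * (z * z) * H)          ≤⟨ +-monoʳ-≤ _ (*-monoʳ-≤ q N₀) ⟩
        2 * (z * z) * u + q * u                          ∎))
        where
        open ≤-Reasoning
        q = length S
        expand : ∀ z u q H → 2 * (z * z * (u + q * H)) ≡ 2 * (z * z) * u + q * (2 * (z * z) * H)
        expand = solve-∀
        s : G → ℕ
        s x = count (λ σ → (σ ⊖ x) ∈? U) S
        total : q * u ≤ z * ∑ U s
        total = begin
          q * u                          ≡⟨ sym (∑-const S u) ⟩
          ∑ S (λ _ → u)                  ≤⟨ ∑-mono S (λ σ∈ → <⇒≤ (heavy σ∈)) ⟩
          ∑ S (λ σ → z * sums U σ)       ≡⟨ ∑-*ˡ z S _ ⟩
          z * ∑ S (sums U)               ≡⟨ cong (z *_) (double-count (λ σ x → (σ ⊖ x) ∈? U) S U) ⟩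
          z * ∑ U s                      ∎
        pair : G → G → ℕ
        pair σ σ′ = ∑ U (λ x → 𝟙 ((σ ⊖ x) ∈? U) * 𝟙 ((σ′ ⊖ x) ∈? U))
        pair-same : ∀ σ σ′ → pair σ σ′ ≤ u
        pair-same σ σ′ = ≤-trans (∑-mono U (λ {x} _ → *-mono-≤ (𝟙≤1 ((σ ⊖ x) ∈? U)) (𝟙≤1 ((σ′ ⊖ x) ∈? U)))) (≤-reflexive (∑-length U))
          where
          𝟙≤1 : {P : Set} (d : Dec P) → 𝟙 d ≤ 1
          𝟙≤1 (yes _) = ≤-refl
          𝟙≤1 (no _)  = z≤n
        pair-diff : ∀ σ σ′ → σ ≢ σ′ → pair σ σ′ ≤ H
        pair-diff σ σ′ ne = begin
          pair σ σ′                  ≡⟨ ∑-cong U (λ {x} _ → both x) ⟩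
          ∑ U (λ x → 𝟙 (both? x))    ≡⟨ sym (count-∑ both? U) ⟩
          count both? U              ≤⟨ inj⇒length≤ _≟_ {ys = filter (λ a → (a ⊕ (σ′ ⊖ σ)) ∈? U) U} (σ ⊖_) (Uniq.filter⁺ both? uU)
                                          (λ {x} x∈ → let (_ , (p , p′)) = ∈-filter⁻ both? {xs = U} x∈ in
                                            ∈-filter⁺ (λ a → (a ⊕ (σ′ ⊖ σ)) ∈? U) p (subst (_∈ U) (solve (x₁ :- x₂) ((x₀ :- x₂) :+ (x₁ :- x₀)) (σ ∷ σ′ ∷ x ∷ []) refl) p′))
                                          (λ {x} {y} _ _ eq → sym (by₁ (solve (x₁ :- x₀) ((x₂ :- x₀) :- (x₂ :- x₁)) (x ∷ y ∷ σ ∷ []) refl) eq)) ⟩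
          diffs U (σ′ ⊖ σ)           ≤⟨ flat (λ eq → ne (sym (⊖≡𝟘⇒≡ eq))) ⟩
          H                          ∎
          where
          both? = λ x → ((σ ⊖ x) ∈? U) ×-dec ((σ′ ⊖ x) ∈? U)
          both : ∀ x → 𝟙 ((σ ⊖ x) ∈? U) * 𝟙 ((σ′ ⊖ x) ∈? U) ≡ 𝟙 (both? x)
          both x with (σ ⊖ x) ∈? U | (σ′ ⊖ x) ∈? U
          ... | yes _ | yes _ = refl
          ... | yes _ | no _  = refl
          ... | no _  | _     = refl
        squares : ∑ U (λ x → s x * s x) ≤ q * (u + q * H)
        squares = begin
          ∑ U (λ x → s x * s x)                                        ≡⟨ ∑-cong U (λ {x} _ → square x) ⟩
          ∑ U (λ x → ∑ S (λ σ → ∑ S (λ σ′ → 𝟙 ((σ ⊖ x) ∈? U) * 𝟙 ((σ′ ⊖ x) ∈? U))))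
                                                                       ≡⟨ ∑-swap U S _ ⟩
          ∑ S (λ σ → ∑ U (λ x → ∑ S (λ σ′ → 𝟙 ((σ ⊖ x) ∈? U) * 𝟙 ((σ′ ⊖ x) ∈? U))))
                                                                       ≡⟨ ∑-cong S (λ {σ} _ → ∑-swap U S _) ⟩
          ∑ S (λ σ → ∑ S (pair σ))                                     ≤⟨ ∑-mono S (λ {σ} _ → ∑-mono S (λ {σ′} _ → bound σ σ′)) ⟩
          ∑ S (λ σ → ∑ S (λ σ′ → u * 𝟙 (σ′ ≟ σ) + H))                  ≡⟨ ∑-cong S (λ {σ} _ → trans (∑-+ S _ _) (cong₂ _+_ (∑-*ˡ u S _) (∑-const S H))) ⟩
          ∑ S (λ σ → u * ∑ S (λ σ′ → 𝟙 (σ′ ≟ σ)) + q * H)              ≤⟨ ∑-mono S (λ {σ} _ → +-monoˡ-≤ (q * H) (≤-trans (*-monoʳ-≤ u (≤-trans (≤-reflexive (sym (count-∑ (_≟ σ) S)))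
                                                                             (count-≤1 (_≟ σ) uS (λ _ _ p p′ → trans p (sym p′))))) (≤-reflexive (*-identityʳ u)))) ⟩
          ∑ S (λ σ → u + q * H)                                        ≡⟨ ∑-const S _ ⟩
          q * (u + q * H)                                              ∎
          where
          square : ∀ x → s x * s x ≡ ∑ S (λ σ → ∑ S (λ σ′ → 𝟙 ((σ ⊖ x) ∈? U) * 𝟙 ((σ′ ⊖ x) ∈? U)))
          square x = trans (cong₂ _*_ eq eq) (trans (sym (∑-*ʳ _ S _)) (∑-cong S (λ {σ} _ → sym (∑-*ˡ (𝟙 ((σ ⊖ x) ∈? U)) S (λ σ′ → 𝟙 ((σ′ ⊖ x) ∈? U))))))
            where eq = count-∑ (λ σ → (σ ⊖ x) ∈? U) S
          bound : ∀ σ σ′ → pair σ σ′ ≤ u * 𝟙 (σ′ ≟ σ) + H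
          bound σ σ′ = ≤-*𝟙+ (σ′ ≟ σ) (λ _ → pair-same σ σ′) (λ ne → pair-diff σ σ′ (ne ∘ sym))
        main : q * u ≤ z * z * (u + q * H)
        main = *-cancelˡ-≤ (q * u) {{m*n≢0 q u {{>-nonZero 0<q}}}} (begin
          q * u * (q * u)                              ≤⟨ *-mono-≤ total total ⟩
          z * ∑ U s * (z * ∑ U s)                      ≡⟨ shuffle z (∑ U s) ⟩
          z * z * (∑ U s * ∑ U s)                      ≤⟨ *-monoʳ-≤ (z * z) (≤-trans (Σ-cauchy-schwarz U s) (*-monoʳ-≤ u squares)) ⟩
          z * z * (u * (q * (u + q * H)))              ≡⟨ shuffle′ (z * z) u q (u + q * H) ⟩
          q * u * (z * z * (u + q * H))                ∎)
          where
          shuffle : ∀ a b → a * b * (a * b) ≡ a * a * (b * b)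
          shuffle = solve-∀
          shuffle′ : ∀ a b c d → a * (b * (c * d)) ≡ c * b * (a * d)
          shuffle′ = solve-∀

      -- The cases p = t and t = a are the trivial relations a′ = a and a′ = p. With a heavy sum a +
      -- p, the same p would occur in the rows of too many t.
      RowElem : G → G → G → Set
      RowElem a t p = (a ⊖ t ⊕ p) ∈ U × p ≢ t × t ≢ a × ¬ Heavy (a ⊕ p)

      abstract
       rowElem? : ∀ a t p → Dec (RowElem a t p)
       rowElem? a t p = ((a ⊖ t ⊕ p) ∈? U) ×-dec (¬? (p ≟ t) ×-dec (¬? (t ≟ a) ×-dec ¬? (heavy? (a ⊕ p))))

      row : G → G → List G
      row a t = filter (rowElem? a t) U

      row⁻ : ∀ {a t p} → p ∈ row a t → p ∈ U × RowElem a t p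
      row⁻ {a} {t} = ∈-filter⁻ (rowElem? a t) {xs = U}

      ω : G → ℕ
      ω a = ∑ U (λ t → length (row a t))

      bad? : ∀ a → Dec (8 * D * ω a < u * u * u)
      bad? a = 8 * D * ω a <? u * u * u

      -- Energy between the b bad elements and U: `collisions` yields at least (b u)² / D relations.
      -- Each bad a contributes at most u³ / (2D), even when its trivial and heavy entries, at most
      -- (2 + q) u of them, are restored.
      few-bad : 2 * count bad? U ≤ u
      few-bad with 0 <? count bad? U
      ... | no ¬p = ≤-trans (*-monoʳ-≤ 2 (≮⇒≥ ¬p)) z≤n
      ... | yes 0<b = *-cancelʳ-≤ (2 * b) u (4 * (b * (u * u))) {{m*n≢0 4 (b * (u * u)) {{_}} {{m*n≢0 b (u * u) {{>-nonZero 0<b}} {{m*n≢0 u u}}}}}} (begin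
        2 * b * (4 * (b * (u * u)))                                  ≡⟨ e₁ b u ⟩
        8 * (b * u * (b * u))                                        ≤⟨ *-monoʳ-≤ 8 energy ⟩
        8 * (D * ∑ Bd (λ a → ω a + (2 + q) * u))                     ≡⟨ trans (sym (*-assoc 8 D _)) (sym (∑-*ˡ (8 * D) Bd _)) ⟩
        ∑ Bd (λ a → 8 * D * (ω a + (2 + q) * u))                     ≤⟨ ∑-mono Bd (λ a∈ → each (proj₂ (∈-filter⁻ bad? {xs = U} a∈))) ⟩
        ∑ Bd (λ a → 4 * (u * u * u))                                 ≡⟨ ∑-const Bd _ ⟩
        b * (4 * (u * u * u))                                        ≡⟨ e₂ b u ⟩
        u * (4 * (b * (u * u)))                                      ∎)
        where
        open ≤-Reasoning
        q = 2 * (z * z)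
        Bd = filter bad? U
        b = length Bd
        pairs = cartesianProduct Bd U
        e₁ : ∀ b u → 2 * b * (4 * (b * (u * u))) ≡ 8 * (b * u * (b * u))
        e₁ = solve-∀
        e₂ : ∀ b u → b * (4 * (u * u * u)) ≡ u * (4 * (b * (u * u)))
        e₂ = solve-∀
        each : ∀ {a} → 8 * D * ω a < u * u * u → 8 * D * (ω a + (2 + q) * u) ≤ 4 * (u * u * u)
        each {a} lt = begin
          8 * D * (ω a + (2 + q) * u)           ≡⟨ e₃ (8 * D) (ω a) (2 + q) u ⟩
          8 * D * ω a + 8 * D * (2 + q) * u     ≤⟨ +-mono-≤ (<⇒≤ lt) (*-monoˡ-≤ u N₁) ⟩
          u * u * u + 3 * (u * u) * u           ≡⟨ e₄ u ⟩
          4 * (u * u * u)                       ∎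
          where
          e₃ : ∀ d w k u → d * (w + k * u) ≡ d * w + d * k * u
          e₃ = solve-∀
          e₄ : ∀ u → u * u * u + 3 * (u * u) * u ≡ 4 * (u * u * u)
          e₄ = solve-∀
        φ : G × G → G
        φ (a , t) = a ⊖ t
        through? = λ a t p → (a ⊖ t ⊕ p) ∈? U
        fibre : ∀ {x} → x ∈ pairs → count (λ x′ → φ x′ ≟ φ x) pairs ≤ count (through? (proj₁ x) (proj₂ x)) U
        fibre {a , t} x∈ = inj⇒length≤ _≟_ {ys = filter (through? a t) U} proj₂
          (Uniq.filter⁺ (λ x′ → φ x′ ≟ φ (a , t)) (Uniq.cartesianProduct⁺ (Uniq.filter⁺ bad? uU) uU))
          (λ {x′} x′∈ → let (x′∈₁ , eq) = ∈-filter⁻ (λ x′ → φ x′ ≟ φ (a , t)) {xs = pairs} x′∈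
                            (a′∈ , p∈) = ∈-cartesianProduct⁻ Bd U x′∈₁ in
            ∈-filter⁺ (through? a t) p∈ (subst (_∈ U) (by₁ (solve (x₀ :- (x₂ :+ x₁)) ((x₀ :- x₁) :- x₂) (proj₁ x′ ∷ proj₂ x′ ∷ a ⊖ t ∷ []) refl) eq)
              (proj₁ (∈-filter⁻ bad? {xs = U} a′∈))))
          (λ {x} {y} x∈′ y∈′ eq → cong₂ _,_ (by₂ (solve (x₀ :- x₁) (((x₀ :- x₂) :- (x₁ :- x₃)) :+ (x₂ :- x₃)) (proj₁ x ∷ proj₁ y ∷ proj₂ x ∷ proj₂ y ∷ []) refl)
            (trans (proj₂ (∈-filter⁻ (λ x′ → φ x′ ≟ φ (a , t)) {xs = pairs} x∈′)) (sym (proj₂ (∈-filter⁻ (λ x′ → φ x′ ≟ φ (a , t)) {xs = pairs} y∈′)))) eq) eq)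
        cell : ∀ a t → count (through? a t) U ≤ length (row a t) + (1 + (u * 𝟙 (t ≟ a) + q))
        cell a t = aux (t ≟ a)
         where
         aux : (d : Dec (t ≡ a)) → count (through? a t) U ≤ length (row a t) + (1 + (u * 𝟙 d + q))
         aux (yes _) = ≤-trans (length-filter (through? a t) U) (≤-trans (≤-trans (≤-reflexive (sym (*-identityʳ u))) (≤-trans (m≤m+n _ q) (n≤1+n _))) (m≤n+m _ _))
         aux (no t≢a) = begin
          count (through? a t) U                                                  ≤⟨ count-⊎ (through? a t) (rowElem? a t) rest? U split₁ ⟩
          length (row a t) + count rest? U                                        ≤⟨ +-monoʳ-≤ (length (row a t)) (count-⊎ rest? (_≟ t) (λ p → heavy? (a ⊕ p)) U (λ _ → id)) ⟩
          length (row a t) + (count (_≟ t) U + count (λ p → heavy? (a ⊕ p)) U)    ≤⟨ +-monoʳ-≤ (length (row a t)) (+-mono-≤ (count-≤1 (_≟ t) uU (λ _ _ p p′ → trans p (sym p′))) heavies) ⟩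
          length (row a t) + (1 + q)                                              ≡⟨ cong (λ k → length (row a t) + (1 + (k + q))) (sym (*-zeroʳ u)) ⟩
          length (row a t) + (1 + (u * 0 + q))                                    ∎
          where
          rest? = λ p → (p ≟ t) ⊎-dec heavy? (a ⊕ p)
          split₁ : ∀ {p} → p ∈ U → (a ⊖ t ⊕ p) ∈ U → RowElem a t p ⊎ (p ≡ t ⊎ Heavy (a ⊕ p))
          split₁ {p} _ h with p ≟ t | heavy? (a ⊕ p)
          ... | yes e | _     = inj₂ (inj₁ e)
          ... | no _  | yes v = inj₂ (inj₂ v)
          ... | no ne | no nv = inj₁ (h , ne , t≢a , nv)
          heavies : count (λ p → heavy? (a ⊕ p)) U ≤ q
          heavies = ≤-trans (≤-reflexive (sym (length-map (a ⊕_) (filter (λ p → heavy? (a ⊕ p)) U))))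
            (few-heavy (map-unique (a ⊕_) (λ {x} {y} _ _ eq → by₁ (solve (x₀ :- x₁) ((x₂ :+ x₀) :- (x₂ :+ x₁)) (x ∷ y ∷ a ∷ []) refl) eq) (Uniq.filter⁺ _ uU))
              (λ σ∈ → let (p , p∈ , eq) = ∈-map⁻ (a ⊕_) σ∈ in subst Heavy (sym eq) (proj₂ (∈-filter⁻ (λ p → heavy? (a ⊕ p)) {xs = U} p∈))))
        row-total : ∀ a → ∑ U (λ t → count (through? a t) U) ≤ ω a + (2 + q) * u
        row-total a = begin
          ∑ U (λ t → count (through? a t) U)                                ≤⟨ ∑-mono U (λ {t} _ → cell a t) ⟩
          ∑ U (λ t → length (row a t) + (1 + (u * 𝟙 (t ≟ a) + q)))          ≡⟨ ∑-+ U _ _ ⟩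
          ω a + ∑ U (λ t → 1 + (u * 𝟙 (t ≟ a) + q))                         ≡⟨ cong (ω a +_) (trans (∑-+ U _ _) (cong₂ _+_ (∑-length U) (trans (∑-+ U _ _) (cong₂ _+_ (∑-*ˡ u U _) (∑-const U q))))) ⟩
          ω a + (u + (u * ∑ U (λ t → 𝟙 (t ≟ a)) + u * q))                   ≤⟨ +-monoʳ-≤ (ω a) (+-monoʳ-≤ u (+-monoˡ-≤ (u * q) (*-monoʳ-≤ u (≤-trans (≤-reflexive (sym (count-∑ (_≟ a) U)))
                                                                                  (count-≤1 (_≟ a) uU (λ _ _ p p′ → trans p (sym p′))))))) ⟩
          ω a + (u + (u * 1 + u * q))                                       ≡⟨ e₅ (ω a) u q ⟩
          ω a + (2 + q) * u                                                 ∎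
          where
          e₅ : ∀ w u q → w + (u + (u * 1 + u * q)) ≡ w + (2 + q) * u
          e₅ = solve-∀
        length-pairs : length pairs ≡ b * u
        length-pairs = length-cartesianProduct Bd U
        energy : b * u * (b * u) ≤ D * ∑ Bd (λ a → ω a + (2 + q) * u)
        energy = begin
          b * u * (b * u)                                               ≡⟨ sym (cong₂ _*_ length-pairs length-pairs) ⟩
          length pairs * length pairs                                   ≤⟨ collisions _≟_ {xs = pairs} {ys = U ⊟ U} φ (⊟-unique U U) (λ x∈ → let (a∈ , t∈) = ∈-cartesianProduct⁻ Bd U x∈ in
                                                                             ∈-⊟⁺ (proj₁ (∈-filter⁻ bad? {xs = U} a∈)) t∈) ⟩
          length (U ⊟ U) * ∑ pairs (λ x → count (λ x′ → φ x′ ≟ φ x) pairs)  ≤⟨ *-mono-≤ small (∑-mono pairs fibre) ⟩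
          D * ∑ pairs (λ x → count (through? (proj₁ x) (proj₂ x)) U)    ≡⟨ cong (D *_) (∑-cartesianProduct Bd U _) ⟩
          D * ∑ Bd (λ a → ∑ U (λ t → count (through? a t) U))           ≤⟨ *-monoʳ-≤ D (∑-mono Bd (λ {a} _ → row-total a)) ⟩
          D * ∑ Bd (λ a → ω a + (2 + q) * u)                            ∎

      Good : G → Set
      Good a = u * u * u ≤ 8 * D * ω a

      goods : List G
      goods = filter (¬? ∘ bad?) U

      goods⁻ : ∀ {a} → a ∈ goods → a ∈ U × Good a
      goods⁻ a∈ = let (a∈U , ¬b) = ∈-filter⁻ (¬? ∘ bad?) {xs = U} a∈ in a∈U , ≮⇒≥ ¬b

      many-good : u ≤ 2 * length goods
      many-good = +-cancelˡ-≤ u _ _ (begin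
        u + u                                          ≡⟨ sym (cong (u +_) (+-identityʳ u)) ⟩
        2 * u                                          ≡⟨ cong (2 *_) (sym (count-split bad? U)) ⟩
        2 * (count bad? U + length goods)              ≡⟨ *-distribˡ-+ 2 (count bad? U) _ ⟩
        2 * count bad? U + 2 * length goods            ≤⟨ +-monoˡ-≤ (2 * length goods) few-bad ⟩
        u + 2 * length goods                           ∎)
        where open ≤-Reasoning

      row≤H : ∀ a t → length (row a t) ≤ H
      row≤H a t with t ≟ a
      ... | yes eq = ≤-trans (≤-reflexive (count-none (rowElem? a t) U (λ _ (_ , _ , ne , _) → ne eq))) z≤n
      ... | no ne  = ≤-trans (count-mono (rowElem? a t) (λ p → (p ⊕ (a ⊖ t)) ∈? U) U
          (λ {p} _ (h , _) → subst (_∈ U) (solve ((x₀ :- x₁) :+ x₂) (x₂ :+ (x₀ :- x₁)) (a ∷ t ∷ p ∷ []) refl) h))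
        (flat (λ eq → ne (sym (⊖≡𝟘⇒≡ eq))))

      long? : ∀ a t → Dec (2 * ρ ≤ length (row a t))
      long? a t = 2 * ρ ≤? length (row a t)

      -- Rows shorter than 2ρ make up at most half of the total u³ / (8D), and each of the others
      -- has at most H entries.
      many-long : ∀ {a} → Good a → u * u * u ≤ 16 * D * H * count (long? a) U
      many-long {a} good = +-cancelʳ-≤ (u * u * u) _ _ (begin
        u * u * u + u * u * u                                ≡⟨ sym (cong (u * u * u +_) (+-identityʳ _)) ⟩
        2 * (u * u * u)                                      ≤⟨ *-monoʳ-≤ 2 (≤-trans good (*-monoʳ-≤ (8 * D) total)) ⟩
        2 * (8 * D * (H * count (long? a) U + u * (2 * ρ)))  ≡⟨ e D H (count (long? a) U) u ρ ⟩
        16 * D * H * count (long? a) U + 32 * D * ρ * u      ≤⟨ +-monoʳ-≤ (16 * D * H * count (long? a) U) (*-monoˡ-≤ u N₂) ⟩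
        16 * D * H * count (long? a) U + u * u * u           ∎)
        where
        open ≤-Reasoning
        e : ∀ D H y u ρ → 2 * (8 * D * (H * y + u * (2 * ρ))) ≡ 16 * D * H * y + 32 * D * ρ * u
        e = solve-∀
        each : ∀ t → length (row a t) ≤ H * 𝟙 (long? a t) + 2 * ρ
        each t = ≤-*𝟙+ (long? a t) (λ _ → row≤H a t) (λ ¬l → <⇒≤ (≰⇒> ¬l))
        total : ω a ≤ H * count (long? a) U + u * (2 * ρ)
        total = ≤-trans (∑-mono U (λ {t} _ → each t)) (≤-reflexive (trans (∑-+ U _ _)
          (cong₂ _+_ (trans (∑-*ˡ H U _) (cong (H *_) (sym (count-∑ (long? a) U)))) (∑-const U (2 * ρ)))))

      pay : G → G → List (G × G)
      pay a t = map (λ p → p , (a ⊖ t ⊕ p)) (row a t)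

      pay⁻ : ∀ {a t pq} → pq ∈ pay a t → proj₁ pq ∈ U × RowElem a t (proj₁ pq) × proj₂ pq ≡ a ⊖ t ⊕ proj₁ pq
      pay⁻ {a} {t} pq∈ with ∈-map⁻ (λ p → p , (a ⊖ t ⊕ p)) pq∈
      ... | p , p∈ , refl = let (p∈U , e) = row⁻ {a} {t} p∈ in p∈U , e , refl

      row-unique : ∀ a t → Unique (row a t)
      row-unique a t = Uniq.filter⁺ (rowElem? a t) uU

      pay-unique₁ : ∀ a t → Unique (map proj₁ (pay a t))
      pay-unique₁ a t = subst Unique (sym (trans (sym (map-∘ (row a t))) (map-id (row a t)))) (row-unique a t)

      pay-unique₂ : ∀ a t → Unique (map proj₂ (pay a t))
      pay-unique₂ a t = subst Unique (map-∘ (row a t))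
        (map-unique (λ p → a ⊖ t ⊕ p) (λ {x} {y} _ _ eq → by₁ (solve (x₀ :- x₁) ((x₂ :+ x₀) :- (x₂ :+ x₁)) (x ∷ y ∷ (a ⊖ t) ∷ []) refl) eq) (row-unique a t))

      open Spread _≟_ pay pay-unique₁ pay-unique₂ U B R ρ 0<u 0<B

      -- A long row without progress has ρ stale pairs. A collected p lies in the rows of at most u
      -- / z of the t, its sum with a being light, and a collected a′ occurs for at most H of them.
      -- Fewer than R ρ collected pairs therefore stall at most R (u / z + H) of the t, which is at
      -- most half of the long rows.
      progress : ∀ {a} → Good a → ∀ ts ps → Valid a ts ps → length ps < R * ρ → u ≤ B * count (progressive? a ps) U
      progress {a} good ts ps (src , _ , _) short = *-cancelʳ-≤ _ _ (u * u) {{m*n≢0 u u}} (+-cancelʳ-≤ (u * u * u) _ _ (begin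
        u * (u * u) + u * u * u                         ≡⟨ e₁ u ⟩
        2 * (u * u * u)                                 ≤⟨ *-monoʳ-≤ 2 (many-long good) ⟩
        2 * (16 * D * H * count (long? a) U)            ≡⟨ e₂ D H (count (long? a) U) ⟩
        32 * D * H * count (long? a) U                  ≤⟨ *-monoʳ-≤ (32 * D * H) (count-⊎ (long? a) (progressive? a ps) stuck? U splitting) ⟩
        32 * D * H * (pr + np)                          ≡⟨ *-distribˡ-+ (32 * D * H) pr np ⟩
        32 * D * H * pr + 32 * D * H * np               ≤⟨ +-mono-≤ (*-monoˡ-≤ pr N₄) stuck-bound ⟩
        B * (u * u) * pr + u * u * u                    ≡⟨ cong (_+ u * u * u) (e₃ B (u * u) pr) ⟩
        B * pr * (u * u) + u * u * u                    ∎))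
        where
        open ≤-Reasoning
        e₁ : ∀ u → u * (u * u) + u * u * u ≡ 2 * (u * u * u)
        e₁ = solve-∀
        e₂ : ∀ D H y → 2 * (16 * D * H * y) ≡ 32 * D * H * y
        e₂ = solve-∀
        e₃ : ∀ b w p → b * w * p ≡ b * p * w
        e₃ = solve-∀
        stale : G → ℕ
        stale t = count (¬? ∘ fresh? ps) (pay a t)
        stuck? : ∀ t → Dec (ρ ≤ stale t)
        stuck? t = ρ ≤? stale t
        pr = count (progressive? a ps) U
        np = count stuck? U
        splitting : ∀ {t} → t ∈ U → 2 * ρ ≤ length (row a t) → ρ ≤ count (fresh? ps) (pay a t) ⊎ ρ ≤ stale t
        splitting {t} _ long with ρ ≤? count (fresh? ps) (pay a t)
        ... | yes p = inj₁ p
        ... | no ¬p = inj₂ (+-cancelˡ-≤ ρ _ _ (begin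
          ρ + ρ                                        ≡⟨ sym (cong (ρ +_) (+-identityʳ ρ)) ⟩
          2 * ρ                                        ≤⟨ long ⟩
          length (row a t)                             ≡⟨ sym (length-map _ (row a t)) ⟩
          length (pay a t)                             ≡⟨ sym (count-split (fresh? ps) (pay a t)) ⟩
          count (fresh? ps) (pay a t) + stale t        ≤⟨ +-monoˡ-≤ (stale t) (<⇒≤ (≰⇒> ¬p)) ⟩
          ρ + stale t                                  ∎))
        ps₁ = map proj₁ ps
        ps₂ = map proj₂ ps
        occurs₁ : G → G → ℕ
        occurs₁ t x = count (λ pq → proj₁ pq ≟ x) (pay a t)
        occurs₂ : G → G → ℕ
        occurs₂ t x = count (λ pq → proj₂ pq ≟ x) (pay a t)
        membership-sum : (f : G × G → G) (xs : List G) (ws : List (G × G)) →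
                         count (λ pq → f pq ∈? xs) ws ≤ ∑ xs (λ x → count (λ pq → f pq ≟ x) ws)
        membership-sum f xs ws = begin
          count (λ pq → f pq ∈? xs) ws                       ≡⟨ count-∑ _ ws ⟩
          ∑ ws (λ pq → 𝟙 (f pq ∈? xs))                       ≤⟨ ∑-mono ws (λ {pq} _ → ∈-≤∑-≟ _≟_ (f pq) xs) ⟩
          ∑ ws (λ pq → ∑ xs (λ x → 𝟙 (f pq ≟ x)))            ≡⟨ ∑-swap ws xs _ ⟩
          ∑ xs (λ x → ∑ ws (λ pq → 𝟙 (f pq ≟ x)))            ≡⟨ ∑-cong xs (λ {x} _ → sym (count-∑ (λ pq → f pq ≟ x) ws)) ⟩
          ∑ xs (λ x → count (λ pq → f pq ≟ x) ws)            ∎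
        stale≤ : ∀ t → stale t ≤ ∑ ps₁ (occurs₁ t) + ∑ ps₂ (occurs₂ t)
        stale≤ t = ≤-trans (count-⊎ (¬? ∘ fresh? ps) (λ pq → proj₁ pq ∈? ps₁) (λ pq → proj₂ pq ∈? ps₂) (pay a t) dis)
          (+-mono-≤ (membership-sum proj₁ ps₁ (pay a t)) (membership-sum proj₂ ps₂ (pay a t)))
          where
          dis : ∀ {pq} → pq ∈ pay a t → ¬ Fresh ps pq → proj₁ pq ∈ ps₁ ⊎ proj₂ pq ∈ ps₂
          dis {p , q} _ ¬f with p ∈? ps₁ | q ∈? ps₂
          ... | yes m₁ | _      = inj₁ m₁
          ... | no _   | yes m₂ = inj₂ m₂
          ... | no n₁  | no n₂  = contradiction (n₁ , n₂) ¬f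
        at-most : ∀ {P : Set} (d : Dec P) (f : G × G → G) {t x} → Unique (map f (pay a t)) →
                  (∀ {pq} → pq ∈ pay a t → f pq ≡ x → P) → count (λ pq → f pq ≟ x) (pay a t) ≤ 𝟙 d
        at-most (yes _) f {t} {x} uf h = ≤-trans (≤-reflexive (sym (length-map f (filter (λ pq → f pq ≟ x) (pay a t)))))
          (⊆⇒length≤ _≟_ {ys = x ∷ []} (filter-map-unique (λ pq → f pq ≟ x) f (pay a t) uf)
            (λ z∈ → let (y , y∈ , eq) = ∈-map⁻ f z∈ in here (trans eq (proj₂ (∈-filter⁻ (λ pq → f pq ≟ x) {xs = pay a t} y∈)))))
        at-most (no ¬p) f {t} {x} uf h = ≤-reflexive (count-none (λ pq → f pq ≟ x) (pay a t) (λ pq∈ eq → ¬p (h pq∈ eq)))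
        column : ∀ {x} → x ∈ ps₁ → z * ∑ U (λ t → occurs₁ t x) ≤ u
        column {x} x∈ with ∈-map⁻ proj₁ x∈
        ... | pq , pq∈ , refl with src pq∈
        ... | t₀ , _ , in₀ = ≤-trans (*-monoʳ-≤ z (≤-trans
            (∑-mono U (λ {t} _ → at-most (((a ⊕ x) ⊖ t) ∈? U) proj₁ {t} {x} (pay-unique₁ a t)
              (λ pq∈′ eq → let (_ , (h , _) , _) = pay⁻ {a} {t} pq∈′ in
                subst (_∈ U) (trans (cong (a ⊖ t ⊕_) eq) (solve ((x₀ :- x₁) :+ x₂) ((x₀ :+ x₂) :- x₁) (a ∷ t ∷ x ∷ []) refl)) h)))
            (≤-reflexive (sym (count-∑ (λ t → ((a ⊕ x) ⊖ t) ∈? U) U)))))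
          (≮⇒≥ (let (_ , (_ , _ , _ , light) , _) = pay⁻ {a} {t₀} in₀ in light))
        diagonal : ∀ x → ∑ U (λ t → occurs₂ t x) ≤ H
        diagonal x with x ≟ a
        ... | yes eq = ≤-trans (≤-reflexive (trans (∑-cong U (λ {t} _ → count-none (λ pq → proj₂ pq ≟ x) (pay a t) (λ {pq} pq∈ e →
                let (_ , (_ , p≢t , _) , q≡) = pay⁻ {a} {t} pq∈ in
                p≢t (by₁ (solve (x₀ :- x₂) (((x₁ :- x₂) :+ x₀) :- x₁) (proj₁ pq ∷ a ∷ t ∷ []) refl) (trans (sym q≡) (trans e eq)))))) (∑-zero U))) z≤n
        ... | no ne = begin
          ∑ U (λ t → occurs₂ t x)                       ≤⟨ ∑-mono U (λ {t} _ → at-most ((t ⊕ (x ⊖ a)) ∈? U) proj₂ {t} {x} (pay-unique₂ a t) (λ {pq} pq∈ e →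
                                                             let (p∈ , _ , q≡) = pay⁻ {a} {t} pq∈ in
                                                             subst (_∈ U) (by₁ (solve (x₀ :- (x₁ :+ (x₂ :- x₃))) (((x₃ :- x₁) :+ x₀) :- x₂) (proj₁ pq ∷ t ∷ x ∷ a ∷ []) refl) (trans (sym q≡) e)) p∈)) ⟩
          ∑ U (λ t → 𝟙 ((t ⊕ (x ⊖ a)) ∈? U))            ≡⟨ sym (count-∑ (λ t → (t ⊕ (x ⊖ a)) ∈? U) U) ⟩
          diffs U (x ⊖ a)                               ≤⟨ flat (λ eq → ne (⊖≡𝟘⇒≡ eq)) ⟩
          H                                             ∎
        stale-total : z * ∑ U stale ≤ length ps * (u + z * H)
        stale-total = begin
          z * ∑ U stale                                                                         ≤⟨ *-monoʳ-≤ z (∑-mono U (λ {t} _ → stale≤ t)) ⟩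
          z * ∑ U (λ t → ∑ ps₁ (occurs₁ t) + ∑ ps₂ (occurs₂ t))                                 ≡⟨ cong (z *_) (trans (∑-+ U _ _) (cong₂ _+_ (∑-swap U ps₁ _) (∑-swap U ps₂ _))) ⟩
          z * (∑ ps₁ (λ x → ∑ U (λ t → occurs₁ t x)) + ∑ ps₂ (λ x → ∑ U (λ t → occurs₂ t x)))   ≡⟨ trans (*-distribˡ-+ z _ _) (cong (_+ z * ∑ ps₂ (λ x → ∑ U (λ t → occurs₂ t x))) (sym (∑-*ˡ z ps₁ _))) ⟩
          ∑ ps₁ (λ x → z * ∑ U (λ t → occurs₁ t x)) + z * ∑ ps₂ (λ x → ∑ U (λ t → occurs₂ t x)) ≤⟨ +-mono-≤ (∑-mono ps₁ column) (*-monoʳ-≤ z (∑-mono ps₂ (λ {x} _ → diagonal x))) ⟩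
          ∑ ps₁ (λ _ → u) + z * ∑ ps₂ (λ _ → H)                                                 ≡⟨ cong₂ (λ v w → v + z * w) (trans (∑-const ps₁ u) (cong (_* u) (length-map proj₁ ps))) (trans (∑-const ps₂ H) (cong (_* H) (length-map proj₂ ps))) ⟩
          length ps * u + z * (length ps * H)                                                   ≡⟨ e₄ (length ps) u z H ⟩
          length ps * (u + z * H)                                                               ∎
          where
          e₄ : ∀ l u z H → l * u + z * (l * H) ≡ l * (u + z * H)
          e₄ = solve-∀
        stuck-count : z * np ≤ R * (u + z * H)
        stuck-count = *-cancelˡ-≤ ρ (begin
          ρ * (z * np)                         ≡⟨ e₅ ρ z np ⟩
          z * (ρ * np)                         ≡⟨ cong (λ k → z * (ρ * k)) (count-∑ stuck? U) ⟩
          z * (ρ * ∑ U (λ t → 𝟙 (stuck? t)))   ≡⟨ cong (z *_) (sym (∑-*ˡ ρ U _)) ⟩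
          z * ∑ U (λ t → ρ * 𝟙 (stuck? t))     ≤⟨ *-monoʳ-≤ z (∑-mono U (λ {t} _ → markov t)) ⟩
          z * ∑ U stale                        ≤⟨ stale-total ⟩
          length ps * (u + z * H)              ≤⟨ *-monoˡ-≤ (u + z * H) (<⇒≤ short) ⟩
          R * ρ * (u + z * H)                  ≡⟨ e₆ R ρ (u + z * H) ⟩
          ρ * (R * (u + z * H))                ∎)
          where
          e₅ : ∀ a b c → a * (b * c) ≡ b * (a * c)
          e₅ = solve-∀
          e₆ : ∀ a b c → a * b * c ≡ b * (a * c)
          e₆ = solve-∀
          markov : ∀ t → ρ * 𝟙 (stuck? t) ≤ stale t
          markov t = *𝟙-≤ (stuck? t) id
        stuck-bound : 32 * D * H * np ≤ u * u * u
        stuck-bound = *-cancelˡ-≤ z (begin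
          z * (32 * D * H * np)                  ≡⟨ e₇ z (32 * D * H) np ⟩
          32 * D * H * (z * np)                  ≤⟨ *-monoʳ-≤ (32 * D * H) stuck-count ⟩
          32 * D * H * (R * (u + z * H))         ≤⟨ N₃ ⟩
          z * (u * u * u)                        ∎)
          where
          e₇ : ∀ a b c → a * (b * c) ≡ b * (a * c)
          e₇ = solve-∀

    private
      Collected : List G → G → Set
      Collected T₁ a = ∃ λ ps → Valid a T₁ ps × R * ρ ≤ length ps

      abstract
        phase₁ : ∃ λ T₁ → (∀ {t} → t ∈ T₁ → t ∈ U) × length T₁ ≤ R * (ℓ * (2 * B)) × (∀ {a} → a ∈ goods → Collected T₁ a)
        phase₁ = spread ℓ goods (≤-<-trans (length-filter (¬? ∘ bad?) U) u<2^ℓ)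
                   (λ a∈ ts ps val _ short → progress (proj₂ (goods⁻ a∈)) ts ps val short)

      module _ (T₁ : List G) (coll : ∀ {a} → a ∈ goods → Collected T₁ a) where

        indices : List (G × List (G × G))
        indices = mapWith∈ goods (λ {a} a∈ → a , proj₁ (coll a∈))

        first? : ∀ (i : G × List (G × G)) p → Dec (p ∈ map proj₁ (proj₂ i))
        first? i p = p ∈? map proj₁ (proj₂ i)

        dense : ∀ {i} → i ∈ indices → u ≤ B₂ * (count (first? i) U ∸ m)
        dense {i} i∈ = let (a , a∈ , eq) = ∈-mapWith∈ goods _ i∈ in subst (λ i → u ≤ B₂ * (count (first? i) U ∸ m)) (sym eq) (go (coll a∈))
          where
          go : ∀ {a} (c : Collected T₁ a) → u ≤ B₂ * (count (first? (a , proj₁ c)) U ∸ m)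
          go {a} (ps , (src , u₁ , _) , len) = ≤-trans N₅ (*-monoʳ-≤ B₂ (∸-monoˡ-≤ m (≤-trans len (≤-trans (≤-reflexive (sym (length-map proj₁ ps)))
              (⊆⇒length≤ _≟_ u₁ (λ x∈ → ∈-filter⁺ (first? (a , ps)) (inU x∈) x∈))))))
            where
            inU : ∀ {x} → x ∈ map proj₁ ps → x ∈ U
            inU x∈ = let (pq , pq∈ , eq) = ∈-map⁻ proj₁ x∈ ; (t , _ , w) = src pq∈ in subst (_∈ U) (sym eq) (proj₁ (pay⁻ {a} {t} w))

        abstract
          phase₂ : ∃ λ T₂ → (∀ {t} → t ∈ T₂ → t ∈ U) × Unique T₂ × length T₂ ≤ m * (ℓ * (2 * B₂)) ×
                   (∀ {i} → i ∈ indices → m ≤ count (first? i) T₂)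
          phase₂ = hit-many _≟_ first? U B₂ m 0<u 0<B₂ uU ℓ indices
             (≤-<-trans (≤-reflexive (length-mapWith∈ goods)) (≤-<-trans (length-filter (¬? ∘ bad?) U) u<2^ℓ)) dense

      -- The collected pairs whose first component lies in T₂ have distinct second components, and
      -- each of these is a neighbour of a.
      captured : ∀ {T₁ T₂ a} → Unique T₂ → (c : Collected T₁ a) → m ≤ count (λ p → p ∈? map proj₁ (proj₁ c)) T₂ → m ≤ neighbours U (T₁ ++ T₂) a
      captured {T₁} {T₂} {a} uT₂ (ps , (src , _ , u₂) , _) many = begin
        m                                                    ≤⟨ many ⟩
        count (λ p → p ∈? map proj₁ ps) T₂                   ≤⟨ ⊆⇒length≤ _≟_ {ys = map proj₁ ps′} (Uniq.filter⁺ _ uT₂) into ⟩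
        length (map proj₁ ps′)                               ≡⟨ trans (length-map proj₁ ps′) (sym (length-map proj₂ ps′)) ⟩
        length (map proj₂ ps′)                               ≤⟨ ⊆⇒length≤ _≟_ (filter-map-unique hit? proj₂ ps u₂) onto ⟩
        neighbours U (T₁ ++ T₂) a                              ∎
        where
        open ≤-Reasoning
        hit? = λ (pq : G × G) → proj₁ pq ∈? T₂
        ps′ = filter hit? ps
        into : ∀ {p} → p ∈ filter (λ p → p ∈? map proj₁ ps) T₂ → p ∈ map proj₁ ps′
        into p∈ = let (p∈T₂ , p∈ps) = ∈-filter⁻ (λ p → p ∈? map proj₁ ps) {xs = T₂} p∈
                      (pq , pq∈ , eq) = ∈-map⁻ proj₁ p∈ps in
                  subst (_∈ map proj₁ ps′) (sym eq) (∈-map⁺ proj₁ (∈-filter⁺ hit? pq∈ (subst (_∈ T₂) eq p∈T₂)))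
        onto : ∀ {q} → q ∈ map proj₂ ps′ → q ∈ filter (λ a′ → (a′ ⊖ a) ∈? ((T₁ ++ T₂) ⊟ (T₁ ++ T₂))) U
        onto q∈ = let (pq , pq∈ , eq) = ∈-map⁻ proj₂ q∈
                      (pq∈ps , p∈T₂) = ∈-filter⁻ hit? {xs = ps} pq∈
                      (t , t∈ , w) = src pq∈ps
                      (_ , (h , _) , q≡) = pay⁻ {a} {t} w
                      eq′ = trans eq q≡ in
          ∈-filter⁺ (λ a′ → (a′ ⊖ a) ∈? ((T₁ ++ T₂) ⊟ (T₁ ++ T₂))) (subst (_∈ U) (sym eq′) h)
            (subst (_∈ (T₁ ++ T₂) ⊟ (T₁ ++ T₂)) (sym (trans (cong (_⊖ a) eq′) (solve (((x₀ :- x₁) :+ x₂) :- x₀) (x₂ :- x₁) (a ∷ t ∷ proj₁ pq ∷ []) refl)))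
              (∈-⊟⁺ (∈-++⁺ʳ T₁ p∈T₂) (∈-++⁺ˡ t∈)))

    abstract
      capture : ∃ λ T → T ⊆ U × length T ≤ R * (ℓ * (2 * B)) + m * (ℓ * (2 * B₂)) ×
                u ≤ 2 * count (λ a → m ≤? neighbours U T a) U
      capture =
        let (T₁ , T₁⊆ , len₁ , coll) = phase₁
            (T₂ , T₂⊆ , uT₂ , len₂ , hits) = phase₂ T₁ coll
        in T₁ ++ T₂ , (λ p → ⊎-elim T₁⊆ T₂⊆ (∈-++⁻ T₁ p)) ,
           ≤-trans (≤-reflexive (length-++ T₁)) (+-mono-≤ len₁ len₂) ,
           ≤-trans many-good (*-monoʳ-≤ 2 (⊆⇒length≤ _≟_ (Uniq.filter⁺ (¬? ∘ bad?) uU)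
             (λ a∈ → ∈-filter⁺ (λ a → m ≤? neighbours U (T₁ ++ T₂) a) (proj₁ (goods⁻ a∈))
               (captured {T₁} {T₂} uT₂ (coll a∈) (hits (mapWith∈-∈ goods _ a∈))))))

-- Straight-line programs

module Programs (𝔾 : FinGroup) where
  open Sets 𝔾

  -- L can be produced with ρ free choices, every other entry being computed from earlier ones.
  data Prog : ℕ → List G → Set where
    start : Prog 0 []
    fresh : ∀ {ρ L} x → Prog ρ L → Prog (suc ρ) (x ∷ L)
    comb  : ∀ {ρ L x y z} → x ∈ L → y ∈ L → z ∈ L → Prog ρ L → Prog ρ ((x ⊕ y ⊖ z) ∷ L)
    half  : ∀ {ρ L x y h} → x ∈ L → y ∈ L → h ⊕ h ≡ x ⊕ y → Prog ρ L → Prog ρ (h ∷ L)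

  seeds : ∀ S → Prog (length S) S
  seeds []      = start
  seeds (x ∷ S) = fresh x (seeds S)

  -- The index bounds the number of operations in the derivation tree. A seed is available at every
  -- index, which makes `Der` monotone in it.
  data Der (S : List G) : ℕ → G → Set where
    seed : ∀ {x c} → x ∈ S → Der S c x
    op   : ∀ {a b c n x y z} → Der S a x → Der S b y → Der S c z → a + b + c < n → Der S n (x ⊕ y ⊖ z)

  Der-mono : ∀ {S S′ c x} → S ⊆ S′ → Der S c x → Der S′ c x
  Der-mono sub (seed x∈)  = seed (sub x∈)
  Der-mono sub (op p q r le) = op (Der-mono sub p) (Der-mono sub q) (Der-mono sub r) le

  Der-weaken : ∀ {S c c′ x} → c ≤ c′ → Der S c x → Der S c′ x
  Der-weaken le (seed x∈)     = seed x∈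
  Der-weaken le (op p q r lt) = op p q r (≤-trans lt le)

  -- Every `op` node becomes one computed entry, so the free choices remain those that produced the
  -- seeds.
  realise : ∀ {S c x ρ L} → Der S c x → S ⊆ L → Prog ρ L →
            ∃ λ L′ → Prog ρ L′ × L ⊆ L′ × x ∈ L′ × length L′ ≤ c + length L
  realise (seed x∈) sub prog = _ , prog , id , sub x∈ , m≤n+m _ _
  realise {L = L} (op {a} {b} {c} p q r lt) sub prog =
    let (L₁ , prog₁ , sub₁ , x∈ , le₁) = realise p sub prog
        (L₂ , prog₂ , sub₂ , y∈ , le₂) = realise q (sub₁ ∘ sub) prog₁
        (L₃ , prog₃ , sub₃ , z∈ , le₃) = realise r (sub₂ ∘ sub₁ ∘ sub) prog₂
    in _ , comb (sub₃ (sub₂ x∈)) (sub₃ y∈) z∈ prog₃ , there ∘ sub₃ ∘ sub₂ ∘ sub₁ , here refl ,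
       ≤-trans (s≤s (≤-trans le₃ (≤-trans (+-monoʳ-≤ c (≤-trans le₂ (+-monoʳ-≤ b le₁))) (≤-reflexive (e a b c (length L)))))) (+-monoˡ-≤ (length L) lt)
    where
    e : ∀ a b c l → c + (b + (a + l)) ≡ a + b + c + l
    e = solve-∀

  realise-all : ∀ {S c ρ L} xs → (∀ {x} → x ∈ xs → Der S c x) → S ⊆ L → Prog ρ L →
                ∃ λ L′ → Prog ρ L′ × L ⊆ L′ × xs ⊆ L′ × length L′ ≤ length xs * c + length L
  realise-all [] ders sub prog = _ , prog , id , (λ ()) , ≤-refl
  realise-all {c = c} {L = L} (x ∷ xs) ders sub prog =
    let (L₁ , prog₁ , sub₁ , xs⊆ , le₁) = realise-all xs (ders ∘ there) sub prog
        (L₂ , prog₂ , sub₂ , x∈ , le₂) = realise (ders (here refl)) (sub₁ ∘ sub) prog₁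
    in L₂ , prog₂ , sub₂ ∘ sub₁ , (λ { (here refl) → x∈ ; (there p) → sub₂ (xs⊆ p) }) ,
       ≤-trans le₂ (≤-trans (+-monoʳ-≤ c le₁) (≤-reflexive (sym (+-assoc c (length xs * c) (length L)))))

  module _ {S : List G} (𝟘∈ : 𝟘 ∈ S) where

    Der-⊕ : ∀ {a b x y} → Der S a x → Der S b y → Der S (suc (a + b)) (x ⊕ y)
    Der-⊕ {a} {b} {x} {y} p q = subst₂ (Der S) (cong suc (+-identityʳ (a + b))) (solve ((x₀ :+ x₁) :- :0) (x₀ :+ x₁) (x ∷ y ∷ []) refl)
      (op p q (seed {c = 0} 𝟘∈) ≤-refl)

    Der-⊖ : ∀ {a b x y} → Der S a x → Der S b y → Der S (suc (a + b)) (x ⊖ y)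
    Der-⊖ {a} {b} {x} {y} p q = subst₂ (Der S) (cong (λ k → suc (k + b)) (+-identityʳ a)) (solve ((x₀ :+ :0) :- x₁) (x₀ :- x₁) (x ∷ y ∷ []) refl)
      (op p (seed {c = 0} 𝟘∈) q ≤-refl)

    Der-⊝ : ∀ {b y} → Der S b y → Der S (suc b) (⊝ y)
    Der-⊝ {b} {y} q = subst (Der S (suc b)) (solve (:0 :- x₀) (:- x₀) (y ∷ []) refl) (Der-⊖ (seed {c = 0} 𝟘∈) q)

  record Window (S : List G) (c : ℕ) : Set where
    field
      elems : List G
      𝟘∈    : 𝟘 ∈ elems
      ⊝∈    : ∀ {w} → w ∈ elems → ⊝ w ∈ elems
      der   : ∀ {w} → w ∈ elems → Der S c w

  cell : List G → List G → G → List G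
  cell A W v = filter (λ a → (a ⊖ v) ∈? W) A

-- Growing windows

∈⇒pairs : {X : Set} {R : X → X → Set} → (∀ {x y} → R x y → R y x) → {xs : List X} → AllPairs R xs →
          ∀ {x y} → x ∈ xs → y ∈ xs → x ≢ y → R x y
∈⇒pairs sm (r ∷ rs) (here refl) (here refl) ne = contradiction refl ne
∈⇒pairs sm (r ∷ rs) (here refl) (there q)   ne = All.lookup r q
∈⇒pairs sm (r ∷ rs) (there p)   (here refl) ne = sm (All.lookup r p)
∈⇒pairs sm (r ∷ rs) (there p)   (there q)   ne = ∈⇒pairs sm rs p q ne

length-concatMap : {X Y : Set} (f : X → List Y) (xs : List X) → length (concatMap f xs) ≡ ∑ xs (length ∘ f)
length-concatMap f []       = refl
length-concatMap f (x ∷ xs) = trans (length-++ (f x)) (cong (length (f x) +_) (length-concatMap f xs))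

concatMap-unique : {X Y : Set} (f : X → List Y) {xs : List X} → Unique xs → (∀ {x} → x ∈ xs → Unique (f x)) →
                   (∀ {x x′ y} → x ∈ xs → x′ ∈ xs → y ∈ f x → y ∈ f x′ → x ≡ x′) → Unique (concatMap f xs)
concatMap-unique f []       uf dis = []
concatMap-unique f {x ∷ xs} (x∉ ∷ u) uf dis = Uniq.++⁺ (uf (here refl)) (concatMap-unique f u (uf ∘ there) (λ p q → dis (there p) (there q)))
  (λ (y∈ , y∈′) → let (x′ , x′∈ , y∈x′) = find (∈-concatMap⁻ f {xs = xs} y∈′) in
    All.lookup x∉ x′∈ (dis (here refl) (there x′∈) y∈ y∈x′))

^-*-distrib : ∀ k a b → (a * b) ^ k ≡ a ^ k * b ^ k
^-*-distrib zero    a b = refl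
^-*-distrib (suc k) a b = trans (cong (a * b *_) (^-*-distrib k a b)) (e a b (a ^ k) (b ^ k))
  where
  e : ∀ a b c d → a * b * (c * d) ≡ a * c * (b * d)
  e = solve-∀

^-cancelʳ-≤ : ∀ k {a b} → 0 < k → a ^ k ≤ b ^ k → a ≤ b
^-cancelʳ-≤ (suc k) {a} {b} _ le = ≮⇒≥ λ lt → <⇒≱ (^-monoˡ-< (suc k) lt) le

-- The cost c of a translation after j + 1 rounds of quadrupling a window and adding a difference of seeds.
grow : ℕ → ℕ → ℕ
grow zero    c = 4 * c + 5
grow (suc j) c = grow j (4 * c + 5)

module _ (𝔾 : FinGroup) where
  open Sets 𝔾
  open Growth 𝔾
  open Programs 𝔾

  module Chain (𝔸 A : List G) (wf : WindowFree 𝔸) (A⊆ : A ⊆ 𝔸) (uA : Unique A) (m M k β D : ℕ) (M¹⁴≤m : M ^ 14 ≤ m) (small : length (A ⊟ A) ≤ D)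
    (0<M : 0 < M) (A★ : List G) (A★⊆ : A★ ⊆ A) where

    quad : List G → List G
    quad W = (W ⊞ W) ⊟ (W ⊞ W)

    next : List G → List G → List G
    next T W = (T ⊟ T) ⊞ quad W

    f : List G → G → ℕ
    f W v = length (cell A W v)

    private
      cell⁻ : ∀ {W v a} → a ∈ cell A W v → a ∈ A × (a ⊖ v) ∈ W
      cell⁻ {W} {v} = ∈-filter⁻ (λ a → (a ⊖ v) ∈? W) {xs = A}

      cell-unique : ∀ W v → Unique (cell A W v)
      cell-unique W v = Uniq.filter⁺ _ uA

      module Stage (W T : List G) (𝟘∈W : 𝟘 ∈ W) (uT : Unique T) (T⊆ : T ⊆ A)
        (T-big : ∀ {t} → t ∈ T → m ≤ f W t) (T-sep : ∀ {t t′} → t ∈ T → t′ ∈ T → t ≢ t′ → (t ⊖ t′) ∉ quad W) where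

        quad-∈ : ∀ {p q r s} → p ∈ W → q ∈ W → r ∈ W → s ∈ W → (p ⊕ q) ⊖ (r ⊕ s) ∈ quad W
        quad-∈ p q r s = ∈-⊟⁺ (∈-⊞⁺ p q) (∈-⊞⁺ r s)

        big : ∀ {v t} → v ∈ A → t ∈ T → f W v * M ≤ length (cell A W v ⊟ cell A W t)
        big {v} {t} v∈ t∈ = ^-cancelʳ-≤ 14 (s≤s z≤n) (begin
          (f W v * M) ^ 14                            ≡⟨ ^-*-distrib 14 (f W v) M ⟩
          f W v ^ 14 * M ^ 14                         ≤⟨ *-monoʳ-≤ (f W v ^ 14) (≤-trans M¹⁴≤m (T-big t∈)) ⟩
          f W v ^ 14 * f W t                          ≤⟨ growth wf (A⊆ ∘ proj₁ ∘ cell⁻ {W} {v}) (A⊆ ∘ proj₁ ∘ cell⁻ {W} {t}) (cell-unique W v) (cell-unique W t)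
                                                           (∈⇒0<length (∈-filter⁺ (λ a → (a ⊖ v) ∈? W) v∈ (subst (_∈ W) (sym (⊖-self v)) 𝟘∈W))) ⟩
          length (cell A W v ⊟ cell A W t) ^ 14       ∎)
          where
          open ≤-Reasoning

        -- The sets (A ∩ (v + W)) - (A ∩ (t + W)), for v in R and t in T, are disjoint parts of A -
        -- A: a coincidence puts v - v′ in (T - T) + 4W, so v = v′, and then t - t′ in 4W, so t =
        -- t′. By `growth` and M ^ 14 ≤ m each of them is at least M times as large as the cell of
        -- v.
        total : ∀ {R} → Unique R → R ⊆ A → (∀ {v v′} → v ∈ R → v′ ∈ R → v ≢ v′ → (v ⊖ v′) ∉ next T W) →
                ∑ R (f W) * (length T * M) ≤ D
        total {R} uR R⊆ R-sep = begin
          ∑ R (f W) * (length T * M)                                            ≡⟨ sym (∑-*ʳ _ R (f W)) ⟩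
          ∑ R (λ v → f W v * (length T * M))                                    ≡⟨ ∑-cong R (λ {v} _ → trans (e (f W v) (length T) M) (sym (∑-const T (f W v * M)))) ⟩
          ∑ R (λ v → ∑ T (λ t → f W v * M))                                     ≤⟨ ∑-mono R (λ v∈ → ∑-mono T (λ t∈ → big (R⊆ v∈) t∈)) ⟩
          ∑ R (λ v → ∑ T (λ t → length (cell A W v ⊟ cell A W t)))              ≡⟨ sym (∑-cartesianProduct R T _) ⟩
          ∑ (cartesianProduct R T) (λ p → length (block p))                     ≡⟨ sym (length-concatMap block (cartesianProduct R T)) ⟩
          length (concatMap block (cartesianProduct R T))                       ≤⟨ ⊆⇒length≤ _≟_ (concatMap-unique block (Uniq.cartesianProduct⁺ uR uT) (λ _ → ⊟-unique _ _) disjoint) inside ⟩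
          length (A ⊟ A)                                                        ≤⟨ small ⟩
          D                                                                     ∎
          where
          open ≤-Reasoning
          e : ∀ a b c → a * (b * c) ≡ b * (a * c)
          e = solve-∀
          block : G × G → List G
          block (v , t) = cell A W v ⊟ cell A W t
          inside : ∀ {x} → x ∈ concatMap block (cartesianProduct R T) → x ∈ A ⊟ A
          inside x∈ = let ((v , t) , _ , x∈b) = find (∈-concatMap⁻ block {xs = cartesianProduct R T} x∈) in
            ⊟-mono {cell A W v} {A} {cell A W t} {A} (proj₁ ∘ cell⁻ {W} {v}) (proj₁ ∘ cell⁻ {W} {t}) x∈b
          disjoint : ∀ {p p′ y} → p ∈ cartesianProduct R T → p′ ∈ cartesianProduct R T → y ∈ block p → y ∈ block p′ → p ≡ p′
          disjoint {v , t} {v′ , t′} p∈ p′∈ y∈ y∈′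
            with ∈-cartesianProduct⁻ R T p∈ | ∈-cartesianProduct⁻ R T p′∈ | ∈-⊟⁻ (cell A W v) (cell A W t) y∈ | ∈-⊟⁻ (cell A W v′) (cell A W t′) y∈′
          ... | v∈ , t∈ | v′∈ , t′∈ | a , b , a∈ , b∈ , refl | a′ , b′ , a′∈ , b′∈ , eq = cong₂ _,_ v≡ (t≡ v≡)
            where
            wa = proj₂ (cell⁻ {W} {v} a∈)
            wb = proj₂ (cell⁻ {W} {t} b∈)
            wa′ = proj₂ (cell⁻ {W} {v′} a′∈)
            wb′ = proj₂ (cell⁻ {W} {t′} b′∈)
            env = v ∷ v′ ∷ t ∷ t′ ∷ a ∷ b ∷ a′ ∷ b′ ∷ []
            v≡ : v ≡ v′
            v≡ with v ≟ v′
            ... | yes p = p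
            ... | no ne = contradiction (subst (_∈ next T W)
              (sym (by₁ (solve ((x₀ :- x₁) :- ((x₂ :- x₃) :+ (((x₆ :- x₁) :+ (x₅ :- x₂)) :- ((x₄ :- x₀) :+ (x₇ :- x₃))))) ((x₄ :- x₅) :- (x₆ :- x₇)) env refl) eq))
              (∈-⊞⁺ (∈-⊟⁺ t∈ t′∈) (quad-∈ wa′ wb wa wb′))) (R-sep v∈ v′∈ ne)
            t≡ : v ≡ v′ → t ≡ t′
            t≡ refl with t ≟ t′
            ... | yes p = p
            ... | no ne = contradiction (subst (_∈ quad W)
              (by₁ (solve ((((x₄ :- x₀) :+ (x₇ :- x₃)) :- ((x₆ :- x₀) :+ (x₅ :- x₂))) :- (x₂ :- x₃)) ((x₄ :- x₅) :- (x₆ :- x₇)) env refl) eq)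
              (quad-∈ wa wb′ wa′ wb)) (T-sep t∈ t′∈ ne)

        -- Away from few exceptions, passing to the next window enlarges every cell by a factor β.
        stagnant : List G
        stagnant = filter (λ v → f (next T W) v <? β * f W v) A

        -- The cells of the new window around a maximal separated subset R cover the stagnant
        -- elements. Each is less than β times the old cell at the same centre, and `total` bounds
        -- the sum of the old cells over R.
        stagnant-few : (∀ {w} → w ∈ next T W → ⊝ w ∈ next T W) → 𝟘 ∈ next T W → length stagnant * (length T * M) ≤ β * D
        stagnant-few nsym 𝟘∈N = begin
          length stagnant * (length T * M)                     ≤⟨ *-monoˡ-≤ (length T * M) covered ⟩
          ∑ R (f (next T W)) * (length T * M)                  ≤⟨ *-monoˡ-≤ (length T * M) (∑-mono R (λ v∈ → <⇒≤ (proj₂ (∈-filter⁻ (λ v → f (next T W) v <? β * f W v) {xs = A} (R⊆ v∈))))) ⟩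
          ∑ R (λ v → β * f W v) * (length T * M)               ≡⟨ cong (_* (length T * M)) (∑-*ˡ β R _) ⟩
          β * ∑ R (f W) * (length T * M)                       ≡⟨ *-assoc β _ _ ⟩
          β * (∑ R (f W) * (length T * M))                     ≤⟨ *-monoʳ-≤ β (total uR (λ v∈ → proj₁ (∈-filter⁻ (λ v → f (next T W) v <? β * f W v) {xs = A} (R⊆ v∈))) R-sep) ⟩
          β * D                                                ∎
          where
          open ≤-Reasoning
          close? = λ v v′ → (v ⊖ v′) ∈? next T W
          R = separated close? stagnant
          R⊆ : R ⊆ stagnant
          R⊆ = separated-⊆ close? stagnant
          flip : ∀ {v v′} → ¬ ((v ⊖ v′) ∈ next T W) → ¬ ((v′ ⊖ v) ∈ next T W)
          flip {v} {v′} h p = h (subst (_∈ next T W) (solve (:- (x₁ :- x₀)) (x₀ :- x₁) (v ∷ v′ ∷ []) refl) (nsym p))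
          R-sep : ∀ {v v′} → v ∈ R → v′ ∈ R → v ≢ v′ → (v ⊖ v′) ∉ next T W
          R-sep = ∈⇒pairs flip (separated-pairs close? stagnant)
          uR : Unique R
          uR = AllPairs.map (λ h eq → h (subst (_∈ next T W) (sym (trans (cong (_⊖ _) eq) (⊖-self _))) 𝟘∈N)) (separated-pairs close? stagnant)
          covered : length stagnant ≤ ∑ R (f (next T W))
          covered = begin
            length stagnant                                                 ≡⟨ sym (∑-length stagnant) ⟩
            ∑ stagnant (λ _ → 1)                                            ≤⟨ ∑-mono stagnant (λ {v} v∈ → let (r , r∈ , p) = separated-covers close? (λ x → subst (_∈ next T W) (sym (⊖-self x)) 𝟘∈N) stagnant v∈ in
                                                                                 ∃⇒0<count (λ r → (v ⊖ r) ∈? next T W) r∈ p) ⟩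
            ∑ stagnant (λ v → count (λ r → (v ⊖ r) ∈? next T W) R)          ≡⟨ double-count (λ v r → (v ⊖ r) ∈? next T W) stagnant R ⟩
            ∑ R (λ r → count (λ v → (v ⊖ r) ∈? next T W) stagnant)          ≤⟨ ∑-mono R (λ {r} _ → ⊆⇒length≤ _≟_ (Uniq.filter⁺ (λ v → (v ⊖ r) ∈? next T W) (Uniq.filter⁺ _ uA)) (λ p →
                                                                                 let (p∈ , q) = ∈-filter⁻ (λ v → (v ⊖ r) ∈? next T W) {xs = stagnant} p in
                                                                                 ∈-filter⁺ (λ a → (a ⊖ r) ∈? next T W) (proj₁ (∈-filter⁻ (λ v → f (next T W) v <? β * f W v) {xs = A} p∈)) q)) ⟩
            ∑ R (f (next T W))                                              ∎

    private
      quad-der : ∀ {S c W} → 𝟘 ∈ S → (∀ {w} → w ∈ W → Der S c w) → ∀ {q} → q ∈ quad W → Der S (4 * c + 3) q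
      quad-der {S} {c} {W} 𝟘∈ der q∈ with ∈-⊟⁻ (W ⊞ W) (W ⊞ W) q∈
      ... | p , r , p∈ , r∈ , refl with ∈-⊞⁻ W W p∈ | ∈-⊞⁻ W W r∈
      ... | w₁ , w₂ , i₁ , i₂ , refl | w₃ , w₄ , i₃ , i₄ , refl =
        Der-weaken (≤-reflexive (e c)) (Der-⊖ 𝟘∈ (Der-⊕ 𝟘∈ (der i₁) (der i₂)) (Der-⊕ 𝟘∈ (der i₃) (der i₄)))
        where
        e : ∀ c → suc (suc (c + c) + suc (c + c)) ≡ 4 * c + 3
        e = solve-∀

      next-der : ∀ {S c W T} → 𝟘 ∈ S → T ⊆ S → (∀ {w} → w ∈ W → Der S c w) → ∀ {q} → q ∈ next T W → Der S (4 * c + 5) q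
      next-der {S} {c} {W} {T} 𝟘∈ T⊆S der q∈ with ∈-⊞⁻ (T ⊟ T) (quad W) q∈
      ... | d , r , d∈ , r∈ , refl with ∈-⊟⁻ T T d∈
      ... | t , t′ , t∈ , t′∈ , refl = Der-weaken (≤-reflexive (e c))
        (Der-⊕ 𝟘∈ (Der-⊖ 𝟘∈ (seed {c = 0} (T⊆S t∈)) (seed {c = 0} (T⊆S t′∈))) (quad-der 𝟘∈ der r∈))
        where
        e : ∀ c → suc (1 + (4 * c + 3)) ≡ 4 * c + 5
        e = solve-∀

      quad-𝟘 : ∀ {W} → 𝟘 ∈ W → 𝟘 ∈ quad W
      quad-𝟘 {W} p = subst (_∈ quad W) (solve {n = 0} ((:0 :+ :0) :- (:0 :+ :0)) :0 [] refl) (∈-⊟⁺ (∈-⊞⁺ p p) (∈-⊞⁺ p p))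

      quad-⊝ : ∀ {W w} → w ∈ quad W → ⊝ w ∈ quad W
      quad-⊝ {W} w∈ with ∈-⊟⁻ (W ⊞ W) (W ⊞ W) w∈
      ... | p , q , p∈ , q∈ , refl = subst (_∈ quad W) (solve (x₁ :- x₀) (:- (x₀ :- x₁)) (p ∷ q ∷ []) refl) (∈-⊟⁺ q∈ p∈)

      next-𝟘 : ∀ {T W t} → t ∈ T → 𝟘 ∈ W → 𝟘 ∈ next T W
      next-𝟘 {T} {W} {t} t∈ p = subst (_∈ next T W) (solve ((x₀ :- x₀) :+ :0) :0 (t ∷ []) refl) (∈-⊞⁺ (∈-⊟⁺ t∈ t∈) (quad-𝟘 p))

      next-⊝ : ∀ {T W w} → w ∈ next T W → ⊝ w ∈ next T W
      next-⊝ {T} {W} w∈ with ∈-⊞⁻ (T ⊟ T) (quad W) w∈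
      ... | d , q , d∈ , q∈ , refl with ∈-⊟⁻ T T d∈
      ... | t , t′ , t∈ , t′∈ , refl = subst (_∈ next T W) (solve ((x₁ :- x₀) :+ (:- x₂)) (:- ((x₀ :- x₁) :+ x₂)) (t ∷ t′ ∷ q ∷ []) refl)
        (∈-⊞⁺ (∈-⊟⁺ t′∈ t∈) (quad-⊝ q∈))

    Generated : List G → ℕ → ℕ → Set
    Generated S j c = ∃ λ S′ → length S′ ≤ length S + suc j * k × (∀ {a} → a ∈ A★ → Der S′ (grow j c) a) × 𝟘 ∈ S′

    -- Read backwards from the last window, whose cells have at most |A| elements: outside `Bad`,
    -- each of the j enlargements has multiplied the cell at v by at least β.
    Growing : ℕ → List G → Set
    Growing j W = ∃ λ Bad → length Bad * (k * M) ≤ j * (β * D) × (∀ {v} → v ∈ A → v ∉ Bad → β ^ j * f W v ≤ length A)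

    private
      ≤grow : ∀ j c → c ≤ grow j c
      ≤grow zero    c = ≤-trans (m≤m+n c _) (m≤m+n (4 * c) 5)
      ≤grow (suc j) c = ≤-trans (≤grow zero c) (≤grow j (4 * c + 5))

    -- A maximal 4W-separated part of `A★` decides. If it has fewer than k elements, it becomes part
    -- of the seeds, and every a in `A★` is some t in it plus an element of 4W. Otherwise k of its
    -- elements form T and lead to the next window.
    levels : 0 < k → ∀ j {S c} W → 𝟘 ∈ S → 𝟘 ∈ W → (∀ {w} → w ∈ W → Der S c w) → (∀ {a} → a ∈ A★ → m ≤ f W a) →
             Generated S j c ⊎ Growing j W
    levels 0<k zero W 𝟘∈S 𝟘∈W der big★ = inj₂ ([] , z≤n , λ _ _ → ≤-trans (≤-reflexive (*-identityˡ _)) (length-filter _ A))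
    levels 0<k (suc j) {S} {c} W 𝟘∈S 𝟘∈W der big★ = branch (k ≤? length sepT)
      where
      close? = λ t t′ → (t ⊖ t′) ∈? quad W
      sepT = separated close? A★
      covers = separated-covers close? (λ x → subst (_∈ quad W) (sym (⊖-self x)) (quad-𝟘 𝟘∈W)) A★
      branch : Dec (k ≤ length sepT) → Generated S (suc j) c ⊎ Growing (suc j) W
      branch (no ¬many) = inj₁ (sepT ++ S ,
          ≤-trans (≤-reflexive (trans (length-++ sepT) (+-comm (length sepT) _))) (+-monoʳ-≤ (length S) (≤-trans (<⇒≤ (≰⇒> ¬many)) (m≤m+n k _))) ,
          derive , ∈-++⁺ʳ sepT 𝟘∈S)
        where
        derive : ∀ {a} → a ∈ A★ → Der (sepT ++ S) (grow (suc j) c) a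
        derive {a} a∈ = let (t , t∈ , q) = covers a∈ in
          Der-weaken (≤-trans (≤-trans (≤-reflexive (e c)) (n≤1+n _)) (≤-trans (≤-reflexive (e′ c)) (≤grow j (4 * c + 5))))
            (subst (Der (sepT ++ S) _) (solve (x₁ :+ (x₀ :- x₁)) x₀ (a ∷ t ∷ []) refl)
              (Der-⊕ (∈-++⁺ʳ sepT 𝟘∈S) (seed {c = 0} (∈-++⁺ˡ t∈)) (quad-der (∈-++⁺ʳ sepT 𝟘∈S) (λ w∈ → Der-mono (∈-++⁺ʳ sepT) (der w∈)) q)))
          where
          e : ∀ c → suc (0 + (4 * c + 3)) ≡ 4 * c + 4
          e = solve-∀
          e′ : ∀ c → suc (4 * c + 4) ≡ 4 * c + 5
          e′ = solve-∀
      branch (yes many) = combine (levels 0<k j {T ++ S} {4 * c + 5} (next T W) (∈-++⁺ʳ T 𝟘∈S) (next-𝟘 (proj₂ t₀) 𝟘∈W)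
          (next-der (∈-++⁺ʳ T 𝟘∈S) ∈-++⁺ˡ (λ w∈ → Der-mono (∈-++⁺ʳ T) (der w∈)))
          (λ {a} a∈ → ≤-trans (big★ a∈) (count-mono (λ b → (b ⊖ a) ∈? W) (λ b → (b ⊖ a) ∈? next T W) A (λ _ → W⊆next))))
        where
        T = take k sepT
        length-T : length T ≡ k
        length-T = trans (length-take k sepT) (m≤n⇒m⊓n≡m many)
        T⊆sep : T ⊆ sepT
        T⊆sep = take-⊆ k sepT
          where
          take-⊆ : ∀ n (xs : List G) {x} → x ∈ take n xs → x ∈ xs
          take-⊆ (suc n) (y ∷ xs) (here p)  = here p
          take-⊆ (suc n) (y ∷ xs) (there p) = there (take-⊆ n xs p)
        t₀ : ∃ λ t → t ∈ T
        t₀ = 0<length⇒∃ T (≤-trans 0<k (≤-reflexive (sym length-T)))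
        W⊆next : W ⊆ next T W
        W⊆next {w} w∈ = subst (_∈ next T W) (solve ((x₀ :- x₀) :+ ((x₁ :+ :0) :- (:0 :+ :0))) x₁ (proj₁ t₀ ∷ w ∷ []) refl)
          (∈-⊞⁺ (∈-⊟⁺ (proj₂ t₀) (proj₂ t₀)) (∈-⊟⁺ (∈-⊞⁺ w∈ 𝟘∈W) (∈-⊞⁺ 𝟘∈W 𝟘∈W)))
        pairs : AllPairs (λ t t′ → ¬ ((t ⊖ t′) ∈ quad W)) T
        pairs = Pairs.take⁺ k (separated-pairs close? A★)
        flip : ∀ {t t′} → ¬ ((t ⊖ t′) ∈ quad W) → ¬ ((t′ ⊖ t) ∈ quad W)
        flip {t} {t′} h p = h (subst (_∈ quad W) (solve (:- (x₁ :- x₀)) (x₀ :- x₁) (t ∷ t′ ∷ []) refl) (quad-⊝ p))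
        T⊆★ : T ⊆ A★
        T⊆★ = separated-⊆ close? A★ ∘ T⊆sep
        open Stage W T 𝟘∈W
          (AllPairs.map (λ h eq → h (subst (_∈ quad W) (sym (trans (cong (_⊖ _) eq) (⊖-self _))) (quad-𝟘 𝟘∈W))) pairs)
          (A★⊆ ∘ T⊆★) (big★ ∘ T⊆★) (∈⇒pairs flip pairs)
        combine : Generated (T ++ S) j (4 * c + 5) ⊎ Growing j (next T W) → Generated S (suc j) c ⊎ Growing (suc j) W
        combine (inj₁ (S′ , len , ders , 𝟘∈)) = inj₁ (S′ , ≤-trans len (≤-reflexive
          (trans (cong (_+ suc j * k) (trans (length-++ T) (cong (_+ length S) length-T))) (e k (length S) (suc j * k)))) , ders , 𝟘∈)
          where
          e : ∀ k s r → k + s + r ≡ s + (k + r)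
          e = solve-∀
        combine (inj₂ (Bad , few , large)) = inj₂ (stagnant ++ Bad ,
          ≤-trans (≤-reflexive (trans (cong (_* (k * M)) (length-++ stagnant)) (*-distribʳ-+ (k * M) (length stagnant) _)))
            (+-mono-≤ (subst (λ n → length stagnant * (n * M) ≤ β * D) length-T (stagnant-few next-⊝ (next-𝟘 (proj₂ t₀) 𝟘∈W))) few) ,
          λ {v} v∈ v∉ → ≤-trans (≤-trans (≤-reflexive (e β (β ^ j) (f W v))) (*-monoʳ-≤ (β ^ j)
              (≮⇒≥ (λ lt → v∉ (∈-++⁺ˡ (∈-filter⁺ (λ v → f (next T W) v <? β * f W v) v∈ lt))))))
            (large v∈ (v∉ ∘ ∈-++⁺ʳ stagnant)))
          where
          e : ∀ a b c → a * b * c ≡ b * (a * c)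
          e = solve-∀

    -- Every cell contains its own centre, so β ^ J > |A| leaves no element of A outside `Bad`; the
    -- first numerical hypothesis makes `Bad` too small for that.
    generated : 0 < k → ∀ J {S c} (W : Window S c) → 𝟘 ∈ S → (∀ {a} → a ∈ A★ → m ≤ f (Window.elems W) a) →
                J * (β * D) < length A * (k * M) → length A < β ^ J → Generated S J c
    generated 0<k J {S} {c} W 𝟘∈S big★ few<all short = conclude (levels 0<k J elems 𝟘∈S 𝟘∈ der big★)
      where
      open Window W
      conclude : Generated S J c ⊎ Growing J elems → Generated S J c
      conclude (inj₁ g) = g
      conclude (inj₂ (Bad , few , large)) with Any.any? (λ v → ¬? (v ∈? Bad)) A
      ... | yes ex = let (v , v∈ , v∉) = find ex in
        ⊥-elim (<⇒≱ short (≤-trans (≤-trans (≤-reflexive (sym (*-identityʳ (β ^ J)))) (*-monoʳ-≤ (β ^ J)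
          (∈⇒0<length (∈-filter⁺ (λ a → (a ⊖ v) ∈? elems) v∈ (subst (_∈ elems) (sym (⊖-self v)) 𝟘∈))))) (large v∈ v∉)))
      ... | no ¬ex = ⊥-elim (<⇒≱ few<all (≤-trans (*-monoˡ-≤ (k * M) (⊆⇒length≤ _≟_ uA inBad)) few))
        where
        inBad : A ⊆ Bad
        inBad {v} v∈ with v ∈? Bad
        ... | yes p = p
        ... | no ¬p = contradiction (Any.map (λ { refl → ¬p }) v∈) ¬ex

-- The first window

-- These are the numerical hypotheses of `Flat`, to be supplied for every possible u = |U|, as U
-- only emerges during the rounds. `flat-bound` translates the popularity threshold thr / D into the
-- bound H.
record FlatParams (D thr ℓ m τ u : ℕ) : Set where
  field
    H z ρ R B B₂ : ℕ
    flat-bound : ∀ e → D * e < thr → e ≤ H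
    0<B  : 0 < B
    0<B₂ : 0 < B₂
    0<z  : 0 < z
    0<ρ  : 0 < ρ
    N₀ : 2 * (z * z) * H ≤ u
    N₁ : 8 * D * (2 + 2 * (z * z)) ≤ 3 * (u * u)
    N₂ : 32 * D * ρ ≤ u * u
    N₃ : 32 * D * H * (R * (u + z * H)) ≤ z * (u * u * u)
    N₄ : 32 * D * H ≤ B * (u * u)
    N₅ : u ≤ B₂ * (R * ρ ∸ m)
    total : R * (ℓ * (2 * B)) + m * (ℓ * (2 * B₂)) ≤ τ

module _ (𝔾 : FinGroup) where
  open Sets 𝔾
  open Programs 𝔾

  -- The window consists of 𝟘, the popular differences Δ and all T - T. Of a pair d, - d in Δ one
  -- member is enough among the seeds.
  module StartSeeds (A : List G) (m τ : ℕ) (Δ Ds : List G) (Ts : List (List G)) (uΔ : Unique Δ) (⊝∈ : ∀ {d} → d ∈ Δ → ⊝ d ∈ Δ)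
    (source : ∀ {d} → d ∈ Δ → d ∈ Ds ⊎ (∃ λ d′ → d′ ∈ Ds × d ≡ ⊝ d′)) (Ts⊆ : All (λ T → T ⊆ A × length T ≤ τ) Ts) where

    rich : List G → List G
    rich W = filter (λ a → m ≤? length (cell A W a)) A

    S : List G
    S = 𝟘 ∷ (Ds ++ concat Ts)
    blocks : List G
    blocks = concatMap (λ T → T ⊟ T) Ts
    elems : List G
    elems = 𝟘 ∷ (Δ ++ blocks)
    blocks⁻ : ∀ {w} → w ∈ blocks → ∃ λ T → T ∈ Ts × (∃ λ t → ∃ λ t′ → t ∈ T × t′ ∈ T × w ≡ t ⊖ t′)
    blocks⁻ p = let (T , T∈ , q) = find (∈-concatMap⁻ (λ T → T ⊟ T) {xs = Ts} p) in T , T∈ , ∈-⊟⁻ T T q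
    blocks⁺ : ∀ {T t t′} → T ∈ Ts → t ∈ T → t′ ∈ T → t ⊖ t′ ∈ blocks
    blocks⁺ T∈ t∈ t′∈ = ∈-concatMap⁺ (λ T → T ⊟ T) (Any.map (λ { refl → ∈-⊟⁺ t∈ t′∈ }) T∈)
    derive-Δ : ∀ {w} → w ∈ Ds ⊎ (∃ λ d → d ∈ Ds × w ≡ ⊝ d) → Der S 1 w
    derive-Δ (inj₁ q) = seed (there (∈-++⁺ˡ q))
    derive-Δ (inj₂ (d , d∈ , eq)) = subst (Der S 1) (sym eq) (Der-⊝ (here refl) (seed {c = 0} (there (∈-++⁺ˡ d∈))))
    in-S : ∀ {T t} → T ∈ Ts → t ∈ T → t ∈ S
    in-S T∈ t∈ = there (∈-++⁺ʳ Ds (∈-concat⁺′ t∈ T∈))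
    derive-⊎ : ∀ {w} → w ∈ Δ ⊎ w ∈ blocks → Der S 1 w
    derive-⊎ (inj₁ p) = derive-Δ (source p)
    derive-⊎ (inj₂ p) = let (T , T∈ , t , t′ , t∈ , t′∈ , eq) = blocks⁻ p in
      subst (Der S 1) (sym eq) (Der-⊖ (here refl) (seed {c = 0} (in-S T∈ t∈)) (seed {c = 0} (in-S T∈ t′∈)))
    derive : ∀ {w} → w ∈ elems → Der S 1 w
    derive (here eq)  = subst (Der S 1) (sym eq) (seed (here refl))
    derive (there w∈) = derive-⊎ (∈-++⁻ Δ w∈)
    negate-⊎ : ∀ {w} → w ∈ Δ ⊎ w ∈ blocks → ⊝ w ∈ elems
    negate-⊎ (inj₁ p) = there (∈-++⁺ˡ (⊝∈ p))
    negate-⊎ (inj₂ p) = let (T , T∈ , t , t′ , t∈ , t′∈ , eq) = blocks⁻ p in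
      there (∈-++⁺ʳ Δ (subst (_∈ blocks) (trans (solve (x₁ :- x₀) (:- (x₀ :- x₁)) (t ∷ t′ ∷ []) refl) (cong ⊝_ (sym eq))) (blocks⁺ T∈ t′∈ t∈)))
    negate : ∀ {w} → w ∈ elems → ⊝ w ∈ elems
    negate (here eq)  = here (trans (cong ⊝_ eq) (solve {n = 0} (:- :0) :0 [] refl))
    negate (there w∈) = negate-⊎ (∈-++⁻ Δ w∈)
    W : Window S 1
    W = record { elems = elems ; 𝟘∈ = here refl ; ⊝∈ = negate ; der = derive }
    length-concat : ∀ Ts → All (λ T → T ⊆ A × length T ≤ τ) Ts → length (concat Ts) ≤ length Ts * τ
    length-concat []       []              = z≤n
    length-concat (T ∷ Ts) ((_ , le) ∷ ps) = ≤-trans (≤-reflexive (length-++ T)) (+-mono-≤ le (length-concat Ts ps))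
    len : length Ts ≤ 8 * m → length S ≤ 1 + (length Ds + 8 * m * τ)
    len few = s≤s (≤-trans (≤-reflexive (length-++ Ds)) (+-monoʳ-≤ (length Ds) (≤-trans (length-concat Ts Ts⊆)
      (*-monoˡ-≤ τ few))))
    rich-hits : ∀ {a} → a ∈ A → m ≤ count (λ d → (a ⊕ d) ∈? A) Δ → a ∈ rich elems
    rich-hits {a} a∈ h = ∈-filter⁺ (λ a → m ≤? length (cell A elems a)) a∈ (≤-trans h
      (inj⇒length≤ _≟_ {ys = cell A elems a} (a ⊕_) (Uniq.filter⁺ (λ d → (a ⊕ d) ∈? A) uΔ)
        (λ {d} d∈ → let (d∈Δ , q) = ∈-filter⁻ (λ d → (a ⊕ d) ∈? A) {xs = Δ} d∈ in
          ∈-filter⁺ (λ b → (b ⊖ a) ∈? elems) q (subst (_∈ elems) (solve x₁ ((x₀ :+ x₁) :- x₀) (a ∷ d ∷ []) refl) (there (∈-++⁺ˡ d∈Δ))))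
        (λ {x} {y} _ _ eq → by₁ (solve (x₀ :- x₁) ((x₂ :+ x₀) :- (x₂ :+ x₁)) (x ∷ y ∷ a ∷ []) refl) eq)))
    rich-captured : ∀ {a} → a ∈ A → Any (λ T → m ≤ count (λ a′ → (a′ ⊖ a) ∈? (T ⊟ T)) A) Ts → a ∈ rich elems
    rich-captured {a} a∈ c = let (T , T∈ , cap) = find c in
      ∈-filter⁺ (λ a → m ≤? length (cell A elems a)) a∈ (≤-trans cap (count-mono (λ a′ → (a′ ⊖ a) ∈? (T ⊟ T)) (λ b → (b ⊖ a) ∈? elems) A
        (λ _ q → there (∈-++⁺ʳ Δ (∈-concatMap⁺ (λ T → T ⊟ T) (Any.map (λ { refl → q }) T∈))))))

module _ (𝔾 : FinGroup) where
  open Sets 𝔾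
  open Popularity 𝔾
  open Programs 𝔾

  module Start (A : List G) (uA : Unique A) (0<A : 0 < length A) (m thr D ℓ τ : ℕ) (small : length (A ⊟ A) ≤ D) (0<m : 0 < m) (0<thr : 0 < thr)
    (short : length A < 2 ^ ℓ) (params : ∀ u → length A ≤ 4 * m * u → u ≤ length A → FlatParams D thr ℓ m τ u) where

    private
      instance
        m≢0 : NonZero m
        m≢0 = >-nonZero 0<m

      hits : List G → G → ℕ
      hits Δ a = count (λ d → (a ⊕ d) ∈? A) Δ

      -- The potential of the greedy choice of popular differences. Truncation at m counts only
      -- progress of elements that are still poor and keeps the total below |A| m, which bounds the
      -- number of choices.
      Φ : List G → ℕ
      Φ Δ = ∑ A (λ a → hits Δ a ⊓ m)

      Φ≤ : ∀ Δ → Φ Δ ≤ length A * m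
      Φ≤ Δ = ≤-trans (∑-mono A (λ {a} _ → m⊓n≤n (hits Δ a) m)) (≤-reflexive (∑-const A m))

      poor? : ∀ Δ a → Dec (hits Δ a < m)
      poor? Δ a = hits Δ a <? m

      opaque
        poor : List G → List G
        poor Δ = filter (poor? Δ) A

        poor⁻ : ∀ {Δ a} → a ∈ poor Δ → a ∈ A × hits Δ a < m
        poor⁻ {Δ} = ∈-filter⁻ (poor? Δ) {xs = A}

        poor⁺ : ∀ {Δ a} → a ∈ A → hits Δ a < m → a ∈ poor Δ
        poor⁺ {Δ} = ∈-filter⁺ (poor? Δ)

        poor-unique : ∀ Δ → Unique (poor Δ)
        poor-unique Δ = Uniq.filter⁺ (poor? Δ) uA

        count-poor : ∀ Δ {P : Pred G 0ℓ} (P? : Decidable P) → count P? (poor Δ) ≡ ∑ A (λ a → 𝟙 (poor? Δ a) * 𝟙 (P? a))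
        count-poor Δ P? = trans (count-∑ P? (filter (poor? Δ) A)) (go A)
          where
          go : ∀ xs → ∑ (filter (poor? Δ) xs) (λ a → 𝟙 (P? a)) ≡ ∑ xs (λ a → 𝟙 (poor? Δ a) * 𝟙 (P? a))
          go []       = refl
          go (x ∷ xs) with does (poor? Δ x)
          ... | true  = cong₂ _+_ (sym (+-identityʳ _)) (go xs)
          ... | false = go xs

      pop : List G → G → ℕ
      pop Δ d = count (λ a → (a ⊕ d) ∈? A) (poor Δ)

      -- `pop` counts poor elements only, where the truncation at m leaves room for one more hit. So
      -- d alone raises their terms, and - d can only add to this.
      Φ-step : ∀ Δ d → Φ Δ + pop Δ d ≤ Φ (d ∷ ⊝ d ∷ Δ)
      Φ-step Δ d = begin
        Φ Δ + pop Δ d                                                          ≡⟨ cong (Φ Δ +_) (count-poor Δ (λ a → (a ⊕ d) ∈? A)) ⟩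
        Φ Δ + ∑ A (λ a → 𝟙 (poor? Δ a) * 𝟙 ((a ⊕ d) ∈? A))                     ≡⟨ sym (∑-+ A _ _) ⟩
        ∑ A (λ a → hits Δ a ⊓ m + 𝟙 (poor? Δ a) * 𝟙 ((a ⊕ d) ∈? A))            ≤⟨ ∑-mono A (λ {a} _ → ≤-trans (pointwise (poor? Δ a) (𝟙≤1 ((a ⊕ d) ∈? A))) (⊓-monoˡ-≤ m (more a))) ⟩
        Φ (d ∷ ⊝ d ∷ Δ)                                                        ∎
        where
        open ≤-Reasoning
        pointwise : ∀ {h i} (p : Dec (h < m)) → i ≤ 1 → h ⊓ m + 𝟙 p * i ≤ (i + h) ⊓ m
        pointwise {h} {i} (yes h<m) i≤1 = ≤-trans (≤-reflexive (trans (cong₂ _+_ (m≤n⇒m⊓n≡m (<⇒≤ h<m)) (*-identityˡ i)) (+-comm h i)))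
          (⊓-glb ≤-refl (≤-trans (+-monoˡ-≤ h i≤1) h<m))
        pointwise {h} {i} (no _) _ = ≤-trans (≤-reflexive (+-identityʳ _)) (⊓-monoˡ-≤ m (m≤n+m h i))
        𝟙≤1 : {P : Set} (d : Dec P) → 𝟙 d ≤ 1
        𝟙≤1 (yes _) = ≤-refl
        𝟙≤1 (no _)  = z≤n
        more : ∀ a → 𝟙 ((a ⊕ d) ∈? A) + hits Δ a ≤ hits (d ∷ ⊝ d ∷ Δ) a
        more a = ≤-trans (+-monoʳ-≤ (𝟙 ((a ⊕ d) ∈? A)) (≤-trans (≤-reflexive (count-∑ P? Δ)) (m≤n+m _ (𝟙 (P? (⊝ d)))))) (≤-reflexive (sym (count-∑ P? (d ∷ ⊝ d ∷ Δ))))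
          where P? = λ d → (a ⊕ d) ∈? A

      record Greedy (Δ Ds : List G) : Set where
        field
          uΔ     : Unique Δ
          ⊝∈     : ∀ {d} → d ∈ Δ → ⊝ d ∈ Δ
          𝟘∉     : 𝟘 ∉ Δ
          source : ∀ {d} → d ∈ Δ → d ∈ Ds ⊎ (∃ λ d′ → d′ ∈ Ds × d ≡ ⊝ d′)
          cheap  : length Ds * thr ≤ D * Φ Δ

      ⊝⊝ : ∀ d → ⊝ (⊝ d) ≡ d
      ⊝⊝ d = solve (:- (:- x₀)) x₀ (d ∷ []) refl

      extend : ∀ {Δ Ds d} → Greedy Δ Ds → d ≢ 𝟘 → d ∉ Δ → thr ≤ D * pop Δ d → Greedy (d ∷ ⊝ d ∷ Δ) (d ∷ Ds)
      extend {Δ} {Ds} {d} g d≢𝟘 d∉ popular = record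
        { uΔ = ((λ eq → d≢𝟘 (no-2-torsion d (trans (cong (d ⊕_) eq) (⊖-self d)))) ∷ All.tabulate (λ d′∈ eq → d∉ (subst (_∈ Δ) (sym eq) d′∈))) ∷
               (All.tabulate (λ d′∈ eq → d∉ (subst (_∈ Δ) (trans (cong ⊝_ (sym eq)) (⊝⊝ d)) (⊝∈ d′∈))) ∷ uΔ)
        ; ⊝∈ = λ { (here refl) → there (here refl) ; (there (here refl)) → here (⊝⊝ d) ; (there (there p)) → there (there (⊝∈ p)) }
        ; 𝟘∉ = λ { (here eq) → d≢𝟘 (sym eq) ; (there (here eq)) → d≢𝟘 (trans (sym (⊝⊝ d)) (trans (cong ⊝_ (sym eq)) (solve {n = 0} (:- :0) :0 [] refl))) ; (there (there p)) → 𝟘∉ p }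
        ; source = λ { (here refl) → inj₁ (here refl) ; (there (here refl)) → inj₂ (d , here refl , refl) ;
                       (there (there p)) → ⊎-elim (inj₁ ∘ there) (λ (d′ , d′∈ , eq) → inj₂ (d′ , there d′∈ , eq)) (source p) }
        ; cheap = ≤-trans (+-mono-≤ popular cheap) (≤-trans (≤-reflexive (trans (sym (*-distribˡ-+ D (pop Δ d) (Φ Δ))) (cong (D *_) (+-comm (pop Δ d) (Φ Δ))))) (*-monoʳ-≤ D (Φ-step Δ d)))
        }
        where open Greedy g

      Stuck : List G → Set
      Stuck Δ = ∀ {d} → d ≢ 𝟘 → d ∉ Δ → D * pop Δ d < thr

      abstract
        run : ∀ fuel {Δ Ds} → Greedy Δ Ds → length A * m ≤ fuel + Φ Δ → ∃ λ Δ′ → ∃ λ Ds′ → Greedy Δ′ Ds′ × Stuck Δ′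
        run fuel {Δ} {Ds} g enough = branch fuel enough (Any.any? try? (A ⊟ A))
          where
          try? : ∀ d → Dec (d ≢ 𝟘 × d ∉ Δ × thr ≤ D * pop Δ d)
          try? d = ¬? (d ≟ 𝟘) ×-dec (¬? (d ∈? Δ) ×-dec (thr ≤? D * pop Δ d))
          branch : ∀ fuel → length A * m ≤ fuel + Φ Δ → Dec (Any (λ d → d ≢ 𝟘 × d ∉ Δ × thr ≤ D * pop Δ d) (A ⊟ A)) →
                   ∃ λ Δ′ → ∃ λ Ds′ → Greedy Δ′ Ds′ × Stuck Δ′
          branch _ _ (no ¬ex) = Δ , Ds , g , stuck
            where
            stuck : Stuck Δ
            stuck {d} d≢ d∉ with thr ≤? D * pop Δ d
            ... | no ¬le = ≰⇒> ¬le
            ... | yes le = contradiction (Any.map (λ { refl → d≢ , d∉ , le }) d∈) ¬ex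
              where
              0<pop : 0 < pop Δ d
              0<pop with 0 <? pop Δ d
              ... | yes p = p
              ... | no ¬p = ⊥-elim (<⇒≱ 0<thr (≤-trans le (≤-reflexive (trans (cong (D *_) (n≤0⇒n≡0 (≮⇒≥ ¬p))) (*-zeroʳ D)))))
              d∈ : d ∈ A ⊟ A
              d∈ = let (a , a∈) = 0<length⇒∃ _ 0<pop ; (a∈p , q) = ∈-filter⁻ (λ a → (a ⊕ d) ∈? A) {xs = poor Δ} a∈ in
                subst (_∈ A ⊟ A) (solve ((x₀ :+ x₁) :- x₀) x₁ (a ∷ d ∷ []) refl) (∈-⊟⁺ q (proj₁ (poor⁻ {Δ} a∈p)))
          branch zero en (yes ex) = let (d , _ , (_ , _ , le)) = find ex in
            ⊥-elim (<⇒≱ (<-≤-trans (m<m+n (Φ Δ) (0<pop le)) (Φ-step Δ d)) (≤-trans (Φ≤ (d ∷ ⊝ d ∷ Δ)) en))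
            where
            0<pop : ∀ {n} → thr ≤ D * n → 0 < n
            0<pop {zero}  le = ⊥-elim (<⇒≱ 0<thr (≤-trans le (≤-reflexive (*-zeroʳ D))))
            0<pop {suc n} _  = s≤s z≤n
          branch (suc fuel) en (yes ex) = let (d , _ , (d≢ , d∉ , le)) = find ex in
            run fuel (extend g d≢ d∉ le) (≤-trans en (≤-trans (≤-reflexive (sym (+-suc fuel (Φ Δ)))) (+-monoʳ-≤ fuel (<-≤-trans (m<m+n (Φ Δ) (0<pop le)) (Φ-step Δ d)))))
            where
            0<pop : ∀ {n} → thr ≤ D * n → 0 < n
            0<pop {zero}  le = ⊥-elim (<⇒≱ 0<thr (≤-trans le (≤-reflexive (*-zeroʳ D))))
            0<pop {suc n} _  = s≤s z≤n

        greedy : ∃ λ Δ → ∃ λ Ds → Greedy Δ Ds × Stuck Δ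
        greedy = run (length A * m) {[]} {[]} (record { uΔ = [] ; ⊝∈ = λ () ; 𝟘∉ = λ () ; source = λ () ; cheap = z≤n }) (m≤m+n _ _)

    rich : List G → List G
    rich W = filter (λ a → m ≤? length (cell A W a)) A

    private
      module Rounds (Δ Ds : List G) (g : Greedy Δ Ds) (stuck : Stuck Δ) where
        open Greedy g

        Captured : List G → G → Set
        Captured T a = m ≤ count (λ a′ → (a′ ⊖ a) ∈? (T ⊟ T)) A

        captured? : ∀ a T → Dec (Captured T a)
        captured? a T = m ≤? count (λ a′ → (a′ ⊖ a) ∈? (T ⊟ T)) A

        open? : ∀ Ts a → Dec (¬ Any (λ T → Captured T a) Ts)
        open? Ts a = ¬? (Any.any? (captured? a) Ts)

        opaque
          unc : List (List G) → List G
          unc Ts = filter (open? Ts) (poor Δ)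

          unc⁻ : ∀ {Ts a} → a ∈ unc Ts → a ∈ A × hits Δ a < m × ¬ Any (λ T → Captured T a) Ts
          unc⁻ {Ts} a∈ = let (a∈p , o) = ∈-filter⁻ (open? Ts) {xs = poor Δ} a∈ ; (a∈A , h) = poor⁻ {Δ} a∈p in a∈A , h , o

          unc⁺ : ∀ {Ts a} → a ∈ A → hits Δ a < m → ¬ Any (λ T → Captured T a) Ts → a ∈ unc Ts
          unc⁺ {Ts} a∈ h o = ∈-filter⁺ (open? Ts) (poor⁺ {Δ} a∈ h) o

          unc-unique : ∀ Ts → Unique (unc Ts)
          unc-unique Ts = Uniq.filter⁺ (open? Ts) (poor-unique Δ)

        near? : ∀ a a′ → Dec ((a′ ⊖ a) ∈ Δ ⊎ a ≡ a′)
        near? a a′ = ((a′ ⊖ a) ∈? Δ) ⊎-dec (a ≟ a′)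

        -- U is a maximal part of the remaining elements without differences in Δ. Its members are
        -- poor, so each dominates at most m remaining elements and |U| ≥ |A| / (4m). Differences in
        -- Δ do not occur in U, and the greedy choice has stopped at all others; so U is flat.
        module Round (Ts : List (List G)) (large : length A ≤ 4 * length (unc Ts)) where
          opaque
            U : List G
            U = separated near? (unc Ts)

            U⊆unc : U ⊆ unc Ts
            U⊆unc = separated-⊆ near? (unc Ts)

            U-pairs : AllPairs (λ a a′ → ¬ ((a′ ⊖ a) ∈ Δ ⊎ a ≡ a′)) U
            U-pairs = separated-pairs near? (unc Ts)

            U-covers : ∀ {a} → a ∈ unc Ts → ∃ λ r → r ∈ U × ((r ⊖ a) ∈ Δ ⊎ a ≡ r)
            U-covers = separated-covers near? (λ _ → inj₂ refl) (unc Ts)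

          U⊆A : U ⊆ A
          U⊆A u∈ = proj₁ (unc⁻ {Ts} (U⊆unc u∈))

          uU : Unique U
          uU = AllPairs.map (λ h eq → h (inj₂ eq)) U-pairs

          U-far : ∀ {a a′} → a ∈ U → a′ ∈ U → a ≢ a′ → (a′ ⊖ a) ∉ Δ
          U-far a∈ a′∈ ne p = ∈⇒pairs flip U-pairs a∈ a′∈ ne (inj₁ p)
            where
            flip : ∀ {x y} → ¬ ((y ⊖ x) ∈ Δ ⊎ x ≡ y) → ¬ ((x ⊖ y) ∈ Δ ⊎ y ≡ x)
            flip {x} {y} h (inj₁ q) = h (inj₁ (subst (_∈ Δ) (solve (:- (x₀ :- x₁)) (x₁ :- x₀) (x ∷ y ∷ []) refl) (⊝∈ q)))
            flip h (inj₂ q) = h (inj₂ (sym q))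

          dominated : ∀ {r} → r ∈ U → count (λ a → near? a r) (unc Ts) ≤ m
          dominated {r} r∈ = begin
            count (λ a → near? a r) (unc Ts)                                     ≤⟨ count-⊎ (λ a → near? a r) (λ a → (r ⊖ a) ∈? Δ) (_≟ r) (unc Ts) (λ _ → id) ⟩
            count (λ a → (r ⊖ a) ∈? Δ) (unc Ts) + count (_≟ r) (unc Ts)          ≤⟨ +-mono-≤ (inj⇒length≤ _≟_ {ys = filter (λ d → (r ⊕ d) ∈? A) Δ} (_⊖ r) (Uniq.filter⁺ (λ a → (r ⊖ a) ∈? Δ) (unc-unique Ts))
                                                                                      (λ {a} a∈ → let (a∈u , q) = ∈-filter⁻ (λ a → (r ⊖ a) ∈? Δ) {xs = unc Ts} a∈ in
                                                                                         ∈-filter⁺ (λ d → (r ⊕ d) ∈? A) (subst (_∈ Δ) (solve (:- (x₁ :- x₀)) (x₀ :- x₁) (a ∷ r ∷ []) refl) (⊝∈ q))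
                                                                                           (subst (_∈ A) (solve x₀ (x₁ :+ (x₀ :- x₁)) (a ∷ r ∷ []) refl) (proj₁ (unc⁻ {Ts} a∈u))))
                                                                                      (λ {x} {y} _ _ eq → by₁ (solve (x₀ :- x₁) ((x₀ :- x₂) :- (x₁ :- x₂)) (x ∷ y ∷ r ∷ []) refl) eq))
                                                                                    (count-≤1 (_≟ r) (unc-unique Ts) (λ _ _ p q → trans p (sym q))) ⟩
            hits Δ r + 1                                                         ≡⟨ +-comm (hits Δ r) 1 ⟩
            suc (hits Δ r)                                                       ≤⟨ proj₁ (proj₂ (unc⁻ {Ts} (U⊆unc r∈))) ⟩
            m                                                                    ∎
            where open ≤-Reasoning

          unc≤ : length (unc Ts) ≤ length U * m
          unc≤ = begin
            length (unc Ts)                                        ≡⟨ sym (∑-length (unc Ts)) ⟩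
            ∑ (unc Ts) (λ _ → 1)                                   ≤⟨ ∑-mono (unc Ts) (λ {a} a∈ → let (r , r∈ , q) = U-covers a∈ in ∃⇒0<count (near? a) r∈ q) ⟩
            ∑ (unc Ts) (λ a → count (near? a) U)                   ≡⟨ double-count near? (unc Ts) U ⟩
            ∑ U (λ r → count (λ a → near? a r) (unc Ts))           ≤⟨ ∑-mono U dominated ⟩
            ∑ U (λ _ → m)                                          ≡⟨ ∑-const U m ⟩
            length U * m                                           ∎
            where open ≤-Reasoning

          A≤ : length A ≤ 4 * m * length U
          A≤ = ≤-trans large (≤-trans (*-monoʳ-≤ 4 unc≤) (≤-reflexive (e (length U) m)))
            where
            e : ∀ u m → 4 * (u * m) ≡ 4 * m * u
            e = solve-∀

          U≤A : length U ≤ length A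
          U≤A = ⊆⇒length≤ _≟_ uU U⊆A

          opaque
            flat-params : FlatParams D thr ℓ m τ (length U)
            flat-params = params (length U) A≤ U≤A

          open FlatParams flat-params

          0<U : 0 < length U
          0<U with 0 <? length U
          ... | yes p = p
          ... | no ¬p = ⊥-elim (<⇒≱ 0<A (≤-trans A≤ (≤-reflexive (trans (cong (4 * m *_) (n≤0⇒n≡0 (≮⇒≥ ¬p))) (*-zeroʳ (4 * m))))))

          flat : ∀ {d} → d ≢ 𝟘 → diffs U d ≤ H
          flat {d} d≢ with d ∈? Δ
          ... | yes d∈ = ≤-trans (≤-reflexive (count-none (λ a → (a ⊕ d) ∈? U) U (λ {a} a∈ q →
                  U-far a∈ q (λ eq → d≢ (by₁ (solve (x₁ :- :0) ((x₀ :+ x₁) :- x₀) (a ∷ d ∷ []) refl) (sym eq)))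
                    (subst (_∈ Δ) (solve x₁ ((x₀ :+ x₁) :- x₀) (a ∷ d ∷ []) refl) d∈)))) z≤n
          ... | no d∉ = flat-bound _ (≤-<-trans (*-monoʳ-≤ D (⊆⇒length≤ _≟_ (Uniq.filter⁺ (λ a → (a ⊕ d) ∈? U) uU) (λ p →
                  let (a∈ , q) = ∈-filter⁻ (λ a → (a ⊕ d) ∈? U) {xs = U} p ; (a∈A , h , _) = unc⁻ {Ts} (U⊆unc a∈) in
                  ∈-filter⁺ (λ a → (a ⊕ d) ∈? A) (poor⁺ {Δ} a∈A h) (U⊆A q)))) (stuck d≢ d∉))

          opaque
            caught-half : ∃ λ T → T ⊆ U × length T ≤ R * (ℓ * (2 * B)) + m * (ℓ * (2 * B₂)) × length U ≤ 2 * count (λ a → m ≤? neighbours U T a) U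
            caught-half = Flat.capture 𝔾 U uU H D z ρ R B B₂ m ℓ flat (≤-trans (∣⊟∣-mono {U} {A} {U} {A} U⊆A U⊆A) small) 0<U 0<B 0<B₂ 0<z 0<ρ
                       (≤-<-trans U≤A short) N₀ N₁ N₂ N₃ N₄ N₅

          -- Half of U becomes captured, and this removes at least |A| / (8m) of the remaining
          -- elements. Hence there can be at most 8m rounds.
          round : ∃ λ T → T ⊆ A × length T ≤ τ × length A + 8 * m * length (unc (T ∷ Ts)) ≤ 8 * m * length (unc Ts)
          round = finish caught-half
            where
            finish : (∃ λ T → T ⊆ U × length T ≤ R * (ℓ * (2 * B)) + m * (ℓ * (2 * B₂)) × length U ≤ 2 * count (λ a → m ≤? neighbours U T a) U) →
                     ∃ λ T → T ⊆ A × length T ≤ τ × length A + 8 * m * length (unc (T ∷ Ts)) ≤ 8 * m * length (unc Ts)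
            finish (T , T⊆ , len , many) = T , U⊆A ∘ T⊆ , ≤-trans len total , (begin
              length A + 8 * m * length (unc (T ∷ Ts))                    ≤⟨ +-monoˡ-≤ _ (≤-trans A≤ (*-monoʳ-≤ (4 * m) many)) ⟩
              4 * m * (2 * length caught) + 8 * m * length (unc (T ∷ Ts)) ≡⟨ e m (length caught) (length (unc (T ∷ Ts))) ⟩
              8 * m * (length caught + length (unc (T ∷ Ts)))             ≡⟨ cong (8 * m *_) (sym (length-++ caught)) ⟩
              8 * m * length (caught ++ unc (T ∷ Ts))                     ≤⟨ *-monoʳ-≤ (8 * m) (⊆⇒length≤ _≟_ (Uniq.++⁺ (Uniq.filter⁺ caught? uU) (unc-unique (T ∷ Ts)) disj) sub) ⟩
              8 * m * length (unc Ts)                                     ∎)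
              where
              open ≤-Reasoning
              caught? = λ a → m ≤? neighbours U T a
              caught = filter caught? U
              e : ∀ m c u → 4 * m * (2 * c) + 8 * m * u ≡ 8 * m * (c + u)
              e = solve-∀
              is-captured : ∀ {a} → a ∈ caught → Captured T a
              is-captured {a} a∈ = ≤-trans (proj₂ (∈-filter⁻ caught? {xs = U} a∈)) (⊆⇒length≤ _≟_ (Uniq.filter⁺ (λ a′ → (a′ ⊖ a) ∈? (T ⊟ T)) uU) (λ p →
                let (p∈ , q) = ∈-filter⁻ (λ a′ → (a′ ⊖ a) ∈? (T ⊟ T)) {xs = U} p in ∈-filter⁺ (λ a′ → (a′ ⊖ a) ∈? (T ⊟ T)) (U⊆A p∈) q))
              disj : ∀ {a} → a ∈ caught × a ∈ unc (T ∷ Ts) → ⊥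
              disj (p , q) = proj₂ (proj₂ (unc⁻ {T ∷ Ts} q)) (here (is-captured p))
              sub : caught ++ unc (T ∷ Ts) ⊆ unc Ts
              sub a∈ with ∈-++⁻ caught a∈
              ... | inj₁ p = U⊆unc (proj₁ (∈-filter⁻ caught? {xs = U} p))
              ... | inj₂ p = let (a∈A , h , o) = unc⁻ {T ∷ Ts} p in unc⁺ {Ts} a∈A h (o ∘ there)

        Progress : List (List G) → Set
        Progress Ts = All (λ T → T ⊆ A × length T ≤ τ) Ts × length Ts * length A + 8 * m * length (unc Ts) ≤ 8 * m * length A

        abstract
          rounds : ∀ fuel Ts → Progress Ts → 8 * m < fuel + length Ts → ∃ λ Ts′ → Progress Ts′ × 4 * length (unc Ts′) < length A
          rounds fuel Ts prog en = branch fuel en (length A ≤? 4 * length (unc Ts))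
            where
            branch : ∀ fuel → 8 * m < fuel + length Ts → Dec (length A ≤ 4 * length (unc Ts)) → ∃ λ Ts′ → Progress Ts′ × 4 * length (unc Ts′) < length A
            branch _ _ (no ¬large) = Ts , prog , ≰⇒> ¬large
            branch zero lt (yes _) = ⊥-elim (<⇒≱ (*-monoˡ-< (length A) {{>-nonZero 0<A}} lt) (≤-trans (m≤m+n _ _) (proj₂ prog)))
            branch (suc fuel) lt (yes large) = let (T , T⊆ , len , le) = Round.round Ts large in
              rounds fuel (T ∷ Ts) ((T⊆ , len) ∷ proj₁ prog ,
                ≤-trans (≤-reflexive (e (length A) (length Ts * length A) _)) (≤-trans (+-monoʳ-≤ (length Ts * length A) le) (proj₂ prog)))
                (≤-trans lt (≤-reflexive (sym (+-suc fuel (length Ts)))))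
              where
              e : ∀ a b c → a + b + c ≡ b + (a + c)
              e = solve-∀

          finished : ∃ λ Ts → Progress Ts × 4 * length (unc Ts) < length A
          finished = rounds (suc (8 * m)) [] ([] , *-monoʳ-≤ (8 * m) (⊆⇒length≤ _≟_ (unc-unique []) (proj₁ ∘ unc⁻ {[]}))) (≤-trans ≤-refl (m≤m+n _ 0))

    StartWindow : Set
    StartWindow = ∃ λ S → Σ (Window S 1) λ W → 𝟘 ∈ S × (∃ λ k → k * thr ≤ D * (length A * m) × length S ≤ 1 + (k + 8 * m * τ)) ×
                     length A ≤ 4 * length (rich (Window.elems W))

    opaque
      start-window : StartWindow
      start-window = assemble greedy
        where
        assemble : (∃ λ Δ → ∃ λ Ds → Greedy Δ Ds × Stuck Δ) → StartWindow
        assemble (Δ , Ds , g , stuck) = build finished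
          where
          open Rounds Δ Ds g stuck using (Progress; Captured; captured?; unc; unc⁺; finished)
          open Greedy g using (uΔ; ⊝∈; source)
          build : (∃ λ Ts → Progress Ts × 4 * length (unc Ts) < length A) → StartWindow
          build (Ts , (Ts⊆ , count≤) , few) =
            S , W , here refl , (length Ds , ≤-trans (Greedy.cheap g) (*-monoʳ-≤ D (Φ≤ Δ)) ,
              len (*-cancelʳ-≤ (length Ts) (8 * m) (length A) {{>-nonZero 0<A}} (≤-trans (m≤m+n _ _) count≤))) , most
            where
            open StartSeeds 𝔾 A m τ Δ Ds Ts uΔ ⊝∈ source Ts⊆ using (S; W; elems; len; rich-hits; rich-captured)
            sort : ∀ {a} → a ∈ A → Dec (hits Δ a < m) → Dec (Any (λ T → Captured T a) Ts) → a ∈ rich elems ++ unc Ts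
            sort a∈ (no ¬p) _       = ∈-++⁺ˡ (rich-hits a∈ (≮⇒≥ ¬p))
            sort a∈ (yes p) (yes c) = ∈-++⁺ˡ (rich-captured a∈ c)
            sort a∈ (yes p) (no ¬c) = ∈-++⁺ʳ (rich elems) (unc⁺ {Ts} a∈ p ¬c)
            sorted : ∀ {a} → a ∈ A → a ∈ rich elems ++ unc Ts
            sorted {a} a∈ = sort a∈ (poor? Δ a) (Any.any? (captured? a) Ts)
            -- Fewer than a quarter of A remains uncaptured, so three quarters are rich; the weaker
            -- bound of one quarter is recorded.
            most : length A ≤ 4 * length (rich elems)
            most = ≤-trans (*-cancelˡ-≤ 3 (+-cancelʳ-≤ (length A) _ _ (begin
              3 * length A + length A                           ≡⟨ e₁ (length A) ⟩
              4 * length A                                      ≤⟨ *-monoʳ-≤ 4 (≤-trans (⊆⇒length≤ _≟_ uA sorted) (≤-reflexive (length-++ (rich elems)))) ⟩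
              4 * (length (rich elems) + length (unc Ts))       ≡⟨ *-distribˡ-+ 4 (length (rich elems)) _ ⟩
              4 * length (rich elems) + 4 * length (unc Ts)     ≤⟨ +-mono-≤ (m≤m*n (4 * length (rich elems)) 3) (<⇒≤ few) ⟩
              4 * length (rich elems) * 3 + length A            ≡⟨ cong (_+ length A) (*-comm (4 * length (rich elems)) 3) ⟩
              3 * (4 * length (rich elems)) + length A          ∎))) ≤-refl
              where
              open ≤-Reasoning
              e₁ : ∀ a → 3 * a + a ≡ 4 * a
              e₁ = solve-∀

-- Parallelograms and seeds

module _ (𝔾 : FinGroup) where
  open Sets 𝔾

  module Parallelograms (A : List G) where

    -- With y = x - v + a this is a parallelogram v - a = x - y in A, on account of which the
    -- difference v - a may fail to be new when v is added. If v - x ∈ C - C or v + y ∈ C + C, it is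
    -- explained: v can then be computed from x or from y with the help of C.
    Unexplained : List G → G → G → G → Set
    Unexplained C v a x = (x ⊖ v ⊕ a) ∈ A × x ≢ v × (v ⊖ x) ∉ C ⊟ C × (v ⊕ (x ⊖ v ⊕ a)) ∉ C ⊞ C

    opaque
      unexplained? : ∀ C v a x → Dec (Unexplained C v a x)
      unexplained? C v a x = ((x ⊖ v ⊕ a) ∈? A) ×-dec (¬? (x ≟ v) ×-dec (¬? ((v ⊖ x) ∈? (C ⊟ C)) ×-dec ¬? ((v ⊕ (x ⊖ v ⊕ a)) ∈? (C ⊞ C))))

    Bad : List G → G → G → Set
    Bad C v a = Any (Unexplained C v a) A

    bad? : ∀ C v a → Dec (Bad C v a)
    bad? C v a = Any.any? (unexplained? C v a) A

module _ (𝔾 : FinGroup) where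
  open Sets 𝔾
  open Popularity 𝔾
  module _ (A : List G) where
    open Parallelograms 𝔾 A

    -- C has two tasks: to explain all differences and sums with b representations, and to generate
    -- every v with n / h bad partners a. The second is possible because the remaining
    -- parallelograms involve only unpopular differences and sums, so that those of one v spread
    -- over many x and y.
    module SharpSeeds (uA : Unique A) (0<n : 0 < length A) (ℓ : ℕ) (n²<2^ℓ : length A * length A < 2 ^ ℓ) (h b s s₁ s₂ B₂ B₃ B₄ B₅ : ℕ) (0<h : 0 < h)
      (0<b : 0 < b) (0<B₂ : 0 < B₂) (0<B₃ : 0 < B₃) (0<B₄ : 0 < B₄) (0<B₅ : 0 < B₅) (M₁ : length A ≤ B₄ * (b ∸ s₁)) (M₂ : length A ≤ B₅ * s₁)
      (M₃ : 4 * h * s * b ≤ length A) (M₄ : length A ≤ B₂ * (s ∸ s₂)) (M₅ : length A ≤ B₃ * s₂) where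

      private
        n = length A

        n<2^ℓ : n < 2 ^ ℓ
        n<2^ℓ = ≤-<-trans (m≤m*n n n {{>-nonZero 0<n}}) n²<2^ℓ

      -- Both x and `π i x` must land in T. First T₁ hits the admissible x of every i at least `s₁`
      -- times; their images are then dense enough in A for T₂ to hit one.
      module Ends (π π⁻ : G → G → G) (left : ∀ i x → π⁻ i (π i x) ≡ x) (right : ∀ i y → π i (π⁻ i y) ≡ y)
        (Q : List G) (few : length Q ≤ n * n) (popular : ∀ {i} → i ∈ Q → b ≤ count (λ x → π i x ∈? A) A) where

        opaque
          ends : ∃ λ T → T ⊆ A × length T ≤ s₁ * (ℓ * (2 * B₄)) + ℓ * (2 * B₅) × (∀ {i} → i ∈ Q → ∃ λ x → x ∈ T × π i x ∈ T)
          ends = let (T₁ , T₁⊆ , uT₁ , len₁ , many) = hit-many _≟_ (λ i x → π i x ∈? A) A B₄ s₁ 0<n 0<B₄ uA ℓ Q (≤-<-trans few n²<2^ℓ)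
                       (λ i∈ → ≤-trans M₁ (*-monoʳ-≤ B₄ (∸-monoˡ-≤ s₁ (popular i∈))))
                     (T₂ , T₂⊆ , len₂ , hits) = hit (λ i y → (π⁻ i y ∈? T₁)) A B₅ 0<n 0<B₅ ℓ Q (≤-<-trans few n²<2^ℓ)
                       (λ {i} i∈ → ≤-trans M₂ (*-monoʳ-≤ B₅ (≤-trans (many i∈)
                         (inj⇒length≤ _≟_ {ys = filter (λ y → π⁻ i y ∈? T₁) A} (π i) (Uniq.filter⁺ (λ x → π i x ∈? A) uT₁)
                           (λ {x} x∈ → let (x∈T , q) = ∈-filter⁻ (λ x → π i x ∈? A) {xs = T₁} x∈ in
                             ∈-filter⁺ (λ y → π⁻ i y ∈? T₁) q (subst (_∈ T₁) (sym (left i x)) x∈T))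
                           (λ {x} {y} _ _ eq → trans (sym (left i x)) (trans (cong (π⁻ i) eq) (left i y)))))))
                 in T₁ ++ T₂ , (λ p → ⊎-elim T₁⊆ T₂⊆ (∈-++⁻ T₁ p)) , ≤-trans (≤-reflexive (length-++ T₁)) (+-mono-≤ len₁ len₂) ,
                    λ {i} i∈ → let (y , y∈ , q) = hits i∈ in π⁻ i y , ∈-++⁺ˡ q , ∈-++⁺ʳ T₁ (subst (_∈ T₂) (sym (right i y)) y∈)

      private
        opaque
          popular-diffs : List G
          popular-diffs = filter (λ d → b ≤? diffs A d) (A ⊟ A)

          popular-diffs⁻ : ∀ {d} → d ∈ popular-diffs → b ≤ diffs A d
          popular-diffs⁻ d∈ = proj₂ (∈-filter⁻ (λ d → b ≤? diffs A d) {xs = A ⊟ A} d∈)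

          popular-diffs-few : length popular-diffs ≤ n * n
          popular-diffs-few = ≤-trans (length-filter (λ d → b ≤? diffs A d) (A ⊟ A)) (∣⊟∣≤ A A)

          popular-diffs⁺ : ∀ {d} → b ≤ diffs A d → d ∈ popular-diffs
          popular-diffs⁺ {d} le = ∈-filter⁺ (λ d → b ≤? diffs A d) (let (a , a∈) = 0<length⇒∃ _ (≤-trans 0<b le) ; (a∈A , q) = ∈-filter⁻ (λ a → (a ⊕ d) ∈? A) {xs = A} a∈ in
            subst (_∈ A ⊟ A) (solve ((x₀ :+ x₁) :- x₀) x₁ (a ∷ d ∷ []) refl) (∈-⊟⁺ q a∈A)) le

          popular-sums : List G
          popular-sums = filter (λ σ → b ≤? sums A σ) (A ⊞ A)

          popular-sums⁻ : ∀ {σ} → σ ∈ popular-sums → b ≤ sums A σ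
          popular-sums⁻ σ∈ = proj₂ (∈-filter⁻ (λ σ → b ≤? sums A σ) {xs = A ⊞ A} σ∈)

          popular-sums-few : length popular-sums ≤ n * n
          popular-sums-few = ≤-trans (length-filter (λ σ → b ≤? sums A σ) (A ⊞ A)) (∣⊞∣≤ A A)

          popular-sums⁺ : ∀ {σ} → b ≤ sums A σ → σ ∈ popular-sums
          popular-sums⁺ {σ} le = ∈-filter⁺ (λ σ → b ≤? sums A σ) (let (a , a∈) = 0<length⇒∃ _ (≤-trans 0<b le) ; (a∈A , q) = ∈-filter⁻ (λ a → (σ ⊖ a) ∈? A) {xs = A} a∈ in
            subst (_∈ A ⊞ A) (solve ((x₁ :- x₀) :+ x₀) x₁ (a ∷ σ ∷ []) refl) (∈-⊞⁺ q a∈A)) le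

        module EndsD = Ends (λ d x → x ⊕ d) (λ d y → y ⊖ d) (λ d x → solve ((x₁ :+ x₀) :- x₀) x₁ (d ∷ x ∷ []) refl)
          (λ d y → solve ((x₁ :- x₀) :+ x₀) x₁ (d ∷ y ∷ []) refl) popular-diffs popular-diffs-few popular-diffs⁻
        module EndsS = Ends (λ σ x → σ ⊖ x) (λ σ x → σ ⊖ x) (λ σ x → solve (x₀ :- (x₀ :- x₁)) x₁ (σ ∷ x ∷ []) refl)
          (λ σ x → solve (x₀ :- (x₀ :- x₁)) x₁ (σ ∷ x ∷ []) refl) popular-sums popular-sums-few popular-sums⁻

      module Triples (C : List G) (known-d : ∀ {d} → b ≤ diffs A d → d ∈ C ⊟ C) (known-s : ∀ {σ} → b ≤ sums A σ → σ ∈ C ⊞ C) where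

        private
          pay : G → G → List (G × G)
          pay v a = map (λ x → x , (x ⊖ v ⊕ a)) (filter (unexplained? C v a) A)

          pay⁻ : ∀ {v a pq} → pq ∈ pay v a → proj₁ pq ∈ A × Unexplained C v a (proj₁ pq) × proj₂ pq ≡ proj₁ pq ⊖ v ⊕ a
          pay⁻ {v} {a} p = let (x , x∈ , eq) = ∈-map⁻ (λ x → x , (x ⊖ v ⊕ a)) p ; (x∈A , un) = ∈-filter⁻ (unexplained? C v a) {xs = A} x∈ in
            subst (λ pq → proj₁ pq ∈ A × Unexplained C v a (proj₁ pq) × proj₂ pq ≡ proj₁ pq ⊖ v ⊕ a) (sym eq) (x∈A , un , refl)

          u-row : ∀ v a → Unique (filter (unexplained? C v a) A)
          u-row v a = Uniq.filter⁺ (unexplained? C v a) uA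

          pay-unique₁ : ∀ v a → Unique (map proj₁ (pay v a))
          pay-unique₁ v a = subst Unique (sym (trans (sym (map-∘ (filter (unexplained? C v a) A))) (map-id _))) (u-row v a)

          pay-unique₂ : ∀ v a → Unique (map proj₂ (pay v a))
          pay-unique₂ v a = subst Unique (map-∘ (filter (unexplained? C v a) A))
            (map-unique (λ x → x ⊖ v ⊕ a) (λ {x} {y} _ _ eq → by₁ (solve (x₀ :- x₁) (((x₀ :- x₂) :+ x₃) :- ((x₁ :- x₂) :+ x₃)) (x ∷ y ∷ v ∷ a ∷ []) refl) eq) (u-row v a))

          0<2h : 0 < 2 * h
          0<2h = ≤-trans 0<h (m≤m+n h _)

        open Spread _≟_ pay pay-unique₁ pay-unique₂ A (2 * h) s 1 0<n 0<2h

        private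
          unknown-d : ∀ {v a pq} → pq ∈ pay v a → diffs A (proj₁ pq ⊖ v) ≤ b
          unknown-d {v} {a} {x , y} p = let (_ , (_ , _ , un , _) , _) = pay⁻ {v} {a} p in <⇒≤ (≰⇒> λ le → un (flip (known-d le)))
            where
            flip : x ⊖ v ∈ C ⊟ C → v ⊖ x ∈ C ⊟ C
            flip q = let (c , c′ , c∈ , c′∈ , eq) = ∈-⊟⁻ C C q in
              subst (_∈ C ⊟ C) (sym (by₁ (solve ((x₁ :- x₀) :- (x₃ :- x₂)) (:- (x₀ :- x₁) :- :- (x₂ :- x₃)) (x ∷ v ∷ c ∷ c′ ∷ []) refl) (cong ⊝_ eq))) (∈-⊟⁺ c′∈ c∈)

          unknown-s : ∀ {v a pq} → pq ∈ pay v a → sums A (v ⊕ proj₂ pq) ≤ b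
          unknown-s {v} {a} {x , y} p = let (_ , (_ , _ , _ , un) , eq) = pay⁻ {v} {a} p in <⇒≤ (≰⇒> λ le → un (subst (λ y → v ⊕ y ∈ C ⊞ C) eq (known-s le)))

          -- A bad a that brings no new pair has its x or its y among the collected ones. A
          -- collected x serves at most b of the a because the difference x - v is unpopular, and a
          -- collected y at most b because the sum v + y is. So at most 2sb ≤ n / (2h) of the bad a
          -- are stuck.
          progress : ∀ {v} → n ≤ h * count (bad? C v) A → ∀ ts ps → Valid v ts ps → length ps < s * 1 → n ≤ 2 * h * count (progressive? v ps) A
          progress {v} many ts ps (src , _ , _) short = +-cancelʳ-≤ n _ _ (begin
            n + n                                                              ≡⟨ sym (cong (n +_) (+-identityʳ n)) ⟩
            2 * n                                                              ≤⟨ *-monoʳ-≤ 2 (≤-trans many (*-monoʳ-≤ h (count-⊎ (bad? C v) (progressive? v ps) stuck? A splitting))) ⟩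
            2 * (h * (count (progressive? v ps) A + count stuck? A))           ≡⟨ e h (count (progressive? v ps) A) (count stuck? A) ⟩
            2 * h * count (progressive? v ps) A + 2 * h * count stuck? A       ≤⟨ +-monoʳ-≤ (2 * h * count (progressive? v ps) A) (≤-trans (*-monoʳ-≤ (2 * h) stuck-few) (≤-trans (≤-reflexive (e′ h (length ps) b)) (≤-trans
                                                                                    (*-monoˡ-≤ b (*-monoʳ-≤ (4 * h) (<⇒≤ (subst (length ps <_) (*-identityʳ s) short)))) M₃))) ⟩
            2 * h * count (progressive? v ps) A + n                            ∎)
            where
            open ≤-Reasoning
            e : ∀ h p q → 2 * (h * (p + q)) ≡ 2 * h * p + 2 * h * q
            e = solve-∀
            e′ : ∀ h l b → 2 * h * (l * b + l * b) ≡ 4 * h * l * b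
            e′ = solve-∀
            ps₁ : List G
            ps₁ = map proj₁ ps
            ps₂ : List G
            ps₂ = map proj₂ ps
            via₁? : ∀ a x → Dec ((a ⊕ (x ⊖ v)) ∈ A)
            via₁? a x = (a ⊕ (x ⊖ v)) ∈? A
            via₂? : ∀ a y → Dec (((v ⊕ y) ⊖ a) ∈ A)
            via₂? a y = ((v ⊕ y) ⊖ a) ∈? A
            stuck? : ∀ a → Dec (Any (λ x → (a ⊕ (x ⊖ v)) ∈ A) ps₁ ⊎ Any (λ y → ((v ⊕ y) ⊖ a) ∈ A) ps₂)
            stuck? a = Any.any? (via₁? a) ps₁ ⊎-dec Any.any? (via₂? a) ps₂
            splitting : ∀ {a} → a ∈ A → Bad C v a → Progressive v ps a ⊎ (Any (λ x → (a ⊕ (x ⊖ v)) ∈ A) ps₁ ⊎ Any (λ y → ((v ⊕ y) ⊖ a) ∈ A) ps₂)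
            splitting {a} a∈ bad = let (x , x∈ , un) = find bad in decide x x∈ un (x ∈? ps₁) ((x ⊖ v ⊕ a) ∈? ps₂)
              where
              decide : ∀ x → x ∈ A → Unexplained C v a x → Dec (x ∈ ps₁) → Dec ((x ⊖ v ⊕ a) ∈ ps₂) →
                       Progressive v ps a ⊎ (Any (λ x → (a ⊕ (x ⊖ v)) ∈ A) ps₁ ⊎ Any (λ y → ((v ⊕ y) ⊖ a) ∈ A) ps₂)
              decide x x∈ (y∈ , _) (yes p) _ = inj₂ (inj₁ (Any.map (λ { refl → subst (_∈ A) (solve ((x₀ :- x₁) :+ x₂) (x₂ :+ (x₀ :- x₁)) (x ∷ v ∷ a ∷ []) refl) y∈ }) p))
              decide x x∈ _ (no _) (yes q) = inj₂ (inj₂ (Any.map (λ { refl → subst (_∈ A) (solve x₀ ((x₁ :+ ((x₀ :- x₁) :+ x₂)) :- x₂) (x ∷ v ∷ a ∷ []) refl) x∈ }) q))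
              decide x x∈ un (no p) (no q) = inj₁ (∃⇒0<count (fresh? ps) (∈-map⁺ (λ x → x , (x ⊖ v ⊕ a)) (∈-filter⁺ (unexplained? C v a) x∈ un)) (p , q))
            any≤ : ∀ {P : G → G → Set} (P? : ∀ a x → Dec (P a x)) xs → (∀ {x} → x ∈ xs → count (λ a → P? a x) A ≤ b) →
                   count (λ a → Any.any? (P? a) xs) A ≤ length xs * b
            any≤ {P} P? xs small = begin
              count (λ a → Any.any? (P? a) xs) A         ≡⟨ count-∑ _ A ⟩
              ∑ A (λ a → 𝟙 (Any.any? (P? a) xs))         ≤⟨ ∑-mono A (λ {a} _ → one a (Any.any? (P? a) xs)) ⟩
              ∑ A (λ a → count (P? a) xs)                ≡⟨ double-count P? A xs ⟩
              ∑ xs (λ x → count (λ a → P? a x) A)        ≤⟨ ∑-mono xs small ⟩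
              ∑ xs (λ _ → b)                             ≡⟨ ∑-const xs b ⟩
              length xs * b                              ∎
              where
              one : ∀ a (d : Dec (Any (P a) xs)) → 𝟙 d ≤ count (P? a) xs
              one a (yes p) = let (x , x∈ , q) = find p in ∃⇒0<count (P? a) x∈ q
              one a (no _)  = z≤n
            stuck-few : count stuck? A ≤ length ps * b + length ps * b
            stuck-few = ≤-trans (count-⊎ stuck? (λ a → Any.any? (via₁? a) ps₁) (λ a → Any.any? (via₂? a) ps₂) A (λ _ → id))
              (+-mono-≤ (≤-trans (any≤ via₁? ps₁ small₁) (≤-reflexive (cong (_* b) (length-map proj₁ ps))))
                        (≤-trans (any≤ via₂? ps₂ small₂) (≤-reflexive (cong (_* b) (length-map proj₂ ps)))))
              where
              small₁ : ∀ {x} → x ∈ ps₁ → count (λ a → via₁? a x) A ≤ b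
              small₁ x∈ = let (pq , pq∈ , eq) = ∈-map⁻ proj₁ x∈ ; (t , _ , w) = src pq∈ in subst (λ x → count (λ a → via₁? a x) A ≤ b) (sym eq) (unknown-d {v} {t} w)
              small₂ : ∀ {y} → y ∈ ps₂ → count (λ a → via₂? a y) A ≤ b
              small₂ y∈ = let (pq , pq∈ , eq) = ∈-map⁻ proj₂ y∈ ; (t , _ , w) = src pq∈ in subst (λ y → count (λ a → via₂? a y) A ≤ b) (sym eq) (unknown-s {v} {t} w)

          opaque
            targets : List G
            targets = filter (λ v → n ≤? h * count (bad? C v) A) A

            targets⁻ : ∀ {v} → v ∈ targets → n ≤ h * count (bad? C v) A
            targets⁻ v∈ = proj₂ (∈-filter⁻ (λ v → n ≤? h * count (bad? C v) A) {xs = A} v∈)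

            targets⁺ : ∀ {v} → v ∈ A → n ≤ h * count (bad? C v) A → v ∈ targets
            targets⁺ = ∈-filter⁺ (λ v → n ≤? h * count (bad? C v) A)

            targets-few : length targets < 2 ^ ℓ
            targets-few = ≤-<-trans (length-filter (λ v → n ≤? h * count (bad? C v) A) A) n<2^ℓ

          Collected : List G → G → Set
          Collected T v = ∃ λ ps → Valid v T ps × s * 1 ≤ length ps

          opaque
            phase₁ : ∃ λ T → T ⊆ A × length T ≤ s * (ℓ * (2 * (2 * h))) × (∀ {v} → v ∈ targets → Collected T v)
            phase₁ = spread ℓ targets targets-few (λ v∈ ts ps val _ short → progress (targets⁻ v∈) ts ps val short)

          module _ (T₃ : List G) (coll : ∀ {v} → v ∈ targets → Collected T₃ v) where

            inA₁ : ∀ {v ps} → Valid v T₃ ps → ∀ {x} → x ∈ map proj₁ ps → x ∈ A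
            inA₁ {v} (src , _) x∈ = let (pq , pq∈ , eq) = ∈-map⁻ proj₁ x∈ ; (t , _ , w) = src pq∈ in subst (_∈ A) (sym eq) (proj₁ (pay⁻ {v} {t} w))

            inA₂ : ∀ {v ps} → Valid v T₃ ps → ∀ {y} → y ∈ map proj₂ ps → y ∈ A
            inA₂ {v} (src , _) y∈ = let (pq , pq∈ , eq) = ∈-map⁻ proj₂ y∈ ; (t , _ , w) = src pq∈ ; (_ , (q , _) , eq′) = pay⁻ {v} {t} w in
              subst (_∈ A) (sym (trans eq eq′)) q

            indices : List (G × List (G × G))
            indices = mapWith∈ targets (λ {v} v∈ → v , proj₁ (coll v∈))

            first? : ∀ (i : G × List (G × G)) x → Dec (x ∈ map proj₁ (proj₂ i))
            first? i x = x ∈? map proj₁ (proj₂ i)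

            opaque
              phase₂ : ∃ λ T → T ⊆ A × Unique T × length T ≤ s₂ * (ℓ * (2 * B₂)) × (∀ {i} → i ∈ indices → s₂ ≤ count (first? i) T)
              phase₂ = hit-many _≟_ first? A B₂ s₂ 0<n 0<B₂ uA ℓ indices (≤-<-trans (≤-reflexive (length-mapWith∈ targets)) targets-few)
                (λ {i} i∈ → let (v , v∈ , eq) = ∈-mapWith∈ targets _ i∈ in subst (λ i → n ≤ B₂ * (count (first? i) A ∸ s₂)) (sym eq) (dense (coll v∈)))
                where
                dense : ∀ {v} (c : Collected T₃ v) → n ≤ B₂ * (count (first? (v , proj₁ c)) A ∸ s₂)
                dense {v} (ps , val@(_ , u₁ , _) , len) = ≤-trans M₄ (*-monoʳ-≤ B₂ (∸-monoˡ-≤ s₂ (≤-trans (≤-reflexive (sym (*-identityʳ s))) (≤-trans len (≤-trans (≤-reflexive (sym (length-map proj₁ ps)))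
                  (⊆⇒length≤ _≟_ u₁ (λ x∈ → ∈-filter⁺ (first? (v , ps)) (inA₁ {v} {ps} val x∈) x∈)))))))

            module _ (T₄ : List G) (uT₄ : Unique T₄) (many : ∀ {i} → i ∈ indices → s₂ ≤ count (first? i) T₄) where

              hit? : ∀ (pq : G × G) → Dec (proj₁ pq ∈ T₄)
              hit? pq = proj₁ pq ∈? T₄

              second? : ∀ (i : G × List (G × G)) y → Dec (y ∈ map proj₂ (filter hit? (proj₂ i)))
              second? i y = y ∈? map proj₂ (filter hit? (proj₂ i))

              opaque
                phase₃ : ∃ λ T → T ⊆ A × length T ≤ ℓ * (2 * B₃) × (∀ {i} → i ∈ indices → ∃ λ y → y ∈ T × y ∈ map proj₂ (filter hit? (proj₂ i)))
                phase₃ = hit second? A B₃ 0<n 0<B₃ ℓ indices (≤-<-trans (≤-reflexive (length-mapWith∈ targets)) targets-few)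
                  (λ {i} i∈ → let (v , v∈ , eq) = ∈-mapWith∈ targets _ i∈ in
                    subst (λ i → n ≤ B₃ * count (second? i) A) (sym eq) (dense (coll v∈) (many (mapWith∈-∈ targets _ v∈))))
                  where
                  dense : ∀ {v} (c : Collected T₃ v) → s₂ ≤ count (first? (v , proj₁ c)) T₄ → n ≤ B₃ * count (second? (v , proj₁ c)) A
                  dense {v} (ps , val@(_ , _ , u₂) , _) le = ≤-trans M₅ (*-monoʳ-≤ B₃ (begin
                    s₂                                           ≤⟨ le ⟩
                    count (first? (v , ps)) T₄                   ≤⟨ ⊆⇒length≤ _≟_ {ys = map proj₁ (filter hit? ps)} (Uniq.filter⁺ (first? (v , ps)) uT₄) (λ x∈ →
                                                                      let (x∈T , q) = ∈-filter⁻ (first? (v , ps)) {xs = T₄} x∈ ; (pq , pq∈ , eq) = ∈-map⁻ proj₁ q in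
                                                                      subst (_∈ map proj₁ (filter hit? ps)) (sym eq) (∈-map⁺ proj₁ (∈-filter⁺ hit? pq∈ (subst (_∈ T₄) eq x∈T)))) ⟩
                    length (map proj₁ (filter hit? ps))          ≡⟨ trans (length-map proj₁ (filter hit? ps)) (sym (length-map proj₂ (filter hit? ps))) ⟩
                    length (map proj₂ (filter hit? ps))          ≤⟨ ⊆⇒length≤ _≟_ (filter-map-unique hit? proj₂ ps u₂) (λ y∈ → ∈-filter⁺ (second? (v , ps)) (inA₂ {v} {ps} val (sub y∈)) y∈) ⟩
                    count (second? (v , ps)) A                   ∎))
                    where
                    open ≤-Reasoning
                    sub : ∀ {y} → y ∈ map proj₂ (filter hit? ps) → y ∈ map proj₂ ps
                    sub y∈ = let (pq , pq∈ , eq) = ∈-map⁻ proj₂ y∈ in subst (_∈ map proj₂ ps) (sym eq) (∈-map⁺ proj₂ (proj₁ (∈-filter⁻ hit? {xs = ps} pq∈)))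

        opaque
          -- T₃ contains the a, T₄ hits the first components of the collected pairs `s₂` times, and
          -- T₅ hits the second component y of a pair whose x is in T₄. The a from which this pair
          -- was collected completes v = a + x - y.
          triples : ∃ λ T → T ⊆ A × length T ≤ s * (ℓ * (2 * (2 * h))) + (s₂ * (ℓ * (2 * B₂)) + ℓ * (2 * B₃)) ×
                    (∀ {v} → v ∈ A → n ≤ h * count (bad? C v) A → ∃ λ a → ∃ λ x → ∃ λ y → a ∈ T × x ∈ T × y ∈ T × v ≡ a ⊕ x ⊖ y)
          triples =
            let (T₃ , T₃⊆ , len₃ , coll) = phase₁
                (T₄ , T₄⊆ , uT₄ , len₄ , many) = phase₂ T₃ coll
                (T₅ , T₅⊆ , len₅ , hits) = phase₃ T₃ coll T₄ uT₄ many
                triple : ∀ {v} (c : Collected T₃ v) → (∃ λ y → y ∈ T₅ × y ∈ map proj₂ (filter (hit? T₃ coll T₄ uT₄ many) (proj₁ c))) →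
                         ∃ λ a → ∃ λ x → ∃ λ y → a ∈ T₃ ++ (T₄ ++ T₅) × x ∈ T₃ ++ (T₄ ++ T₅) × y ∈ T₃ ++ (T₄ ++ T₅) × v ≡ a ⊕ x ⊖ y
                triple {v} (ps , (src , _) , _) (y , y∈ , q) =
                  let (pq , pq∈ , eq) = ∈-map⁻ proj₂ q
                      (pq∈ps , x∈) = ∈-filter⁻ (hit? T₃ coll T₄ uT₄ many) {xs = ps} pq∈
                      (a , a∈ , w) = src pq∈ps
                      (_ , _ , eq′) = pay⁻ {v} {a} w
                  in a , proj₁ pq , y , ∈-++⁺ˡ a∈ , ∈-++⁺ʳ T₃ (∈-++⁺ˡ x∈) , ∈-++⁺ʳ T₃ (∈-++⁺ʳ T₄ y∈) ,
                     by₁ (solve (x₀ :- ((x₁ :+ x₂) :- x₃)) (x₃ :- ((x₂ :- x₀) :+ x₁)) (v ∷ a ∷ proj₁ pq ∷ y ∷ []) refl) (trans eq eq′)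
            in T₃ ++ (T₄ ++ T₅) ,
               (λ p → ⊎-elim T₃⊆ (λ q → ⊎-elim T₄⊆ T₅⊆ (∈-++⁻ T₄ q)) (∈-++⁻ T₃ p)) ,
               ≤-trans (≤-reflexive (trans (length-++ T₃) (cong (length T₃ +_) (length-++ T₄)))) (+-mono-≤ len₃ (+-mono-≤ len₄ len₅)) ,
               λ v∈ le → let t∈ = targets⁺ v∈ le in triple (coll t∈) (hits (mapWith∈-∈ targets _ t∈))

      SharpSeeds : Set
      SharpSeeds = ∃ λ C → C ⊆ A × length C ≤ 2 * (s₁ * (ℓ * (2 * B₄)) + ℓ * (2 * B₅)) + (s * (ℓ * (2 * (2 * h))) + (s₂ * (ℓ * (2 * B₂)) + ℓ * (2 * B₃))) ×
                   (∀ {v} → v ∈ A → n ≤ h * count (bad? C v) A → ∃ λ a → ∃ λ x → ∃ λ y → a ∈ C × x ∈ C × y ∈ C × v ≡ a ⊕ x ⊖ y)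

      private
        -- A larger C explains more. So the v that must be generated after T has joined C₀ were
        -- targets already when T was built.
        bad-antitone : ∀ C T v {a} → a ∈ A → Bad (C ++ T) v a → Bad C v a
        bad-antitone C T v {a} _ = Any.map weaken
          where
          weaken : ∀ {x} → Unexplained (C ++ T) v a x → Unexplained C v a x
          weaken (p , q , r , w) = p , q , (λ i → r (⊟-mono {C} {C ++ T} {C} {C ++ T} ∈-++⁺ˡ ∈-++⁺ˡ i)) ,
            (λ i → let (c , c′ , c∈ , c′∈ , eq) = ∈-⊞⁻ C C i in w (subst (_∈ (C ++ T) ⊞ (C ++ T)) (sym eq) (∈-⊞⁺ (∈-++⁺ˡ c∈) (∈-++⁺ˡ c′∈))))

        module Join (Td : List G) (Td⊆ : Td ⊆ A) (lend : length Td ≤ s₁ * (ℓ * (2 * B₄)) + ℓ * (2 * B₅))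
          (endsd : ∀ {d} → d ∈ popular-diffs → ∃ λ x → x ∈ Td × (x ⊕ d) ∈ Td)
          (Ts : List G) (Ts⊆ : Ts ⊆ A) (lens : length Ts ≤ s₁ * (ℓ * (2 * B₄)) + ℓ * (2 * B₅))
          (endss : ∀ {σ} → σ ∈ popular-sums → ∃ λ x → x ∈ Ts × (σ ⊖ x) ∈ Ts) where

          C₀ : List G
          C₀ = Td ++ Ts

          known-d : ∀ {d} → b ≤ diffs A d → d ∈ C₀ ⊟ C₀
          known-d {d} le = let (x , x∈ , y∈) = endsd (popular-diffs⁺ le) in
            subst (_∈ C₀ ⊟ C₀) (solve ((x₀ :+ x₁) :- x₀) x₁ (x ∷ d ∷ []) refl) (∈-⊟⁺ (∈-++⁺ˡ {ys = Ts} y∈) (∈-++⁺ˡ {ys = Ts} x∈))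

          known-s : ∀ {σ} → b ≤ sums A σ → σ ∈ C₀ ⊞ C₀
          known-s {σ} le = let (x , x∈ , y∈) = endss (popular-sums⁺ le) in
            subst (_∈ C₀ ⊞ C₀) (solve (x₀ :+ (x₁ :- x₀)) x₁ (x ∷ σ ∷ []) refl) (∈-⊞⁺ (∈-++⁺ʳ Td x∈) (∈-++⁺ʳ Td y∈))

          joined : (∃ λ T → T ⊆ A × length T ≤ s * (ℓ * (2 * (2 * h))) + (s₂ * (ℓ * (2 * B₂)) + ℓ * (2 * B₃)) ×
                    (∀ {v} → v ∈ A → n ≤ h * count (bad? C₀ v) A → ∃ λ a → ∃ λ x → ∃ λ y → a ∈ T × x ∈ T × y ∈ T × v ≡ a ⊕ x ⊖ y)) → SharpSeeds
          joined (T , T⊆ , lenT , tri) = C₀ ++ T , (λ p → ⊎-elim (λ q → ⊎-elim Td⊆ Ts⊆ (∈-++⁻ Td q)) T⊆ (∈-++⁻ C₀ p)) , len , derive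
            where
            E : ℕ
            E = s₁ * (ℓ * (2 * B₄)) + ℓ * (2 * B₅)
            len : length (C₀ ++ T) ≤ 2 * E + (s * (ℓ * (2 * (2 * h))) + (s₂ * (ℓ * (2 * B₂)) + ℓ * (2 * B₃)))
            len = ≤-trans (≤-reflexive (length-++ C₀)) (+-mono-≤ (≤-trans (≤-reflexive (length-++ Td)) (≤-trans (+-mono-≤ lend lens) (≤-reflexive (cong (E +_) (sym (+-identityʳ E)))))) lenT)
            derive : ∀ {v} → v ∈ A → n ≤ h * count (bad? (C₀ ++ T) v) A → ∃ λ a → ∃ λ x → ∃ λ y → a ∈ C₀ ++ T × x ∈ C₀ ++ T × y ∈ C₀ ++ T × v ≡ a ⊕ x ⊖ y
            derive {v} v∈ le = let (a , x , y , a∈ , x∈ , y∈ , eq) = tri v∈ (≤-trans le (*-monoʳ-≤ h (count-mono (bad? (C₀ ++ T) v) (bad? C₀ v) A (bad-antitone C₀ T v)))) in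
              a , x , y , ∈-++⁺ʳ C₀ a∈ , ∈-++⁺ʳ C₀ x∈ , ∈-++⁺ʳ C₀ y∈ , eq

      opaque
        sharp-seeds : SharpSeeds
        sharp-seeds = go EndsD.ends EndsS.ends
          where
          go : (∃ λ T → T ⊆ A × length T ≤ s₁ * (ℓ * (2 * B₄)) + ℓ * (2 * B₅) × (∀ {i} → i ∈ popular-diffs → ∃ λ x → x ∈ T × (x ⊕ i) ∈ T)) →
               (∃ λ T → T ⊆ A × length T ≤ s₁ * (ℓ * (2 * B₄)) + ℓ * (2 * B₅) × (∀ {i} → i ∈ popular-sums → ∃ λ x → x ∈ T × (i ⊖ x) ∈ T)) → SharpSeeds
          go (Td , Td⊆ , lend , endsd) (Ts , Ts⊆ , lens , endss) = J.joined (Triples.triples J.C₀ J.known-d J.known-s)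
            where module J = Join Td Td⊆ lend endsd Ts Ts⊆ lens endss

-- Counting free choices by new differences

argmax : {X : Set} (f : X → ℕ) (xs : List X) → 0 < length xs → ∃ λ x → x ∈ xs × (∀ {y} → y ∈ xs → f y ≤ f x)
argmax f (x ∷ []) _ = x , here refl , λ { (here refl) → ≤-refl }
argmax f (x ∷ xs@(_ ∷ _)) _ with argmax f xs (s≤s z≤n)
... | y , y∈ , max with ≤-total (f x) (f y)
... | inj₁ le = y , there y∈ , λ { (here refl) → le ; (there p) → max p }
... | inj₂ ge = x , here refl , λ { (here refl) → ≤-refl ; (there p) → ≤-trans (max p) ge }

module _ (𝔾 : FinGroup) where
  open Sets 𝔾
  open Programs 𝔾
  module _ (A : List G) where
    open Parallelograms 𝔾 A

    module SharpCount (uA : Unique A) (C : List G) (C⊆A : C ⊆ A) (h : ℕ)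
      (derive : ∀ {v} → v ∈ A → length A ≤ h * count (bad? C v) A → ∃ λ a → ∃ λ x → ∃ λ y → a ∈ C × x ∈ C × y ∈ C × v ≡ a ⊕ x ⊖ y) where

      private
        n = length A

        -- In either case v′ is one computed entry away from v, as v + c - c′ or as c + c′ - v.
        Link : G → G → Set
        Link v v′ = (v′ ⊖ v) ∈ C ⊟ C ⊎ (v ⊕ v′) ∈ C ⊞ C

        link? : ∀ v v′ → Dec (Link v v′)
        link? v v′ = ((v′ ⊖ v) ∈? (C ⊟ C)) ⊎-dec ((v ⊕ v′) ∈? (C ⊞ C))

        Closed : (G → Set) → Set
        Closed K = ∀ {v v′} → K v → v′ ∈ A → Link v v′ → K v′

        record State (ρ : ℕ) (L : List G) : Set where
          field
            prog : Prog ρ L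
            uL   : Unique L
            L⊆   : L ⊆ A
            C⊆   : C ⊆ L

        full : ∀ {L} → Unique L → L ⊆ A → n ≤ length L → A ⊆ L
        full {L} uL L⊆ le {a} a∈ with a ∈? L
        ... | yes p = p
        ... | no ¬p = ⊥-elim (<⇒≱ (s≤s le) (⊆⇒length≤ _≟_ {xs = a ∷ L} (All.tabulate (λ x∈ eq → ¬p (subst (_∈ L) (sym eq) x∈)) ∷ uL)
                        (λ { (here refl) → a∈ ; (there p) → L⊆ p })))

        cons-unique : ∀ {x : G} {L} → x ∉ L → Unique L → Unique (x ∷ L)
        cons-unique {L = L} x∉ u = All.tabulate (λ y∈ eq → x∉ (subst (_∈ L) (sym eq) y∈)) ∷ u

        Linkable : List G → Set
        Linkable L = Any (λ v′ → v′ ∉ L × Any (λ v → Link v v′) L) A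

        linkable? : ∀ L → Dec (Linkable L)
        linkable? L = Any.any? (λ v′ → ¬? (v′ ∈? L) ×-dec Any.any? (λ v → link? v v′) L) A

        mutual
          closure : ℕ → List G → List G
          closure zero    L = L
          closure (suc k) L = closure-step k L (linkable? L)

          closure-step : ∀ k L → Dec (Linkable L) → List G
          closure-step k L (yes ex) = closure k (proj₁ (find ex) ∷ L)
          closure-step k L (no _)   = L

        link-prog : ∀ {ρ L v v′} → State ρ L → v ∈ L → Link v v′ → Prog ρ (v′ ∷ L)
        link-prog {ρ} {L} {v} {v′} st v∈ (inj₁ d) = let (c , c′ , c∈ , c′∈ , eq) = ∈-⊟⁻ C C d in
          subst (λ x → Prog ρ (x ∷ L)) (sym (by₁ (solve (x₁ :- ((x₀ :+ x₂) :- x₃)) ((x₁ :- x₀) :- (x₂ :- x₃)) (v ∷ v′ ∷ c ∷ c′ ∷ []) refl) eq))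
            (comb v∈ (State.C⊆ st c∈) (State.C⊆ st c′∈) (State.prog st))
        link-prog {ρ} {L} {v} {v′} st v∈ (inj₂ d) = let (c , c′ , c∈ , c′∈ , eq) = ∈-⊞⁻ C C d in
          subst (λ x → Prog ρ (x ∷ L)) (sym (by₁ (solve (x₁ :- ((x₂ :+ x₃) :- x₀)) ((x₀ :+ x₁) :- (x₂ :+ x₃)) (v ∷ v′ ∷ c ∷ c′ ∷ []) refl) eq))
            (comb (State.C⊆ st c∈) (State.C⊆ st c′∈) v∈ (State.prog st))

        -- The last component, minimality among closed predicates, serves to compare closures over
        -- different lists.
        ClosureOf : ℕ → List G → List G → Set₁
        ClosureOf ρ L L′ = State ρ L′ × L ⊆ L′ × Closed (_∈ L′) × (∀ (K : G → Set) → Closed K → (∀ {x} → x ∈ L → K x) → ∀ {x} → x ∈ L′ → K x)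

        mutual
          -- The fuel suffices because the list remains a duplicate-free part of A and grows at
          -- every step.
          closure-spec : ∀ k {ρ L} → State ρ L → n ≤ k + length L → ClosureOf ρ L (closure k L)
          closure-spec zero    st le = st , id , (λ _ v′∈ _ → full (State.uL st) (State.L⊆ st) le v′∈) , λ K cl sub → sub
          closure-spec (suc k) {ρ} {L} st le = closure-step-spec k st le (linkable? L)

          closure-step-spec : ∀ k {ρ L} → State ρ L → n ≤ suc k + length L → (d : Dec (Linkable L)) → ClosureOf ρ L (closure-step k L d)
          closure-step-spec k {ρ} {L} st le (no ¬ex) = st , id , closed , λ K cl sub → sub
            where
            closed : Closed (_∈ L)
            closed {v} {v′} v∈ v′∈ lk with v′ ∈? L
            ... | yes p = p
            ... | no ¬p = contradiction (Any.map (λ { refl → ¬p , Any.map (λ { refl → lk }) v∈ }) v′∈) ¬ex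
          closure-step-spec k {ρ} {L} st le (yes ex) = go (find ex)
            where
            go : (f : ∃ λ v′ → v′ ∈ A × (v′ ∉ L × Any (λ v → Link v v′) L)) → ClosureOf ρ L (closure k (proj₁ f ∷ L))
            go (v′ , v′∈ , v′∉ , an) =
              let (v , v∈ , lk) = find an
                  open State st
                  st′ = record { prog = link-prog st v∈ lk ; uL = cons-unique v′∉ uL ; L⊆ = λ { (here refl) → v′∈ ; (there p) → L⊆ p } ; C⊆ = there ∘ C⊆ }
                  (st″ , sub , cl , min) = closure-spec k {ρ} {v′ ∷ L} st′ (≤-trans le (≤-reflexive (sym (+-suc k (length L)))))
              in st″ , sub ∘ there , cl , λ K clK subK → min K clK (λ { (here refl) → clK (subK v∈) v′∈ lk ; (there p) → subK p })

        cl : List G → G → List G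
        cl L v = closure n (v ∷ L)

        Derived : G → Set
        Derived v = (∃ λ a → ∃ λ x → ∃ λ y → a ∈ C × x ∈ C × y ∈ C × v ≡ a ⊕ x ⊖ y) ⊎ (v ⊕ v) ∈ C ⊞ C

        -- For every good a in L both v - a and a - v are new: if v - a = x - y with x in L and y in
        -- L or y = v, goodness explains this parallelogram, and then v is linked to L or derived
        -- from C, so it would lie in L. At most n / h of the a are bad, since otherwise C would
        -- generate v.
        gain : ∀ {ρ L L₁ v} → State ρ L → Closed (_∈ L) → (∀ {w} → w ∈ A → Derived w → w ∈ L) → v ∈ A → v ∉ L → (∀ {x} → x ∈ v ∷ L → x ∈ L₁) →
               h * length (L ⊟ L) + 2 * (h * length L) ≤ h * length (L₁ ⊟ L₁) + 2 * n
        gain {ρ} {L} {L₁} {v} st closed complete v∈ v∉ sub = begin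
          h * length (L ⊟ L) + 2 * (h * length L)                                         ≡⟨ cong (λ t → h * length (L ⊟ L) + 2 * (h * t)) (sym (count-split (bad? C v) L)) ⟩
          h * length (L ⊟ L) + 2 * (h * (count (bad? C v) L + length good))               ≡⟨ e h (length (L ⊟ L)) (count (bad? C v) L) (length good) ⟩
          h * (length (L ⊟ L) + (length good + length good)) + 2 * (h * count (bad? C v) L)
                                                                                          ≤⟨ +-mono-≤ (*-monoʳ-≤ h fresh-diffs) (*-monoʳ-≤ 2 few-bad) ⟩
          h * length (L₁ ⊟ L₁) + 2 * n                                                    ∎
          where
          open ≤-Reasoning
          open State st
          e : ∀ h d p q → h * d + 2 * (h * (p + q)) ≡ h * (d + (q + q)) + 2 * (h * p)
          e = solve-∀
          good? : ∀ a → Dec (¬ Bad C v a)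
          good? a = ¬? (bad? C v a)
          good : List G
          good = filter good? L
          good⁻ : ∀ {a} → a ∈ good → a ∈ L × ¬ Bad C v a
          good⁻ = ∈-filter⁻ good? {xs = L}
          few-bad : h * count (bad? C v) L ≤ n
          few-bad = ≤-trans (*-monoʳ-≤ h (⊆⇒length≤ _≟_ (Uniq.filter⁺ (bad? C v) uL) (λ p → let (q , r) = ∈-filter⁻ (bad? C v) {xs = L} p in ∈-filter⁺ (bad? C v) (L⊆ q) r)))
            (<⇒≤ (≰⇒> λ le → v∉ (complete v∈ (inj₁ (derive v∈ le)))))
          -- An equation v - a = x - y with a good forces a link from v to x or y.
          explained : ∀ {a x y} → a ∈ good → x ∈ L → y ∈ A → v ⊖ a ≡ x ⊖ y → (v ⊕ y) ∈ C ⊞ C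
          explained {a} {x} {y} a∈ x∈ y∈ eq = decide ((v ⊖ x) ∈? (C ⊟ C)) ((v ⊕ y) ∈? (C ⊞ C))
            where
            y≡ : y ≡ x ⊖ v ⊕ a
            y≡ = sym (by₁ (solve (((x₂ :- x₀) :+ x₁) :- x₃) ((x₂ :- x₃) :- (x₀ :- x₁)) (v ∷ a ∷ x ∷ y ∷ []) refl) (sym eq))
            decide : Dec ((v ⊖ x) ∈ C ⊟ C) → Dec ((v ⊕ y) ∈ C ⊞ C) → (v ⊕ y) ∈ C ⊞ C
            decide _ (yes q) = q
            decide (yes p) _ = ⊥-elim (v∉ (closed x∈ v∈ (inj₁ p)))
            decide (no ¬p) (no ¬q) = ⊥-elim (proj₂ (good⁻ a∈) (Any.map (λ { refl → subst (_∈ A) y≡ y∈ ,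
              (λ eq′ → v∉ (subst (_∈ L) eq′ x∈)) , ¬p , (λ q → ¬q (subst (λ y → (v ⊕ y) ∈ C ⊞ C) (sym y≡) q)) }) (L⊆ x∈)))
          not-old : ∀ {a x y} → a ∈ good → x ∈ L → y ∈ L → v ⊖ a ≢ x ⊖ y
          not-old {y = y} a∈ x∈ y∈ eq = v∉ (closed y∈ v∈ (inj₂ (subst (_∈ C ⊞ C) (solve (x₀ :+ x₁) (x₁ :+ x₀) (v ∷ y ∷ []) refl) (explained a∈ x∈ (L⊆ y∈) eq))))
          not-mirror : ∀ {a x} → a ∈ good → x ∈ L → v ⊖ a ≢ x ⊖ v
          not-mirror a∈ x∈ eq = v∉ (complete v∈ (inj₂ (explained a∈ x∈ v∈ eq)))
          fresh-diffs : length (L ⊟ L) + (length good + length good) ≤ length (L₁ ⊟ L₁)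
          fresh-diffs = ≤-trans (≤-reflexive (sym (trans (length-++ (L ⊟ L)) (cong (length (L ⊟ L) +_) (trans (length-++ (map (v ⊖_) good)) (cong₂ _+_ (length-map (v ⊖_) good) (length-map (_⊖ v) good)))))))
            (⊆⇒length≤ _≟_ unique inside)
            where
            u-good : Unique good
            u-good = Uniq.filter⁺ good? uL
            unique : Unique ((L ⊟ L) ++ (map (v ⊖_) good ++ map (_⊖ v) good))
            unique = Uniq.++⁺ (⊟-unique L L) (Uniq.++⁺
                (map-unique (v ⊖_) (λ {x} {y} _ _ eq → sym (by₁ (solve (x₁ :- x₀) ((x₂ :- x₀) :- (x₂ :- x₁)) (x ∷ y ∷ v ∷ []) refl) eq)) u-good)
                (map-unique (_⊖ v) (λ {x} {y} _ _ eq → by₁ (solve (x₀ :- x₁) ((x₀ :- x₂) :- (x₁ :- x₂)) (x ∷ y ∷ v ∷ []) refl) eq) u-good)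
                (λ (p , q) → let (a , a∈ , eq) = ∈-map⁻ (v ⊖_) p ; (a′ , a′∈ , eq′) = ∈-map⁻ (_⊖ v) q in not-mirror a∈ (proj₁ (good⁻ a′∈)) (trans (sym eq) eq′)))
              (λ (p , q) → let (x , y , x∈ , y∈ , eq) = ∈-⊟⁻ L L p in ⊎-elim
                (λ r → let (a , a∈ , eq′) = ∈-map⁻ (v ⊖_) r in not-old a∈ x∈ y∈ (trans (sym eq′) eq))
                (λ r → let (a , a∈ , eq′) = ∈-map⁻ (_⊖ v) r in not-old a∈ y∈ x∈
                  (by₁ (solve ((x₀ :- x₁) :- (x₃ :- x₂)) (:- (x₁ :- x₀) :- :- (x₂ :- x₃)) (v ∷ a ∷ x ∷ y ∷ []) refl) (cong ⊝_ (trans (sym eq′) eq))))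
                (∈-++⁻ (map (v ⊖_) good) q))
            inside : (L ⊟ L) ++ (map (v ⊖_) good ++ map (_⊖ v) good) ⊆ L₁ ⊟ L₁
            inside p = ⊎-elim (⊟-mono {L} {L₁} {L} {L₁} (sub ∘ there) (sub ∘ there))
              (λ q → ⊎-elim (λ r → let (a , a∈ , eq) = ∈-map⁻ (v ⊖_) r in subst (_∈ L₁ ⊟ L₁) (sym eq) (∈-⊟⁺ (sub (here refl)) (sub (there (proj₁ (good⁻ a∈))))))
                            (λ r → let (a , a∈ , eq) = ∈-map⁻ (_⊖ v) r in subst (_∈ L₁ ⊟ L₁) (sym eq) (∈-⊟⁺ (sub (there (proj₁ (good⁻ a∈)))) (sub (here refl))))
                            (∈-++⁻ (map (v ⊖_) good) q)) (∈-++⁻ (L ⊟ L) p)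

        -- Here r counts the free choices and w the elements still to come. A class added to a
        -- current set K gains about 2|K| differences; over classes of nonincreasing size these
        -- gains sum to at least r (|L| + n) - w, with equality when all classes are equal. The
        -- inequality is this sum times h, with a loss of 2n per class for bad elements.
        Finished : ℕ → List G → ℕ → Set
        Finished ρ L hb = ∃ λ r → ∃ λ w → (∃ λ L′ → Prog (r + ρ) L′ × A ⊆ L′ × length L′ ≤ n) × length L + w ≡ n × w ≤ r * hb ×
          h * length (L ⊟ L) + h * (r * (length L + n)) ≤ h * length (A ⊟ A) + h * w + 2 * (r * n)

        -- Adding the classes in order of decreasing size keeps the current set above its average size.
        process : ∀ fuel {ρ L} hb → State ρ L → Closed (_∈ L) → (∀ {w} → w ∈ A → Derived w → w ∈ L) → n ≤ fuel + length L →
                  (∀ {v} → v ∈ A → v ∉ L → length (cl L v) ≤ length L + hb) → Finished ρ L hb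
        process fuel {ρ} {L} hb st closed complete en bound = branch fuel en (0 <? length outside)
          where
          open State st
          out? : ∀ a → Dec (a ∉ L)
          out? a = ¬? (a ∈? L)
          outside : List G
          outside = filter out? A
          out⁻ : ∀ {a} → a ∈ outside → a ∈ A × a ∉ L
          out⁻ = ∈-filter⁻ out? {xs = A}
          L≤n : length L ≤ n
          L≤n = ⊆⇒length≤ _≟_ uL L⊆
          everything : ¬ 0 < length outside → A ⊆ L
          everything ¬o {a} a∈ with a ∈? L
          ... | yes p = p
          ... | no ¬p = contradiction (∈⇒0<length (∈-filter⁺ out? a∈ ¬p)) ¬o
          branch : ∀ fuel → n ≤ fuel + length L → Dec (0 < length outside) → Finished ρ L hb
          branch _ _ (no ¬o) = 0 , 0 , (L , prog , everything ¬o , L≤n) ,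
            trans (+-identityʳ _) (≤-antisym L≤n (⊆⇒length≤ _≟_ uA (everything ¬o))) , z≤n ,
            ≤-trans (≤-reflexive (trans (cong (h * length (L ⊟ L) +_) (*-zeroʳ h)) (+-identityʳ _)))
              (≤-trans (*-monoʳ-≤ h (∣⊟∣-mono {L} {A} {L} {A} L⊆ L⊆)) (≤-trans (m≤m+n _ (h * 0)) (m≤m+n _ 0)))
          branch zero en (yes o) = let (a , a∈) = 0<length⇒∃ outside o in contradiction (full uL L⊆ en (proj₁ (out⁻ a∈))) (proj₂ (out⁻ a∈))
          branch (suc fuel) en (yes o) = choose (argmax (λ v → length (cl L v)) outside o)
            where
            choose : (∃ λ v → v ∈ outside × (∀ {v′} → v′ ∈ outside → length (cl L v′) ≤ length (cl L v))) → Finished ρ L hb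
            choose (v , v∈o , max) = next (closure-spec n {suc ρ} {v ∷ L} st₁ (m≤m+n n _))
              where
              v∈ = proj₁ (out⁻ v∈o)
              v∉ = proj₂ (out⁻ v∈o)
              st₁ : State (suc ρ) (v ∷ L)
              st₁ = record { prog = fresh v prog ; uL = cons-unique v∉ uL ; L⊆ = λ { (here refl) → v∈ ; (there p) → L⊆ p } ; C⊆ = there ∘ C⊆ }
              L₁ : List G
              L₁ = cl L v
              next : ClosureOf (suc ρ) (v ∷ L) L₁ → Finished ρ L hb
              next (st₂ , sub , closed₁ , min) = conclude (process fuel {suc ρ} {L₁} s st₂ closed₁ (λ w∈ d → sub (there (complete w∈ d))) en₁ bound₁)
                where
                longer : suc (length L) ≤ length L₁
                longer = ⊆⇒length≤ _≟_ (cons-unique v∉ uL) sub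
                s : ℕ
                s = length L₁ ∸ length L
                L₁≡ : length L + s ≡ length L₁
                L₁≡ = m+[n∸m]≡n (<⇒≤ longer)
                s≤hb : s ≤ hb
                s≤hb = +-cancelˡ-≤ (length L) _ _ (≤-trans (≤-reflexive L₁≡) (bound v∈ v∉))
                en₁ : n ≤ fuel + length L₁
                en₁ = ≤-trans en (≤-trans (≤-reflexive (sym (+-suc fuel (length L)))) (+-monoʳ-≤ fuel longer))
                -- Classes can only shrink: `L₁` and the closure of u over L are both closed, so
                -- their union contains the closure of u over `L₁`. The choice of v as a maximiser
                -- then bounds the new part by s.
                bound₁ : ∀ {u} → u ∈ A → u ∉ L₁ → length (cl L₁ u) ≤ length L₁ + s
                bound₁ {u} u∈ u∉ = within (closure-spec n {suc (suc ρ)} {u ∷ L₁} st₃ (m≤m+n n _)) (closure-spec n {suc ρ} {u ∷ L} st₄ (m≤m+n n _))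
                  where
                  u∉L : u ∉ L
                  u∉L p = u∉ (sub (there p))
                  st₃ : State (suc (suc ρ)) (u ∷ L₁)
                  st₃ = record { prog = fresh u (State.prog st₂) ; uL = cons-unique u∉ (State.uL st₂) ; L⊆ = λ { (here refl) → u∈ ; (there p) → State.L⊆ st₂ p } ; C⊆ = there ∘ State.C⊆ st₂ }
                  st₄ : State (suc ρ) (u ∷ L)
                  st₄ = record { prog = fresh u prog ; uL = cons-unique u∉L uL ; L⊆ = λ { (here refl) → u∈ ; (there p) → L⊆ p } ; C⊆ = there ∘ C⊆ }
                  within : ClosureOf (suc (suc ρ)) (u ∷ L₁) (cl L₁ u) → ClosureOf (suc ρ) (u ∷ L) (cl L u) → length (cl L₁ u) ≤ length L₁ + s
                  within (st₅ , _ , _ , min₅) (st₆ , sub₆ , closed₆ , _) = begin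
                    length (cl L₁ u)                                                       ≡⟨ sym (count-split (_∈? L₁) (cl L₁ u)) ⟩
                    count (_∈? L₁) (cl L₁ u) + count (λ x → ¬? (x ∈? L₁)) (cl L₁ u)        ≤⟨ +-mono-≤ old new ⟩
                    length L₁ + s                                                          ∎
                    where
                    open ≤-Reasoning
                    inUnion : ∀ {x} → x ∈ cl L₁ u → x ∈ L₁ ⊎ x ∈ cl L u
                    inUnion = min₅ (λ x → x ∈ L₁ ⊎ x ∈ cl L u)
                      (λ { (inj₁ p) v′∈ lk → inj₁ (closed₁ p v′∈ lk) ; (inj₂ p) v′∈ lk → inj₂ (closed₆ p v′∈ lk) })
                      (λ { (here refl) → inj₂ (sub₆ (here refl)) ; (there p) → inj₁ p })
                    old : count (_∈? L₁) (cl L₁ u) ≤ length L₁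
                    old = ⊆⇒length≤ _≟_ (Uniq.filter⁺ (_∈? L₁) (State.uL st₅)) (λ p → proj₂ (∈-filter⁻ (_∈? L₁) {xs = cl L₁ u} p))
                    newcomer : ∀ {x} → x ∈ L₁ ⊎ x ∈ cl L u → x ∉ L₁ → x ∈ cl L u
                    newcomer (inj₁ p) x∉ = contradiction p x∉
                    newcomer (inj₂ p) _  = p
                    outL? : ∀ x → Dec (x ∉ L)
                    outL? x = ¬? (x ∈? L)
                    inL : length L ≤ count (_∈? L) (cl L u)
                    inL = ⊆⇒length≤ _≟_ uL (λ p → ∈-filter⁺ (_∈? L) (sub₆ (there p)) p)
                    new : count (λ x → ¬? (x ∈? L₁)) (cl L₁ u) ≤ s
                    new = +-cancelˡ-≤ (length L) _ _ (begin
                      length L + count (λ x → ¬? (x ∈? L₁)) (cl L₁ u)             ≤⟨ +-mono-≤ inL (⊆⇒length≤ _≟_ {ys = filter outL? (cl L u)} (Uniq.filter⁺ (λ x → ¬? (x ∈? L₁)) (State.uL st₅)) (λ p →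
                                                                                       let (q , x∉) = ∈-filter⁻ (λ x → ¬? (x ∈? L₁)) {xs = cl L₁ u} p in
                                                                                       ∈-filter⁺ outL? (newcomer (inUnion q) x∉) (λ r → x∉ (sub (there r))))) ⟩
                      count (_∈? L) (cl L u) + count outL? (cl L u)               ≡⟨ count-split (_∈? L) (cl L u) ⟩
                      length (cl L u)                                             ≤⟨ max (∈-filter⁺ out? u∈ u∉L) ⟩
                      length L₁                                                   ≡⟨ sym L₁≡ ⟩
                      length L + s                                                ∎)
                conclude : Finished (suc ρ) L₁ s → Finished ρ L hb
                conclude (r , w , (L′ , prog′ , cov , len) , eq , w≤ , ineq) = suc r , s + w ,
                  (L′ , subst (λ k → Prog k L′) (+-suc r ρ) prog′ , cov , len) ,
                  trans (sym (+-assoc (length L) s w)) (trans (cong (_+ w) L₁≡) eq) ,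
                  +-mono-≤ s≤hb (≤-trans w≤ (*-monoʳ-≤ r s≤hb)) ,
                  final
                  where
                  open ≤-Reasoning
                  t = length L
                  d = length (L ⊟ L)
                  d₁ = length (L₁ ⊟ L₁)
                  DA = length (A ⊟ A)
                  n≡ : n ≡ t + s + w
                  n≡ = sym (trans (cong (_+ w) L₁≡) eq)
                  step₁ : h * d + 2 * (h * t) ≤ h * d₁ + 2 * n
                  step₁ = gain st closed complete v∈ v∉ sub
                  ineq′ : h * d₁ + h * (r * (t + s + n)) ≤ h * DA + h * w + 2 * (r * n)
                  ineq′ = subst (λ k → h * d₁ + h * (r * (k + n)) ≤ h * DA + h * w + 2 * (r * n)) (sym L₁≡) ineq
                  e₁ : ∀ h d t r s n w → n ≡ t + s + w → h * d + h * (suc r * (t + n)) + (h * (r * s) + h * (2 * t)) ≡ (h * d + 2 * (h * t)) + h * (r * (t + s + n)) + (h * (t + s + w) + h * t)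
                  e₁ h d t r s n w refl = lem h d t r s w
                    where
                    lem : ∀ h d t r s w → h * d + h * (suc r * (t + (t + s + w))) + (h * (r * s) + h * (2 * t)) ≡ (h * d + 2 * (h * t)) + h * (r * (t + s + (t + s + w))) + (h * (t + s + w) + h * t)
                    lem = solve-∀
                  -- The decreasing order enters through w ≤ r s: the r later classes have at most s
                  -- elements each.
                  final : h * d + h * (suc r * (t + n)) ≤ h * DA + h * (s + w) + 2 * (suc r * n)
                  final = +-cancelʳ-≤ (h * (r * s) + h * (2 * t)) _ _ (begin
                    h * d + h * (suc r * (t + n)) + (h * (r * s) + h * (2 * t))                          ≡⟨ e₁ h d t r s n w n≡ ⟩
                    (h * d + 2 * (h * t)) + h * (r * (t + s + n)) + (h * (t + s + w) + h * t)            ≤⟨ +-monoˡ-≤ _ (+-monoˡ-≤ (h * (r * (t + s + n))) step₁) ⟩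
                    (h * d₁ + 2 * n) + h * (r * (t + s + n)) + (h * (t + s + w) + h * t)                 ≡⟨ e₂ (h * d₁) (2 * n) (h * (r * (t + s + n))) _ ⟩
                    (h * d₁ + h * (r * (t + s + n))) + (2 * n + (h * (t + s + w) + h * t))               ≤⟨ +-mono-≤ ineq′ (+-monoʳ-≤ (2 * n) (+-monoˡ-≤ (h * t) (*-monoʳ-≤ h (+-monoʳ-≤ (t + s) w≤)))) ⟩
                    (h * DA + h * w + 2 * (r * n)) + (2 * n + (h * (t + s + r * s) + h * t))             ≡⟨ e₃ h DA w r n t s ⟩
                    h * DA + h * (s + w) + 2 * (suc r * n) + (h * (r * s) + h * (2 * t))                 ∎)
                    where
                    e₂ : ∀ a b c d → (a + b) + c + d ≡ (a + c) + (b + d)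
                    e₂ = solve-∀
                    e₃ : ∀ h D w r n t s → (h * D + h * w + 2 * (r * n)) + (2 * n + (h * (t + s + r * s) + h * t)) ≡ h * D + h * (s + w) + 2 * (suc r * n) + (h * (r * s) + h * (2 * t))
                    e₃ = solve-∀

        gather : ∀ xs → xs ⊆ A → ∃ λ L → ∃ λ ρ → Prog ρ L × Unique L × L ⊆ A × xs ⊆ L × ρ ≤ length xs
        gather [] _ = [] , 0 , start , [] , (λ ()) , (λ ()) , z≤n
        gather (x ∷ xs) sub with gather xs (sub ∘ there)
        ... | L , ρ , prog , uL , L⊆ , xs⊆ , le with x ∈? L
        ... | yes p = L , ρ , prog , uL , L⊆ , (λ { (here refl) → p ; (there q) → xs⊆ q }) , m≤n⇒m≤1+n le
        ... | no ¬p = x ∷ L , suc ρ , fresh x prog , cons-unique ¬p uL , (λ { (here refl) → sub (here refl) ; (there q) → L⊆ q }) ,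
                      (λ { (here refl) → here refl ; (there q) → there (xs⊆ q) }) , s≤s le

        derive-prog : ∀ {ρ L v} → State ρ L → Derived v → Prog ρ (v ∷ L)
        derive-prog {ρ} {L} st (inj₁ (a , x , y , a∈ , x∈ , y∈ , eq)) = subst (λ v → Prog ρ (v ∷ L)) (sym eq) (comb (C⊆ a∈) (C⊆ x∈) (C⊆ y∈) prog)
          where open State st
        derive-prog st (inj₂ d) = let (c , c′ , c∈ , c′∈ , eq) = ∈-⊞⁻ C C d in half (State.C⊆ st c∈) (State.C⊆ st c′∈) eq (State.prog st)

        derived? : ∀ v → Dec (Any (λ a → Any (λ x → Any (λ y → v ≡ a ⊕ x ⊖ y) C) C) C ⊎ (v ⊕ v) ∈ C ⊞ C)
        derived? v = Any.any? (λ a → Any.any? (λ x → Any.any? (λ y → v ≟ (a ⊕ x ⊖ y)) C) C) C ⊎-dec ((v ⊕ v) ∈? (C ⊞ C))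

        -- All derived elements enter as computed entries before any element outside C is chosen
        -- freely, so that in `gain` a derived v is already in L. An element v with v + v ∈ C + C
        -- enters by `half`.
        absorb : ∀ {ρ L} → State ρ L → ∀ xs → xs ⊆ A → ∃ λ L′ → State ρ L′ × L ⊆ L′ × (∀ {v} → v ∈ xs → Derived v → v ∈ L′)
        absorb st [] _ = _ , st , id , λ ()
        absorb {ρ} st (x ∷ xs) sub with absorb st xs (sub ∘ there)
        ... | L , st′ , L⊆L , got = decide (x ∈? L) (derived? x)
          where
          open State st′
          decide : Dec (x ∈ L) → Dec (Any (λ a → Any (λ y → Any (λ z → x ≡ a ⊕ y ⊖ z) C) C) C ⊎ (x ⊕ x) ∈ C ⊞ C) →
                   ∃ λ L′ → State ρ L′ × _ ⊆ L′ × (∀ {v} → v ∈ x ∷ xs → Derived v → v ∈ L′)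
          decide (yes p) _ = L , st′ , L⊆L , λ { (here refl) _ → p ; (there q) → got q }
          decide (no ¬p) (yes d) = x ∷ L ,
            record { prog = derive-prog st′ (to d) ; uL = cons-unique ¬p uL ; L⊆ = λ { (here refl) → sub (here refl) ; (there q) → L⊆ q } ; C⊆ = there ∘ C⊆ } ,
            there ∘ L⊆L , λ { (here refl) _ → here refl ; (there q) dv → there (got q dv) }
            where
            to : Any (λ a → Any (λ y → Any (λ z → x ≡ a ⊕ y ⊖ z) C) C) C ⊎ (x ⊕ x) ∈ C ⊞ C → Derived x
            to (inj₁ p₁) = let (a , a∈ , p₂) = find p₁ ; (y , y∈ , p₃) = find p₂ ; (z , z∈ , eq) = find p₃ in inj₁ (a , y , z , a∈ , y∈ , z∈ , eq)
            to (inj₂ q)  = inj₂ q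
          decide (no ¬p) (no ¬d) = L , st′ , L⊆L , λ { (here refl) dv → contradiction (from dv) ¬d ; (there q) → got q }
            where
            from : Derived x → Any (λ a → Any (λ y → Any (λ z → x ≡ a ⊕ y ⊖ z) C) C) C ⊎ (x ⊕ x) ∈ C ⊞ C
            from (inj₁ (a , y , z , a∈ , y∈ , z∈ , eq)) = inj₁ (Any.map (λ { refl → Any.map (λ { refl → Any.map (λ { refl → eq }) z∈ }) y∈ }) a∈)
            from (inj₂ q) = inj₂ q

        prog-length : ∀ {ρ L} → Prog ρ L → ρ ≤ length L
        prog-length start          = z≤n
        prog-length (fresh _ p)    = s≤s (prog-length p)
        prog-length (comb _ _ _ p) = m≤n⇒m≤1+n (prog-length p)
        prog-length (half _ _ _ p) = m≤n⇒m≤1+n (prog-length p)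

      opaque
        sharp-count : ∃ λ ρ → (∃ λ L → Prog ρ L × A ⊆ L × length L ≤ n) × h * (ρ * n) ≤ h * length (A ⊟ A) + h * n + 2 * (n * n) + h * (length C * n)
        sharp-count = begin-with (gather C C⊆A)
          where
          Goal : Set
          Goal = ∃ λ ρ → (∃ λ L → Prog ρ L × A ⊆ L × length L ≤ n) × h * (ρ * n) ≤ h * length (A ⊟ A) + h * n + 2 * (n * n) + h * (length C * n)
          begin-with : (∃ λ L → ∃ λ ρ → Prog ρ L × Unique L × L ⊆ A × C ⊆ L × ρ ≤ length C) → Goal
          begin-with (L₀ , ρ₀ , prog₀ , u₀ , L₀⊆ , C⊆₀ , ρ₀≤) =
            let st₀ = record { prog = prog₀ ; uL = u₀ ; L⊆ = L₀⊆ ; C⊆ = C⊆₀ }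
                (L₁ , st₁ , _ , got) = absorb {ρ₀} {L₀} st₀ A id
                (st₂ , sub , closed , _) = closure-spec n {ρ₀} {L₁} st₁ (m≤m+n n _)
            in finish (process n {ρ₀} {closure n L₁} n st₂ closed (λ w∈ d → sub (got w∈ d)) (m≤m+n n _)
                 (λ {v} v∈ v∉ → ≤-trans (⊆⇒length≤ _≟_ (State.uL (proj₁ (spec st₂ v∈ v∉))) (State.L⊆ (proj₁ (spec st₂ v∈ v∉)))) (m≤n+m n _)))
            where
            spec : ∀ {ρ L v} → State ρ L → v ∈ A → v ∉ L → ClosureOf (suc ρ) (v ∷ L) (cl L v)
            spec {ρ} {L} {v} st v∈ v∉ = closure-spec n {suc ρ} {v ∷ L}
              (record { prog = fresh v (State.prog st) ; uL = cons-unique v∉ (State.uL st) ; L⊆ = λ { (here refl) → v∈ ; (there p) → State.L⊆ st p } ; C⊆ = there ∘ State.C⊆ st }) (m≤m+n n _)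
            finish : ∀ {L} → Finished ρ₀ L n → Goal
            finish {L} (r , w , (L′ , prog′ , cov , len) , eq , w≤ , ineq) = r + ρ₀ , (L′ , prog′ , cov , len) , (begin
              h * ((r + ρ₀) * n)                                                    ≡⟨ e₁ h r ρ₀ n ⟩
              h * (r * n) + h * (ρ₀ * n)                                            ≤⟨ +-mono-≤ main (*-monoʳ-≤ h (*-monoˡ-≤ n ρ₀≤)) ⟩
              h * length (A ⊟ A) + h * n + 2 * (n * n) + h * (length C * n)         ∎)
              where
              open ≤-Reasoning
              e₁ : ∀ h r q n → h * ((r + q) * n) ≡ h * (r * n) + h * (q * n)
              e₁ = solve-∀
              r≤n : r ≤ n
              r≤n = ≤-trans (m≤m+n r ρ₀) (≤-trans (prog-length prog′) len)
              w≤n : w ≤ n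
              w≤n = ≤-trans (m≤n+m w (length L)) (≤-reflexive eq)
              main : h * (r * n) ≤ h * length (A ⊟ A) + h * n + 2 * (n * n)
              main = ≤-trans (*-monoʳ-≤ h (*-monoʳ-≤ r (m≤n+m n (length L)))) (≤-trans (m≤n+m _ (h * length (L ⊟ L))) (≤-trans ineq
                (+-mono-≤ (+-monoʳ-≤ (h * length (A ⊟ A)) (*-monoʳ-≤ h w≤n)) (*-monoʳ-≤ 2 (*-monoˡ-≤ n r≤n)))))

-- Scales

n<2^n : ∀ n → n < 2 ^ n
n<2^n zero    = s≤s z≤n
n<2^n (suc n) = ≤-trans (+-mono-≤ (m^n>0 2 n) (n<2^n n)) (≤-reflexive (cong (2 ^ n +_) (sym (+-identityʳ (2 ^ n)))))

-- For j the quotient of β by k + 1 one has β < (j + 1)(k + 1) and j + 1 ≤ 2 ^ j; raising to the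
-- power k + 1 gives β ^ (k + 1) < (k + 1) ^ (k + 1) 2 ^ β.
poly<exp : ∀ k β → suc k ^ suc k ≤ β → β ^ k < 2 ^ β
poly<exp k β le = *-cancelʳ-< (suc k ^ suc k) (β ^ k) (2 ^ β) (begin-strict
  β ^ k * suc k ^ suc k                   ≤⟨ *-monoʳ-≤ (β ^ k) le ⟩
  β ^ k * β                               ≡⟨ *-comm (β ^ k) β ⟩
  β ^ suc k                               <⟨ ^-monoˡ-< (suc k) covers ⟩
  (suc j * suc k) ^ suc k                 ≡⟨ ^-*-distrib (suc k) (suc j) (suc k) ⟩
  suc j ^ suc k * suc k ^ suc k           ≤⟨ *-monoˡ-≤ (suc k ^ suc k) (begin
    suc j ^ suc k                           ≤⟨ ^-monoˡ-≤ (suc k) (n<2^n j) ⟩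
    (2 ^ j) ^ suc k                         ≡⟨ ^-*-assoc 2 j (suc k) ⟩
    2 ^ (j * suc k)                         ≤⟨ ^-monoʳ-≤ 2 (m/n*n≤m β (suc k)) ⟩
    2 ^ β                                   ∎) ⟩
  2 ^ β * suc k ^ suc k                   ∎)
  where
  open ≤-Reasoning
  j = β / suc k
  covers : β < suc j * suc k
  covers = ≤-trans (s≤s (≤-reflexive (m≡m%n+[m/n]*n β (suc k)))) (+-monoˡ-≤ (j * suc k) (m%n<n β (suc k)))

-- Exponents of β for the various scales; only the listed inequalities between them matter.
opaque
  E E₁ c δ μ₀ μ a y x ζ κ ε r₁ r₂ w : ℕ
  -- The values follow from one another: μ₀ from F₁₀, then μ, a and y, then x from F₇ through κ, ζ
  -- from F₃ and c from F₁. F₄ reflects |A - A| ≥ |A| ^ (15/14), so that δ - E is about E / 14, and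
  -- E is large enough for this surplus to satisfy F₀.
  μ₀ = 8
  μ  = 112
  a  = 114
  y  = 116
  x  = 346
  ζ  = 691
  c  = 1611
  E₁ = 22694
  E  = 22695
  δ  = 24315
  κ  = 22926
  ε = 17844
  r₁ = 21077
  r₂ = 19458
  w  = 21079

  E≡ : E ≡ suc E₁
  E≡ = refl
  μ≡ : μ₀ * 14 ≡ μ
  μ≡ = refl
  y≡ : y ≡ μ + 4
  y≡ = refl
  a≡ : a ≡ μ + 2
  a≡ = refl
  κ≡ : κ + suc a ≡ E + x
  κ≡ = refl
  ε≡ : ε + (3 * c + 18) ≡ E
  ε≡ = refl
  r₁≡ : r₁ + (c + 7) ≡ E
  r₁≡ = refl
  r₂≡ : r₂ + (2 * c + 15) ≡ E
  r₂≡ = refl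
  w≡ : w + (c + 5) ≡ E
  w≡ = refl
  F₀ : ζ + ζ + (2 * E + y) + suc a ≤ E + δ
  F₀ = ≤ᵇ⇒≤ _ _ tt
  F₁ : ζ + ζ + (1 + 2 * a) ≤ c
  F₁ = ≤ᵇ⇒≤ _ _ tt
  F₃ : y + x + 1 + 2 * a ≤ ζ
  F₃ = ≤ᵇ⇒≤ _ _ tt
  F₄ : 14 * δ ≤ 15 * E₁
  F₄ = ≤ᵇ⇒≤ _ _ tt
  F₅ : suc μ ≤ x
  F₅ = ≤ᵇ⇒≤ _ _ tt
  F₆ : κ ≤ δ
  F₆ = ≤ᵇ⇒≤ _ _ tt
  F₇ : E + 2 * μ + 7 ≤ κ
  F₇ = ≤ᵇ⇒≤ _ _ tt
  F₈ : E + (μ + x + y + 2 * a + 8) ≤ δ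
  F₈ = ≤ᵇ⇒≤ _ _ tt
  F₁₀ : 8 ≤ μ₀
  F₁₀ = ≤ᵇ⇒≤ _ _ tt
  F₁₁ : 5 * c + 40 ≤ E
  F₁₁ = ≤ᵇ⇒≤ _ _ tt

module Powers (β : ℕ) (0<β : 0 < β) where
  instance
    β≢0 : NonZero β
    β≢0 = >-nonZero 0<β

  0<pow : ∀ i → 0 < β ^ i
  0<pow i = m^n>0 β i

  pow≢0 : ∀ i → NonZero (β ^ i)
  pow≢0 i = >-nonZero (0<pow i)

  pow-mono : ∀ i j → i ≤ j → β ^ i ≤ β ^ j
  pow-mono i j = ^-monoʳ-≤ β

  pow-+ : ∀ i j → β ^ i * β ^ j ≡ β ^ (i + j)
  pow-+ i j = sym (^-distribˡ-+-* β i j)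

  absorb : ∀ {k} i → k ≤ β → k * β ^ i ≤ β ^ suc i
  absorb i = *-monoˡ-≤ (β ^ i)

-- Sets with at least n² / β ^ c differences
module _ (𝔾 : FinGroup) where
  open Sets 𝔾
  open Programs 𝔾

  module Dense (β : ℕ) (64≤β : 64 ≤ β) (poly : β ^ (2 * E) < 2 ^ β) (A : List G) (uA : Unique A) (size : length A ≡ β ^ E)
    (dense : β ^ (2 * E) ≤ length (A ⊟ A) * β ^ c) where

    private
      0<β : 0 < β
      0<β = ≤-trans (s≤s z≤n) 64≤β
      open Powers β 0<β
      n = length A
      D = length (A ⊟ A)

      2≤β : 2 ≤ β
      2≤β = ≤-trans (≤ᵇ⇒≤ 2 64 tt) 64≤β
      4≤β : 4 ≤ β
      4≤β = ≤-trans (≤ᵇ⇒≤ 4 64 tt) 64≤β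

      0<n : 0 < n
      0<n = subst (0 <_) (sym size) (0<pow E)

      n² : n * n ≡ β ^ (2 * E)
      n² = trans (cong₂ _*_ size size) (trans (pow-+ E E) (cong (β ^_) (cong (E +_) (sym (+-identityʳ E)))))

      h b s s₁ B₂ B₃ B₄ : ℕ
      -- As D ≥ n² / β ^ c, this makes the loss 2n² / h caused by bad elements at most D / β. The
      -- exponent of b is then the largest one with 4hsb ≤ n for which a factor β covers the
      -- constant 4.
      h = β ^ (c + 2)
      b = β ^ ε
      s = β ^ (2 * c + 15)
      s₁ = β ^ (c + 7)
      B₂ = β ^ suc r₂
      B₃ = β ^ r₁
      B₄ = β ^ suc (3 * c + 18)

      spare : ∀ {i j} → suc j ≤ i → β ^ i ≤ β * (β ^ i ∸ β ^ j)
      spare {i} {j} lt = ≤-trans halved (*-monoˡ-≤ (β ^ i ∸ β ^ j) 2≤β)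
        where
        open ≤-Reasoning
        twice : β ^ j + β ^ j ≤ β ^ i
        twice = ≤-trans (≤-reflexive (cong (β ^ j +_) (sym (+-identityʳ (β ^ j))))) (≤-trans (absorb j 2≤β) (pow-mono (suc j) i lt))
        halved : β ^ i ≤ 2 * (β ^ i ∸ β ^ j)
        halved = +-cancelˡ-≤ (β ^ j + β ^ j) _ _ (begin
          β ^ j + β ^ j + β ^ i                              ≤⟨ +-monoˡ-≤ (β ^ i) twice ⟩
          β ^ i + β ^ i                                      ≡⟨ sym (cong₂ _+_ (m+[n∸m]≡n le) (m+[n∸m]≡n le)) ⟩
          (β ^ j + d) + (β ^ j + d)                          ≡⟨ e (β ^ j) d ⟩
          β ^ j + β ^ j + 2 * d                              ∎)
          where
          d = β ^ i ∸ β ^ j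
          le : β ^ j ≤ β ^ i
          le = pow-mono j i (<⇒≤ lt)
          e : ∀ p q → (p + q) + (p + q) ≡ p + p + 2 * q
          e = solve-∀

      cover : ∀ {i j k} → k + i ≡ E → suc j ≤ i → n ≤ β ^ suc k * (β ^ i ∸ β ^ j)
      cover {i} {j} {k} eq lt = begin
        n                                    ≡⟨ trans size (trans (cong (β ^_) (sym eq)) (sym (pow-+ k i))) ⟩
        β ^ k * β ^ i                        ≤⟨ *-monoʳ-≤ (β ^ k) (spare lt) ⟩
        β ^ k * (β * (β ^ i ∸ β ^ j))        ≡⟨ trans (sym (*-assoc (β ^ k) β _)) (cong (_* (β ^ i ∸ β ^ j)) (*-comm (β ^ k) β)) ⟩
        β ^ suc k * (β ^ i ∸ β ^ j)          ∎
        where open ≤-Reasoning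

      exact : ∀ {i k} → k + i ≡ E → n ≤ β ^ k * β ^ i
      exact {i} {k} eq = ≤-reflexive (trans size (trans (cong (β ^_) (sym eq)) (sym (pow-+ k i))))

      j≤ : ∀ i j k → i + k ≡ E → j + k ≤ E → j ≤ i
      j≤ i j k eq le = +-cancelʳ-≤ k j i (≤-trans le (≤-reflexive (sym eq)))

      M₃ : 4 * h * s * b ≤ n
      M₃ = begin
        4 * h * s * b                                        ≡⟨ e 4 h s b ⟩
        4 * (h * s * b)                                      ≡⟨ cong (4 *_) (trans (cong (_* b) (pow-+ (c + 2) (2 * c + 15))) (pow-+ (c + 2 + (2 * c + 15)) ε)) ⟩
        4 * β ^ (c + 2 + (2 * c + 15) + ε)                 ≤⟨ absorb (c + 2 + (2 * c + 15) + ε) 4≤β ⟩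
        β ^ suc (c + 2 + (2 * c + 15) + ε)                 ≡⟨ trans (cong (β ^_) (trans (e′ c ε) ε≡)) (sym size) ⟩
        n                                                    ∎
        where
        open ≤-Reasoning
        e : ∀ p q r s → p * q * r * s ≡ p * (q * r * s)
        e = solve-∀
        e′ : ∀ c b → suc (c + 2 + (2 * c + 15) + b) ≡ b + (3 * c + 18)
        e′ = solve-∀

      gap : ∀ k l → k + l * c ≤ 40 + 5 * c → k + l * c ≤ E
      gap k l le = ≤-trans le (≤-trans (≤-reflexive (+-comm 40 (5 * c))) F₁₁)

      lin : ∀ k l → k ≤ 40 → l ≤ 5 → k + l * c ≤ E
      lin k l p q = gap k l (+-mono-≤ p (*-monoˡ-≤ c q))

      open Parallelograms 𝔾 A
      opaque
        seeds′ : ∃ λ C → C ⊆ A × length C ≤ 2 * (s₁ * (β * (2 * B₄)) + β * (2 * B₃)) + (s * (β * (2 * (2 * h))) + (s₁ * (β * (2 * B₂)) + β * (2 * B₃))) ×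
                 (∀ {v} → v ∈ A → n ≤ h * count (bad? C v) A → ∃ λ a → ∃ λ x → ∃ λ y → a ∈ C × x ∈ C × y ∈ C × v ≡ a ⊕ x ⊖ y)
        seeds′ = SharpSeeds.sharp-seeds 𝔾 A uA 0<n β (subst (_< 2 ^ β) (sym n²) poly) h b s s₁ s₁ B₂ B₃ B₄ B₃
          (0<pow (c + 2)) (0<pow ε) (0<pow (suc r₂)) (0<pow r₁) (0<pow (suc (3 * c + 18))) (0<pow r₁)
          (cover {ε} {c + 7} {3 * c + 18} (trans (+-comm (3 * c + 18) ε) ε≡) (j≤ ε (suc (c + 7)) (3 * c + 18) ε≡ (≤-trans (≤-reflexive (e₁ c)) (lin 26 4 (≤ᵇ⇒≤ _ _ tt) (≤ᵇ⇒≤ _ _ tt)))))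
          (exact {c + 7} {r₁} r₁≡) M₃
          (cover {2 * c + 15} {c + 7} {r₂} r₂≡ (≤-trans (≤-reflexive (e₂ c)) (≤-trans (+-monoʳ-≤ (c + 8) z≤n) (≤-reflexive (e₃ c)))))
          (exact {c + 7} {r₁} r₁≡)
          where
          e₁ : ∀ c → suc (c + 7) + (3 * c + 18) ≡ 26 + 4 * c
          e₁ = solve-∀
          e₂ : ∀ c → suc (c + 7) ≡ c + 8 + 0
          e₂ = solve-∀
          e₃ : ∀ c → c + 8 + (c + 7) ≡ 2 * c + 15
          e₃ = solve-∀

      term : ∀ k i j → k ≤ β → β ^ i * (β * (k * β ^ j)) ≤ β ^ (2 + (i + j))
      term k i j le = ≤-trans (≤-reflexive (trans (e (β ^ i) β k (β ^ j)) (cong (λ p → k * (β * p)) (pow-+ i j)))) (absorb (suc (i + j)) le)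
        where
        e : ∀ p b k q → p * (b * (k * q)) ≡ k * (b * (p * q))
        e = solve-∀

      few-seeds : ∀ {l} → l ≤ 2 * (s₁ * (β * (2 * B₄)) + β * (2 * B₃)) + (s * (β * (2 * (2 * h))) + (s₁ * (β * (2 * B₂)) + β * (2 * B₃))) → l ≤ β ^ suc w
      few-seeds le = ≤-trans le (begin
        2 * (s₁ * (β * (2 * B₄)) + β * (2 * B₃)) + (s * (β * (2 * (2 * h))) + (s₁ * (β * (2 * B₂)) + β * (2 * B₃)))
          ≡⟨ expand β s₁ B₄ B₃ s h B₂ ⟩
        (s₁ * (β * (4 * B₄)) + 1 * (β * (4 * B₃))) + (s * (β * (4 * h)) + (s₁ * (β * (2 * B₂)) + 1 * (β * (2 * B₃))))
          ≤⟨ +-mono-≤ (+-mono-≤ (≤-trans (term 4 (c + 7) (suc (3 * c + 18)) 4≤β) (pow-mono (2 + (c + 7 + suc (3 * c + 18))) w (j≤ w (2 + (c + 7 + suc (3 * c + 18))) (c + 5) w≡ (≤-trans (≤-reflexive (e₁ c)) (lin 33 5 (≤ᵇ⇒≤ _ _ tt) ≤-refl)))))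
                                (≤-trans (term 4 0 r₁ 4≤β) r₁w))
               (+-mono-≤ (≤-trans (term 4 (2 * c + 15) (c + 2) 4≤β) (pow-mono (2 + (2 * c + 15 + (c + 2))) w (j≤ w (2 + (2 * c + 15 + (c + 2))) (c + 5) w≡ (≤-trans (≤-reflexive (e₃ c)) (lin 24 4 (≤ᵇ⇒≤ _ _ tt) (≤ᵇ⇒≤ _ _ tt))))))
                 (+-mono-≤ (≤-trans (term 2 (c + 7) (suc r₂) 2≤β) (pow-mono (2 + (c + 7 + suc r₂)) w (j≤ w (2 + (c + 7 + suc r₂)) (c + 5) w≡ (≤-reflexive (trans (e₄ c r₂) r₂≡)))))
                           (≤-trans (term 2 0 r₁ 2≤β) r₁w))) ⟩
        (β ^ w + β ^ w) + (β ^ w + (β ^ w + β ^ w))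
          ≡⟨ five (β ^ w) ⟩
        5 * β ^ w
          ≤⟨ absorb w (≤-trans (≤ᵇ⇒≤ 5 64 tt) 64≤β) ⟩
        β ^ suc w ∎)
        where
        open ≤-Reasoning
        five : ∀ p → (p + p) + (p + (p + p)) ≡ 5 * p
        five = solve-∀
        expand : ∀ β s₁ B₄ B₃ s h B₂ → 2 * (s₁ * (β * (2 * B₄)) + β * (2 * B₃)) + (s * (β * (2 * (2 * h))) + (s₁ * (β * (2 * B₂)) + β * (2 * B₃))) ≡
                 (s₁ * (β * (4 * B₄)) + 1 * (β * (4 * B₃))) + (s * (β * (4 * h)) + (s₁ * (β * (2 * B₂)) + 1 * (β * (2 * B₃))))
        expand = solve-∀
        e₁ : ∀ c → 2 + (c + 7 + suc (3 * c + 18)) + (c + 5) ≡ 33 + 5 * c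
        e₁ = solve-∀
        e₃ : ∀ c → 2 + (2 * c + 15 + (c + 2)) + (c + 5) ≡ 24 + 4 * c
        e₃ = solve-∀
        e₄ : ∀ c r → 2 + (c + 7 + suc r) + (c + 5) ≡ r + (2 * c + 15)
        e₄ = solve-∀
        e₅ : ∀ c r → 2 + r + (c + 5) ≡ r + (c + 7)
        e₅ = solve-∀
        r₁w : β ^ (2 + r₁) ≤ β ^ w
        r₁w = pow-mono (2 + r₁) w (j≤ w (2 + r₁) (c + 5) w≡ (≤-reflexive (trans (e₅ c r₁) r₁≡)))

    -- Z = β³ leaves room for the description of the computed entries.
    dense-key : ∀ Q → 4 * Q ≤ β → ∃ λ ρ → (∃ λ L → Prog ρ L × A ⊆ L × length L ≤ n) × Q * ((ρ + β ^ 3) * n) ≤ suc Q * D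
    dense-key Q 4Q≤β = go seeds′
      where
      open ≤-Reasoning
      go : (∃ λ C → C ⊆ A × length C ≤ 2 * (s₁ * (β * (2 * B₄)) + β * (2 * B₃)) + (s * (β * (2 * (2 * h))) + (s₁ * (β * (2 * B₂)) + β * (2 * B₃))) ×
             (∀ {v} → v ∈ A → n ≤ h * count (bad? C v) A → ∃ λ a → ∃ λ x → ∃ λ y → a ∈ C × x ∈ C × y ∈ C × v ≡ a ⊕ x ⊖ y)) →
           ∃ λ ρ → (∃ λ L → Prog ρ L × A ⊆ L × length L ≤ n) × Q * ((ρ + β ^ 3) * n) ≤ suc Q * D
      go (C , C⊆ , len , derive) = let (ρ , enc , ineq) = SharpCount.sharp-count 𝔾 A uA C C⊆ h derive in ρ , enc , finish ρ ineq
        where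
        Dn : ∀ i → i + c ≤ 2 * E → β ^ i ≤ D
        Dn i le = *-cancelʳ-≤ (β ^ i) D (β ^ c) {{pow≢0 c}} (≤-trans (≤-reflexive (pow-+ i c)) (≤-trans (pow-mono (i + c) (2 * E) le) dense))
        βn≤ : β * (β ^ 3 * n) ≤ D
        βn≤ = ≤-trans (≤-reflexive (trans (sym (*-assoc β (β ^ 3) n)) (trans (cong (β ^ 4 *_) size) (pow-+ 4 E)))) (Dn (4 + E)
          (≤-trans (≤-reflexive (e E c)) (+-monoʳ-≤ E (≤-trans (≤-trans (≤-reflexive (cong (4 +_) (sym (+-identityʳ c)))) (lin 4 1 (≤ᵇ⇒≤ _ _ tt) (≤ᵇ⇒≤ _ _ tt))) (≤-reflexive (sym (+-identityʳ E)))))))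
          where
          e : ∀ E c → 4 + E + c ≡ E + (4 + c)
          e = solve-∀
        n≤ : β * n ≤ D
        n≤ = ≤-trans (*-monoʳ-≤ β (m≤n*m n (β ^ 3) {{pow≢0 3}})) βn≤
        C≤ : β * (length C * n) ≤ D
        C≤ = ≤-trans (*-monoʳ-≤ β (*-mono-≤ (few-seeds len) (≤-reflexive size))) (≤-trans (≤-reflexive (cong (β *_) (pow-+ (suc w) E))) (Dn (suc (suc w + E))
          (≤-trans (≤-reflexive (e w E c)) (≤-trans (+-monoˡ-≤ E (≤-trans (+-monoʳ-≤ w (m≤n+m (c + 2) 3)) (≤-reflexive (trans (cong (w +_) (e′ c)) w≡)))) (≤-reflexive (cong (E +_) (sym (+-identityʳ E))))))))
          where
          e : ∀ w E c → suc (suc w + E) + c ≡ w + (c + 2) + E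
          e = solve-∀
          e′ : ∀ c → 3 + (c + 2) ≡ c + 5
          e′ = solve-∀
        square≤ : β * (2 * (n * n)) ≤ h * D
        square≤ = begin
          β * (2 * (n * n))           ≡⟨ trans (e β (n * n)) (cong (2 * β *_) n²) ⟩
          2 * β * β ^ (2 * E)         ≤⟨ *-mono-≤ (*-monoˡ-≤ β 2≤β) dense ⟩
          β * β * (D * β ^ c)         ≡⟨ e′ β D (β ^ c) ⟩
          β * (β * (β ^ c)) * D       ≡⟨ cong (λ k → β ^ k * D) (+-comm 2 c) ⟩
          h * D                       ∎
          where
          e : ∀ b k → b * (2 * k) ≡ 2 * b * k
          e = solve-∀
          e′ : ∀ b d k → b * b * (d * k) ≡ b * (b * k) * d
          e′ = solve-∀
        -- Four error terms, stemming from h n, 2n², |C| n and the reserve β ^ 3, are each at most h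
        -- D after multiplication by β. Together they cost 4Q h D ≤ β h D, which is the step from Q
        -- to Q + 1.
        finish : ∀ ρ → h * (ρ * n) ≤ h * D + h * n + 2 * (n * n) + h * (length C * n) → Q * ((ρ + β ^ 3) * n) ≤ suc Q * D
        finish ρ ineq = *-cancelˡ-≤ (β * h) {{m*n≢0 β h {{β≢0}} {{pow≢0 (c + 2)}}}} (begin
          β * h * (Q * ((ρ + β ^ 3) * n))                                         ≡⟨ e₁ β h Q ρ (β ^ 3) n ⟩
          Q * (β * (h * (ρ * n)) + h * (β * (β ^ 3 * n)))                         ≤⟨ *-monoʳ-≤ Q (+-monoˡ-≤ (h * (β * (β ^ 3 * n))) (*-monoʳ-≤ β ineq)) ⟩
          Q * (β * (h * D + h * n + 2 * (n * n) + h * (length C * n)) + h * (β * (β ^ 3 * n)))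
                                                                                  ≡⟨ cong (Q *_) (e₂ β h D n (2 * (n * n)) (length C * n) (h * (β * (β ^ 3 * n)))) ⟩
          Q * (β * (h * D) + (h * (β * n) + (β * (2 * (n * n)) + (h * (β * (length C * n)) + h * (β * (β ^ 3 * n))))))
                                                                                  ≤⟨ *-monoʳ-≤ Q (+-monoʳ-≤ (β * (h * D)) (+-mono-≤ (*-monoʳ-≤ h n≤) (+-mono-≤ square≤ (+-mono-≤ (*-monoʳ-≤ h C≤) (*-monoʳ-≤ h βn≤))))) ⟩
          Q * (β * (h * D) + (h * D + (h * D + (h * D + h * D))))                 ≡⟨ e₃ Q β (h * D) ⟩
          Q * (β * (h * D)) + 4 * Q * (h * D)                                     ≤⟨ +-monoʳ-≤ (Q * (β * (h * D))) (*-monoˡ-≤ (h * D) 4Q≤β) ⟩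
          Q * (β * (h * D)) + β * (h * D)                                         ≡⟨ e₄ Q β h D ⟩
          β * h * (suc Q * D)                                                     ∎)
          where
          e₁ : ∀ b h q r k n → b * h * (q * ((r + k) * n)) ≡ q * (b * (h * (r * n)) + h * (b * (k * n)))
          e₁ = solve-∀
          e₂ : ∀ b h d n s t z → b * (h * d + h * n + s + h * t) + z ≡ b * (h * d) + (h * (b * n) + (b * s + (h * (b * t) + z)))
          e₂ = solve-∀
          e₃ : ∀ q b k → q * (b * k + (k + (k + (k + k)))) ≡ q * (b * k) + 4 * q * k
          e₃ = solve-∀
          e₄ : ∀ q b h d → q * (b * (h * d)) + b * (h * d) ≡ b * h * (suc q * d)
          e₄ = solve-∀

-- Sets with fewer than n² / β ^ c differences
module _ (𝔾 : FinGroup) where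
  open Sets 𝔾
  open Growth 𝔾
  open Programs 𝔾

  -- The size of A is known only up to a factor β, because the descent passes to subsets; the
  -- exponents leave room for this.
  module Sparse (β : ℕ) (128≤β : 128 ≤ β) (poly : β ^ (2 * E) < 2 ^ β) (J≤ : 2 * (2 + E) ≤ β) (cost : suc (grow (suc E) 1) ≤ β) (𝔸 : List G)
    (wf : WindowFree 𝔸) (A : List G) (A⊆ : A ⊆ 𝔸) (uA : Unique A) (lower : β ^ E₁ ≤ length A) (upper : length A ≤ β ^ E)
    (sparse : length (A ⊟ A) * β ^ c < β ^ (2 * E)) where

    private
      0<β : 0 < β
      0<β = ≤-trans (s≤s z≤n) 128≤β
      open Powers β 0<β
      n = length A
      D = length (A ⊟ A)

      2≤β : 2 ≤ β
      2≤β = ≤-trans (≤ᵇ⇒≤ 2 128 tt) 128≤β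
      32≤β : 32 ≤ β
      32≤β = ≤-trans (≤ᵇ⇒≤ 32 128 tt) 128≤β

      0<n : 0 < n
      0<n = ≤-trans (0<pow E₁) lower

      opaque
        -- `growth` with X = C = A gives |A| ^ 15 ≤ |A - A| ^ 14.
        δ≤ : β ^ δ ≤ D
        δ≤ = ^-cancelʳ-≤ 14 (s≤s z≤n) (begin
          (β ^ δ) ^ 14      ≡⟨ trans (^-*-assoc β δ 14) (cong (β ^_) (*-comm δ 14)) ⟩
          β ^ (14 * δ)      ≤⟨ pow-mono (14 * δ) (15 * E₁) F₄ ⟩
          β ^ (15 * E₁)     ≡⟨ trans (cong (β ^_) (*-comm 15 E₁)) (sym (^-*-assoc β E₁ 15)) ⟩
          (β ^ E₁) ^ 15     ≤⟨ ^-monoˡ-≤ 15 lower ⟩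
          n ^ 15            ≡⟨ *-comm n (n ^ 14) ⟩
          n ^ 14 * n        ≤⟨ growth {𝔸} {A} {A} wf A⊆ A⊆ uA uA 0<n ⟩
          D ^ 14            ∎)
          where open ≤-Reasoning

      pow≤D : ∀ i → i ≤ δ → β ^ i ≤ D
      pow≤D i le = ≤-trans (pow-mono i δ le) δ≤

      0<D : 0 < D
      0<D = ≤-trans (0<pow δ) δ≤

      instance
        D≢0 : NonZero D
        D≢0 = >-nonZero 0<D
        32D≢0 : NonZero (32 * D)
        32D≢0 = m*n≢0 32 D

      m M thr z R B B₂ τ k : ℕ
      -- A cell with m elements counts as rich, and M = m ^ (1/14) is the growth it guarantees.
      -- Popular means at least thr / D representations, so the popular seeds number at most D |A| m
      -- / thr ≤ D / β ^ (E + 4). The same amount k is granted to each enlargement; the total budget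
      -- is D / β ^ (E + 1).
      m   = β ^ μ
      M   = β ^ μ₀
      thr = β ^ (2 * E + y)
      z   = β ^ ζ
      R   = β ^ x
      B   = β ^ (y + 1 + 2 * a)
      -- N₅ asks for about 128 D / (R u). This is below D / β ^ κ, since β ^ (κ + a + 1) = R β ^ E
      -- and β ^ E ≤ u β ^ a.
      B₂  = suc ((D / β ^ κ) {{pow≢0 κ}})
      τ   = R * (β * (2 * B)) + m * (β * (2 * B₂))
      k   = (D / β ^ (E + 4)) {{pow≢0 (E + 4)}}

      β²ᴱ : β ^ (2 * E) ≡ β ^ E * β ^ E
      β²ᴱ = trans (cong (λ j → β ^ (E + j)) (+-identityʳ E)) (sym (pow-+ E E))

      /-upper : ∀ p q .{{_ : NonZero q}} → p < suc (p / q) * q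
      /-upper p q = ≤-trans (s≤s (≤-reflexive (m≡m%n+[m/n]*n p q))) (+-monoˡ-≤ (p / q * q) (m%n<n p q))

      module _ (u : ℕ) (n≤ : n ≤ 4 * m * u) where
        open ≤-Reasoning

        H ρ : ℕ
        H = thr / D
        ρ = (u * u) / (32 * D)

        -- The exponent a = μ + 2 pays for the factor m between |A| and |U|, for the constant 4, and
        -- for |A| ≥ β ^ E₁ instead of β ^ E.
        uβ : β ^ E ≤ u * β ^ a
        uβ = begin
          β ^ E                    ≡⟨ cong (β ^_) E≡ ⟩
          β * β ^ E₁               ≤⟨ *-monoʳ-≤ β (≤-trans lower n≤) ⟩
          β * (4 * m * u)          ≡⟨ e β m u ⟩
          4 * (β * m) * u          ≤⟨ *-monoˡ-≤ u (absorb (suc μ) (≤-trans (≤ᵇ⇒≤ 4 128 tt) 128≤β)) ⟩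
          β ^ (2 + μ) * u          ≡⟨ trans (*-comm (β ^ (2 + μ)) u) (cong (λ j → u * β ^ j) (trans (+-comm 2 μ) (sym a≡))) ⟩
          u * β ^ a                ∎
          where
          e : ∀ b m u → b * (4 * m * u) ≡ 4 * (b * m) * u
          e = solve-∀

        DH≤ : D * H ≤ thr
        DH≤ = ≤-trans (≤-reflexive (*-comm D H)) (m/n*n≤m thr D)

        u²β : β ^ (2 * E) ≤ u * u * β ^ (2 * a)
        u²β = begin
          β ^ (2 * E)                    ≡⟨ β²ᴱ ⟩
          β ^ E * β ^ E                  ≤⟨ *-mono-≤ uβ uβ ⟩
          u * β ^ a * (u * β ^ a)        ≡⟨ e u (β ^ a) ⟩
          u * u * (β ^ a * β ^ a)        ≡⟨ cong (u * u *_) (trans (pow-+ a a) (cong (λ j → β ^ (a + j)) (sym (+-identityʳ a)))) ⟩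
          u * u * β ^ (2 * a)            ∎
          where
          e : ∀ u p → u * p * (u * p) ≡ u * u * (p * p)
          e = solve-∀

        N₀′ : 2 * (z * z) * H ≤ u
        N₀′ = *-cancelʳ-≤ _ _ (D * β ^ a) {{m*n≢0 D (β ^ a) {{D≢0}} {{pow≢0 a}}}} (begin
          2 * (z * z) * H * (D * β ^ a)                       ≡⟨ e z H D (β ^ a) ⟩
          2 * (z * z * (D * H) * β ^ a)                       ≤⟨ *-monoʳ-≤ 2 (*-monoˡ-≤ (β ^ a) (*-monoʳ-≤ (z * z) DH≤)) ⟩
          2 * (z * z * thr * β ^ a)                           ≡⟨ cong (2 *_) (trans (cong (_* β ^ a) (trans (cong (_* thr) (pow-+ ζ ζ)) (pow-+ (ζ + ζ) (2 * E + y)))) (pow-+ (ζ + ζ + (2 * E + y)) a)) ⟩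
          2 * β ^ (ζ + ζ + (2 * E + y) + a)                   ≤⟨ absorb (ζ + ζ + (2 * E + y) + a) 2≤β ⟩
          β ^ suc (ζ + ζ + (2 * E + y) + a)                   ≤⟨ pow-mono (suc (ζ + ζ + (2 * E + y) + a)) (E + δ) (≤-trans (≤-reflexive (sym (+-suc (ζ + ζ + (2 * E + y)) a))) F₀) ⟩
          β ^ (E + δ)                                         ≡⟨ sym (pow-+ E δ) ⟩
          β ^ E * β ^ δ                                       ≤⟨ *-mono-≤ uβ δ≤ ⟩
          u * β ^ a * D                                       ≡⟨ e′ u (β ^ a) D ⟩
          u * (D * β ^ a)                                     ∎)
          where
          e : ∀ z h d p → 2 * (z * z) * h * (d * p) ≡ 2 * (z * z * (d * h) * p)
          e = solve-∀
          e′ : ∀ u p d → u * p * d ≡ u * (d * p)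
          e′ = solve-∀

        -- Sparseness enters here: D < β ^ (2E - c), while u² ≥ β ^ (2E - 2a), and c exceeds 2a by
        -- enough to accommodate 32 z².
        big : 32 * D * (z * z) ≤ u * u
        big = *-cancelʳ-≤ _ _ (β ^ (2 * a) * β ^ c) {{m*n≢0 (β ^ (2 * a)) (β ^ c) {{pow≢0 (2 * a)}} {{pow≢0 c}}}} (begin
          32 * D * (z * z) * (β ^ (2 * a) * β ^ c)             ≡⟨ e D (z * z) (β ^ (2 * a)) (β ^ c) ⟩
          D * β ^ c * (32 * (z * z * β ^ (2 * a)))             ≤⟨ *-mono-≤ (<⇒≤ sparse) (begin
            32 * (z * z * β ^ (2 * a))                           ≡⟨ cong (32 *_) (trans (cong (_* β ^ (2 * a)) (pow-+ ζ ζ)) (pow-+ (ζ + ζ) (2 * a))) ⟩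
            32 * β ^ (ζ + ζ + 2 * a)                             ≤⟨ absorb {32} (ζ + ζ + 2 * a) 32≤β ⟩
            β ^ suc (ζ + ζ + 2 * a)                              ≤⟨ pow-mono (suc (ζ + ζ + 2 * a)) c (≤-trans (≤-reflexive (sym (+-suc (ζ + ζ) (2 * a)))) F₁) ⟩
            β ^ c                                                ∎) ⟩
          β ^ (2 * E) * β ^ c                                  ≤⟨ *-monoˡ-≤ (β ^ c) u²β ⟩
          u * u * β ^ (2 * a) * β ^ c                          ≡⟨ *-assoc (u * u) (β ^ (2 * a)) (β ^ c) ⟩
          u * u * (β ^ (2 * a) * β ^ c)                        ∎)
          where
          e : ∀ d z p q → 32 * d * z * (p * q) ≡ d * q * (32 * (z * p))
          e = solve-∀

        0<z² : 0 < z * z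
        0<z² = *-mono-≤ (0<pow ζ) (0<pow ζ)

        N₁′ : 8 * D * (2 + 2 * (z * z)) ≤ 3 * (u * u)
        N₁′ = begin
          8 * D * (2 + 2 * (z * z))                ≤⟨ *-monoʳ-≤ (8 * D) (+-monoˡ-≤ (2 * (z * z)) (*-monoʳ-≤ 2 0<z²)) ⟩
          8 * D * (2 * (z * z) + 2 * (z * z))      ≡⟨ e D (z * z) ⟩
          32 * D * (z * z)                         ≤⟨ big ⟩
          u * u                                    ≤⟨ m≤m+n (u * u) _ ⟩
          3 * (u * u)                              ∎
          where
          e : ∀ d z → 8 * d * (2 * z + 2 * z) ≡ 32 * d * z
          e = solve-∀

        0<ρ′ : 0 < ρ
        0<ρ′ = n≢0⇒n>0 (λ eq → <⇒≱ (/-upper (u * u) (32 * D)) (begin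
          suc ρ * (32 * D)             ≡⟨ trans (cong (λ j → suc j * (32 * D)) eq) (trans (+-identityʳ (32 * D)) (sym (*-identityʳ (32 * D)))) ⟩
          32 * D * 1                   ≤⟨ *-monoʳ-≤ (32 * D) 0<z² ⟩
          32 * D * (z * z)             ≤⟨ big ⟩
          u * u                        ∎))

        N₂′ : 32 * D * ρ ≤ u * u
        N₂′ = ≤-trans (≤-reflexive (*-comm (32 * D) ρ)) (m/n*n≤m (u * u) (32 * D))

        u²≤ρ : u * u ≤ 64 * D * ρ
        u²≤ρ = begin
          u * u                          ≤⟨ <⇒≤ (/-upper (u * u) (32 * D)) ⟩
          suc ρ * (32 * D)               ≤⟨ *-monoˡ-≤ (32 * D) (+-monoˡ-≤ ρ 0<ρ′) ⟩
          (ρ + ρ) * (32 * D)             ≡⟨ e ρ D ⟩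
          64 * D * ρ                     ∎
          where
          e : ∀ r d → (r + r) * (32 * d) ≡ 64 * d * r
          e = solve-∀

        N₃′ : 32 * D * H * (R * (u + z * H)) ≤ z * (u * u * u)
        N₃′ = begin
          32 * D * H * (R * (u + z * H))        ≤⟨ *-monoʳ-≤ (32 * D * H) (*-monoʳ-≤ R (+-monoʳ-≤ u zH≤)) ⟩
          32 * D * H * (R * (u + u))            ≡⟨ e D H R u ⟩
          64 * (D * H * R) * u                  ≤⟨ *-monoˡ-≤ u (*-cancelʳ-≤ (64 * (D * H * R)) (z * (u * u)) (β ^ (2 * a)) {{pow≢0 (2 * a)}} (begin
            64 * (D * H * R) * β ^ (2 * a)        ≤⟨ *-monoˡ-≤ (β ^ (2 * a)) (*-monoʳ-≤ 64 (*-monoˡ-≤ R DH≤)) ⟩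
            64 * (thr * R) * β ^ (2 * a)          ≤⟨ *-monoˡ-≤ (β ^ (2 * a)) (≤-trans (≤-reflexive (cong (64 *_) (pow-+ (2 * E + y) x))) (absorb {64} (2 * E + y + x) (≤-trans (≤ᵇ⇒≤ 64 128 tt) 128≤β))) ⟩
            β ^ suc (2 * E + y + x) * β ^ (2 * a) ≡⟨ pow-+ (suc (2 * E + y + x)) (2 * a) ⟩
            β ^ (suc (2 * E + y + x) + 2 * a)     ≤⟨ pow-mono (suc (2 * E + y + x) + 2 * a) (ζ + 2 * E) (≤-trans (≤-reflexive (e₂ (2 * E) y x (2 * a))) (+-monoˡ-≤ (2 * E) F₃)) ⟩
            β ^ (ζ + 2 * E)                       ≡⟨ sym (pow-+ ζ (2 * E)) ⟩
            z * β ^ (2 * E)                       ≤⟨ *-monoʳ-≤ z u²β ⟩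
            z * (u * u * β ^ (2 * a))             ≡⟨ sym (*-assoc z (u * u) (β ^ (2 * a))) ⟩
            z * (u * u) * β ^ (2 * a)             ∎)) ⟩
          z * (u * u) * u                       ≡⟨ *-assoc z (u * u) u ⟩
          z * (u * u * u)                       ∎
          where
          zH≤ : z * H ≤ u
          zH≤ = ≤-trans (*-monoˡ-≤ H (≤-trans (m≤m*n z z {{pow≢0 ζ}}) (m≤m+n (z * z) _))) N₀′
          e : ∀ d h r u → 32 * d * h * (r * (u + u)) ≡ 64 * (d * h * r) * u
          e = solve-∀
          e₂ : ∀ E y x a → suc (E + y + x) + a ≡ y + x + 1 + a + E
          e₂ = solve-∀

        N₄′ : 32 * D * H ≤ B * (u * u)
        N₄′ = begin
          32 * D * H                                ≡⟨ *-assoc 32 D H ⟩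
          32 * (D * H)                              ≤⟨ *-mono-≤ 32≤β DH≤ ⟩
          β ^ suc (2 * E + y)                       ≡⟨ cong (β ^_) (e (2 * E) y) ⟩
          β ^ (y + 1 + 2 * E)                       ≡⟨ sym (pow-+ (y + 1) (2 * E)) ⟩
          β ^ (y + 1) * β ^ (2 * E)                 ≤⟨ *-monoʳ-≤ (β ^ (y + 1)) u²β ⟩
          β ^ (y + 1) * (u * u * β ^ (2 * a))       ≡⟨ e′ (β ^ (y + 1)) (u * u) (β ^ (2 * a)) ⟩
          β ^ (y + 1) * β ^ (2 * a) * (u * u)       ≡⟨ cong (_* (u * u)) (pow-+ (y + 1) (2 * a)) ⟩
          B * (u * u)                               ∎
          where
          e : ∀ E y → suc (E + y) ≡ y + 1 + E
          e = solve-∀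
          e′ : ∀ p u q → p * (u * q) ≡ p * q * u
          e′ = solve-∀

        N₅′ : u ≤ B₂ * (R * ρ ∸ m)
        N₅′ = *-cancelˡ-≤ (128 * D) {{m*n≢0 128 D}} (begin
          128 * D * u                               ≤⟨ *-monoˡ-≤ u enough ⟩
          B₂ * (R * u) * u                          ≡⟨ e₁ B₂ R u ⟩
          B₂ * (R * (u * u))                        ≤⟨ *-monoʳ-≤ B₂ (*-monoʳ-≤ R u²≤ρ) ⟩
          B₂ * (R * (64 * D * ρ))                   ≡⟨ e₂ B₂ R D ρ ⟩
          64 * D * (B₂ * (R * ρ))                   ≤⟨ *-monoʳ-≤ (64 * D) (*-monoʳ-≤ B₂ doubled) ⟩
          64 * D * (B₂ * (2 * (R * ρ ∸ m)))         ≡⟨ e₃ D B₂ (R * ρ ∸ m) ⟩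
          128 * D * (B₂ * (R * ρ ∸ m))              ∎)
          where
          e₁ : ∀ b r u → b * (r * u) * u ≡ b * (r * (u * u))
          e₁ = solve-∀
          e₂ : ∀ b r d p → b * (r * (64 * d * p)) ≡ 64 * d * (b * (r * p))
          e₂ = solve-∀
          e₃ : ∀ d b r → 64 * d * (b * (2 * r)) ≡ 128 * d * (b * r)
          e₃ = solve-∀
          e₄ : ∀ b r u p → b * (r * u) * p ≡ b * (r * (u * p))
          e₄ = solve-∀
          2m≤ : m + m ≤ R * ρ
          2m≤ = begin
            m + m                  ≡⟨ cong (m +_) (sym (+-identityʳ m)) ⟩
            2 * m                  ≤⟨ absorb μ 2≤β ⟩
            β ^ suc μ              ≤⟨ pow-mono (suc μ) x F₅ ⟩
            R                      ≤⟨ m≤m*n R ρ {{>-nonZero 0<ρ′}} ⟩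
            R * ρ                  ∎
          doubled : R * ρ ≤ 2 * (R * ρ ∸ m)
          doubled = +-cancelˡ-≤ (m + m) _ _ (begin
            m + m + R * ρ                        ≤⟨ +-monoˡ-≤ (R * ρ) 2m≤ ⟩
            R * ρ + R * ρ                        ≡⟨ sym (cong₂ _+_ eq eq) ⟩
            (m + d) + (m + d)                    ≡⟨ e m d ⟩
            m + m + 2 * d                        ∎)
            where
            d = R * ρ ∸ m
            eq : m + d ≡ R * ρ
            eq = m+[n∸m]≡n (≤-trans (m≤m+n m m) 2m≤)
            e : ∀ p q → (p + q) + (p + q) ≡ p + p + 2 * q
            e = solve-∀
          enough : 128 * D ≤ B₂ * (R * u)
          enough = *-cancelʳ-≤ _ _ (β ^ a) {{pow≢0 a}} (begin
            128 * D * β ^ a                      ≤⟨ *-monoˡ-≤ (β ^ a) (*-mono-≤ 128≤β (<⇒≤ (/-upper D (β ^ κ) {{pow≢0 κ}}))) ⟩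
            β * (B₂ * β ^ κ) * β ^ a             ≡⟨ e β B₂ (β ^ κ) (β ^ a) ⟩
            B₂ * (β ^ κ * (β * β ^ a))           ≡⟨ cong (B₂ *_) (trans (pow-+ κ (suc a)) (trans (cong (β ^_) (trans κ≡ (+-comm E x))) (sym (pow-+ x E)))) ⟩
            B₂ * (R * β ^ E)                     ≤⟨ *-monoʳ-≤ B₂ (*-monoʳ-≤ R uβ) ⟩
            B₂ * (R * (u * β ^ a))               ≡⟨ sym (e₄ B₂ R u (β ^ a)) ⟩
            B₂ * (R * u) * β ^ a                 ∎)
            where
            e : ∀ b c k a → b * (c * k) * a ≡ c * (k * (b * a))
            e = solve-∀

        flat-params : FlatParams D thr β m τ u
        flat-params = record
          { H = H ; z = z ; ρ = ρ ; R = R ; B = B ; B₂ = B₂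
          ; flat-bound = λ e lt → ≤-trans (≤-reflexive (sym (m*n/n≡m e D))) (/-monoˡ-≤ D (≤-trans (≤-reflexive (*-comm e D)) (<⇒≤ lt)))
          ; 0<B = 0<pow (y + 1 + 2 * a) ; 0<B₂ = s≤s z≤n ; 0<z = 0<pow ζ ; 0<ρ = 0<ρ′
          ; N₀ = N₀′ ; N₁ = N₁′ ; N₂ = N₂′ ; N₃ = N₃′ ; N₄ = N₄′ ; N₅ = N₅′ ; total = ≤-refl }

      M¹⁴≤m : M ^ 14 ≤ m
      M¹⁴≤m = ≤-reflexive (trans (^-*-assoc β μ₀ 14) (cong (β ^_) μ≡))

      8≤δ : E + 8 ≤ δ
      8≤δ = ≤-trans (+-monoʳ-≤ E (m≤n+m 8 (μ + x + y + 2 * a))) F₈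

      n<2^β : n < 2 ^ β
      n<2^β = ≤-trans (s≤s (≤-trans upper (pow-mono E (2 * E) (m≤m+n E (E + 0))))) poly

      0<k : 0 < k
      0<k = n≢0⇒n>0 (λ eq → <⇒≱ (/-upper D (β ^ (E + 4)) {{pow≢0 (E + 4)}})
        (≤-trans (≤-reflexive (trans (cong (λ j → suc j * β ^ (E + 4)) eq) (+-identityʳ (β ^ (E + 4)))))
          (pow≤D (E + 4) (≤-trans (+-monoʳ-≤ E (≤ᵇ⇒≤ 4 8 tt)) 8≤δ))))

      D≤k : D < 2 * k * β ^ (E + 4)
      D≤k = ≤-trans (/-upper D (β ^ (E + 4)) {{pow≢0 (E + 4)}}) (*-monoˡ-≤ (β ^ (E + 4)) (≤-trans (+-monoˡ-≤ k 0<k) (≤-reflexive (cong (k +_) (sym (+-identityʳ k))))))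

      -- This leaves elements of A outside all the exceptional sets of `suc E` enlargements: k M is
      -- of order D β ^ (4 - E) and |A| ≥ β ^ (E - 1), so the right side is of order D β ^ 3.
      expands : suc E * (β * D) < n * (k * M)
      expands = *-cancelʳ-< (2 * β ^ (E + 4)) _ _ (begin-strict
        suc E * (β * D) * (2 * β ^ (E + 4))        ≡⟨ e₁ (suc E) β D (β ^ (E + 4)) ⟩
        2 * suc E * (D * (β * β ^ (E + 4)))        ≤⟨ *-monoˡ-≤ (D * (β * β ^ (E + 4))) (≤-trans (*-monoʳ-≤ 2 (n≤1+n (suc E))) J≤) ⟩
        β * (D * (β * β ^ (E + 4)))                ≡⟨ e₂ β D (β ^ (E + 4)) ⟩
        D * (β * (β * β ^ (E + 4)))                ≤⟨ *-monoʳ-≤ D (pow-mono (2 + (E + 4)) (E₁ + μ₀) exponents) ⟩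
        D * β ^ (E₁ + μ₀)                          <⟨ *-monoˡ-< (β ^ (E₁ + μ₀)) {{pow≢0 (E₁ + μ₀)}} D≤k ⟩
        2 * k * β ^ (E + 4) * β ^ (E₁ + μ₀)        ≡⟨ cong (2 * k * β ^ (E + 4) *_) (sym (pow-+ E₁ μ₀)) ⟩
        2 * k * β ^ (E + 4) * (β ^ E₁ * M)         ≤⟨ *-monoʳ-≤ (2 * k * β ^ (E + 4)) (*-monoˡ-≤ M lower) ⟩
        2 * k * β ^ (E + 4) * (n * M)              ≡⟨ e₃ k (β ^ (E + 4)) n M ⟩
        n * (k * M) * (2 * β ^ (E + 4))            ∎)
        where
        open ≤-Reasoning
        e₁ : ∀ j b d p → j * (b * d) * (2 * p) ≡ 2 * j * (d * (b * p))
        e₁ = solve-∀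
        e₂ : ∀ b d p → b * (d * (b * p)) ≡ d * (b * (b * p))
        e₂ = solve-∀
        e₃ : ∀ k p n m → 2 * k * p * (n * m) ≡ n * (k * m) * (2 * p)
        e₃ = solve-∀
        exponents : 2 + (E + 4) ≤ E₁ + μ₀
        exponents = ≤-trans (≤-reflexive (trans (cong (λ j → 2 + (j + 4)) E≡) (e E₁))) (+-monoʳ-≤ E₁ (≤-trans (n≤1+n 7) F₁₀))
          where
          e : ∀ p → 2 + (suc p + 4) ≡ p + 7
          e = solve-∀

      -- The choices consist of 𝟘, the popular differences, the two parts of the sets T, the seeds
      -- of the enlargements and the reserve β ^ 3. After multiplication by β ^ (E + 2) they
      -- contribute at most 7D. The result is better by a factor β than a set of size β ^ E
      -- requires, which lets the described subset have fewer differences than A.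
      choices : ∀ {s s′ k₀} → k₀ * thr ≤ D * (n * m) → s ≤ 1 + (k₀ + 8 * m * τ) → s′ ≤ s + suc (suc E) * k → (s′ + β ^ 3) * (β ^ E * β) ≤ D
      choices {s} {s′} {k₀} popular s≤ s′≤ = *-cancelʳ-≤ _ _ β (begin
        (s′ + β ^ 3) * (β ^ E * β) * β
          ≡⟨ e₀ (s′ + β ^ 3) (β ^ E) β ⟩
        (s′ + β ^ 3) * (β * (β * β ^ E))
          ≤⟨ *-monoˡ-≤ P (+-monoˡ-≤ (β ^ 3) (≤-trans s′≤ (+-monoˡ-≤ (suc (suc E) * k) s≤))) ⟩
        (1 + (k₀ + 8 * m * τ) + suc (suc E) * k + β ^ 3) * P
          ≡⟨ e₁ k₀ m R β B B₂ (suc (suc E) * k) (β ^ 3) P ⟩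
        P + (k₀ * P + (16 * (m * R * (β * B) * P) + (16 * (m * m * β * P) * B₂ + (suc (suc E) * k * P + β ^ 3 * P))))
          ≤⟨ +-mono-≤ t₁ (+-mono-≤ t₂ (+-mono-≤ t₃ (+-mono-≤ t₄ (+-mono-≤ t₅ t₆)))) ⟩
        D + (D + (D + ((D + D) + (D + D))))
          ≡⟨ e₂ D ⟩
        7 * D
          ≤⟨ *-monoˡ-≤ D (≤-trans (≤ᵇ⇒≤ 7 128 tt) 128≤β) ⟩
        β * D
          ≡⟨ *-comm β D ⟩
        D * β ∎)
        where
        open ≤-Reasoning
        P = β ^ (2 + E)
        e₀ : ∀ s p b → s * (p * b) * b ≡ s * (b * (b * p))
        e₀ = solve-∀
        e₁ : ∀ k m r b B B₂ j q p → (1 + (k + 8 * m * (r * (b * (2 * B)) + m * (b * (2 * B₂)))) + j + q) * p ≡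
             p + (k * p + (16 * (m * r * (b * B) * p) + (16 * (m * m * b * p) * B₂ + (j * p + q * p))))
        e₁ = solve-∀
        e₂ : ∀ d → d + (d + (d + ((d + d) + (d + d)))) ≡ 7 * d
        e₂ = solve-∀
        t₁ : P ≤ D
        t₁ = pow≤D (2 + E) (≤-trans (≤-trans (≤-reflexive (+-comm 2 E)) (+-monoʳ-≤ E (≤ᵇ⇒≤ 2 8 tt))) 8≤δ)
        t₂ : k₀ * P ≤ D
        t₂ = *-cancelʳ-≤ _ _ (β ^ (E + μ)) {{pow≢0 (E + μ)}} (begin
          k₀ * P * β ^ (E + μ)            ≡⟨ trans (*-assoc k₀ P (β ^ (E + μ))) (cong (k₀ *_) (pow-+ (2 + E) (E + μ))) ⟩
          k₀ * β ^ (2 + E + (E + μ))      ≤⟨ *-monoʳ-≤ k₀ (pow-mono (2 + E + (E + μ)) (2 * E + y) (≤-trans (m≤n+m _ 2) (≤-reflexive (trans (e E μ) (cong (2 * E +_) (sym y≡)))))) ⟩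
          k₀ * thr                        ≤⟨ popular ⟩
          D * (n * m)                     ≤⟨ *-monoʳ-≤ D (≤-trans (*-monoˡ-≤ m upper) (≤-reflexive (pow-+ E μ))) ⟩
          D * β ^ (E + μ)                 ∎)
          where
          e : ∀ E μ → 2 + (2 + E + (E + μ)) ≡ 2 * E + (μ + 4)
          e = solve-∀
        t₃ : 16 * (m * R * (β * B) * P) ≤ D
        t₃ = begin
          16 * (m * R * (β * B) * P)                                  ≡⟨ cong (16 *_) (trans (cong (_* P) (trans (cong (_* (β * B)) (pow-+ μ x)) (pow-+ (μ + x) (suc (y + 1 + 2 * a))))) (pow-+ (μ + x + suc (y + 1 + 2 * a)) (2 + E))) ⟩
          16 * β ^ (μ + x + suc (y + 1 + 2 * a) + (2 + E))            ≤⟨ absorb {16} (μ + x + suc (y + 1 + 2 * a) + (2 + E)) (≤-trans (≤ᵇ⇒≤ 16 128 tt) 128≤β) ⟩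
          β ^ suc (μ + x + suc (y + 1 + 2 * a) + (2 + E))             ≤⟨ pow≤D (suc (μ + x + suc (y + 1 + 2 * a) + (2 + E))) (≤-trans (m≤n+m _ 3) (≤-trans (≤-reflexive (e μ x y (2 * a) E)) F₈)) ⟩
          D                                                           ∎
          where
          e : ∀ μ x y a E → 3 + suc (μ + x + suc (y + 1 + a) + (2 + E)) ≡ E + (μ + x + y + a + 8)
          e = solve-∀
        t₄ : 16 * (m * m * β * P) * B₂ ≤ D + D
        t₄ = begin
          16 * (m * m * β * P) * B₂                ≤⟨ *-monoˡ-≤ B₂ (begin
            16 * (m * m * β * P)                     ≡⟨ cong (16 *_) (trans (e′ m β P) (trans (cong (_* (β * P)) (pow-+ μ μ)) (pow-+ (μ + μ) (3 + E)))) ⟩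
            16 * β ^ (μ + μ + (3 + E))               ≤⟨ absorb {16} (μ + μ + (3 + E)) (≤-trans (≤ᵇ⇒≤ 16 128 tt) 128≤β) ⟩
            β ^ suc (μ + μ + (3 + E))                ≤⟨ pow-mono (suc (μ + μ + (3 + E))) κ (≤-trans (m≤n+m _ 3) (≤-trans (≤-reflexive (e μ E)) F₇)) ⟩
            β ^ κ                                    ∎) ⟩
          β ^ κ * B₂                               ≡⟨ *-comm (β ^ κ) B₂ ⟩
          β ^ κ + (D / β ^ κ) {{pow≢0 κ}} * β ^ κ  ≤⟨ +-mono-≤ (pow≤D κ F₆) (m/n*n≤m D (β ^ κ) {{pow≢0 κ}}) ⟩
          D + D                                    ∎
          where
          e : ∀ μ E → 3 + suc (μ + μ + (3 + E)) ≡ E + 2 * μ + 7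
          e = solve-∀
          e′ : ∀ m b p → m * m * b * p ≡ m * m * (b * p)
          e′ = solve-∀
        t₅ : suc (suc E) * k * P ≤ D
        t₅ = begin
          suc (suc E) * k * P           ≤⟨ *-monoˡ-≤ P (*-monoˡ-≤ k (≤-trans (m≤m+n (2 + E) _) J≤)) ⟩
          β * k * P                     ≡⟨ e β k P ⟩
          k * β ^ (3 + E)               ≤⟨ *-monoʳ-≤ k (pow-mono (3 + E) (E + 4) (≤-trans (n≤1+n (3 + E)) (≤-reflexive (+-comm 4 E)))) ⟩
          k * β ^ (E + 4)               ≤⟨ m/n*n≤m D (β ^ (E + 4)) {{pow≢0 (E + 4)}} ⟩
          D                             ∎
          where
          e : ∀ b k p → b * k * p ≡ k * (b * p)
          e = solve-∀
        t₆ : β ^ 3 * P ≤ D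
        t₆ = ≤-trans (≤-reflexive (pow-+ 3 (2 + E))) (pow≤D (3 + (2 + E)) (≤-trans (≤-trans (≤-reflexive (+-comm 5 E)) (+-monoʳ-≤ E (≤ᵇ⇒≤ 5 8 tt))) 8≤δ))

      short-list : ∀ {s l} X → X ⊆ A → Unique X → (s + β ^ 3) * (β ^ E * β) ≤ D → l ≤ length X * grow (suc E) 1 + s → l ≤ β * β ^ E
      short-list {s} {l} X X⊆ uX le l≤ = begin
        l                                              ≤⟨ l≤ ⟩
        length X * grow (suc E) 1 + s                  ≤⟨ +-mono-≤ (*-monoˡ-≤ (grow (suc E) 1) (≤-trans (⊆⇒length≤ _≟_ uX X⊆) upper)) s≤ ⟩
        β ^ E * grow (suc E) 1 + β ^ E                 ≡⟨ trans (+-comm (β ^ E * grow (suc E) 1) (β ^ E)) (trans (sym (*-suc (β ^ E) (grow (suc E) 1))) (*-comm (β ^ E) _)) ⟩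
        suc (grow (suc E) 1) * β ^ E                   ≤⟨ *-monoˡ-≤ (β ^ E) cost ⟩
        β * β ^ E                                      ∎
        where
        open ≤-Reasoning
        s≤ : s ≤ β ^ E
        s≤ = *-cancelʳ-≤ _ _ (β ^ E) {{pow≢0 E}} (begin
          s * β ^ E                         ≤⟨ *-mono-≤ (m≤m+n s (β ^ 3)) (m≤m*n (β ^ E) β) ⟩
          (s + β ^ 3) * (β ^ E * β)         ≤⟨ le ⟩
          D                                 ≤⟨ ∣⊟∣≤ A A ⟩
          n * n                             ≤⟨ *-mono-≤ upper upper ⟩
          β ^ E * β ^ E                     ∎)

    opaque
      describe : ∃ λ A★ → A★ ⊆ A × Unique A★ × n ≤ 4 * length A★ ×
                 (∃ λ ρ → ∃ λ L → Prog ρ L × A★ ⊆ L × length L ≤ β * β ^ E × (ρ + β ^ 3) * (β ^ E * β) ≤ D)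
      describe = go (Start.start-window 𝔾 A uA 0<n m thr D β τ ≤-refl (0<pow μ) (0<pow (2 * E + y)) n<2^β (λ u n≤ _ → flat-params u n≤))
        where
        rich? : ∀ W v → Dec (m ≤ length (cell A W v))
        rich? W v = m ≤? length (cell A W v)
        go : (∃ λ S → Σ (Window S 1) λ W → 𝟘 ∈ S × (∃ λ k → k * thr ≤ D * (n * m) × length S ≤ 1 + (k + 8 * m * τ)) ×
               n ≤ 4 * length (filter (rich? (Window.elems W)) A)) →
             ∃ λ A★ → A★ ⊆ A × Unique A★ × n ≤ 4 * length A★ ×
               (∃ λ ρ → ∃ λ L → Prog ρ L × A★ ⊆ L × length L ≤ β * β ^ E × (ρ + β ^ 3) * (β ^ E * β) ≤ D)
        go (S , W , 𝟘∈S , (k₀ , popular , S≤) , many) = A★ , A★⊆ , uA★ , many ,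
          finish (Chain.generated 𝔾 𝔸 A wf A⊆ uA m M k β D M¹⁴≤m ≤-refl (0<pow μ₀) A★ A★⊆ 0<k (suc E) W 𝟘∈S
            (λ v∈ → proj₂ (∈-filter⁻ (rich? (Window.elems W)) {xs = A} v∈)) expands (≤-trans (s≤s upper) (^-monoʳ-< β 2≤β (n<1+n E))))
          where
          A★ : List G
          A★ = filter (rich? (Window.elems W)) A
          A★⊆ : A★ ⊆ A
          A★⊆ v∈ = proj₁ (∈-filter⁻ (rich? (Window.elems W)) {xs = A} v∈)
          uA★ : Unique A★
          uA★ = Uniq.filter⁺ (rich? (Window.elems W)) uA
          finish : (∃ λ S′ → length S′ ≤ length S + suc (suc E) * k × (∀ {v} → v ∈ A★ → Der S′ (grow (suc E) 1) v) × 𝟘 ∈ S′) →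
                   ∃ λ ρ → ∃ λ L → Prog ρ L × A★ ⊆ L × length L ≤ β * β ^ E × (ρ + β ^ 3) * (β ^ E * β) ≤ D
          finish (S′ , S′≤ , ders , _) =
            let (L , prog , _ , sub , L≤) = realise-all A★ ders id (seeds S′)
                few = choices {length S} {length S′} {k₀} popular S≤ S′≤
            in length S′ , L , prog , sub , short-list A★ A★⊆ uA★ few L≤ , few

-- Descent to a subset with a short description

record Large (Q β : ℕ) : Set where
  field
    128≤β : 128 ≤ β
    4Q≤β  : 4 * Q ≤ β
    poly  : β ^ (2 * E) < 2 ^ β
    J≤    : 2 * (2 + E) ≤ β
    cost  : suc (grow (suc E) 1) ≤ β
    4²ᴱ≤  : 4 ^ (2 * E) ≤ β

opaque
  β₀ : ℕ → ℕ
  β₀ Q = 128 + (4 * Q + (suc (2 * E) ^ suc (2 * E) + (2 * (2 + E) + (suc (grow (suc E) 1) + 4 ^ (2 * E)))))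

  large : ∀ Q {β} → β₀ Q ≤ β → Large Q β
  large Q {β} le = record
    { 128≤β = ≤-trans (m≤m+n 128 _) le
    ; 4Q≤β  = ≤-trans (m≤m+n (4 * Q) _) le₁
    ; poly  = poly<exp (2 * E) β (≤-trans (m≤m+n (suc (2 * E) ^ suc (2 * E)) _) le₂)
    ; J≤    = ≤-trans (m≤m+n (2 * (2 + E)) _) le₃
    ; cost  = ≤-trans (m≤m+n (suc (grow (suc E) 1)) _) le₄
    ; 4²ᴱ≤  = ≤-trans (m≤n+m (4 ^ (2 * E)) (suc (grow (suc E) 1))) le₄
    }
    where
    le₁ : 4 * Q + (suc (2 * E) ^ suc (2 * E) + (2 * (2 + E) + (suc (grow (suc E) 1) + 4 ^ (2 * E)))) ≤ β
    le₁ = ≤-trans (m≤n+m _ 128) le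
    le₂ : suc (2 * E) ^ suc (2 * E) + (2 * (2 + E) + (suc (grow (suc E) 1) + 4 ^ (2 * E))) ≤ β
    le₂ = ≤-trans (m≤n+m _ (4 * Q)) le₁
    le₃ : 2 * (2 + E) + (suc (grow (suc E) 1) + 4 ^ (2 * E)) ≤ β
    le₃ = ≤-trans (m≤n+m _ (suc (2 * E) ^ suc (2 * E))) le₂
    le₄ : suc (grow (suc E) 1) + 4 ^ (2 * E) ≤ β
    le₄ = ≤-trans (m≤n+m _ (2 * (2 + E))) le₃

module _ (𝔾 : FinGroup) where
  open Sets 𝔾
  open Growth 𝔾
  open Programs 𝔾

  module KeyProposition (Q β : ℕ) (lrg : Large Q β) where

    open Large lrg

    -- With N = |V| and n ≈ 2 log₂ N, the ρ free choices take N ^ ρ ≈ 2 ^ (ρ * n / 2) values, which the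
    -- last inequality compares with the probability 2 ^ (- |X ⊟ X| / 2) that X is monochromatic.
    Described : List G → Set
    Described A = ∃ λ ρ → ∃ λ L → ∃ λ X → Prog ρ L × X ⊆ L × X ⊆ A × Unique X × length L ≤ β * β ^ E ×
      Q * ((ρ + β ^ 3) * β ^ E) ≤ suc Q * length (X ⊟ X)

    private
      0<β : 0 < β
      0<β = ≤-trans (s≤s z≤n) 128≤β
      open Powers β 0<β

      -- Each step of the descent costs a factor 4 in |A| and gains a factor β in |A ⊟ A|.
      descend : ∀ f t (𝔸 A : List G) → WindowFree 𝔸 → A ⊆ 𝔸 → Unique A → length A ≤ β ^ E →
                f + t ≡ 2 * E → β ^ E ≤ 4 ^ t * length A → length (A ⊟ A) < β ^ f → length (A ⊟ A) * β ^ c < β ^ (2 * E) → Described A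
      descend f t 𝔸 A wf A⊆ uA upper f+t big D< sparse =
        go f f+t D< (Sparse.describe 𝔾 β 128≤β poly J≤ cost 𝔸 wf A A⊆ uA lower upper sparse)
        where
        open ≤-Reasoning
        D = length (A ⊟ A)
        lower : β ^ E₁ ≤ length A
        lower = *-cancelˡ-≤ β (begin
          β * β ^ E₁          ≡⟨ cong (β ^_) (sym E≡) ⟩
          β ^ E               ≤⟨ big ⟩
          4 ^ t * length A    ≤⟨ *-monoˡ-≤ (length A) (≤-trans (^-monoʳ-≤ 4 (≤-trans (m≤n+m t f) (≤-reflexive f+t))) 4²ᴱ≤) ⟩
          β * length A        ∎)
        go : ∀ f → f + t ≡ 2 * E → D < β ^ f → (∃ λ A★ → A★ ⊆ A × Unique A★ × length A ≤ 4 * length A★ ×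
               (∃ λ ρ → ∃ λ L → Prog ρ L × A★ ⊆ L × length L ≤ β * β ^ E × (ρ + β ^ 3) * (β ^ E * β) ≤ D)) → Described A
        go zero    _   D< (_ , _ , _ , _ , ρ , _ , _ , _ , _ , few) =
          ⊥-elim (<⇒≱ D< (≤-trans (*-mono-≤ (≤-trans (0<pow 3) (m≤n+m (β ^ 3) ρ)) (*-mono-≤ (0<pow E) 0<β)) few))
        go (suc f) f+t D< (A★ , A★⊆ , uA★ , quarter , ρ , L , prog , A★⊆L , L≤ , few) = decide (D ≤? length (A★ ⊟ A★) * β)
          where
          decide : Dec (D ≤ length (A★ ⊟ A★) * β) → Described A
          -- Here |A★ - A★| ≥ D / β, and the spare factor β in `few` absorbs the loss.
          decide (yes D≤) = ρ , L , A★ , prog , A★⊆L , A★⊆ , uA★ , L≤ ,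
            *-mono-≤ (n≤1+n Q) (*-cancelʳ-≤ _ _ β (≤-trans (≤-reflexive (*-assoc (ρ + β ^ 3) (β ^ E) β)) (≤-trans few D≤)))
          decide (no D≰) =
            let (ρ , L , X , prog , X⊆L , X⊆ , uX , L≤ , few) =
                  descend f (suc t) 𝔸 A★ wf (A⊆ ∘ A★⊆) uA★ (≤-trans (⊆⇒length≤ _≟_ uA★ A★⊆) upper) (trans (+-suc f t) f+t)
                    (≤-trans big (≤-trans (*-monoʳ-≤ (4 ^ t) quarter) (≤-reflexive (e (4 ^ t) (length A★)))))
                    (*-cancelˡ-< β _ _ (≤-trans (s≤s (≤-reflexive (*-comm β (length (A★ ⊟ A★))))) (≤-trans (≰⇒> D≰) (<⇒≤ D<))))
                    (≤-trans (s≤s (*-monoˡ-≤ (β ^ c) (∣⊟∣-mono {A★} {A} {A★} {A} A★⊆ A★⊆))) sparse)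
            in ρ , L , X , prog , X⊆L , A★⊆ ∘ X⊆ , uX , L≤ , few
            where
            e : ∀ p q → p * (4 * q) ≡ 4 * p * q
            e = solve-∀

    opaque
      described : ∀ {A} → WindowFree A → Unique A → length A ≡ β ^ E → Described A
      described {A} wf uA size = decide (β ^ (2 * E) ≤? length (A ⊟ A) * β ^ c)
        where
        decide : Dec (β ^ (2 * E) ≤ length (A ⊟ A) * β ^ c) → Described A
        decide (yes dense) =
          let (ρ , (L , prog , A⊆L , L≤) , few) = Dense.dense-key 𝔾 β (≤-trans (≤ᵇ⇒≤ 64 128 tt) 128≤β) poly A uA size dense Q 4Q≤β
          in ρ , L , A , prog , A⊆L , id , uA , ≤-trans L≤ (≤-trans (≤-reflexive size) (m≤n*m (β ^ E) β)) ,
             subst (λ n → Q * ((ρ + β ^ 3) * n) ≤ suc Q * length (A ⊟ A)) size few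
        decide (no ¬dense) = descend (2 * E) 0 A A wf id uA (≤-reflexive size) (+-identityʳ (2 * E))
          (≤-reflexive (trans (sym size) (sym (+-identityʳ (length A)))))
          (≤-trans (s≤s (m≤m*n (length (A ⊟ A)) (β ^ c) {{pow≢0 c}})) (≰⇒> ¬dense)) (≰⇒> ¬dense)

-- The method of conditional expectations.
module Avoidance {K : Set} (_≟_ : DecidableEquality K) where

  factor : Maybe Bool → ℕ
  factor nothing  = 2
  factor (just _) = 1

  -- The number of assignments to the keys that agree with a partial assignment.
  weight : List K → (K → Maybe Bool) → ℕ
  weight []       e = 1
  weight (k ∷ ks) e = factor (e k) * weight ks e

  private
    keep : Bool → Maybe Bool → (K → Maybe Bool) → List (K → Maybe Bool) → List (K → Maybe Bool)
    keep _     nothing      e es = e ∷ es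
    keep true  (just true)  e es = e ∷ es
    keep true  (just false) e es = es
    keep false (just true)  e es = es
    keep false (just false) e es = e ∷ es

    -- Keeps the partial assignments that the value c at k does not contradict; these must be
    -- contradicted at later keys.
    restrict : Bool → K → List (K → Maybe Bool) → List (K → Maybe Bool)
    restrict c k []       = []
    restrict c k (e ∷ es) = keep c (e k) e (restrict c k es)

    restrict-∈ : ∀ c k {es e} → e ∈ es → e k ≡ just (not c) ⊎ e ∈ restrict c k es
    restrict-∈ c k {e ∷ es} (here refl) = go c (e k)
      where
      go : ∀ c v → v ≡ just (not c) ⊎ e ∈ keep c v e (restrict c k es)
      go true  nothing      = inj₂ (here refl)
      go false nothing      = inj₂ (here refl)
      go true  (just true)  = inj₂ (here refl)
      go true  (just false) = inj₁ refl
      go false (just true)  = inj₁ refl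
      go false (just false) = inj₂ (here refl)
    restrict-∈ c k {e ∷ es} (there p) = ⊎-map id (weaken c (e k)) (restrict-∈ c k p)
      where
      weaken : ∀ c v {f es} → f ∈ es → f ∈ keep c v e es
      weaken true  nothing      = there
      weaken false nothing      = there
      weaken true  (just true)  = there
      weaken true  (just false) = id
      weaken false (just true)  = id
      weaken false (just false) = there

    restrict-∑ : ∀ k ks es → ∑ (restrict true k es) (weight ks) + ∑ (restrict false k es) (weight ks) ≡ ∑ es (weight (k ∷ ks))
    restrict-∑ k ks []       = refl
    restrict-∑ k ks (e ∷ es) = trans (go (e k) (restrict true k es) (restrict false k es)) (cong (factor (e k) * weight ks e +_) (restrict-∑ k ks es))
      where
      e₁ : ∀ w p q → w + p + (w + q) ≡ 2 * w + (p + q)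
      e₁ = solve-∀
      e₂ : ∀ w p q → w + p + q ≡ 1 * w + (p + q)
      e₂ = solve-∀
      e₃ : ∀ w p q → p + (w + q) ≡ 1 * w + (p + q)
      e₃ = solve-∀
      go : ∀ v es fs → ∑ (keep true v e es) (weight ks) + ∑ (keep false v e fs) (weight ks) ≡
                       factor v * weight ks e + (∑ es (weight ks) + ∑ fs (weight ks))
      go nothing      es fs = e₁ (weight ks e) (∑ es (weight ks)) (∑ fs (weight ks))
      go (just true)  es fs = e₂ (weight ks e) (∑ es (weight ks)) (∑ fs (weight ks))
      go (just false) es fs = e₃ (weight ks e) (∑ es (weight ks)) (∑ fs (weight ks))

    override : {P : Set} → Dec P → Bool → Bool → Bool
    override (yes _) c _ = c
    override (no _)  _ d = d

    override-yes : {P : Set} (d : Dec P) → P → ∀ {c c′} → override d c c′ ≡ c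
    override-yes (yes _) _ = refl
    override-yes (no ¬p) p = contradiction p ¬p

    override-no : {P : Set} (d : Dec P) → ¬ P → ∀ {c c′} → override d c c′ ≡ c′
    override-no (yes p) ¬p = contradiction p ¬p
    override-no (no _)  _  = refl

  -- The surviving weights for the two values at k add up to the total weight, which is less than 2
  -- * 2 ^ length ks, so one value leaves less than 2 ^ length ks. When the keys are exhausted, a
  -- weight below 1 means that no partial assignment has survived.
  avoid : ∀ {ks} → Unique ks → ∀ es → ∑ es (weight ks) < 2 ^ length ks →
          ∃ λ (b : K → Bool) → ∀ {e} → e ∈ es → ∃ λ k → k ∈ ks × e k ≡ just (not (b k))
  avoid {[]} _ es lt = (λ _ → true) , λ e∈ → ⊥-elim (<⇒≱ lt (∈⇒≤∑ (weight []) e∈))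
  avoid {k ∷ ks} (k∉ ∷ u) es lt = choose (∑ (restrict true k es) (weight ks) <? 2 ^ length ks)
    where
    Avoided = ∃ λ (b : K → Bool) → ∀ {e} → e ∈ es → ∃ λ k′ → k′ ∈ k ∷ ks × e k′ ≡ just (not (b k′))
    extend : ∀ c → (∃ λ (b : K → Bool) → ∀ {e} → e ∈ restrict c k es → ∃ λ k′ → k′ ∈ ks × e k′ ≡ just (not (b k′))) → Avoided
    extend c (b , avoids) = (λ x → override (x ≟ k) c (b x)) , λ e∈ → go (restrict-∈ c k e∈)
      where
      go : ∀ {e} → e k ≡ just (not c) ⊎ e ∈ restrict c k es → ∃ λ k′ → k′ ∈ k ∷ ks × e k′ ≡ just (not (override (k′ ≟ k) c (b k′)))
      go (inj₁ eq) = k , here refl , trans eq (cong (just ∘ not) (sym (override-yes (k ≟ k) refl)))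
      go (inj₂ e∈) = let (k′ , k′∈ , eq) = avoids e∈ in
        k′ , there k′∈ , trans eq (cong (just ∘ not) (sym (override-no (k′ ≟ k) (All.lookup k∉ k′∈ ∘ sym))))
    choose : Dec (∑ (restrict true k es) (weight ks) < 2 ^ length ks) → Avoided
    choose (yes lt₁) = extend true (avoid u (restrict true k es) lt₁)
    choose (no ≮)    = extend false (avoid u (restrict false k es) (+-cancelˡ-< (2 ^ length ks) _ _ (begin-strict
      2 ^ length ks + ∑ (restrict false k es) (weight ks)                             ≤⟨ +-monoˡ-≤ _ (≮⇒≥ ≮) ⟩
      ∑ (restrict true k es) (weight ks) + ∑ (restrict false k es) (weight ks)        ≡⟨ restrict-∑ k ks es ⟩
      ∑ es (weight (k ∷ ks))                                                          <⟨ lt ⟩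
      2 ^ length ks + (2 ^ length ks + 0)                                             ≡⟨ cong (2 ^ length ks +_) (+-identityʳ _) ⟩
      2 ^ length ks + 2 ^ length ks                                                   ∎)))
      where open ≤-Reasoning

  mark : {P : Set} → (P → Bool) → Dec P → Maybe Bool
  mark f (yes p) = just (f p)
  mark f (no _)  = nothing

  weight-mark : {P : K → Set} (P? : ∀ k → Dec (P k)) (f : ∀ k → P k → Bool) (ks : List K) →
                weight ks (λ k → mark (f k) (P? k)) * 2 ^ count P? ks ≡ 2 ^ length ks
  weight-mark P? f []       = refl
  weight-mark P? f (k ∷ ks) with P? k
  ... | yes _ = trans (e (weight ks (λ k → mark (f k) (P? k))) (2 ^ count P? ks)) (cong (2 *_) (weight-mark P? f ks))
    where
    e : ∀ w p → 1 * w * (2 * p) ≡ 2 * (w * p)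
    e = solve-∀
  ... | no _  = trans (*-assoc 2 (weight ks (λ k → mark (f k) (P? k))) (2 ^ count P? ks)) (cong (2 *_) (weight-mark P? f ks))

-- The colouring

module Colouring (𝔾 : FinGroup) where
  open Sets 𝔾
  open Growth 𝔾

  private
    double-⊝ : ∀ g → ⊝ g ⊕ ⊝ g ≡ ⊝ (g ⊕ g)
    double-⊝ g = solve (:- x₀ :+ :- x₀) (:- (x₀ :+ x₀)) (g ∷ []) refl

    ⊝-involutive : ∀ g → ⊝ (⊝ g) ≡ g
    ⊝-involutive g = solve (:- (:- x₀)) x₀ (g ∷ []) refl

  ·-+ : ∀ j k g → (j + k) · g ≡ j · g ⊕ k · g
  ·-+ zero    k g = solve x₀ (:0 :+ x₀) (k · g ∷ []) refl
  ·-+ (suc j) k g = trans (cong (g ⊕_) (·-+ j k g)) (solve (x₀ :+ (x₁ :+ x₂)) ((x₀ :+ x₁) :+ x₂) (g ∷ j · g ∷ k · g ∷ []) refl)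

  ·-* : ∀ j k g → (j * k) · g ≡ j · k · g
  ·-* zero    k g = refl
  ·-* (suc j) k g = trans (·-+ k (j * k) g) (cong (k · g ⊕_) (·-* j k g))

  2·-injective : ∀ {g h} → 2 · g ≡ 2 · h → g ≡ h
  2·-injective {g} {h} eq = double-injective (trans (solve (x₀ :+ x₀) (x₀ :+ (x₀ :+ :0)) (g ∷ []) refl) (trans eq (solve (x₀ :+ (x₀ :+ :0)) (x₀ :+ x₀) (h ∷ []) refl)))

  2^·-injective : ∀ i {g h} → (2 ^ i) · g ≡ (2 ^ i) · h → g ≡ h
  2^·-injective zero    {g} {h} eq = by₁ (solve (x₀ :- x₁) ((x₀ :+ :0) :- (x₁ :+ :0)) (g ∷ h ∷ []) refl) eq
  2^·-injective (suc i) {g} {h} eq = 2^·-injective i (2·-injective (trans (sym (·-* 2 (2 ^ i) g)) (trans eq (·-* 2 (2 ^ i) h))))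

  ·-𝟘 : ∀ k → k · 𝟘 ≡ 𝟘
  ·-𝟘 zero    = refl
  ·-𝟘 (suc k) = trans (cong (𝟘 ⊕_) (·-𝟘 k)) (solve (:0 :+ :0) :0 [] refl)

  2^·-nonzero : ∀ i {g} → g ≢ 𝟘 → (2 ^ i) · g ≢ 𝟘
  2^·-nonzero i g≢𝟘 eq = g≢𝟘 (2^·-injective i (trans eq (sym (·-𝟘 (2 ^ i)))))

  -- `done` lists the elements treated so far. Once it is everything, each g ≠ 0 is in M, has its
  -- double in M, or is the double of a member.
  record Alternating (M done : List G) : Set where
    field
      nonzero   : 𝟘 ∉ M
      negated   : ∀ {g} → g ∈ M → ⊝ g ∈ M
      sparse    : ∀ {g} → g ∈ M → g ⊕ g ∉ M
      maximal   : ∀ {g} → g ∈ done → g ≢ 𝟘 → g ∈ M ⊎ g ⊕ g ∈ M ⊎ (∃ λ h → h ∈ M × h ⊕ h ≡ g)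

  private
    open Alternating

    -- Adding g and - g together could create a forbidden pair only through 2g = g, through 2g = -
    -- g, which the absence of 3-torsion excludes, or through a pair with an old member, which the
    -- hypotheses exclude up to sign.
    extend : ∀ {M done g} → Alternating M done → g ≢ 𝟘 → g ⊕ g ∉ M → (∀ {h} → h ∈ M → h ⊕ h ≢ g) → Alternating (g ∷ ⊝ g ∷ M) (g ∷ done)
    extend {M} {done} {g} alt g≢𝟘 ¬double ¬half = record { nonzero = nz ; negated = ng ; sparse = sp ; maximal = mx }
      where
      nz : 𝟘 ∉ g ∷ ⊝ g ∷ M
      nz (here eq)         = g≢𝟘 (sym eq)
      nz (there (here eq)) = g≢𝟘 (by₁ (solve (x₀ :- :0) (:0 :- :- x₀) (g ∷ []) refl) eq)
      nz (there (there p)) = nonzero alt p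
      ng : ∀ {h} → h ∈ g ∷ ⊝ g ∷ M → ⊝ h ∈ g ∷ ⊝ g ∷ M
      ng (here eq)         = there (here (cong ⊝_ eq))
      ng (there (here eq)) = here (trans (cong ⊝_ eq) (⊝-involutive g))
      ng (there (there p)) = there (there (negated alt p))
      3g : g ⊕ g ≡ ⊝ g → ⊥
      3g eq = g≢𝟘 (no-3-torsion g (by₁ (solve ((x₀ :+ x₀ :+ x₀) :- :0) ((x₀ :+ x₀) :- :- x₀) (g ∷ []) refl) eq))
      own : g ⊕ g ∉ g ∷ ⊝ g ∷ M
      own (here eq)         = g≢𝟘 (by₁ (solve (x₀ :- :0) ((x₀ :+ x₀) :- x₀) (g ∷ []) refl) eq)
      own (there (here eq)) = 3g eq
      own (there (there p)) = ¬double p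
      undo : ∀ {h} → h ≡ ⊝ g → ⊝ (h ⊕ h) ≡ g ⊕ g
      undo refl = solve (:- (:- x₀ :+ :- x₀)) (x₀ :+ x₀) (g ∷ []) refl
      sp : ∀ {h} → h ∈ g ∷ ⊝ g ∷ M → h ⊕ h ∉ g ∷ ⊝ g ∷ M
      sp (here eq)         q = own (subst (λ h → h ⊕ h ∈ g ∷ ⊝ g ∷ M) eq q)
      sp (there (here eq)) q = own (subst (_∈ g ∷ ⊝ g ∷ M) (undo eq) (ng q))
      sp (there (there p)) (here eq) = ¬half p eq
      sp {h} (there (there p)) (there (here eq)) = ¬half (negated alt p) (trans (double-⊝ h) (trans (cong ⊝_ eq) (⊝-involutive g)))
      sp (there (there p)) (there (there q)) = sparse alt p q
      mx : ∀ {h} → h ∈ g ∷ done → h ≢ 𝟘 → h ∈ g ∷ ⊝ g ∷ M ⊎ h ⊕ h ∈ g ∷ ⊝ g ∷ M ⊎ (∃ λ h′ → h′ ∈ g ∷ ⊝ g ∷ M × h′ ⊕ h′ ≡ h)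
      mx (here eq) _  = inj₁ (here eq)
      mx (there p) h≢ = go (maximal alt p h≢)
        where
        go : ∀ {h} → h ∈ M ⊎ h ⊕ h ∈ M ⊎ (∃ λ h′ → h′ ∈ M × h′ ⊕ h′ ≡ h) → h ∈ g ∷ ⊝ g ∷ M ⊎ h ⊕ h ∈ g ∷ ⊝ g ∷ M ⊎ (∃ λ h′ → h′ ∈ g ∷ ⊝ g ∷ M × h′ ⊕ h′ ≡ h)
        go (inj₁ q)                    = inj₁ (there (there q))
        go (inj₂ (inj₁ q))             = inj₂ (inj₁ (there (there q)))
        go (inj₂ (inj₂ (h′ , q , eq))) = inj₂ (inj₂ (h′ , there (there q) , eq))

    skip : ∀ {M done g} → Alternating M done → (g ≢ 𝟘 → g ∈ M ⊎ g ⊕ g ∈ M ⊎ (∃ λ h → h ∈ M × h ⊕ h ≡ g)) → Alternating M (g ∷ done)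
    skip alt now = record { nonzero = nonzero alt ; negated = negated alt ; sparse = sparse alt
                          ; maximal = λ { (here refl) → now ; (there p) → maximal alt p } }

    greedy : ∀ xs → ∃ λ M → Alternating M xs
    greedy [] = [] , record { nonzero = λ () ; negated = λ () ; sparse = λ () ; maximal = λ () }
    greedy (g ∷ xs) = go (greedy xs)
      where
      go : (∃ λ M → Alternating M xs) → ∃ λ M → Alternating M (g ∷ xs)
      go (M , alt) = decide (g ≟ 𝟘) ((g ⊕ g) ∈? M) (Any.any? (λ h → (h ⊕ h) ≟ g) M)
        where
        decide : Dec (g ≡ 𝟘) → Dec (g ⊕ g ∈ M) → Dec (Any (λ h → h ⊕ h ≡ g) M) → ∃ λ M → Alternating M (g ∷ xs)
        decide (yes eq) _ _             = M , skip alt (contradiction eq)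
        decide (no _)  (yes p) _        = M , skip alt (λ _ → inj₂ (inj₁ p))
        decide (no _)  (no _)  (yes ex) = M , skip alt (λ _ → inj₂ (inj₂ (find ex)))
        decide (no ≢𝟘) (no ¬d) (no ¬h)  = _ , extend alt ≢𝟘 ¬d (λ h∈ eq → ¬h (Any.map (λ { refl → eq }) h∈))

    first : {P : Pred G 0ℓ} → Decidable P → List G → G
    first P? []       = 𝟘
    first P? (x ∷ xs) = if does (P? x) then x else first P? xs

    first-sat : {P : Pred G 0ℓ} (P? : Decidable P) {xs : List G} → Any P xs → P (first P? xs)
    first-sat P? {x ∷ xs} ex with P? x
    first-sat P? {x ∷ xs} ex         | yes p = p
    first-sat P? {x ∷ xs} (here p)   | no ¬p = contradiction p ¬p
    first-sat P? {x ∷ xs} (there ex) | no _  = first-sat P? ex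

    first-cong : {P Q : Pred G 0ℓ} (P? : Decidable P) (Q? : Decidable Q) → (∀ {x} → P x → Q x) → (∀ {x} → Q x → P x) → ∀ xs → first P? xs ≡ first Q? xs
    first-cong P? Q? to from []       = refl
    first-cong P? Q? to from (x ∷ xs) with P? x | Q? x
    ... | yes _ | yes _ = refl
    ... | yes p | no ¬q = contradiction (to p) ¬q
    ... | no ¬p | yes q = contradiction (from q) ¬p
    ... | no _  | no _  = first-cong P? Q? to from xs

  Opposite : G → G → Set
  Opposite g h = h ≡ g ⊎ h ≡ ⊝ g

  private
    opposite? : ∀ g h → Dec (Opposite g h)
    opposite? g h = (h ≟ g) ⊎-dec (h ≟ (⊝ g))

    opposite-⊝ : ∀ {g h} → Opposite (⊝ g) h → Opposite g h
    opposite-⊝ (inj₁ eq) = inj₂ eq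
    opposite-⊝ {g} (inj₂ eq) = inj₁ (trans eq (⊝-involutive g))

    opposite-⊝⁻¹ : ∀ {g h} → Opposite g h → Opposite (⊝ g) h
    opposite-⊝⁻¹ {g} (inj₁ eq) = inj₂ (trans eq (sym (⊝-involutive g)))
    opposite-⊝⁻¹ (inj₂ eq) = inj₁ eq

    opposite-join : ∀ {g h k} → Opposite g k → Opposite h k → Opposite g h
    opposite-join (inj₁ refl) (inj₁ refl) = inj₁ refl
    opposite-join {h = h} (inj₁ refl) (inj₂ eq) = inj₂ (trans (sym (⊝-involutive h)) (cong ⊝_ (sym eq)))
    opposite-join (inj₂ refl) (inj₁ refl) = inj₂ refl
    opposite-join {g} {h} (inj₂ refl) (inj₂ eq) = inj₁ (trans (sym (⊝-involutive h)) (trans (cong ⊝_ (sym eq)) (⊝-involutive g)))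

  opaque
    -- The first of g and - g in the enumeration, hence a name for the pair that both elements agree
    -- on.
    rep : G → G
    rep g = first (opposite? g) univ

    rep-⊝ : ∀ g → rep (⊝ g) ≡ rep g
    rep-⊝ g = first-cong (opposite? (⊝ g)) (opposite? g) opposite-⊝ opposite-⊝⁻¹ univ

    rep-opposite : ∀ g → Opposite g (rep g)
    rep-opposite g = first-sat (opposite? g) (Any.map (λ { refl → inj₁ refl }) (univ-complete g))

    M : List G
    M = proj₁ (greedy univ)

    alternating : Alternating M univ
    alternating = proj₂ (greedy univ)

  rep-injective : ∀ {g h} → rep g ≡ rep h → Opposite g h
  rep-injective {g} {h} eq = opposite-join (rep-opposite g) (subst (Opposite h) (sym eq) (rep-opposite h))

  private
    closed⁻¹ : ∀ {g h} → Opposite g h → h ∈ M → g ∈ M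
    closed⁻¹ (inj₁ refl) p = p
    closed⁻¹ {g} (inj₂ refl) p = subst (_∈ M) (⊝-involutive g) (negated alternating p)

  data Class (g : G) : Set where
    member  : g ∈ M → Class g
    doubled : ∀ h → h ∈ M → h ⊕ h ≡ g → Class g
    neither : g ∉ M → (∀ {h} → h ∈ M → h ⊕ h ≢ g) → Class g

  -- The element 2h with h ∈ M takes its bit from the pair of h, and `signOf` reverses it; every
  -- other element uses the bit of its own pair.
  keyOf : ∀ {g} → Class g → G
  keyOf {g} (member _)      = rep g
  keyOf     (doubled h _ _) = rep h
  keyOf {g} (neither _ _)   = rep g

  signOf : ∀ {g} → Class g → Bool
  signOf (member _)      = true
  signOf (doubled _ _ _) = false
  signOf (neither _ _)   = true

  private
    classify′ : ∀ {g} → Dec (g ∈ M) → Dec (Any (λ h → h ⊕ h ≡ g) M) → Class g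
    classify′ (yes p) _        = member p
    classify′ (no _)  (yes ex) = let (h , h∈ , eq) = find ex in doubled h h∈ eq
    classify′ (no ¬p) (no ¬ex) = neither ¬p (λ h∈ eq → ¬ex (Any.map (λ { refl → eq }) h∈))

    ⊕-opposite : ∀ {g h g′ h′} → g ⊕ g ≡ g′ → h ⊕ h ≡ h′ → Opposite g h → Opposite g′ h′
    ⊕-opposite refl refl (inj₁ refl) = inj₁ refl
    ⊕-opposite {g} refl refl (inj₂ refl) = inj₂ (double-⊝ g)

    fibre′ : ∀ {g h} (p : Class g) (q : Class h) → keyOf p ≡ keyOf q → signOf p ≡ signOf q → Opposite g h
    fibre′ (member _)        (member _)        eq _ = rep-injective eq
    fibre′ (member _)        (neither _ _)     eq _ = rep-injective eq
    fibre′ (doubled _ _ eq₁) (doubled _ _ eq₂) eq _ = ⊕-opposite eq₁ eq₂ (rep-injective eq)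
    fibre′ (neither _ _)     (member _)        eq _ = rep-injective eq
    fibre′ (neither _ _)     (neither _ _)     eq _ = rep-injective eq

    same : ∀ {g h} (p : Class g) (q : Class h) → Opposite g h → keyOf p ≡ keyOf q × signOf p ≡ signOf q
    same {g} p q (inj₁ refl) = go p q
      where
      go : (p q : Class g) → keyOf p ≡ keyOf q × signOf p ≡ signOf q
      go (member _)        (member _)        = refl , refl
      go (member g∈)       (doubled h h∈ eq) = ⊥-elim (sparse alternating h∈ (subst (_∈ M) (sym eq) g∈))
      go (member g∈)       (neither g∉ _)    = contradiction g∈ g∉
      go (doubled h h∈ eq) (member g∈)       = ⊥-elim (sparse alternating h∈ (subst (_∈ M) (sym eq) g∈))
      go (doubled h _ eq)  (doubled h′ _ eq′) = cong rep (double-injective (trans eq (sym eq′))) , refl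
      go (doubled h h∈ eq) (neither _ ¬h)    = ⊥-elim (¬h h∈ eq)
      go (neither g∉ _)    (member g∈)       = contradiction g∈ g∉
      go (neither _ ¬h)    (doubled h h∈ eq) = ⊥-elim (¬h h∈ eq)
      go (neither _ _)     (neither _ _)     = refl , refl
    same {g} p q (inj₂ refl) = let (k , s) = same (mirror p) q (inj₁ refl) in trans (key p) k , trans (sign p) s
      where
      mirror : Class g → Class (⊝ g)
      mirror (member g∈)       = member (negated alternating g∈)
      mirror (doubled h h∈ eq) = doubled (⊝ h) (negated alternating h∈) (trans (double-⊝ h) (cong ⊝_ eq))
      mirror (neither g∉ ¬h)   = neither (g∉ ∘ closed⁻¹ (inj₂ refl)) (λ {h} h∈ eq → ¬h (negated alternating h∈) (trans (double-⊝ h) (trans (cong ⊝_ eq) (⊝-involutive g))))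
      key : ∀ p → keyOf p ≡ keyOf (mirror p)
      key (member _)      = sym (rep-⊝ g)
      key (doubled h _ _) = sym (rep-⊝ h)
      key (neither _ _)   = sym (rep-⊝ g)
      sign : ∀ p → signOf p ≡ signOf (mirror p)
      sign (member _)      = refl
      sign (doubled _ _ _) = refl
      sign (neither _ _)   = refl

  opaque
    classify : ∀ g → Class g
    classify g = classify′ (g ∈? M) (Any.any? (λ h → (h ⊕ h) ≟ g) M)

  key : G → G
  key g = keyOf (classify g)

  sign : G → Bool
  sign g = signOf (classify g)

  -- A bit governs at most the two pairs ± h and ± 2h, and these carry different signs.
  key-fibre : ∀ {g h} → key g ≡ key h → sign g ≡ sign h → Opposite g h
  key-fibre {g} {h} = fibre′ (classify g) (classify h)

  literal : Bool → Bool → Bool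
  literal true  v = v
  literal false v = not v

  literal-involutive : ∀ s v → literal s (literal s v) ≡ v
  literal-involutive true  v = refl
  literal-involutive false v = not-involutive v

  literal-injective : ∀ s t v → literal s v ≡ literal t v → s ≡ t
  literal-injective true  true  v     _  = refl
  literal-injective false false v     _  = refl
  literal-injective true  false true  ()
  literal-injective true  false false ()
  literal-injective false true  true  ()
  literal-injective false true  false ()

  module _ (b : G → Bool) where

    colour : G → Bool
    colour g = literal (sign g) (b (key g))

    colour-⊝ : ∀ g → colour (⊝ g) ≡ colour g
    colour-⊝ g = let (k , s) = same (classify g) (classify (⊝ g)) (inj₂ refl) in sym (cong₂ literal s (cong b k))

    colour-doubled : ∀ {g} → g ∈ M → colour (g ⊕ g) ≡ not (colour g)
    colour-doubled {g} g∈ =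
      let (k , s) = same (classify g) (member g∈) (inj₁ refl)
          (k′ , s′) = same (classify (g ⊕ g)) (doubled g g∈ refl) (inj₁ refl)
      in trans (cong₂ literal s′ (cong b k′)) (cong not (sym (cong₂ literal s (cong b k))))

    private
      2· : ∀ g → 2 · g ≡ g ⊕ g
      2· g = solve (x₀ :+ (x₀ :+ :0)) (x₀ :+ x₀) (g ∷ []) refl
      4· : ∀ g → 4 · g ≡ (g ⊕ g) ⊕ (g ⊕ g)
      4· g = solve (x₀ :+ (x₀ :+ (x₀ :+ (x₀ :+ :0)))) ((x₀ :+ x₀) :+ (x₀ :+ x₀)) (g ∷ []) refl
      8· : ∀ g → 8 · g ≡ ((g ⊕ g) ⊕ (g ⊕ g)) ⊕ ((g ⊕ g) ⊕ (g ⊕ g))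
      8· g = solve (x₀ :+ (x₀ :+ (x₀ :+ (x₀ :+ (x₀ :+ (x₀ :+ (x₀ :+ (x₀ :+ :0)))))))) (((x₀ :+ x₀) :+ (x₀ :+ x₀)) :+ ((x₀ :+ x₀) :+ (x₀ :+ x₀))) (g ∷ []) refl

    Switches : G → Set
    Switches g = colour (2 · g) ≡ not (colour g) ⊎ colour (4 · g) ≡ not (colour (2 · g)) ⊎ colour (8 · g) ≡ not (colour (4 · g))

    -- Maximality of M is applied to 2g rather than to g: its three cases put 2g, 4g or g into M,
    -- and the double of the member has the opposite colour.
    switches : ∀ {g} → g ≢ 𝟘 → Switches g
    switches {g} g≢𝟘 = go (maximal alternating (univ-complete (g ⊕ g)) (λ eq → g≢𝟘 (no-2-torsion g eq)))
      where
      go : g ⊕ g ∈ M ⊎ (g ⊕ g) ⊕ (g ⊕ g) ∈ M ⊎ (∃ λ h → h ∈ M × h ⊕ h ≡ g ⊕ g) → Switches g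
      go (inj₁ p)                   = inj₂ (inj₁ (subst₂ (λ p q → colour p ≡ not (colour q)) (sym (4· g)) (sym (2· g)) (colour-doubled p)))
      go (inj₂ (inj₁ p))            = inj₂ (inj₂ (subst₂ (λ p q → colour p ≡ not (colour q)) (sym (8· g)) (sym (4· g)) (colour-doubled p)))
      go (inj₂ (inj₂ (h , p , eq))) = inj₁ (subst (λ p → colour p ≡ not (colour g)) (sym (2· g)) (colour-doubled (subst (_∈ M) (double-injective eq) p)))

    Mono : Bool → List G → Set
    Mono c A = ∀ {d} → d ∈ A ⊟ A → d ≢ 𝟘 → colour d ≡ c

    mono⇒windowfree : ∀ {c A} → Mono c A → WindowFree A
    mono⇒windowfree {c} mono {d} d≢𝟘 p₁ p₂ p₄ p₈ = go (switches d≢𝟘)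
      where
      c₁ = mono p₁ d≢𝟘
      c₂ = mono p₂ (2^·-nonzero 1 d≢𝟘)
      c₄ = mono p₄ (2^·-nonzero 2 d≢𝟘)
      c₈ = mono p₈ (2^·-nonzero 3 d≢𝟘)
      clash : ∀ {p q} → p ≡ c → q ≡ c → p ≡ not q → ⊥
      clash refl refl eq = not-¬ refl eq
      go : Switches d → ⊥
      go (inj₁ eq)        = clash c₂ c₁ eq
      go (inj₂ (inj₁ eq)) = clash c₄ c₂ eq
      go (inj₂ (inj₂ eq)) = clash c₈ c₄ eq

-- A colour class generates the group

module Generation (𝔾 : FinGroup) where
  open Sets 𝔾
  open Growth 𝔾
  open Colouring 𝔾

  private
    two-in : {X : Set} {xs : List X} → Unique xs → 2 ≤ length xs → ∃ λ i → ∃ λ j → i ∈ xs × j ∈ xs × i ≢ j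
    two-in {xs = _ ∷ []} _ (s≤s ())
    two-in {xs = i ∷ j ∷ _} ((i≢ ∷ _) ∷ _) _ = i , j , here refl , there (here refl) , i≢

    -- Two of the elements 2 ^ i · g coincide by the pigeonhole principle, and injectivity of
    -- doubling cancels the smaller power.
    returns : ∀ g → ∃ λ e → 0 < e × (2 ^ e) · g ≡ g
    returns g = go (pigeonhole _≟_ {xs = upTo (suc N)} {ys = U} φ uU (λ _ → ∈-deduplicate⁺ _≟_ (univ-complete _)) 0<N)
      where
      U = deduplicate _≟_ univ
      uU : Unique U
      uU = deduplicate-! _≟_ univ
      N = length U
      0<N : 0 < N
      0<N = ∈⇒0<length (∈-deduplicate⁺ _≟_ (univ-complete 𝟘))
      φ : ℕ → G
      φ i = (2 ^ i) · g
      ordered : ∀ {i j} → i < j → φ i ≡ φ j → ∃ λ e → 0 < e × (2 ^ e) · g ≡ g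
      ordered {i} {j} i<j eq = j ∸ i , m<n⇒0<n∸m i<j , sym (2^·-injective i (trans eq (trans
        (cong (_· g) (trans (cong (2 ^_) (sym (m+[n∸m]≡n (<⇒≤ i<j)))) (^-distribˡ-+-* 2 i (j ∸ i)))) (·-* (2 ^ i) (2 ^ (j ∸ i)) g))))
      distinct : ∀ {i j} → i ≢ j → φ i ≡ φ j → ∃ λ e → 0 < e × (2 ^ e) · g ≡ g
      distinct {i} {j} i≢j eq = ⊎-elim (λ lt → ordered lt eq) (λ gt → ordered gt (sym eq)) (≢⇒<∨> i≢j)
        where
        ≢⇒<∨> : ∀ {i j} → i ≢ j → i < j ⊎ j < i
        ≢⇒<∨> {i} {j} i≢j = ⊎-map (λ le → ≤∧≢⇒< le i≢j) (λ ge → ≤∧≢⇒< ge (i≢j ∘ sym)) (≤-total i j)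
      go : (∃ λ y → y ∈ U × length (upTo (suc N)) ≤ N * count (λ i → φ i ≟ y) (upTo (suc N))) → ∃ λ e → 0 < e × (2 ^ e) · g ≡ g
      go (y , _ , le) =
        let (i , j , i∈ , j∈ , i≢j) = two-in (Uniq.filter⁺ (λ i → φ i ≟ y) (Uniq.upTo⁺ (suc N)))
              (≮⇒≥ (λ lt → <⇒≱ (n<1+n N) (≤-trans (≤-reflexive (sym (length-upTo (suc N)))) (≤-trans le (≤-trans (*-monoʳ-≤ N (≤-pred lt)) (≤-reflexive (*-identityʳ N)))))))
        in distinct i≢j (trans (proj₂ (∈-filter⁻ (λ i → φ i ≟ y) {xs = upTo (suc N)} i∈)) (sym (proj₂ (∈-filter⁻ (λ i → φ i ≟ y) {xs = upTo (suc N)} j∈))))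

    -- Since 2 ^ (e + 1) · g = g for some e, a factor 2 is undone by the multiple 2 ^ e.
    recover : ∀ i g → ∃ λ k → k · (2 ^ i) · g ≡ g
    recover zero    g = 1 , solve ((x₀ :+ :0) :+ :0) x₀ (g ∷ []) refl
    recover (suc i) g = go (returns g) (recover i g)
      where
      go : (∃ λ e → 0 < e × (2 ^ e) · g ≡ g) → (∃ λ k → k · (2 ^ i) · g ≡ g) → ∃ λ k → k · (2 ^ suc i) · g ≡ g
      go (suc e , _ , eq) (k , eq′) = k * 2 ^ e , (begin
        (k * 2 ^ e) · (2 ^ suc i) · g         ≡⟨ sym (·-* (k * 2 ^ e) (2 ^ suc i) g) ⟩
        (k * 2 ^ e * 2 ^ suc i) · g           ≡⟨ cong (_· g) (e′ k (2 ^ e) (2 ^ i)) ⟩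
        (k * (2 ^ i * 2 ^ suc e)) · g         ≡⟨ ·-* k (2 ^ i * 2 ^ suc e) g ⟩
        k · (2 ^ i * 2 ^ suc e) · g           ≡⟨ cong (k ·_) (·-* (2 ^ i) (2 ^ suc e) g) ⟩
        k · (2 ^ i) · (2 ^ suc e) · g         ≡⟨ cong (λ h → k · (2 ^ i) · h) eq ⟩
        k · (2 ^ i) · g                       ≡⟨ eq′ ⟩
        g                                     ∎)
        where
        open ≡-Reasoning
        e′ : ∀ k p q → k * p * (2 * q) ≡ k * (q * (2 * p))
        e′ = solve-∀

  sum : List G → G
  sum = foldr _⊕_ 𝟘

  sum-replicate : ∀ k g → sum (replicate k g) ≡ k · g
  sum-replicate zero    g = refl
  sum-replicate (suc k) g = cong (g ⊕_) (sum-replicate k g)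

  module _ (b : G → Bool) where

    private
      some-true : ∀ {g} → g ≢ 𝟘 → ∃ λ i → colour b ((2 ^ i) · g) ≡ true
      some-true {g} g≢𝟘 = go (switches b g≢𝟘)
        where
        either : ∀ i j → colour b ((2 ^ i) · g) ≡ not (colour b ((2 ^ j) · g)) → ∃ λ i → colour b ((2 ^ i) · g) ≡ true
        either i j eq = pick (colour b ((2 ^ j) · g)) refl eq
          where
          pick : ∀ v → colour b ((2 ^ j) · g) ≡ v → colour b ((2 ^ i) · g) ≡ not v → ∃ λ i → colour b ((2 ^ i) · g) ≡ true
          pick true  eq₁ _   = j , eq₁
          pick false _   eq₂ = i , eq₂
        2⁰ : g ≡ (2 ^ 0) · g
        2⁰ = solve x₀ (x₀ :+ :0) (g ∷ []) refl
        go : Switches b g → ∃ λ i → colour b ((2 ^ i) · g) ≡ true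
        go (inj₁ eq)        = either 1 0 (subst (λ h → colour b (2 · g) ≡ not (colour b h)) 2⁰ eq)
        go (inj₂ (inj₁ eq)) = either 2 1 eq
        go (inj₂ (inj₂ eq)) = either 3 2 eq

    -- The colour changes somewhere along g, 2g, 4g, 8g, so one of them has the colour `true`, and g
    -- is a multiple of it by `recover`.
    generating : ∀ g → ∃ λ xs → All (λ h → h ≢ 𝟘 × colour b h ≡ true) xs × sum xs ≡ g
    generating g = decide (g ≟ 𝟘)
      where
      decide : Dec (g ≡ 𝟘) → ∃ λ xs → All (λ h → h ≢ 𝟘 × colour b h ≡ true) xs × sum xs ≡ g
      decide (yes eq) = [] , [] , sym eq
      decide (no ≢𝟘)  =
        let (i , eq) = some-true ≢𝟘
            (k , eq′) = recover i g
        in replicate k ((2 ^ i) · g) , AllProperties.replicate⁺ k (2^·-nonzero i ≢𝟘 , eq) , trans (sum-replicate k _) eq′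

-- Monochromatic difference sets as partial assignments

module _ (𝔾 : FinGroup) where
  open Sets 𝔾
  open Colouring 𝔾

  module Events (univ-unique : Unique univ) where

    open Avoidance _≟_

    private
      nonzero? : ∀ g → Dec (g ≢ 𝟘)
      nonzero? g = ¬? (g ≟ 𝟘)

    opaque
      proper : List G → List G
      proper X = filter nonzero? (X ⊟ X)

      proper⁺ : ∀ {X d} → d ∈ X ⊟ X → d ≢ 𝟘 → d ∈ proper X
      proper⁺ = ∈-filter⁺ nonzero?

      proper⁻ : ∀ {X d} → d ∈ proper X → d ∈ X ⊟ X × d ≢ 𝟘
      proper⁻ {X} = ∈-filter⁻ nonzero? {xs = X ⊟ X}

      proper-unique : ∀ X → Unique (proper X)
      proper-unique X = Uniq.filter⁺ nonzero? (⊟-unique X X)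

    -- If one bit occurs in X ⊟ X with both signs, two differences have opposite colours whatever
    -- the bit is. The union bound therefore ranges over consistent X.
    Consistent : List G → Set
    Consistent X = All (λ g → All (λ h → key g ≡ key h → sign g ≡ sign h) (proper X)) (proper X)

    consistent? : ∀ X → Dec (Consistent X)
    consistent? X = All.all? (λ g → All.all? (λ h → (key g ≟ key h) →-dec (sign g Bool.≟ sign h)) (proper X)) (proper X)

    private
      hits? : ∀ X k → Dec (Any (λ g → key g ≡ k) (proper X))
      hits? X k = Any.any? (λ g → key g ≟ k) (proper X)

    -- The partial assignment forced by the requirement that X ⊟ X has colour c away from 𝟘.
    forced : Bool → List G → G → Maybe Bool
    forced c X k = mark (λ ex → literal (sign (proj₁ (find ex))) c) (hits? X k)

    mono⇒consistent : ∀ b {c X} → Mono b c X → Consistent X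
    mono⇒consistent b {c} {X} mono = All.tabulate (λ {g} g∈ → All.tabulate (λ {h} h∈ eq →
      let (p , g≢) = proper⁻ {X} g∈
          (q , h≢) = proper⁻ {X} h∈
      in literal-injective (sign g) (sign h) (b (key g)) (trans (mono p g≢) (trans (sym (mono q h≢)) (cong (λ k → literal (sign h) (b k)) (sym eq))))))

    mono⇒forced : ∀ b {c X k} → Mono b c X → forced c X k ≢ just (not (b k))
    mono⇒forced b {c} {X} {k} mono = go (hits? X k)
      where
      go : (d : Dec (Any (λ g → key g ≡ k) (proper X))) → mark (λ ex → literal (sign (proj₁ (find ex))) c) d ≢ just (not (b k))
      go (no _)   ()
      go (yes ex) eq = not-¬ refl (trans (sym value) (just-injective eq))
        where
        g = proj₁ (find ex)
        g∈ : g ∈ proper X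
        g∈ = proj₁ (proj₂ (find ex))
        value : literal (sign g) c ≡ b k
        value = trans (cong (literal (sign g)) (sym (mono (proj₁ (proper⁻ {X} g∈)) (proj₂ (proper⁻ {X} g∈)))))
          (trans (literal-involutive (sign g) (b (key g))) (cong b (proj₂ (proj₂ (find ex)))))

    -- Consistency leaves at most the two elements g and - g of X ⊟ X for each bit. So at least (|X
    -- - X| - 1) / 2 bits are prescribed, the 1 standing for 𝟘, and each prescribed bit halves the
    -- weight.
    weight-forced : ∀ {X} c → Consistent X → ∃ λ t → length (X ⊟ X) ≤ suc (2 * t) × weight univ (forced c X) * 2 ^ t ≡ 2 ^ length univ
    weight-forced {X} c con = t , many , weight-mark (hits? X) (λ k ex → literal (sign (proj₁ (find ex))) c) univ
      where
      t = count (hits? X) univ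
      open ≤-Reasoning
      fibre : ∀ k → count (λ g → key g ≟ k) (proper X) ≤ 2 * 𝟙 (hits? X k)
      fibre k = ≤-trans (≤-*𝟙+ (hits? X k) {r = 0} small (λ ¬ex → ≤-reflexive (count-none (λ g → key g ≟ k) (proper X) (λ g∈ eq → ¬ex (Any.map (λ { refl → eq }) g∈)))))
          (≤-reflexive (+-identityʳ _))
        where
        small : Any (λ g → key g ≡ k) (proper X) → count (λ g → key g ≟ k) (proper X) ≤ 2
        small ex = let (g , g∈ , eq) = find ex in
          ⊆⇒length≤ _≟_ {ys = g ∷ ⊝ g ∷ []} (Uniq.filter⁺ (λ g → key g ≟ k) (proper-unique X)) (λ {h} h∈′ →
            let (h∈ , eq′) = ∈-filter⁻ (λ g → key g ≟ k) {xs = proper X} h∈′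
                same-key = trans eq (sym eq′)
            in place (key-fibre same-key (All.lookup (All.lookup con g∈) h∈ same-key)))
          where
          place : ∀ {g h} → Opposite g h → h ∈ g ∷ ⊝ g ∷ []
          place (inj₁ eq) = here eq
          place (inj₂ eq) = there (here eq)
      split : (X ⊟ X) ⊆ (𝟘 ∷ proper X)
      split {d} d∈ = decide (d ≟ 𝟘)
        where
        decide : Dec (d ≡ 𝟘) → d ∈ 𝟘 ∷ proper X
        decide (yes eq) = here eq
        decide (no ≢𝟘)  = there (proper⁺ {X} d∈ ≢𝟘)
      many : length (X ⊟ X) ≤ suc (2 * t)
      many = begin
        length (X ⊟ X)                                              ≤⟨ ⊆⇒length≤ _≟_ (⊟-unique X X) split ⟩
        suc (length (proper X))                                     ≡⟨ cong suc (fibres _≟_ {xs = proper X} key univ-unique (λ _ → univ-complete _)) ⟩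
        suc (∑ univ (λ k → count (λ g → key g ≟ k) (proper X)))     ≤⟨ s≤s (∑-mono univ (λ {k} _ → fibre k)) ⟩
        suc (∑ univ (λ k → 2 * 𝟙 (hits? X k)))                      ≡⟨ cong suc (trans (∑-*ˡ 2 univ _) (cong (2 *_) (sym (count-∑ (hits? X) univ)))) ⟩
        suc (2 * t)                                                 ∎

    avoid-mono : ∀ Xs → ∑ Xs (λ X → weight univ (forced true X) + weight univ (forced false X)) < 2 ^ length univ →
                 ∃ λ b → ∀ {X} → X ∈ Xs → ∀ c → ¬ Mono b c X
    avoid-mono Xs lt = go (avoid univ-unique events (≤-trans (s≤s (≤-reflexive total)) lt))
      where
      events : List (G → Maybe Bool)
      events = map (forced true) Xs ++ map (forced false) Xs
      total : ∑ events (weight univ) ≡ ∑ Xs (λ X → weight univ (forced true X) + weight univ (forced false X))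
      total = trans (∑-++ (map (forced true) Xs) (map (forced false) Xs) (weight univ))
        (trans (cong₂ _+_ (∑-map (forced true) Xs (weight univ)) (∑-map (forced false) Xs (weight univ))) (sym (∑-+ Xs _ _)))
      event∈ : ∀ {X} c → X ∈ Xs → forced c X ∈ events
      event∈ true  X∈ = ∈-++⁺ˡ (∈-map⁺ (forced true) X∈)
      event∈ false X∈ = ∈-++⁺ʳ (map (forced true) Xs) (∈-map⁺ (forced false) X∈)
      go : (∃ λ (b : G → Bool) → ∀ {e} → e ∈ events → ∃ λ k → k ∈ univ × e k ≡ just (not (b k))) → ∃ λ b → ∀ {X} → X ∈ Xs → ∀ c → ¬ Mono b c X
      go (b , avoids) = b , λ {X} X∈ c mono → let (k , _ , eq) = avoids (event∈ c X∈) in mono⇒forced b {c} {X} {k} mono eq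

-- Enumeration of programs and the union bound

∑-concatMap : {X Y : Set} (f : X → List Y) (xs : List X) (g : Y → ℕ) → ∑ (concatMap f xs) g ≡ ∑ xs (λ x → ∑ (f x) g)
∑-concatMap f []       g = refl
∑-concatMap f (x ∷ xs) g = trans (∑-++ (f x) (concatMap f xs) g) (cong (∑ (f x) g +_) (∑-concatMap f xs g))

length-concatMap-≤ : {X Y : Set} (f : X → List Y) (xs : List X) {k : ℕ} → (∀ {x} → x ∈ xs → length (f x) ≤ k) → length (concatMap f xs) ≤ length xs * k
length-concatMap-≤ f xs {k} le = ≤-trans (≤-reflexive (length-concatMap f xs)) (≤-trans (∑-mono xs le) (≤-reflexive (∑-const xs k)))

length-sublists : {X : Set} (xs : List X) → length (sublists xs) ≡ 2 ^ length xs
length-sublists []       = refl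
length-sublists (x ∷ xs) = trans (length-++ (sublists xs)) (cong₂ _+_ (length-sublists xs)
  (trans (length-map (x ∷_) (sublists xs)) (trans (length-sublists xs) (sym (+-identityʳ _)))))

module _ (𝔾 : FinGroup) where
  open Sets 𝔾
  open Programs 𝔾

  module Enumeration (univ-unique : Unique univ) where

    private
      N = length univ

      cons-all : List G → List G → List (List G)
      cons-all L = map (_∷ L)

    opaque
      halves : G → List G
      halves s = filter (λ h → (h ⊕ h) ≟ s) univ

      halves-complete : ∀ {h s} → h ⊕ h ≡ s → h ∈ halves s
      halves-complete {h} = ∈-filter⁺ (λ h → (h ⊕ h) ≟ _) (univ-complete h)

      halves-≤1 : ∀ s → length (halves s) ≤ 1
      halves-≤1 s = count-≤1 (λ h → (h ⊕ h) ≟ s) univ-unique (λ _ _ p q → double-injective (trans p (sym q)))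

      steps : List G → List G
      steps L = map (λ (x , y , z) → x ⊕ y ⊖ z) (cartesianProduct L (cartesianProduct L L)) ++ concatMap (λ (x , y) → halves (x ⊕ y)) (cartesianProduct L L)

      steps-comb : ∀ {L x y z} → x ∈ L → y ∈ L → z ∈ L → x ⊕ y ⊖ z ∈ steps L
      steps-comb x∈ y∈ z∈ = ∈-++⁺ˡ (∈-map⁺ (λ (x , y , z) → x ⊕ y ⊖ z) (∈-cartesianProduct⁺ x∈ (∈-cartesianProduct⁺ y∈ z∈)))

      steps-half : ∀ {L x y h} → x ∈ L → y ∈ L → h ⊕ h ≡ x ⊕ y → h ∈ steps L
      steps-half {L} {x} {y} x∈ y∈ eq = ∈-++⁺ʳ (map (λ (x , y , z) → x ⊕ y ⊖ z) (cartesianProduct L (cartesianProduct L L)))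
        (∈-concatMap⁺ (λ (x , y) → halves (x ⊕ y)) (Any.map (λ { refl → halves-complete eq }) (∈-cartesianProduct⁺ x∈ y∈)))

      length-steps : ∀ L → length (steps L) ≤ length L * (length L * length L) + length L * length L
      length-steps L = ≤-trans (≤-reflexive (length-++ (map (λ (x , y , z) → x ⊕ y ⊖ z) (cartesianProduct L (cartesianProduct L L)))))
        (+-mono-≤ (≤-reflexive (trans (length-map (λ (x , y , z) → x ⊕ y ⊖ z) (cartesianProduct L (cartesianProduct L L)))
                    (trans (length-cartesianProduct L (cartesianProduct L L)) (cong (length L *_) (length-cartesianProduct L L)))))
          (≤-trans (length-concatMap-≤ (λ (x , y) → halves (x ⊕ y)) (cartesianProduct L L) (λ {(x , y)} _ → halves-≤1 (x ⊕ y)))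
            (≤-reflexive (trans (*-identityʳ _) (length-cartesianProduct L L)))))

    progs : ℕ → ℕ → List (List G)
    progs zero    zero    = [] ∷ []
    progs (suc ρ) zero    = []
    progs zero    (suc l) = concatMap (λ L → cons-all L (steps L)) (progs zero l)
    progs (suc ρ) (suc l) = concatMap (λ L → cons-all L (steps L)) (progs (suc ρ) l) ++ concatMap (λ L → cons-all L univ) (progs ρ l)

    private
      computed : ∀ ρ {L x} → L ∈ progs ρ (length L) → x ∈ steps L → (x ∷ L) ∈ progs ρ (suc (length L))
      computed zero    {L} L∈ x∈ = ∈-concatMap⁺ (λ L → cons-all L (steps L)) (Any.map (λ { refl → ∈-map⁺ (_∷ L) x∈ }) L∈)
      computed (suc ρ) {L} L∈ x∈ = ∈-++⁺ˡ (∈-concatMap⁺ (λ L → cons-all L (steps L)) (Any.map (λ { refl → ∈-map⁺ (_∷ L) x∈ }) L∈))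

    progs-complete : ∀ {ρ L} → Prog ρ L → L ∈ progs ρ (length L)
    progs-complete start = here refl
    progs-complete {suc ρ} (fresh {L = L} x p) = ∈-++⁺ʳ (concatMap (λ L → cons-all L (steps L)) (progs (suc ρ) (length L)))
      (∈-concatMap⁺ (λ L → cons-all L univ) (Any.map (λ { refl → ∈-map⁺ (_∷ L) (univ-complete x) }) (progs-complete p)))
    progs-complete {ρ} (comb x∈ y∈ z∈ p) = computed ρ (progs-complete p) (steps-comb x∈ y∈ z∈)
    progs-complete {ρ} (half x∈ y∈ eq p) = computed ρ (progs-complete p) (steps-half x∈ y∈ eq)

    choices≤length : ∀ {ρ L} → Prog ρ L → ρ ≤ length L
    choices≤length start          = z≤n
    choices≤length (fresh _ p)    = s≤s (choices≤length p)
    choices≤length (comb _ _ _ p) = m≤n⇒m≤1+n (choices≤length p)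
    choices≤length (half _ _ _ p) = m≤n⇒m≤1+n (choices≤length p)

    progs-length : ∀ ρ l {L} → L ∈ progs ρ l → length L ≡ l
    progs-length zero    zero    (here refl) = refl
    progs-length ρ       (suc l) {L} L∈      = split ρ L∈
      where
      consed : ∀ ρ (f : List G → List G) → L ∈ concatMap (λ L → cons-all L (f L)) (progs ρ l) → length L ≡ suc l
      consed ρ f p =
        let (L′ , L′∈ , q) = find (∈-concatMap⁻ (λ L → cons-all L (f L)) {xs = progs ρ l} p)
            (x , _ , eq) = ∈-map⁻ (_∷ L′) q
        in trans (cong length eq) (cong suc (progs-length ρ l L′∈))
      split : ∀ ρ → L ∈ progs ρ (suc l) → length L ≡ suc l
      split zero    p = consed zero steps p
      split (suc ρ) p = ⊎-elim (consed (suc ρ) steps) (consed ρ (λ _ → univ)) (∈-++⁻ (concatMap (λ L → cons-all L (steps L)) (progs (suc ρ) l)) p)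

    module _ (m : ℕ) where

      -- There are at most m³ combinations and m² halves to continue with, a sum having at most one
      -- half. The additional 1 stands for continuing with a free choice, whose N possibilities are
      -- counted in N ^ ρ.
      branching : ℕ
      branching = suc (m * (m * m) + m * m)

      private
        few-steps : ∀ ρ {l} → l ≤ m → length (concatMap (λ L → cons-all L (steps L)) (progs ρ l)) ≤ length (progs ρ l) * (m * (m * m) + m * m)
        few-steps ρ {l} l≤m = length-concatMap-≤ (λ L → cons-all L (steps L)) (progs ρ l) (λ {L} L∈ →
          let L≤m = ≤-trans (≤-reflexive (progs-length ρ l L∈)) l≤m
          in ≤-trans (≤-reflexive (length-map (_∷ L) (steps L))) (≤-trans (length-steps L) (+-mono-≤ (*-mono-≤ L≤m (*-mono-≤ L≤m L≤m)) (*-mono-≤ L≤m L≤m))))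

      length-progs : ∀ ρ {l} → l ≤ m → length (progs ρ l) ≤ N ^ ρ * branching ^ l
      length-progs zero    {zero}  _   = s≤s z≤n
      length-progs (suc ρ) {zero}  _   = z≤n
      length-progs zero    {suc l} l<m = begin
        length (progs zero (suc l))                                 ≤⟨ few-steps zero (<⇒≤ l<m) ⟩
        length (progs zero l) * (m * (m * m) + m * m)               ≤⟨ *-mono-≤ (length-progs zero (<⇒≤ l<m)) (n≤1+n _) ⟩
        1 * branching ^ l * branching                               ≡⟨ e (branching ^ l) branching ⟩
        1 * (branching * branching ^ l)                             ∎
        where
        open ≤-Reasoning
        e : ∀ p q → 1 * p * q ≡ 1 * (q * p)
        e = solve-∀
      length-progs (suc ρ) {suc l} l<m = begin
        length (progs (suc ρ) (suc l))
          ≡⟨ length-++ (concatMap (λ L → cons-all L (steps L)) (progs (suc ρ) l)) ⟩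
        length (concatMap (λ L → cons-all L (steps L)) (progs (suc ρ) l)) + length (concatMap (λ L → cons-all L univ) (progs ρ l))
          ≤⟨ +-mono-≤ (few-steps (suc ρ) (<⇒≤ l<m)) (length-concatMap-≤ (λ L → cons-all L univ) (progs ρ l) (λ {L} _ → ≤-reflexive (length-map (_∷ L) univ))) ⟩
        length (progs (suc ρ) l) * (m * (m * m) + m * m) + length (progs ρ l) * N
          ≤⟨ +-mono-≤ (*-monoˡ-≤ (m * (m * m) + m * m) (length-progs (suc ρ) (<⇒≤ l<m))) (*-monoˡ-≤ N (length-progs ρ (<⇒≤ l<m))) ⟩
        N ^ suc ρ * branching ^ l * (m * (m * m) + m * m) + N ^ ρ * branching ^ l * N
          ≡⟨ e N (N ^ ρ) (branching ^ l) (m * (m * m) + m * m) ⟩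
        N ^ suc ρ * branching ^ suc l ∎
        where
        open ≤-Reasoning
        e : ∀ N p q k → N * p * q * k + p * q * N ≡ N * p * (suc k * q)
        e = solve-∀

module _ (𝔾 : FinGroup) where
  open Sets 𝔾
  open Programs 𝔾
  open Colouring 𝔾

  -- `rate` says n ≥ 2 (1 + 1 / Q) log₂ N. Z is a reserve of fictitious free choices: a candidate is
  -- rarer by N ^ Z than its ρ choices demand, and `room` says that this outweighs everything else
  -- that is counted, namely computed entries, sublists of L, the values of ρ and of the length, and
  -- the colours.
  module UnionBound (univ-unique : Unique univ) (n Q Z m : ℕ) (0<N : 0 < length univ) (rate : length univ ^ (2 * suc Q) ≤ 2 ^ (n * Q))
    (room : suc m * suc m * (Enumeration.branching 𝔾 univ-unique m ^ m * 2 ^ m * 4) < length univ ^ Z) where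

    open Avoidance _≟_
    open Events 𝔾 univ-unique
    open Enumeration 𝔾 univ-unique

    private
      N = length univ
      K = branching m
      instance
        N≢0 : NonZero N
        N≢0 = >-nonZero 0<N

      weight₂ : List G → ℕ
      weight₂ X = weight univ (forced true X) + weight univ (forced false X)

      Candidate : ℕ → List G → Set
      Candidate ρ X = Consistent X × Q * ((ρ + Z) * n) ≤ suc Q * length (X ⊟ X)

      candidate? : ∀ ρ X → Dec (Candidate ρ X)
      candidate? ρ X = consistent? X ×-dec (Q * ((ρ + Z) * n) ≤? suc Q * length (X ⊟ X))

      square-≤ : ∀ {a b} → a ^ 2 ≤ b ^ 2 → a ≤ b
      square-≤ = ^-cancelʳ-≤ 2 (s≤s z≤n)

      power≤ : ∀ {ρ X} → Q * ((ρ + Z) * n) ≤ suc Q * length (X ⊟ X) → N ^ (2 * (ρ + Z)) ≤ 2 ^ length (X ⊟ X)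
      power≤ {ρ} {X} le = ^-cancelʳ-≤ (suc Q) (s≤s z≤n) (begin
        (N ^ (2 * (ρ + Z))) ^ suc Q              ≡⟨ trans (^-*-assoc N (2 * (ρ + Z)) (suc Q)) (trans (cong (N ^_) (e (ρ + Z) (suc Q))) (sym (^-*-assoc N (2 * suc Q) (ρ + Z)))) ⟩
        (N ^ (2 * suc Q)) ^ (ρ + Z)              ≤⟨ ^-monoˡ-≤ (ρ + Z) rate ⟩
        (2 ^ (n * Q)) ^ (ρ + Z)                  ≡⟨ trans (^-*-assoc 2 (n * Q) (ρ + Z)) (cong (2 ^_) (e′ n Q (ρ + Z))) ⟩
        2 ^ (Q * ((ρ + Z) * n))                  ≤⟨ ^-monoʳ-≤ 2 le ⟩
        2 ^ (suc Q * length (X ⊟ X))             ≡⟨ trans (cong (2 ^_) (*-comm (suc Q) (length (X ⊟ X)))) (sym (^-*-assoc 2 (length (X ⊟ X)) (suc Q))) ⟩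
        (2 ^ length (X ⊟ X)) ^ suc Q             ∎)
        where
        open ≤-Reasoning
        e : ∀ r q → 2 * r * q ≡ 2 * q * r
        e = solve-∀
        e′ : ∀ n q r → n * q * r ≡ q * (r * n)
        e′ = solve-∀

      -- The prescribed bits give 2 ^ t against N ^ (ρ + Z) ≤ 2 ^ (|X - X| / 2); the factor 2 is the
      -- loss from |X - X| ≤ 2t + 1.
      rare : ∀ {ρ X} c → Candidate ρ X → weight univ (forced c X) * N ^ (ρ + Z) ≤ 2 * 2 ^ N
      rare {ρ} {X} c (con , le) = go (weight-forced {X} c con)
        where
        open ≤-Reasoning
        go : (∃ λ t → length (X ⊟ X) ≤ suc (2 * t) × weight univ (forced c X) * 2 ^ t ≡ 2 ^ N) → weight univ (forced c X) * N ^ (ρ + Z) ≤ 2 * 2 ^ N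
        go (t , d≤ , eq) = begin
          weight univ (forced c X) * N ^ (ρ + Z)        ≤⟨ *-monoʳ-≤ (weight univ (forced c X)) (square-≤ (begin
            (N ^ (ρ + Z)) ^ 2                             ≡⟨ trans (^-*-assoc N (ρ + Z) 2) (cong (N ^_) (*-comm (ρ + Z) 2)) ⟩
            N ^ (2 * (ρ + Z))                             ≤⟨ power≤ {ρ} {X} le ⟩
            2 ^ length (X ⊟ X)                            ≤⟨ ^-monoʳ-≤ 2 (≤-trans d≤ (≤-trans (n≤1+n _) (≤-reflexive (e t)))) ⟩
            2 ^ (suc t * 2)                               ≡⟨ sym (^-*-assoc 2 (suc t) 2) ⟩
            (2 ^ suc t) ^ 2                               ∎)) ⟩
          weight univ (forced c X) * (2 * 2 ^ t)        ≡⟨ e′ (weight univ (forced c X)) (2 ^ t) ⟩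
          2 * (weight univ (forced c X) * 2 ^ t)        ≡⟨ cong (2 *_) eq ⟩
          2 * 2 ^ N                                     ∎
          where
          e : ∀ t → suc (suc (2 * t)) ≡ suc t * 2
          e = solve-∀
          e′ : ∀ w p → w * (2 * p) ≡ 2 * (w * p)
          e′ = solve-∀

      rare₂ : ∀ {ρ X} → Candidate ρ X → weight₂ X * N ^ (ρ + Z) ≤ 4 * 2 ^ N
      rare₂ {ρ} {X} cand = ≤-trans (≤-reflexive (*-distribʳ-+ (N ^ (ρ + Z)) (weight univ (forced true X)) (weight univ (forced false X))))
        (≤-trans (+-mono-≤ (rare {ρ} {X} true cand) (rare {ρ} {X} false cand)) (≤-reflexive (e (2 ^ N))))
        where
        e : ∀ p → 2 * p + 2 * p ≡ 4 * p
        e = solve-∀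

      opaque
        candidates : ℕ → ℕ → List (List G)
        candidates ρ l = filter (candidate? ρ) (concatMap sublists (progs ρ l))

        candidates⁺ : ∀ {ρ L X} → Prog ρ L → X ∈ sublists L → Candidate ρ X → X ∈ candidates ρ (length L)
        candidates⁺ {ρ} prog X∈ cand = ∈-filter⁺ (candidate? ρ) (∈-concatMap⁺ sublists (Any.map (λ { refl → X∈ }) (progs-complete prog))) cand

        candidates⁻ : ∀ {ρ l X} → X ∈ candidates ρ l → Candidate ρ X
        candidates⁻ {ρ} {l} X∈ = proj₂ (∈-filter⁻ (candidate? ρ) {xs = concatMap sublists (progs ρ l)} X∈)

        few-candidates : ∀ ρ l → l ≤ m → length (candidates ρ l) ≤ N ^ ρ * (K ^ m * 2 ^ m)
        few-candidates ρ l l≤m = begin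
          length (candidates ρ l)                     ≤⟨ length-filter (candidate? ρ) (concatMap sublists (progs ρ l)) ⟩
          length (concatMap sublists (progs ρ l))     ≤⟨ length-concatMap-≤ sublists (progs ρ l) (λ {L} L∈ → ≤-trans (≤-reflexive (length-sublists L)) (^-monoʳ-≤ 2 (≤-trans (≤-reflexive (progs-length ρ l L∈)) l≤m))) ⟩
          length (progs ρ l) * 2 ^ m                  ≤⟨ *-monoˡ-≤ (2 ^ m) (≤-trans (length-progs m ρ l≤m) (*-monoʳ-≤ (N ^ ρ) (^-monoʳ-≤ K l≤m))) ⟩
          N ^ ρ * K ^ m * 2 ^ m                       ≡⟨ *-assoc (N ^ ρ) (K ^ m) (2 ^ m) ⟩
          N ^ ρ * (K ^ m * 2 ^ m)                     ∎
          where open ≤-Reasoning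

      light : ∀ ρ l → l ≤ m → ∑ (candidates ρ l) weight₂ * N ^ Z ≤ K ^ m * 2 ^ m * 4 * 2 ^ N
      light ρ l l≤m = *-cancelˡ-≤ (N ^ ρ) {{m^n≢0 N ρ}} (begin
        N ^ ρ * (∑ (candidates ρ l) weight₂ * N ^ Z)              ≡⟨ trans (e (N ^ ρ) (∑ (candidates ρ l) weight₂) (N ^ Z)) (cong (∑ (candidates ρ l) weight₂ *_) (sym (^-distribˡ-+-* N ρ Z))) ⟩
        ∑ (candidates ρ l) weight₂ * N ^ (ρ + Z)                  ≡⟨ sym (∑-*ʳ (N ^ (ρ + Z)) (candidates ρ l) weight₂) ⟩
        ∑ (candidates ρ l) (λ X → weight₂ X * N ^ (ρ + Z))        ≤⟨ ∑-mono (candidates ρ l) (λ {X} X∈ → rare₂ {ρ} {X} (candidates⁻ {ρ} {l} X∈)) ⟩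
        ∑ (candidates ρ l) (λ _ → 4 * 2 ^ N)                      ≡⟨ ∑-const (candidates ρ l) (4 * 2 ^ N) ⟩
        length (candidates ρ l) * (4 * 2 ^ N)                     ≤⟨ *-monoˡ-≤ (4 * 2 ^ N) (few-candidates ρ l l≤m) ⟩
        N ^ ρ * (K ^ m * 2 ^ m) * (4 * 2 ^ N)                     ≡⟨ e′ (N ^ ρ) (K ^ m * 2 ^ m) 4 (2 ^ N) ⟩
        N ^ ρ * (K ^ m * 2 ^ m * 4 * 2 ^ N)                       ∎)
        where
        open ≤-Reasoning
        e : ∀ p s z → p * (s * z) ≡ s * (p * z)
        e = solve-∀
        e′ : ∀ p k f q → p * k * (f * q) ≡ p * (k * f * q)
        e′ = solve-∀

      range : List ℕ
      range = upTo (suc m)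

      T : ℕ
      T = K ^ m * 2 ^ m * 4

      opaque
        all-candidates : List (List G)
        all-candidates = concatMap (λ ρ → concatMap (candidates ρ) range) range

        all-candidates⁺ : ∀ {ρ l X} → ρ ≤ m → l ≤ m → X ∈ candidates ρ l → X ∈ all-candidates
        all-candidates⁺ {ρ} {l} ρ≤ l≤ X∈ = ∈-concatMap⁺ (λ ρ → concatMap (candidates ρ) range)
          (Any.map (λ { refl → ∈-concatMap⁺ (candidates ρ) (Any.map (λ { refl → X∈ }) (∈-upTo⁺ (s≤s l≤))) }) (∈-upTo⁺ (s≤s ρ≤)))

        union : ∑ all-candidates weight₂ < 2 ^ N
        union = *-cancelʳ-< (N ^ Z) _ _ (begin-strict
          ∑ all-candidates weight₂ * N ^ Z
            ≡⟨ cong (_* N ^ Z) (trans (∑-concatMap (λ ρ → concatMap (candidates ρ) range) range weight₂) (∑-cong range (λ {ρ} _ → ∑-concatMap (candidates ρ) range weight₂))) ⟩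
          ∑ range (λ ρ → ∑ range (λ l → ∑ (candidates ρ l) weight₂)) * N ^ Z
            ≡⟨ trans (sym (∑-*ʳ (N ^ Z) range (λ ρ → ∑ range (λ l → ∑ (candidates ρ l) weight₂)))) (∑-cong range (λ {ρ} _ → sym (∑-*ʳ (N ^ Z) range (λ l → ∑ (candidates ρ l) weight₂)))) ⟩
          ∑ range (λ ρ → ∑ range (λ l → ∑ (candidates ρ l) weight₂ * N ^ Z))
            ≤⟨ ∑-mono range (λ {ρ} _ → ∑-mono range (λ {l} l∈ → light ρ l (≤-pred (∈-upTo⁻ l∈)))) ⟩
          ∑ range (λ _ → ∑ range (λ _ → T * 2 ^ N))
            ≡⟨ trans (∑-const range (∑ range (λ _ → T * 2 ^ N))) (cong₂ _*_ (length-upTo (suc m)) (trans (∑-const range (T * 2 ^ N)) (cong (_* (T * 2 ^ N)) (length-upTo (suc m))))) ⟩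
          suc m * (suc m * (T * 2 ^ N))
            ≡⟨ e (suc m) T (2 ^ N) ⟩
          suc m * suc m * T * 2 ^ N
            <⟨ *-monoˡ-< (2 ^ N) {{m^n≢0 2 N}} room ⟩
          N ^ Z * 2 ^ N
            ≡⟨ *-comm (N ^ Z) (2 ^ N) ⟩
          2 ^ N * N ^ Z ∎)
          where
          open ≤-Reasoning
          e : ∀ s t p → s * (s * (t * p)) ≡ s * s * t * p
          e = solve-∀

    opaque
      good-colouring : ∃ λ b → ∀ {ρ L X} → Prog ρ L → X ⊆ L → length L ≤ m → Q * ((ρ + Z) * n) ≤ suc Q * length (X ⊟ X) → ∀ c → ¬ Mono b c X
      good-colouring = go (avoid-mono all-candidates union)
        where
        go : (∃ λ b → ∀ {X} → X ∈ all-candidates → ∀ c → ¬ Mono b c X) →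
             ∃ λ b → ∀ {ρ L X} → Prog ρ L → X ⊆ L → length L ≤ m → Q * ((ρ + Z) * n) ≤ suc Q * length (X ⊟ X) → ∀ c → ¬ Mono b c X
        go (b , avoids) = b , refute
          where
          refute : ∀ {ρ L X} → Prog ρ L → X ⊆ L → length L ≤ m → Q * ((ρ + Z) * n) ≤ suc Q * length (X ⊟ X) → ∀ c → ¬ Mono b c X
          refute {ρ} {L} {X} prog X⊆L L≤m le c mono = avoids (all-candidates⁺ (≤-trans (choices≤length prog) L≤m) L≤m
            (candidates⁺ prog (filter-∈-sublists (_∈? X) L (self-∈-sublists L))
              (mono⇒consistent b {c} {X′} mono′ , ≤-trans le (*-monoʳ-≤ (suc Q) (∣⊟∣-mono {X} {X′} {X} {X′} X⊆X′ X⊆X′))))) c mono′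
            where
            -- X rearranged as a sublist of L, which is the form in which the candidates are listed.
            X′ : List G
            X′ = filter (_∈? X) L
            X⊆X′ : X ⊆ X′
            X⊆X′ g∈ = ∈-filter⁺ (_∈? X) (X⊆L g∈) g∈
            X′⊆X : X′ ⊆ X
            X′⊆X g∈ = proj₂ (∈-filter⁻ (_∈? X) {xs = L} g∈)
            mono′ : Mono b c X′
            mono′ d∈ = mono (⊟-mono {X′} {X} {X′} {X} X′⊆X X′⊆X d∈)

-- Choice of the scale β

last-before : {P : ℕ → Set} → (∀ i → Dec (P i)) → ∀ k {i} → P i → ¬ P (k + i) → ∃ λ j → i ≤ j × P j × ¬ P (suc j)
last-before P? zero    p ¬p = contradiction p ¬p
last-before {P} P? (suc k) {i} p ¬p = decide (P? (suc i))
  where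
  decide : Dec (P (suc i)) → ∃ λ j → i ≤ j × P j × ¬ P (suc j)
  decide (no ¬q) = i , ≤-refl , p , ¬q
  decide (yes q) = let (j , le , r , ¬r) = last-before P? k q (subst (¬_ ∘ P) (sym (+-suc k i)) ¬p) in j , ≤-trans (n≤1+n i) le , r , ¬r

-- This is 2 ^ e - 1, a crude constant C in (1 + 1 / β) ^ e ≤ 1 + C / β.
slack : ℕ → ℕ
slack zero    = 0
slack (suc e) = suc (2 * slack e)

suc-^-≤ : ∀ e {β} → 0 < β → suc β ^ e * β ≤ β ^ e * (β + slack e)
suc-^-≤ zero    {β} _   = ≤-reflexive (cong (1 *_) (sym (+-identityʳ β)))
suc-^-≤ (suc e) {β} 0<β = begin
  suc β * suc β ^ e * β                        ≡⟨ *-assoc (suc β) (suc β ^ e) β ⟩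
  suc β * (suc β ^ e * β)                      ≤⟨ *-monoʳ-≤ (suc β) (suc-^-≤ e 0<β) ⟩
  suc β * (β ^ e * (β + C))                    ≡⟨ e₁ β (β ^ e) C ⟩
  β ^ e * (β * β + β * C + β + C)              ≤⟨ *-monoʳ-≤ (β ^ e) (+-monoʳ-≤ (β * β + β * C + β) (m≤n*m C β {{>-nonZero 0<β}})) ⟩
  β ^ e * (β * β + β * C + β + β * C)          ≡⟨ e₂ β (β ^ e) C ⟩
  β * β ^ e * (β + suc (2 * C))                ∎
  where
  open ≤-Reasoning
  C = slack e
  e₁ : ∀ b p c → suc b * (p * (b + c)) ≡ p * (b * b + b * c + b + c)
  e₁ = solve-∀
  e₂ : ∀ b p c → p * (b * b + b * c + b + b * c) ≡ b * p * (b + suc (2 * c))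
  e₂ = solve-∀

module Scales (p q : ℕ) (0<p : 0 < p) (0<q : 0 < q) where

  r Q : ℕ
  r = 2 * q + p
  -- With ε = p / q ≥ 1 / q one has 2 (1 + 1 / Q) = 2 + 1 / (2q) ≤ 2 + ε / 2. The other half of ε
  -- absorbs the rounding of n to a power β ^ E.
  Q = 4 * q

  opaque
    β₁ : ℕ
    β₁ = β₀ Q + (slack E * (4 * q + 1) + suc (17 * r))

    β₀≤β₁ : β₀ Q ≤ β₁
    β₀≤β₁ = m≤m+n (β₀ Q) _

    slack≤β₁ : slack E * (4 * q + 1) ≤ β₁
    slack≤β₁ = ≤-trans (m≤m+n (slack E * (4 * q + 1)) _) (m≤n+m _ (β₀ Q))

    17r<β₁ : 17 * r < β₁
    17r<β₁ = ≤-trans (m≤n+m (suc (17 * r)) (slack E * (4 * q + 1))) (m≤n+m _ (β₀ Q))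

    N₀ : ℕ
    N₀ = 2 + 2 ^ (β₁ ^ E * q)

    2≤N₀ : 2 ≤ N₀
    2≤N₀ = m≤m+n 2 _

    N₀≥ : 2 ^ (β₁ ^ E * q) ≤ N₀
    N₀≥ = m≤n+m _ 2

  instance
    q≢0 : NonZero q
    q≢0 = >-nonZero 0<q
    r≢0 : NonZero r
    r≢0 = >-nonZero (≤-trans 0<p (m≤n+m p (2 * q)))

  module Scale (N : ℕ) (N₀≤N : N₀ ≤ N) where

    1<N : 1 < N
    1<N = ≤-trans 2≤N₀ N₀≤N
    instance
      N≢0 : NonZero N
      N≢0 = >-nonZero (<⇒≤ 1<N)

    -- In logarithms β ^ E ≤ (2 + ε) log₂ N; n will be the largest power β ^ E of this kind.
    Fits : ℕ → Set
    Fits β = 2 ^ (β ^ E * q) ≤ N ^ r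

    opaque
      chosen : ∃ λ β → β₁ ≤ β × Fits β × ¬ Fits (suc β)
      chosen = last-before (λ β → 2 ^ (β ^ E * q) ≤? N ^ r) (suc (N * r)) {β₁} (≤-trans N₀≥ (≤-trans N₀≤N (m≤m^n N r))) (<⇒≱ (begin-strict
        N ^ r                                  <⟨ ^-monoˡ-< r (n<2^n N) ⟩
        (2 ^ N) ^ r                            ≡⟨ ^-*-assoc 2 N r ⟩
        2 ^ (N * r)                            ≤⟨ ^-monoʳ-≤ 2 (≤-trans (n≤1+n (N * r)) (≤-trans (m≤m+n (suc (N * r)) β₁) (≤-trans (m≤pow (suc (N * r) + β₁)) (m≤m*n ((suc (N * r) + β₁) ^ E) q)))) ⟩
        2 ^ ((suc (N * r) + β₁) ^ E * q)       ∎))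
        where
        open ≤-Reasoning
        m≤m^n : ∀ m n .{{_ : NonZero m}} .{{_ : NonZero n}} → m ≤ m ^ n
        m≤m^n m (suc n) = m≤m*n m (m ^ n) {{m^n≢0 m n}}
        m≤pow : ∀ m → m ≤ m ^ E
        m≤pow zero    = z≤n
        m≤pow (suc m) = subst (λ e → suc m ≤ suc m ^ e) (sym E≡) (m≤m^n (suc m) (suc E₁))

    β : ℕ
    β = proj₁ chosen

    n m : ℕ
    n = β ^ E
    m = β * n

    β₁≤β : β₁ ≤ β
    β₁≤β = proj₁ (proj₂ chosen)

    fits : 2 ^ (n * q) ≤ N ^ r
    fits = proj₁ (proj₂ (proj₂ chosen))

    tight : N ^ r < 2 ^ (suc β ^ E * q)
    tight = ≰⇒> (proj₂ (proj₂ (proj₂ chosen)))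

    lrg : Large Q β
    lrg = large Q (≤-trans β₀≤β₁ β₁≤β)

    open Large lrg

    0<β : 0 < β
    0<β = ≤-trans (s≤s z≤n) 128≤β

    instance
      β≢0 : NonZero β
      β≢0 = >-nonZero 0<β

    0<n : 0 < n
    0<n = m^n>0 β E

    opaque
      -- By `tight` the power (β + 1) ^ E exceeds (2 + ε) log₂ N, and n falls short of it by at most
      -- a factor 1 + `slack E` / β.
      rate : N ^ (2 * suc Q) ≤ 2 ^ (n * Q)
      rate = ^-cancelʳ-≤ (r * β) (*-mono-≤ (>-nonZero⁻¹ r) 0<β) (begin
        (N ^ (2 * suc Q)) ^ (r * β)                    ≡⟨ trans (^-*-assoc N (2 * suc Q) (r * β)) (trans (cong (N ^_) (e₁ (2 * suc Q) r β)) (sym (^-*-assoc N r (β * (2 * suc Q))))) ⟩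
        (N ^ r) ^ (β * (2 * suc Q))                    ≤⟨ ^-monoˡ-≤ (β * (2 * suc Q)) (<⇒≤ tight) ⟩
        (2 ^ (suc β ^ E * q)) ^ (β * (2 * suc Q))      ≡⟨ ^-*-assoc 2 (suc β ^ E * q) (β * (2 * suc Q)) ⟩
        2 ^ (suc β ^ E * q * (β * (2 * suc Q)))        ≤⟨ ^-monoʳ-≤ 2 exponents ⟩
        2 ^ (n * Q * (r * β))                          ≡⟨ sym (^-*-assoc 2 (n * Q) (r * β)) ⟩
        (2 ^ (n * Q)) ^ (r * β)                        ∎)
        where
        open ≤-Reasoning
        e₁ : ∀ k r b → k * (r * b) ≡ r * (b * k)
        e₁ = solve-∀
        exponents : suc β ^ E * q * (β * (2 * suc Q)) ≤ n * Q * (r * β)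
        exponents = begin
          suc β ^ E * q * (β * (2 * suc Q))                             ≡⟨ e₂ (suc β ^ E) q β (suc Q) ⟩
          suc β ^ E * β * (2 * q * suc Q)                               ≤⟨ *-monoˡ-≤ (2 * q * suc Q) (suc-^-≤ E 0<β) ⟩
          n * (β + slack E) * (2 * q * suc Q)                           ≡⟨ e₃ n β (slack E) q ⟩
          n * (2 * q * (β * (4 * q + 1) + slack E * (4 * q + 1)))       ≤⟨ *-monoʳ-≤ n (*-monoʳ-≤ (2 * q) (+-monoʳ-≤ (β * (4 * q + 1)) (≤-trans slack≤β₁ β₁≤β))) ⟩
          n * (2 * q * (β * (4 * q + 1) + β))                           ≡⟨ e₄ n q β ⟩
          n * (4 * q) * ((2 * q + 1) * β)                               ≤⟨ *-monoʳ-≤ (n * (4 * q)) (*-monoˡ-≤ β (+-monoʳ-≤ (2 * q) 0<p)) ⟩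
          n * Q * (r * β)                                               ∎
          where
          e₂ : ∀ s q b Q → s * q * (b * (2 * Q)) ≡ s * b * (2 * q * Q)
          e₂ = solve-∀
          e₃ : ∀ n b c q → n * (b + c) * (2 * q * suc (4 * q)) ≡ n * (2 * q * (b * (4 * q + 1) + c * (4 * q + 1)))
          e₃ = solve-∀
          e₄ : ∀ n q b → n * (2 * q * (b * (4 * q + 1) + b)) ≡ n * (4 * q) * ((2 * q + 1) * b)
          e₄ = solve-∀

    private
      s : ℕ
      s = 2 * β

      m≤2^s : m ≤ 2 ^ s
      m≤2^s = begin
        β * n                       ≤⟨ *-mono-≤ (<⇒≤ (n<2^n β)) (≤-trans (^-monoʳ-≤ β (m≤m+n E (E + 0))) (<⇒≤ poly)) ⟩
        2 ^ β * 2 ^ β               ≡⟨ sym (^-distribˡ-+-* 2 β β) ⟩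
        2 ^ (β + β)                 ≡⟨ cong (λ k → 2 ^ (β + k)) (sym (+-identityʳ β)) ⟩
        2 ^ s                       ∎
        where open ≤-Reasoning

      0<2^s : 0 < 2 ^ s
      0<2^s = m^n>0 2 s

      suc-m≤ : suc m ≤ 2 ^ suc s
      suc-m≤ = ≤-trans (+-mono-≤ 0<2^s m≤2^s) (≤-reflexive (cong (2 ^ s +_) (sym (+-identityʳ (2 ^ s)))))

      branching≤ : suc (m * (m * m) + m * m) ≤ 2 ^ (2 + 3 * s)
      branching≤ = begin
        suc (m * (m * m) + m * m)                      ≤⟨ +-mono-≤ (*-mono-≤ 0<2^s (*-mono-≤ 0<2^s 0<2^s)) (+-mono-≤ (*-mono-≤ m≤2^s (*-mono-≤ m≤2^s m≤2^s)) (*-mono-≤ (≤-trans m≤2^s (m≤m*n (2 ^ s) (2 ^ s) {{m^n≢0 2 s}})) m≤2^s)) ⟩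
        t * (t * t) + (t * (t * t) + t * t * t)        ≤⟨ m≤m+n _ (t * (t * t)) ⟩
        t * (t * t) + (t * (t * t) + t * t * t) + t * (t * t) ≡⟨ e t ⟩
        4 * (t * (t * (t * 1)))                        ≡⟨ cong (4 *_) (trans (^-*-assoc 2 s 3) (cong (2 ^_) (*-comm s 3))) ⟩
        4 * 2 ^ (3 * s)                                ≡⟨ sym (^-distribˡ-+-* 2 2 (3 * s)) ⟩
        2 ^ (2 + 3 * s)                                ∎
        where
        open ≤-Reasoning
        t : ℕ
        t = 2 ^ s
        e : ∀ t → t * (t * t) + (t * (t * t) + t * t * t) + t * (t * t) ≡ 4 * (t * (t * (t * 1)))
        e = solve-∀

    opaque
      -- As m = β n and each base is 2 ^ O(β), the left side is at most 2 ^ (17 β² n q), where 2 ^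
      -- (n q) ≤ N ^ r. The reserve β ^ 3 exceeds 17 r β² because β > 17 r; this is the reason for a
      -- cube.
      room : suc m * suc m * (suc (m * (m * m) + m * m) ^ m * 2 ^ m * 4) < N ^ (β ^ 3)
      room = begin-strict
        suc m * suc m * (suc (m * (m * m) + m * m) ^ m * 2 ^ m * 4)
          ≤⟨ *-mono-≤ (*-mono-≤ suc-m≤ suc-m≤) (*-monoˡ-≤ 4 (*-monoˡ-≤ (2 ^ m) (^-monoˡ-≤ m branching≤))) ⟩
        2 ^ suc s * 2 ^ suc s * ((2 ^ (2 + 3 * s)) ^ m * 2 ^ m * 2 ^ 2)
          ≡⟨ collect ⟩
        2 ^ (suc s + suc s + ((2 + 3 * s) * m + m + 2))
          ≤⟨ ^-monoʳ-≤ 2 exponents ⟩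
        2 ^ (n * q * (17 * (β * β)))
          ≡⟨ sym (^-*-assoc 2 (n * q) (17 * (β * β))) ⟩
        (2 ^ (n * q)) ^ (17 * (β * β))
          ≤⟨ ^-monoˡ-≤ (17 * (β * β)) fits ⟩
        (N ^ r) ^ (17 * (β * β))
          ≡⟨ ^-*-assoc N r (17 * (β * β)) ⟩
        N ^ (r * (17 * (β * β)))
          <⟨ ^-monoʳ-< N 1<N (≤-trans (s≤s (≤-reflexive (e₁ r β))) (≤-trans (*-monoˡ-< (β * β) {{m*n≢0 β β}} (≤-trans 17r<β₁ β₁≤β)) (≤-reflexive (e₂ β)))) ⟩
        N ^ (β ^ 3) ∎
        where
        open ≤-Reasoning
        e₁ : ∀ r b → r * (17 * (b * b)) ≡ 17 * r * (b * b)
        e₁ = solve-∀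
        e₂ : ∀ b → b * (b * b) ≡ b * (b * (b * 1))
        e₂ = solve-∀
        ^-+ : ∀ i j → 2 ^ i * 2 ^ j ≡ 2 ^ (i + j)
        ^-+ i j = sym (^-distribˡ-+-* 2 i j)
        collect : 2 ^ suc s * 2 ^ suc s * ((2 ^ (2 + 3 * s)) ^ m * 2 ^ m * 2 ^ 2) ≡ 2 ^ (suc s + suc s + ((2 + 3 * s) * m + m + 2))
        collect = trans (cong₂ _*_ (^-+ (suc s) (suc s)) (trans (cong (_* 2 ^ 2) (trans (cong (_* 2 ^ m) (^-*-assoc 2 (2 + 3 * s) m)) (^-+ ((2 + 3 * s) * m) m))) (^-+ ((2 + 3 * s) * m + m) 2)))
          (^-+ (suc s + suc s) ((2 + 3 * s) * m + m + 2))
        exponents : suc s + suc s + ((2 + 3 * s) * m + m + 2) ≤ n * q * (17 * (β * β))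
        exponents = begin
          suc s + suc s + ((2 + 3 * s) * m + m + 2)        ≡⟨ e₃ β m ⟩
          (4 * β + 4) * 1 + (6 * β + 3) * m                ≤⟨ +-monoˡ-≤ ((6 * β + 3) * m) (*-monoʳ-≤ (4 * β + 4) (*-mono-≤ 0<β 0<n)) ⟩
          (4 * β + 4) * m + (6 * β + 3) * m                ≡⟨ e₄ β m ⟩
          (10 * β + 7 * 1) * m                             ≤⟨ *-monoˡ-≤ m (+-monoʳ-≤ (10 * β) (*-monoʳ-≤ 7 0<β)) ⟩
          (10 * β + 7 * β) * (β * n)                       ≡⟨ e₅ β n ⟩
          n * 1 * (17 * (β * β))                           ≤⟨ *-monoˡ-≤ (17 * (β * β)) (*-monoʳ-≤ n 0<q) ⟩
          n * q * (17 * (β * β))                           ∎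
          where
          e₃ : ∀ b m → suc (2 * b) + suc (2 * b) + ((2 + 3 * (2 * b)) * m + m + 2) ≡ (4 * b + 4) * 1 + (6 * b + 3) * m
          e₃ = solve-∀
          e₄ : ∀ b m → (4 * b + 4) * m + (6 * b + 3) * m ≡ (10 * b + 7 * 1) * m
          e₄ = solve-∀
          e₅ : ∀ b n → (10 * b + 7 * b) * (b * n) ≡ n * 1 * (17 * (b * b))
          e₅ = solve-∀

  module _ (𝔾 : FinGroup) where
    open Sets 𝔾
    open Programs 𝔾
    open Colouring 𝔾

    module _ (univ-unique : Unique univ) (N₀≤N : N₀ ≤ length univ) where

      open Scale (length univ) N₀≤N

      opaque
        ramsey-colouring : ∃ λ b → ∀ {A} → Unique A → ∀ c → Mono b c A → 2 ^ (length A * q) ≤ length univ ^ r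
        ramsey-colouring = go (UnionBound.good-colouring 𝔾 univ-unique n Q (β ^ 3) m (<⇒≤ 1<N) rate room)
          where
          go : (∃ λ b → ∀ {ρ L X} → Prog ρ L → X ⊆ L → length L ≤ m → Q * ((ρ + β ^ 3) * n) ≤ suc Q * length (X ⊟ X) → ∀ c → ¬ Mono b c X) →
               ∃ λ b → ∀ {A} → Unique A → ∀ c → Mono b c A → 2 ^ (length A * q) ≤ length univ ^ r
          go (b , good) = b , λ {A} uA c mono → ≮⇒≥ (λ big → refute A uA c mono big)
            where
            refute : ∀ A → Unique A → ∀ c → Mono b c A → length univ ^ r < 2 ^ (length A * q) → ⊥
            refute A uA c mono big =
              let (ρ , L , X , prog , X⊆L , X⊆ , _ , L≤ , le) = KeyProposition.described 𝔾 Q β lrg {A₀} (mono⇒windowfree b {c} {A₀} (sub A₀ A₀⊆)) (Uniq.take⁺ n uA) size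
              in good prog X⊆L L≤ le c (sub X (A₀⊆ ∘ X⊆))
              where
              A₀ : List G
              A₀ = take n A
              A₀⊆ : A₀ ⊆ A
              A₀⊆ g∈ = subst (_ ∈_) (take++drop≡id n A) (∈-++⁺ˡ g∈)
              n≤ : n ≤ length A
              n≤ = ≮⇒≥ (λ lt → <⇒≱ big (≤-trans (^-monoʳ-≤ 2 (*-monoˡ-≤ q (<⇒≤ lt))) fits))
              size : length A₀ ≡ n
              size = trans (length-take n A) (m≤n⇒m⊓n≡m n≤)
              sub : ∀ X → X ⊆ A → Mono b c X
              sub X X⊆ d∈ = mono (⊟-mono {X} {A} {X} {A} X⊆ X⊆ d∈)

-- Vector spaces as finite groups

AllPairs-∈ : ∀ {ℓ ℓ′} {X : Set ℓ} {R : X → X → Set ℓ′} {xs : List X} → AllPairs R xs → ∀ {x y} → x ∈ xs → y ∈ xs → x ≡ y ⊎ R x y ⊎ R y x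
AllPairs-∈ (rs ∷ _)  (here refl) (here refl) = inj₁ refl
AllPairs-∈ (rs ∷ _)  (here refl) (there y∈)  = inj₂ (inj₁ (All.lookup rs y∈))
AllPairs-∈ (rs ∷ _)  (there x∈)  (here refl) = inj₂ (inj₂ (All.lookup rs x∈))
AllPairs-∈ (_ ∷ ps)  (there x∈)  (there y∈)  = AllPairs-∈ ps x∈ y∈

module Transport {c ℓ m ℓm : Level} (F : CommutativeRing c ℓ) (field′ : IsField F) (char : CharAtLeast5 F)
  (V : Module F m ℓm) (N : ℕ) (order : HasOrder V N) where

  open CommutativeRing F using (_≈_; 1#; 0#) renaming (_*_ to _·ᶠ_; *-comm to ·ᶠ-comm)
  open Module V
  open Inverse order

  private
    module ≈ = SetoidReasoning ≈ᴹ-setoid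

    multiple : ℕ → Carrierᴹ → Carrierᴹ
    multiple zero    v = 0ᴹ
    multiple (suc k) v = v +ᴹ multiple k v

    natCast-*ₗ : ∀ k v → natCast F k *ₗ v ≈ᴹ multiple k v
    natCast-*ₗ zero    v = *ₗ-zeroˡ v
    natCast-*ₗ (suc k) v = ≈ᴹ-trans (*ₗ-distribʳ v 1# (natCast F k)) (+ᴹ-cong (*ₗ-identityˡ v) (natCast-*ₗ k v))

    -- In the field, k · 1 is nonzero and so has an inverse, which acts on the equation k v = 0.
    torsion-free : ∀ k → 1 ≤ k → k ≤ 4 → ∀ v → multiple k v ≈ᴹ 0ᴹ → v ≈ᴹ 0ᴹ
    torsion-free k 1≤k k≤4 v eq = go (proj₂ field′ (natCast F k) (char k 1≤k k≤4))
      where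
      go : (Σ (CommutativeRing.Carrier F) λ y → natCast F k ·ᶠ y ≈ 1#) → v ≈ᴹ 0ᴹ
      go (y , inv) = ≈.begin
        v                              ≈.≈⟨ ≈ᴹ-sym (*ₗ-identityˡ v) ⟩
        1# *ₗ v                        ≈.≈⟨ *ₗ-congʳ (CommutativeRing.trans F (CommutativeRing.sym F inv) (·ᶠ-comm (natCast F k) y)) ⟩
        (y ·ᶠ natCast F k) *ₗ v        ≈.≈⟨ *ₗ-assoc y (natCast F k) v ⟩
        y *ₗ (natCast F k *ₗ v)        ≈.≈⟨ *ₗ-congˡ (≈ᴹ-trans (natCast-*ₗ k v) eq) ⟩
        y *ₗ 0ᴹ                        ≈.≈⟨ *ₗ-zeroʳ y ⟩
        0ᴹ                             ≈.∎

    from-injective : ∀ {u v} → from u ≡ from v → u ≈ᴹ v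
    from-injective {u} {v} eq = ≈ᴹ-trans (≈ᴹ-sym (strictlyInverseˡ u)) (≈ᴹ-trans (to-cong eq) (strictlyInverseˡ v))

    _⊕′_ : Fin N → Fin N → Fin N
    i ⊕′ j = from (to i +ᴹ to j)

    ⊝′_ : Fin N → Fin N
    ⊝′ i = from (-ᴹ to i)

    𝟘′ : Fin N
    𝟘′ = from 0ᴹ

    group : IsAbelianGroup _≡_ _⊕′_ 𝟘′ ⊝′_
    group = record
      { isGroup = record
        { isMonoid = record
          { isSemigroup = record
            { isMagma = record { isEquivalence = isEquivalence ; ∙-cong = cong₂ _⊕′_ }
            ; assoc = λ i j k → from-cong (≈ᴹ-trans (+ᴹ-cong (strictlyInverseˡ _) ≈ᴹ-refl) (≈ᴹ-trans (+ᴹ-assoc (to i) (to j) (to k)) (+ᴹ-cong ≈ᴹ-refl (≈ᴹ-sym (strictlyInverseˡ _)))))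
            }
          ; identity = (λ i → trans (from-cong (≈ᴹ-trans (+ᴹ-cong (strictlyInverseˡ _) ≈ᴹ-refl) (+ᴹ-identityˡ (to i)))) (strictlyInverseʳ i))
                     , (λ i → trans (from-cong (≈ᴹ-trans (+ᴹ-cong ≈ᴹ-refl (strictlyInverseˡ _)) (+ᴹ-identityʳ (to i)))) (strictlyInverseʳ i))
          }
        ; inverse = (λ i → from-cong (≈ᴹ-trans (+ᴹ-cong (strictlyInverseˡ _) ≈ᴹ-refl) (-ᴹ‿inverseˡ (to i))))
                  , (λ i → from-cong (≈ᴹ-trans (+ᴹ-cong ≈ᴹ-refl (strictlyInverseˡ _)) (-ᴹ‿inverseʳ (to i))))
        ; ⁻¹-cong = cong ⊝′_
        }
      ; comm = λ i j → from-cong (+ᴹ-comm (to i) (to j))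
      }

    to-zero : ∀ {i} → to i ≈ᴹ 0ᴹ → i ≡ 𝟘′
    to-zero {i} eq = trans (sym (strictlyInverseʳ i)) (from-cong eq)

  𝔾 : FinGroup
  𝔾 = record
    { G = Fin N ; _≟_ = Fin._≟_ ; _⊕_ = _⊕′_ ; 𝟘 = 𝟘′ ; ⊝_ = ⊝′_ ; isAbelianGroup = group
    ; univ = allFin N ; univ-complete = ∈-allFin
    ; no-2-torsion = λ i eq → to-zero (torsion-free 2 (≤ᵇ⇒≤ 1 2 tt) (≤ᵇ⇒≤ 2 4 tt) (to i)
        (≈ᴹ-trans (+ᴹ-cong ≈ᴹ-refl (+ᴹ-identityʳ (to i))) (from-injective eq)))
    ; no-3-torsion = λ i eq → to-zero (torsion-free 3 (≤ᵇ⇒≤ 1 3 tt) (≤ᵇ⇒≤ 3 4 tt) (to i)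
        (≈ᴹ-trans (+ᴹ-cong ≈ᴹ-refl (+ᴹ-cong ≈ᴹ-refl (+ᴹ-identityʳ (to i)))) (≈ᴹ-trans (≈ᴹ-sym (+ᴹ-assoc (to i) (to i) (to i)))
          (≈ᴹ-trans (+ᴹ-cong (≈ᴹ-sym (strictlyInverseˡ _)) ≈ᴹ-refl) (from-injective eq)))))
    }

  open Sets 𝔾
  open Colouring 𝔾

  from-⊖ : ∀ u v → from u ⊖ from v ≡ from (u +ᴹ (-ᴹ v))
  from-⊖ u v = from-cong (+ᴹ-cong (strictlyInverseˡ u) (≈ᴹ-trans (strictlyInverseˡ _) (-ᴹ‿cong (strictlyInverseˡ v))))

  module _ (b : Fin N → Bool) where

    S : Carrierᴹ → Set ℓm
    S v = Lift ℓm (from v ≢ 𝟘 × colour b (from v) ≡ true)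

    private
      ⊝-nonzero : ∀ {g} → g ≢ 𝟘 → ⊝ g ≢ 𝟘
      ⊝-nonzero {g} ≢𝟘 eq = ≢𝟘 (by₁ (solve (x₀ :- :0) (:0 :- :- x₀) (g ∷ []) refl) (sym eq))

      to-sum : ∀ xs → sumᴹ V (map to xs) ≈ᴹ to (Generation.sum 𝔾 xs)
      to-sum []       = ≈ᴹ-sym (strictlyInverseˡ 0ᴹ)
      to-sum (x ∷ xs) = ≈ᴹ-trans (+ᴹ-cong ≈ᴹ-refl (to-sum xs)) (≈ᴹ-sym (strictlyInverseˡ _))

      S-to : ∀ {g} → g ≢ 𝟘 × colour b g ≡ true → S (to g)
      S-to {g} = lift ∘ subst (λ g → g ≢ 𝟘 × colour b g ≡ true) (sym (strictlyInverseʳ g))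

      All-to : ∀ {xs} → All (λ g → g ≢ 𝟘 × colour b g ≡ true) xs → All S (map to xs)
      All-to []       = []
      All-to (p ∷ ps) = S-to p ∷ All-to ps

    cayley : IsCayleySet V S
    cayley = record
      { respects  = λ eq → lift ∘ subst (λ g → g ≢ 𝟘 × colour b g ≡ true) (from-cong eq) ∘ Lift.lower
      ; no-zero   = λ p → proj₁ (Lift.lower p) refl
      ; symmetric = λ {v} p → lift (subst (λ g → g ≢ 𝟘 × colour b g ≡ true) (from-cong (-ᴹ‿cong (strictlyInverseˡ v)))
          (⊝-nonzero (proj₁ (Lift.lower p)) , trans (colour-⊝ b (from v)) (proj₂ (Lift.lower p))))
      ; generates = λ v → let (xs , ps , eq) = Generation.generating 𝔾 b (from v) in
          map to xs , All-to ps , ≈ᴹ-trans (to-sum xs) (≈ᴹ-trans (to-cong eq) (strictlyInverseˡ v))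
      }

    module _ {ℓs : Level} (R : Carrierᴹ → Carrierᴹ → Set ℓs) (col : Bool)
      (R-colour : ∀ {u v} → R u v → from (u +ᴹ (-ᴹ v)) ≢ 𝟘 → colour b (from (u +ᴹ (-ᴹ v))) ≡ col) where

      unique-images : ∀ {xs} → AllPairs (λ u v → ¬ (u ≈ᴹ v) × R u v) xs → Unique (map from xs)
      unique-images ps = Pairs.map⁺ (AllPairs.map (λ p eq → proj₁ p (from-injective eq)) ps)

      -- `AllPairs` relates each pair in one order only; the difference in the other order is its
      -- negative and has the same colour.
      mono-images : ∀ {xs} → AllPairs (λ u v → ¬ (u ≈ᴹ v) × R u v) xs → Mono b col (map from xs)
      mono-images {xs} ps {d} d∈ d≢𝟘 =
        let (g , h , g∈ , h∈ , eq) = ∈-⊟⁻ (map from xs) (map from xs) d∈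
            (u , u∈ , gu) = ∈-map⁻ from g∈
            (v , v∈ , hv) = ∈-map⁻ from h∈
        in go u v (trans eq (cong₂ _⊖_ gu hv)) (AllPairs-∈ ps u∈ v∈)
        where
        go : ∀ u v → d ≡ from u ⊖ from v → u ≡ v ⊎ (¬ (u ≈ᴹ v) × R u v) ⊎ (¬ (v ≈ᴹ u) × R v u) → colour b d ≡ col
        go u v eq (inj₁ refl)              = contradiction (trans eq (⊖-self (from u))) d≢𝟘
        go u v eq (inj₂ (inj₁ (_ , uRv))) = trans (cong (colour b) eq′) (R-colour uRv (d≢𝟘 ∘ trans eq′))
          where
          eq′ : d ≡ from (u +ᴹ (-ᴹ v))
          eq′ = trans eq (from-⊖ u v)
        go u v eq (inj₂ (inj₂ (_ , vRu))) = trans (cong (colour b) flip) (trans (colour-⊝ b (from v ⊖ from u))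
            (trans (cong (colour b) (from-⊖ v u)) (R-colour vRu (λ zero → ⊝-nonzero d≢𝟘 (trans (cong ⊝_ flip) (trans (solve (:- (:- x₀)) x₀ ((from v ⊖ from u) ∷ []) refl) (trans (from-⊖ v u) zero)))))))
          where
          flip : d ≡ ⊝ (from v ⊖ from u)
          flip = trans eq (solve (x₀ :- x₁) (:- (x₁ :- x₀)) (from u ∷ from v ∷ []) refl)

  private
    size : length (allFin N) ≡ N
    size = length-tabulate id

    edge : ∀ b {u v} → S b (u +ᴹ (-ᴹ v)) → from (u +ᴹ (-ᴹ v)) ≢ 𝟘 → colour b (from (u +ᴹ (-ᴹ v))) ≡ true
    edge b s _ = proj₂ (Lift.lower s)

    non-edge : ∀ b {u v} → ¬ S b (u +ᴹ (-ᴹ v)) → from (u +ᴹ (-ᴹ v)) ≢ 𝟘 → colour b (from (u +ᴹ (-ᴹ v))) ≡ false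
    non-edge b ¬s ≢𝟘 = ¬-not (λ eq → ¬s (lift (≢𝟘 , eq)))

  cayley-graph : ∀ p q 0<p 0<q → Scales.N₀ p q 0<p 0<q ≤ N →
    Σ (Carrierᴹ → Set ℓm) λ S → IsCayleySet V S × CliqueNumberBoundedBy V S (≤[2+ p / q ]log₂ N) × IndependenceNumberBoundedBy V S (≤[2+ p / q ]log₂ N)
  cayley-graph p q 0<p 0<q N₀≤N = S b , cayley b ,
    (λ xs clique → conclude xs true (unique-images b (Adj V (S b)) true (edge b) clique) (mono-images b (Adj V (S b)) true (edge b) clique)) ,
    (λ xs indep → conclude xs false (unique-images b (λ u v → ¬ Adj V (S b) u v) false (non-edge b) indep)
                                    (mono-images b (λ u v → ¬ Adj V (S b) u v) false (non-edge b) indep))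
    where
    ramsey : ∃ λ b → ∀ {A} → Unique A → ∀ c → Mono b c A → 2 ^ (length A * q) ≤ length (allFin N) ^ (2 * q + p)
    ramsey = Scales.ramsey-colouring p q 0<p 0<q 𝔾 (Uniq.allFin⁺ N) (subst (Scales.N₀ p q 0<p 0<q ≤_) (sym size) N₀≤N)
    b : Fin N → Bool
    b = proj₁ ramsey
    conclude : ∀ xs c → Unique (map from xs) → Mono b c (map from xs) → ≤[2+ p / q ]log₂ N (length xs)
    conclude xs c unique mono = subst₂ (λ k N → 2 ^ (k * q) ≤ N ^ (2 * q + p)) (length-map from xs) size (proj₂ ramsey unique c mono)

theorem1p12 : {c ℓ m ℓm : Level} →
    (p q : ℕ) → 0 < p → 0 < q →
    Σ ℕ λ N₀ →
      (F : CommutativeRing c ℓ) → IsField F → CharAtLeast5 F →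
      (V : Module F m ℓm) → (N : ℕ) → HasOrder V N → N₀ ≤ N →
      Σ (Module.Carrierᴹ V → Set ℓm) λ S →
        IsCayleySet V S
        × CliqueNumberBoundedBy V S (≤[2+ p / q ]log₂ N)
        × IndependenceNumberBoundedBy V S (≤[2+ p / q ]log₂ N)
theorem1p12 p q 0<p 0<q = Scales.N₀ p q 0<p 0<q , λ F isField char V N order N₀≤N →
  Transport.cayley-graph F isField char V N order p q 0<p 0<q N₀≤N
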